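{- For every $n\ge1$, the number of configurations of the twenty-vertex model with DWBC1 on the $n\times n$ grid, and likewise the number with DWBC2, is equal to $T_4(\mathcal A_n)$.
   Context: Twenty-vertex model: vertices $(x,y)\in\{1,\dots,n\}^2$; inner edges horizontal $\{(x,y),(x+1,y)\}$ ($x<n$), vertical $\{(x,y),(x,y+1)\}$ ($y<n$), diagonal $\{(x,y+1),(x+1,y)\}$ ($x,y<n$); boundary edges oriented from $(0,y)$ to $(1,y)$ and from $(n+1,y)$ to $(n,y)$ ($1\le y\le n$), from $(0,y+1)$ to $(1,y)$ and from $(n+1,y)$ to $(n,y+1)$ ($1\le y\le n-1$), from $(x,1)$ to $(x,0)$ and from $(x,n)$ to $(x,n+1)$ ($1\le x\le n$), from $(x,1)$ to $(x+1,0)$ and from $(x+1,n)$ to $(x,n+1)$ ($1\le x\le n-1$); corner edges oriented from $(0,n+1)$ to $(1,n)$ and from $(n,1)$ to $(n+1,0)$ for DWBC1, and from $(1,n)$ to $(0,n+1)$ and from $(n+1,0)$ to $(n,1)$ for DWBC2. A configuration is an orientation of the inner edges such that every vertex has exactly three incoming and three outgoing incident edges. $T_4(\mathcal A_n)$ is the number of quarter-turn symmetric domino tilings of the $2n\times2n$ Aztec-like quasi-square with a central cross-shaped hole; equivalently, it is the number of pairs $(I,\mathcal P)$ where $I=\{i_1<\dots<i_\ell\}\subseteq\{0,\dots,n-1\}$ (possibly empty) and $\mathcal P$ is a family of pairwise vertex-disjoint lattice paths with steps $(-1,0),(0,1),(-1,1)$, none ending with a $(0,1)$ step, the $k$-th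 going from $(i_k,0)$ to $(0,i_k+1)$. -}

module Defs where

open import Data.Nat using (ℕ; zero; suc; _+_; _∸_; _*_; _≡ᵇ_)
open import Data.Bool using (Bool; true; false; _∧_; not; if_then_else_)
open import Data.List using (List; []; _∷_; map; concatMap; length; _++_; upTo)
open import Data.Bool.ListAction using (all; any)
open import Data.Nat.ListAction using (sum)
open import Data.Product using (_×_; _,_; proj₁; proj₂)

countB : {A : Set} → (A → Bool) → List A → ℕ
countB p [] = 0
countB p (x ∷ xs) = if p x then suc (countB p xs) else countB p xs

rng1 : ℕ → List ℕ
rng1 k = map suc (upTo k)

allBools : ℕ → List (List Bool)
allBools zero = [] ∷ []
allBools (suc k) = map (true ∷_) (allBools k) ++ map (false ∷_) (allBools k)

Point : Set
Point = ℕ × ℕ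

-- a directed edge (tail , head)
DEdge : Set
DEdge = Point × Point

_==_ : Point → Point → Bool
(a , b) == (c , d) = (a ≡ᵇ c) ∧ (b ≡ᵇ d)

grid : ℕ → List Point
grid n = concatMap (λ x → map (λ y → (x , y)) (rng1 n)) (rng1 n)

-- inner edges, each listed once with a reference direction (a , b)
innerEdges : ℕ → List DEdge
innerEdges n =
     concatMap (λ x → map (λ y → ((x , y) , (suc x , y))) (rng1 n)) (rng1 (n ∸ 1))
  ++ concatMap (λ x → map (λ y → ((x , y) , (x , suc y))) (rng1 (n ∸ 1))) (rng1 n)
  ++ concatMap (λ x → map (λ y → ((x , suc y) , (suc x , y))) (rng1 (n ∸ 1))) (rng1 (n ∸ 1))

data DWBC : Set where
  DWBC1 DWBC2 : DWBC

cornerEdges : ℕ → DWBC → List DEdge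
cornerEdges n DWBC1 = ((0 , suc n) , (1 , n)) ∷ ((n , 1) , (suc n , 0)) ∷ []
cornerEdges n DWBC2 = ((1 , n) , (0 , suc n)) ∷ ((suc n , 0) , (n , 1)) ∷ []

boundaryEdges : ℕ → DWBC → List DEdge
boundaryEdges n b =
     map (λ y → ((0 , y) , (1 , y))) (rng1 n)
  ++ map (λ y → ((suc n , y) , (n , y))) (rng1 n)
  ++ map (λ y → ((0 , suc y) , (1 , y))) (rng1 (n ∸ 1))
  ++ map (λ y → ((suc n , y) , (n , suc y))) (rng1 (n ∸ 1))
  ++ map (λ x → ((x , 1) , (x , 0))) (rng1 n)
  ++ map (λ x → ((x , n) , (x , suc n))) (rng1 n)
  ++ map (λ x → ((x , 1) , (suc x , 0))) (rng1 (n ∸ 1))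
  ++ map (λ x → ((suc x , n) , (x , suc n))) (rng1 (n ∸ 1))
  ++ cornerEdges n b

orient : List DEdge → List Bool → List DEdge
orient [] _ = []
orient (_ ∷ _) [] = []
orient ((a , c) ∷ es) (true ∷ bs) = (a , c) ∷ orient es bs
orient ((a , c) ∷ es) (false ∷ bs) = (c , a) ∷ orient es bs

indeg : Point → List DEdge → ℕ
indeg v es = countB (λ e → proj₂ e == v) es

outdeg : Point → List DEdge → ℕ
outdeg v es = countB (λ e → proj₁ e == v) es

isConfig : ℕ → DWBC → List Bool → Bool
isConfig n b bs =
  all (λ v → (indeg v E ≡ᵇ 3) ∧ (outdeg v E ≡ᵇ 3)) (grid n)
  where
  E : List DEdge
  E = orient (innerEdges n) bs ++ boundaryEdges n b

numConfigs : ℕ → DWBC → ℕ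
numConfigs n b = countB (isConfig n b) (allBools (length (innerEdges n)))

data Step : Set where
  W N NW : Step

allSteps : ℕ → List (List Step)
allSteps zero = [] ∷ []
allSteps (suc k) = concatMap (λ s → map (s ∷_) (allSteps k)) (W ∷ N ∷ NW ∷ [])

stepsUpTo : ℕ → List (List Step)
stepsUpTo L = concatMap allSteps (upTo (suc L))

xDec : List Step → ℕ
xDec [] = 0
xDec (W ∷ s) = suc (xDec s)
xDec (N ∷ s) = xDec s
xDec (NW ∷ s) = suc (xDec s)

yInc : List Step → ℕ
yInc [] = 0
yInc (W ∷ s) = yInc s
yInc (N ∷ s) = suc (yInc s)
yInc (NW ∷ s) = suc (yInc s)

lastNotN : List Step → Bool
lastNotN [] = true
lastNotN (N ∷ []) = false
lastNotN (_ ∷ []) = true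
lastNotN (_ ∷ s@(_ ∷ _)) = lastNotN s

-- a path from (i,0) to (0,i+1) not ending with a (0,1) step
isPath : ℕ → List Step → Bool
isPath i s = (xDec s ≡ᵇ i) ∧ (yInc s ≡ᵇ suc i) ∧ lastNotN s

trace : Point → List Step → List Point
trace p [] = p ∷ []
trace (x , y) (W ∷ s) = (x , y) ∷ trace (x ∸ 1 , y) s
trace (x , y) (N ∷ s) = (x , y) ∷ trace (x , suc y) s
trace (x , y) (NW ∷ s) = (x , y) ∷ trace (x ∸ 1 , suc y) s

-- all valid paths starting at (i,0), as vertex lists
-- (such a path has exactly xDec + yInc ≤ 2i+1 steps)
pathsFrom : ℕ → List (List Point)
pathsFrom i = map (trace (i , 0)) (filterB (isPath i) (stepsUpTo (suc (2 * i))))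
  where
  filterB : (List Step → Bool) → List (List Step) → List (List Step)
  filterB p [] = []
  filterB p (x ∷ xs) = if p x then x ∷ filterB p xs else filterB p xs

subsets : List ℕ → List (List ℕ)
subsets [] = [] ∷ []
subsets (x ∷ xs) = subsets xs ++ map (x ∷_) (subsets xs)

families : List ℕ → List (List (List Point))
families [] = [] ∷ []
families (i ∷ is) = concatMap (λ p → map (p ∷_) (families is)) (pathsFrom i)

noCommon : List Point → List Point → Bool
noCommon p q = all (λ u → not (any (λ v → u == v) q)) p

pairwiseDisjoint : List (List Point) → Bool
pairwiseDisjoint [] = true
pairwiseDisjoint (p ∷ ps) = all (noCommon p) ps ∧ pairwiseDisjoint ps

T4 : ℕ → ℕ
T4 n = sum (map (λ I → countB pairwiseDisjoint (families I)) (subsets (upTo n)))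

{-# OPTIONS --safe #-}
module Submission where

open import Defs
import Data.Nat as ℕ
open ℕ using (ℕ; zero; suc; _≤_; z≤n; s≤s)
import Data.Nat.Properties as ℕₚ
import Data.Integer as Int
import Data.Integer.Properties as Intₚ
open import Algebra using (IsCommutativeRing; CommutativeRing)
import Algebra.Properties.CommutativeSemigroup as CommutativeSemigroupₚ
open import Tactic.RingSolver using (solve-∀)
import Tactic.RingSolver.Core.AlmostCommutativeRing as ACR
open import Level using (0ℓ)
open import Data.Bool using (Bool; true; false; _∧_; _∨_; not; if_then_else_; T)
open import Data.List using (List; []; _∷_; _++_; map; concatMap; length; upTo; applyUpTo)
open import Data.List.Relation.Unary.All using (All; []; _∷_)
import Data.List.Relation.Unary.All as All
import Data.List.Relation.Unary.All.Properties as Allₚ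
open import Data.List.Relation.Unary.Unique.Propositional using (Unique)
open import Data.List.Relation.Unary.Any using (here; there)
open import Data.List.Membership.Propositional using (_∈_; _∉_)
open import Data.List.Relation.Binary.Pointwise using (Pointwise; []; _∷_)
open import Data.Maybe using (Maybe; just; nothing)
open import Data.Product using (Σ; _×_; _,_; proj₁; proj₂)
open import Data.Sum using (_⊎_; inj₁; inj₂)
open import Data.Empty using (⊥; ⊥-elim)
open import Data.Unit using (⊤; tt)
open import Function using (_∘_; id; case_of_)
open import Relation.Nullary using (¬_; Dec; yes; no)
open import Relation.Binary.PropositionalEquality
  using (_≡_; _≢_; _≗_; setoid; refl; sym; trans; cong; cong₂; subst; subst₂; module ≡-Reasoning)
open import Data.List.Properties using (++-assoc; ++-identityʳ; map-id; map-∘; map-++; map-upTo; length-++; length-map; concatMap-++; map-concatMap; map-cong)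
open import Data.List.Membership.Propositional.Properties using (∈-++⁺ʳ; ∈-++⁺ˡ; ∈-++⁻; ∈-map⁻; ∈-map⁺)
open import Data.Bool.ListAction using (all; any)
open import Data.Nat.ListAction using (sum)
open import Data.List.Relation.Unary.AllPairs using (AllPairs; []; _∷_)
open import Relation.Binary.Definitions using (tri<; tri≈; tri>)
open import Data.Product.Properties using (≡-dec)
open import Relation.Nullary using (does)
open import Relation.Nullary.Decidable using (map′)
open import Data.List.Relation.Binary.Permutation.Propositional as ↭ using (_↭_)
import Data.List.Relation.Unary.AllPairs.Properties as AllPairsₚ
import Data.List.Relation.Binary.Permutation.Propositional.Properties as ↭ₚ
import Data.List.Relation.Binary.Permutation.Setoid.Properties as ↭ₛ
import Algebra.Solver.CommutativeMonoid
open import Data.Bool.Properties using (∧-zeroʳ)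

-- At each vertex of the twenty-vertex model the three lines are resolved into pairwise crossings,
-- at the price of a gauge factor that cancels along the paths. The Yang-Baxter equation then
-- moves every diagonal line out of the square, where it only crosses lines in the same state.
-- This leaves the six-vertex model with domain wall boundary conditions, a = 1, b₁ b₂ = 2 and
-- c₁ = c₂ = 1. After giving the rows parameters w, its partition function times the Vandermonde
-- product is found by Lagrange interpolation in the parameter of the first column: it obeys the
-- same recursion as a determinant of the polynomials κ in w. For w = ε j, divided differences
-- and reduction modulo every large ε replace the limit w → 0 and give a determinant of Taylor
-- coefficients. Row and column operations turn it into det(1 + M), where M i j counts the paths
-- from (i , 0) to (0 , j + 1). Its principal minors are the terms of T4 by the lemma of Lindström,
-- Gessel and Viennot.

-- Everything stays in the integers: divisions become cancellations of nonzero factors, such as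
-- Vandermonde products, powers of 2 and weights of row crossings. Orientations are read as paths
-- running right and down. The two boundary conditions differ only in the diagonal line n + 1, full
-- for DWBC1 and empty for DWBC2. A diagonal line that is full at both ends is pulled out below the
-- square, where it meets full rows and then full columns; an empty one is pulled out above, where
-- it meets empty columns and then empty rows. So both conditions leave the same six-vertex model.
-- All weights satisfy a² + b₁ b₂ - c₁ c₂ = 2 a b₁, the condition behind their Yang-Baxter
-- equations. Izergin's determinant has the kernel c₂ / (a b₁). Here the column parameters p : 1 are
-- all sent to infinity, that is to 1 : 0, and the generating function of κ is this kernel in ζ =
-- 1/p. Only the row parameters are separated again by ε: the points ε j are distinct, so that the
-- Vandermonde product can be cancelled, and congruent to 0, so that divided differences become
-- Taylor coefficients modulo ε.

infixl 7 _*_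
infixl 6 _+_ _-_
infix 8 -_

-- A copy of the integers whose operations do not compute, so that unification can solve
-- for arguments of _+_ and _*_.
opaque
  ℤ : Set
  ℤ = Int.ℤ

  _+_ _*_ : ℤ → ℤ → ℤ
  _+_ = Int._+_
  _*_ = Int._*_

  -_ : ℤ → ℤ
  -_ = Int.-_

  0ℤ 1ℤ : ℤ
  0ℤ = Int.0ℤ
  1ℤ = Int.1ℤ

  ι : ℕ → ℤ
  ι = Int.+_

  ℤ-isCommutativeRing : IsCommutativeRing _≡_ _+_ _*_ -_ 0ℤ 1ℤ
  ℤ-isCommutativeRing = Intₚ.+-*-isCommutativeRing

  0ℤ≟ : ∀ x → Maybe (0ℤ ≡ x)
  0ℤ≟ Int.+0 = just refl
  0ℤ≟ _ = nothing

_-_ : ℤ → ℤ → ℤ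
x - y = x + - y

ℤ-commutativeRing : CommutativeRing 0ℓ 0ℓ
ℤ-commutativeRing = record { isCommutativeRing = ℤ-isCommutativeRing }

open IsCommutativeRing ℤ-isCommutativeRing using
  ( +-identityˡ; +-identityʳ; +-comm; +-assoc; *-identityˡ; *-identityʳ; *-comm; *-assoc
  ; distribˡ; zeroˡ; zeroʳ; -‿inverseʳ)

open CommutativeSemigroupₚ (CommutativeRing.*-commutativeSemigroup ℤ-commutativeRing)
  using () renaming (x∙yz≈y∙xz to *-exchange; interchange to *-interchange)

ring : ACR.AlmostCommutativeRing 0ℓ 0ℓ
ring = ACR.fromCommutativeRing ℤ-commutativeRing 0ℤ≟

-- Congruences modulo ε

infix 4 _≡_[_]
_≡_[_] : ℤ → ℤ → ℤ → Set
x ≡ y [ ε ] = Σ ℤ λ k → x ≡ y + ε * k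

opaque
  unfolding ℤ

  ι-injective : ∀ {m n} → ι m ≡ ι n → m ≡ n
  ι-injective = Intₚ.+-injective

  ι-+ : ∀ m n → ι (m ℕ.+ n) ≡ ι m + ι n
  ι-+ m n = refl

  ι-0 : ι 0 ≡ 0ℤ
  ι-0 = refl

  -0≡0 : - 0ℤ ≡ 0ℤ
  -0≡0 = refl

  ι-1 : ι 1 ≡ 1ℤ
  ι-1 = refl

  -- The absence of 2-torsion turns a change of sign under the exchange of two equal rows or columns
  -- into a zero.
  x≡-x⇒x≡0 : ∀ x → x ≡ - x → x ≡ 0ℤ
  x≡-x⇒x≡0 (Int.+ zero) e = refl
  x≡-x⇒x≡0 (Int.+ suc n) ()
  x≡-x⇒x≡0 (Int.-[1+ n ]) ()

  *-cancelˡ : ∀ x {y z} → x ≢ 0ℤ → x * y ≡ x * z → y ≡ z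
  *-cancelˡ x {y} {z} x≢0 e = Intₚ.*-cancelˡ-≡ x y z {{Int.≢-nonZero x≢0}} e

  *-nonzero : ∀ {x y} → x ≢ 0ℤ → y ≢ 0ℤ → x * y ≢ 0ℤ
  *-nonzero {x} x≢0 y≢0 e = y≢0 (*-cancelˡ x x≢0 (trans e (sym (Intₚ.*-zeroʳ x))))

  1≢0 : 1ℤ ≢ 0ℤ
  1≢0 ()

  -- The modulus may depend on z: for 2 + |z|, which exceeds |z|, a multiple of the modulus with
  -- absolute value |z| must be zero.
  congruent-zero : ∀ z → (∀ n → z ≡ 0ℤ [ ι (2 ℕ.+ n) ]) → z ≡ 0ℤ
  congruent-zero z c = go Int.∣ proj₁ (c Int.∣ z ∣) ∣ (proj₁ (c Int.∣ z ∣)) refl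
      (trans (proj₂ (c Int.∣ z ∣)) (Intₚ.+-identityˡ _))
    where
    go : ∀ m k → Int.∣ k ∣ ≡ m → z ≡ ι (2 ℕ.+ Int.∣ z ∣) * k → z ≡ 0ℤ
    go zero k eq e = trans e (trans (cong (ι (2 ℕ.+ Int.∣ z ∣) *_) (Intₚ.∣i∣≡0⇒i≡0 {k} eq))
      (Intₚ.*-zeroʳ (ι (2 ℕ.+ Int.∣ z ∣))))
    go (suc m) k eq e = ⊥-elim (ℕₚ.<-irrefl
      (trans (cong Int.∣_∣ e) (trans (Intₚ.abs-* (ι (2 ℕ.+ Int.∣ z ∣)) k) (cong ((2 ℕ.+ Int.∣ z ∣) ℕ.*_) eq)))
      (ℕₚ.≤-trans (ℕₚ.n≤1+n (suc Int.∣ z ∣)) (ℕₚ.m≤m*n (2 ℕ.+ Int.∣ z ∣) (suc m))))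

  -- Otherwise the modulus, which is at least 2, would divide 1. The factors 1 - w and `wa` are
  -- shown to be nonzero in this way.
  unit-nonzero : ∀ {x} n → x ≡ 1ℤ [ ι (2 ℕ.+ n) ] → x ≢ 0ℤ
  unit-nonzero n (k , refl) e = go Int.∣ - k ∣ (- k) refl
      (trans (lem (ι (2 ℕ.+ n)) k) (trans (cong (λ t → 1ℤ - t) e) (Intₚ.+-identityʳ 1ℤ)))
    where
    lem : ∀ e k → e * - k ≡ 1ℤ - (1ℤ + e * k)
    lem = solve-∀ ring
    go : ∀ m k → Int.∣ k ∣ ≡ m → ι (2 ℕ.+ n) * k ≢ 1ℤ
    go m k eq e with trans (cong ((2 ℕ.+ n) ℕ.*_) (sym eq)) (trans (sym (Intₚ.abs-* (ι (2 ℕ.+ n)) k)) (cong Int.∣_∣ e))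
    go zero k eq e | q = ℕₚ.1+n≢0 (trans (sym q) (ℕₚ.*-zeroʳ n))
    go (suc m) k eq e | q = ℕₚ.m+1+n≢0 m (ℕₚ.suc-injective q)

congruent⇒≡ : ∀ {x y} → (∀ n → x ≡ y [ ι (2 ℕ.+ n) ]) → x ≡ y
congruent⇒≡ {x} {y} c = trans (lem x y) (trans (cong (y +_) z) (+-identityʳ y))
  where
  opaque
    unfolding ℤ
    lem : ∀ x y → x ≡ y + (x - y)
    lem = solve-∀ ring
    lem₂ : ∀ y e k → y + e * k - y ≡ 0ℤ + e * k
    lem₂ = solve-∀ ring
  z : x - y ≡ 0ℤ
  z = congruent-zero (x - y) (λ n → proj₁ (c n) , trans (cong (_- y) (proj₂ (c n))) (lem₂ y _ _))

≡⇒congruent : ∀ {x y ε} → x ≡ y → x ≡ y [ ε ]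
≡⇒congruent {x} {y} {ε} e = 0ℤ , trans e (sym (trans (cong (y +_) (zeroʳ ε)) (+-identityʳ y)))

+-congruent : ∀ {x x′ y y′ ε} → x ≡ x′ [ ε ] → y ≡ y′ [ ε ] → x + y ≡ x′ + y′ [ ε ]
+-congruent (k , refl) (l , refl) = k + l , lem _ _ _ _ _
  where
  opaque
    unfolding ℤ
    lem : ∀ a b e k l → a + e * k + (b + e * l) ≡ a + b + e * (k + l)
    lem = solve-∀ ring

*-congruent : ∀ {x x′ y y′ ε} → x ≡ x′ [ ε ] → y ≡ y′ [ ε ] → x * y ≡ x′ * y′ [ ε ]
*-congruent (k , refl) (l , refl) = _ , lem _ _ _ _ _
  where
  opaque
    unfolding ℤ
    lem : ∀ a b e k l → (a + e * k) * (b + e * l) ≡ a * b + e * (k * b + a * l + e * k * l)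
    lem = solve-∀ ring

neg-congruent : ∀ {x x′ ε} → x ≡ x′ [ ε ] → - x ≡ - x′ [ ε ]
neg-congruent (k , refl) = _ , lem _ _ _
  where
  opaque
    unfolding ℤ
    lem : ∀ a e k → - (a + e * k) ≡ - a + e * - k
    lem = solve-∀ ring

congruent-trans : ∀ {x y z ε} → x ≡ y [ ε ] → y ≡ z [ ε ] → x ≡ z [ ε ]
congruent-trans (k , refl) (l , refl) = _ , lem _ _ _ _
  where
  opaque
    unfolding ℤ
    lem : ∀ a e k l → a + e * l + e * k ≡ a + e * (l + k)
    lem = solve-∀ ring

congruent-sym : ∀ {x y ε} → x ≡ y [ ε ] → y ≡ x [ ε ]
congruent-sym (k , refl) = _ , lem _ _ _
  where
  opaque
    unfolding ℤ
    lem : ∀ a e k → a ≡ a + e * k + e * - k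
    lem = solve-∀ ring

-- Determinants

variable
  X : Set

∑± : (X → List X → ℤ) → List X → ℤ
∑± K [] = 0ℤ
∑± K (w ∷ ws) = K w ws - ∑± (λ v vs → K v (w ∷ vs)) ws

-- Laplace expansion along the first row. Rows are functions on an arbitrary set of column labels,
-- so that columns may be parameters, indices, or functionals on polynomials and sequences. If the
-- numbers of rows and columns differ, the value is 0.
D : List (X → ℤ) → List X → ℤ
D [] [] = 1ℤ
D [] (_ ∷ _) = 0ℤ
D (f ∷ fs) = ∑± (λ w vs → f w * D fs vs)

∏ : List X → (X → ℤ) → ℤ
∏ [] h = 1ℤ
∏ (x ∷ xs) h = h x * ∏ xs h

sgn : ℕ → ℤ
sgn zero = 1ℤ
sgn (suc n) = - sgn n

∑±-cong : ∀ {K K′ : X → List X → ℤ} → (∀ w vs → K w vs ≡ K′ w vs) → ∀ ws → ∑± K ws ≡ ∑± K′ ws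
∑±-cong e [] = refl
∑±-cong e (w ∷ ws) = cong₂ _-_ (e w ws) (∑±-cong (λ v vs → e v (w ∷ vs)) ws)

∑±-linear : ∀ (K K′ : X → List X → ℤ) c ws →
  ∑± (λ w vs → K w vs + c * K′ w vs) ws ≡ ∑± K ws + c * ∑± K′ ws
∑±-linear K K′ c [] = lem c
  where
  opaque
    unfolding ℤ
    lem : ∀ c → 0ℤ ≡ 0ℤ + c * 0ℤ
    lem = solve-∀ ring
∑±-linear K K′ c (w ∷ ws) = trans
  (cong (λ t → K w ws + c * K′ w ws - t) (∑±-linear (λ v vs → K v (w ∷ vs)) (λ v vs → K′ v (w ∷ vs)) c ws))
  (lem (K w ws) (K′ w ws) c _ _)
  where
  opaque
    unfolding ℤ
    lem : ∀ a b c x y → a + c * b - (x + c * y) ≡ a - x + c * (b - y)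
    lem = solve-∀ ring

∑±-zero : ∀ {K : X → List X → ℤ} → (∀ w vs → K w vs ≡ 0ℤ) → ∀ ws → ∑± K ws ≡ 0ℤ
∑±-zero e [] = refl
∑±-zero e (w ∷ ws) =
  trans (cong₂ _-_ (e w ws) (∑±-zero (λ v vs → e v (w ∷ vs)) ws)) (-‿inverseʳ 0ℤ)

∑±-scale : ∀ (K : X → List X → ℤ) c ws → ∑± (λ w vs → c * K w vs) ws ≡ c * ∑± K ws
∑±-scale K c ws = begin
  ∑± (λ w vs → c * K w vs) ws                 ≡⟨ ∑±-cong (λ w vs → sym (+-identityˡ (c * K w vs))) ws ⟩
  ∑± (λ w vs → 0ℤ + c * K w vs) ws            ≡⟨ ∑±-linear (λ _ _ → 0ℤ) K c ws ⟩
  ∑± (λ _ _ → 0ℤ) ws + c * ∑± K ws            ≡⟨ cong (_+ c * ∑± K ws) (∑±-zero (λ _ _ → refl) ws) ⟩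
  0ℤ + c * ∑± K ws                            ≡⟨ +-identityˡ _ ⟩
  c * ∑± K ws                                 ∎
  where open ≡-Reasoning

∑±-neg : ∀ (K : X → List X → ℤ) ws → ∑± (λ w vs → - K w vs) ws ≡ - ∑± K ws
∑±-neg K [] = sym -0≡0
∑±-neg K (w ∷ ws) = trans (cong (λ t → - K w ws - t) (∑±-neg (λ v vs → K v (w ∷ vs)) ws)) (lem (K w ws) _)
  where
  opaque
    unfolding ℤ
    lem : ∀ a b → - a - (- b) ≡ - (a - b)
    lem = solve-∀ ring

∏-cong : ∀ {h h′ : X → ℤ} → h ≗ h′ → ∀ ws → ∏ ws h ≡ ∏ ws h′
∏-cong e [] = refl
∏-cong e (w ∷ ws) = cong₂ _*_ (e w) (∏-cong e ws)

∏-* : ∀ (h h′ : X → ℤ) ws → ∏ ws (λ w → h w * h′ w) ≡ ∏ ws h * ∏ ws h′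
∏-* h h′ [] = sym (*-identityˡ 1ℤ)
∏-* h h′ (w ∷ ws) = trans (cong (h w * h′ w *_) (∏-* h h′ ws)) (*-interchange (h w) (h′ w) _ _)

-- In every term the chosen w and the remaining vs together make up ws, so the product of h over
-- them is always the same.
∑±-∏ : ∀ (h : X → ℤ) (K : X → List X → ℤ) ws →
  ∑± (λ w vs → h w * ∏ vs h * K w vs) ws ≡ ∏ ws h * ∑± K ws
∑±-∏ h K [] = sym (zeroʳ 1ℤ)
∑±-∏ h K (w ∷ ws) = begin
  h w * ∏ ws h * K w ws - ∑± (λ v vs → h v * (h w * ∏ vs h) * K v (w ∷ vs)) ws
    ≡⟨ cong (λ □ → h w * ∏ ws h * K w ws - □) (∑±-cong (λ v vs → lem₁ (h v) (h w) (∏ vs h) (K v (w ∷ vs))) ws) ⟩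
  h w * ∏ ws h * K w ws - ∑± (λ v vs → h w * (h v * ∏ vs h * K v (w ∷ vs))) ws
    ≡⟨ cong (λ □ → h w * ∏ ws h * K w ws - □) (∑±-scale _ (h w) ws) ⟩
  h w * ∏ ws h * K w ws - h w * ∑± (λ v vs → h v * ∏ vs h * K v (w ∷ vs)) ws
    ≡⟨ cong (λ t → h w * ∏ ws h * K w ws - h w * t) (∑±-∏ h (λ v vs → K v (w ∷ vs)) ws) ⟩
  h w * ∏ ws h * K w ws - h w * (∏ ws h * ∑± (λ v vs → K v (w ∷ vs)) ws)
    ≡⟨ lem₂ (h w) (∏ ws h) (K w ws) _ ⟩
  h w * ∏ ws h * (K w ws - ∑± (λ v vs → K v (w ∷ vs)) ws) ∎
  where
  open ≡-Reasoning
  opaque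
    unfolding ℤ
    lem₁ : ∀ a b c d → a * (b * c) * d ≡ b * (a * c * d)
    lem₁ = solve-∀ ring
    lem₂ : ∀ a b c d → a * b * c - a * (b * d) ≡ a * b * (c - d)
    lem₂ = solve-∀ ring

-- Two successive expansions choose an ordered pair of columns, and choosing the same pair in the
-- other order reverses the sign. The induction separates the pairs that contain the first column w:
-- `F` and `G` belong to those, `P` and `Q` to the others.
expand-swap : ∀ (f g : X → ℤ) (H : List X → ℤ) ws →
  ∑± (λ w vs → f w * ∑± (λ u us → g u * H us) vs) ws ≡ - ∑± (λ w vs → g w * ∑± (λ u us → f u * H us) vs) ws
expand-swap f g H [] = sym -0≡0
expand-swap {X} f g H (w ∷ ws) = begin
  f w * G - ∑± (λ v vs → f v * (g w * H vs - ∑± (λ u us → g u * H (w ∷ us)) vs)) ws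
    ≡⟨ cong (λ □ → f w * G - □) (split f g) ⟩
  f w * G - (g w * F - P)
    ≡⟨ cong (λ t → f w * G - (g w * F - t)) (expand-swap f g (H ∘ (w ∷_)) ws) ⟩
  f w * G - (g w * F - - Q)
    ≡⟨ lem (f w * G) (g w * F) Q ⟩
  - (g w * F - (f w * G - Q))
    ≡⟨ cong (λ t → - (g w * F - t)) (sym (split g f)) ⟩
  - (g w * F - ∑± (λ v vs → g v * (f w * H vs - ∑± (λ u us → f u * H (w ∷ us)) vs)) ws) ∎
  where
  open ≡-Reasoning
  G = ∑± (λ u us → g u * H us) ws
  F = ∑± (λ u us → f u * H us) ws
  P = ∑± (λ v vs → f v * ∑± (λ u us → g u * H (w ∷ us)) vs) ws
  Q = ∑± (λ v vs → g v * ∑± (λ u us → f u * H (w ∷ us)) vs) ws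
  opaque
    unfolding ℤ
    lem : ∀ a b c → a - (b - (- c)) ≡ - (b - (a - c))
    lem = solve-∀ ring
    lem₁ : ∀ a b c d → a * (b * c - d) ≡ - (a * d) + b * (a * c)
    lem₁ = solve-∀ ring
    lem₂ : ∀ a b → - a + b ≡ b - a
    lem₂ = solve-∀ ring
  split : ∀ (f g : X → ℤ) →
    ∑± (λ v vs → f v * (g w * H vs - ∑± (λ u us → g u * H (w ∷ us)) vs)) ws
    ≡ g w * ∑± (λ u us → f u * H us) ws - ∑± (λ v vs → f v * ∑± (λ u us → g u * H (w ∷ us)) vs) ws
  split f g = begin
    _ ≡⟨ ∑±-cong (λ v vs → lem₁ (f v) (g w) (H vs) _) ws ⟩
    _ ≡⟨ ∑±-linear _ (λ v vs → f v * H vs) (g w) ws ⟩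
    _ ≡⟨ cong (_+ g w * ∑± (λ v vs → f v * H vs) ws) (∑±-neg _ ws) ⟩
    _ ≡⟨ lem₂ _ (g w * ∑± (λ v vs → f v * H vs) ws) ⟩
    _ ∎

infix 4 _≋_
-- Wrapped in a record so that the lists of rows can be inferred from the type; they could not be
-- recovered from a bare equation between values of `D`.
record _≋_ (fs gs : List (X → ℤ)) : Set where
  constructor by
  field at : ∀ ws → D fs ws ≡ D gs ws
open _≋_

≋-refl : ∀ {fs : List (X → ℤ)} → fs ≋ fs
≋-refl .at ws = refl

≋-trans : ∀ {fs gs hs : List (X → ℤ)} → fs ≋ gs → gs ≋ hs → fs ≋ hs
≋-trans p q .at ws = trans (at p ws) (at q ws)

D-cons : ∀ {f g : X → ℤ} {fs gs} → f ≗ g → fs ≋ gs → f ∷ fs ≋ g ∷ gs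
D-cons e es .at ws = ∑±-cong (λ w vs → cong₂ _*_ (e w) (at es vs)) ws

D-swap : ∀ (f g : X → ℤ) fs ws → D (f ∷ g ∷ fs) ws ≡ - D (g ∷ f ∷ fs) ws
D-swap f g fs = expand-swap f g (D fs)

D-dup : ∀ (f : X → ℤ) fs ws → D (f ∷ f ∷ fs) ws ≡ 0ℤ
D-dup f fs ws = x≡-x⇒x≡0 _ (D-swap f f fs ws)

D-zero-tail : ∀ (f : X → ℤ) fs → (∀ ws → D fs ws ≡ 0ℤ) → ∀ ws → D (f ∷ fs) ws ≡ 0ℤ
D-zero-tail f fs e = ∑±-zero (λ w vs → trans (cong (f w *_) (e vs)) (zeroʳ (f w)))

D-repeat : ∀ {f : X → ℤ} {fs} → f ∈ fs → ∀ ws → D (f ∷ fs) ws ≡ 0ℤ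
D-repeat {f = f} {_ ∷ fs} (here refl) ws = D-dup f fs ws
D-repeat {f = f} {g ∷ fs} (there m) ws =
  trans (D-swap f g fs ws) (trans (cong -_ (D-zero-tail g (f ∷ fs) (D-repeat m) ws)) -0≡0)

D-linear : ∀ (f g : X → ℤ) c fs ws → D ((λ w → f w + c * g w) ∷ fs) ws ≡ D (f ∷ fs) ws + c * D (g ∷ fs) ws
D-linear f g c fs ws = trans (∑±-cong (λ w vs → lem (f w) (g w) c (D fs vs)) ws) (∑±-linear _ _ c ws)
  where
  opaque
    unfolding ℤ
    lem : ∀ a b c d → (a + c * b) * d ≡ a * d + c * (b * d)
    lem = solve-∀ ring

D-add-next : ∀ (f g : X → ℤ) c fs → ((λ w → f w + c * g w) ∷ g ∷ fs) ≋ f ∷ g ∷ fs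
D-add-next f g c fs .at ws = begin
  D ((λ w → f w + c * g w) ∷ g ∷ fs) ws          ≡⟨ D-linear f g c (g ∷ fs) ws ⟩
  D (f ∷ g ∷ fs) ws + c * D (g ∷ g ∷ fs) ws      ≡⟨ cong (λ t → D (f ∷ g ∷ fs) ws + c * t) (D-dup g fs ws) ⟩
  D (f ∷ g ∷ fs) ws + c * 0ℤ                     ≡⟨ cong (λ □ → D (f ∷ g ∷ fs) ws + □) (zeroʳ c) ⟩
  D (f ∷ g ∷ fs) ws + 0ℤ                         ≡⟨ +-identityʳ _ ⟩
  D (f ∷ g ∷ fs) ws                              ∎
  where open ≡-Reasoning

Modulo : (X → ℤ) → (X → ℤ) → (X → ℤ) → Set
Modulo α f g = Σ ℤ λ c → ∀ w → f w ≡ g w + c * α w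

-- As long as the row α is present, its multiples can be removed from all other rows. In each step α
-- is exchanged with the row treated and back again, so the two signs cancel.
D-modulo : ∀ (α : X → ℤ) {fs gs} → Pointwise (Modulo α) fs gs → α ∷ fs ≋ α ∷ gs
D-modulo α [] = ≋-refl
D-modulo α {f ∷ fs} {g ∷ gs} ((c , e) ∷ es) .at ws = begin
  D (α ∷ f ∷ fs) ws                              ≡⟨ D-swap α f fs ws ⟩
  - D (f ∷ α ∷ fs) ws                            ≡⟨ cong -_ (at (D-cons (λ _ → refl) (D-modulo α es)) ws) ⟩
  - D (f ∷ α ∷ gs) ws                            ≡⟨ cong -_ (at (D-cons {fs = α ∷ gs} e ≋-refl) ws) ⟩
  - D ((λ w → g w + c * α w) ∷ α ∷ gs) ws        ≡⟨ cong -_ (at (D-add-next g α c gs) ws) ⟩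
  - D (g ∷ α ∷ gs) ws                            ≡⟨ sym (D-swap α g gs ws) ⟩
  D (α ∷ g ∷ gs) ws                              ∎
  where open ≡-Reasoning

D-snoc : ∀ (f : X → ℤ) fs ws → D (fs ++ f ∷ []) ws ≡ sgn (length fs) * D (f ∷ fs) ws
D-snoc f [] ws = sym (*-identityˡ _)
D-snoc f (g ∷ fs) ws = begin
  D (g ∷ fs ++ f ∷ []) ws
    ≡⟨ ∑±-cong (λ w vs → trans (cong (g w *_) (D-snoc f fs vs)) (*-exchange (g w) (sgn (length fs)) _)) ws ⟩
  ∑± (λ w vs → sgn (length fs) * (g w * D (f ∷ fs) vs)) ws
    ≡⟨ ∑±-scale _ (sgn (length fs)) ws ⟩
  sgn (length fs) * D (g ∷ f ∷ fs) ws            ≡⟨ cong (sgn (length fs) *_) (D-swap g f fs ws) ⟩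
  sgn (length fs) * - D (f ∷ g ∷ fs) ws          ≡⟨ lem₂ (sgn (length fs)) _ ⟩
  - sgn (length fs) * D (f ∷ g ∷ fs) ws          ∎
  where
  open ≡-Reasoning
  opaque
    unfolding ℤ
    lem₂ : ∀ a b → a * - b ≡ - a * b
    lem₂ = solve-∀ ring

D-scale : ∀ (h : X → ℤ) fs ws → D (map (λ f w → h w * f w) fs) ws ≡ ∏ ws h * D fs ws
D-scale h [] [] = sym (*-identityˡ 1ℤ)
D-scale h [] (w ∷ ws) = sym (zeroʳ (h w * ∏ ws h))
D-scale h (f ∷ fs) ws = trans
  (∑±-cong (λ w vs → trans (cong (h w * f w *_) (D-scale h fs vs)) (*-interchange (h w) (f w) (∏ vs h) (D fs vs))) ws)
  (∑±-∏ h _ ws)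

Alternating : (List X → ℤ) → Set
Alternating {X} H = ∀ pre (x y : X) post → H (pre ++ x ∷ y ∷ post) ≡ - H (pre ++ y ∷ x ∷ post)

∑±-alternating : ∀ (K : X → List X → ℤ) → (∀ w → Alternating (K w)) → Alternating (∑± K)
∑±-alternating K a [] x y post = trans
  (cong (λ t → K x (y ∷ post) - (K y (x ∷ post) - t))
    (trans (∑±-cong (λ v vs → a v [] x y vs) post) (∑±-neg _ post)))
  (lem (K x (y ∷ post)) _ _)
  where
  opaque
    unfolding ℤ
    lem : ∀ a b c → a - (b - (- c)) ≡ - (b - (a - c))
    lem = solve-∀ ring
∑±-alternating K a (u ∷ pre) x y post = trans
  (cong₂ _-_ (a u pre x y post) (∑±-alternating (λ v vs → K v (u ∷ vs)) (λ w p → a w (u ∷ p)) pre x y post))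
  (lem (K u (pre ++ y ∷ x ∷ post)) _)
  where
  opaque
    unfolding ℤ
    lem : ∀ a b → - a - (- b) ≡ - (a - b)
    lem = solve-∀ ring

D-alternating : ∀ (fs : List (X → ℤ)) → Alternating (D fs)
D-alternating [] [] x y post = sym -0≡0
D-alternating [] (_ ∷ _) x y post = sym -0≡0
D-alternating (f ∷ fs) = ∑±-alternating _ λ w pre x y post →
  trans (cong (f w *_) (D-alternating fs pre x y post)) (lem (f w) _)
  where
  opaque
    unfolding ℤ
    lem : ∀ a b → a * - b ≡ - (a * b)
    lem = solve-∀ ring

ColumnLinear : X → X → X → ℤ → (List X → ℤ) → Set
ColumnLinear x y z k H = ∀ pre post → H (pre ++ x ∷ post) ≡ H (pre ++ y ∷ post) + k * H (pre ++ z ∷ post)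

expand-linear : ∀ (f : X → ℤ) H x y z k → f x ≡ f y + k * f z → ColumnLinear x y z k H →
  ColumnLinear x y z k (∑± (λ w vs → f w * H vs))
expand-linear f H x y z k e l [] post = begin
  f x * H post - ∑± (λ v vs → f v * H (x ∷ vs)) post
    ≡⟨ cong₂ (λ s t → s * H post - t) e (∑±-cong (λ v vs → trans (cong (f v *_) (l [] vs)) (lem₁ (f v) k _ _)) post) ⟩
  (f y + k * f z) * H post - ∑± (λ v vs → f v * H (y ∷ vs) + k * (f v * H (z ∷ vs))) post
    ≡⟨ cong (λ □ → (f y + k * f z) * H post - □) (∑±-linear _ _ k post) ⟩
  (f y + k * f z) * H post - (∑± (λ v vs → f v * H (y ∷ vs)) post + k * ∑± (λ v vs → f v * H (z ∷ vs)) post)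
    ≡⟨ lem₂ (f y) (f z) k (H post) _ _ ⟩
  _ ∎
  where
  open ≡-Reasoning
  opaque
    unfolding ℤ
    lem₁ : ∀ a k b c → a * (b + k * c) ≡ a * b + k * (a * c)
    lem₁ = solve-∀ ring
    lem₂ : ∀ a b k h s t → (a + k * b) * h - (s + k * t) ≡ a * h - s + k * (b * h - t)
    lem₂ = solve-∀ ring
expand-linear f H x y z k e l (u ∷ pre) post = trans
  (cong₂ (λ s t → f u * s - t) (l pre post)
    (expand-linear f (H ∘ (u ∷_)) x y z k e (λ p → l (u ∷ p)) pre post))
  (lem (f u) k _ _ _ _)
  where
  opaque
    unfolding ℤ
    lem : ∀ a k b c s t → a * (b + k * c) - (s + k * t) ≡ a * b - s + k * (a * c - t)
    lem = solve-∀ ring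

D-column-linear : ∀ (fs : List (X → ℤ)) x y z k → All (λ f → f x ≡ f y + k * f z) fs →
  ColumnLinear x y z k (D fs)
D-column-linear [] _ _ _ k [] [] post = lem k
  where
  opaque
    unfolding ℤ
    lem : ∀ k → 0ℤ ≡ 0ℤ + k * 0ℤ
    lem = solve-∀ ring
D-column-linear [] _ _ _ k [] (_ ∷ _) post = lem k
  where
  opaque
    unfolding ℤ
    lem : ∀ k → 0ℤ ≡ 0ℤ + k * 0ℤ
    lem = solve-∀ ring
D-column-linear (f ∷ fs) x y z k (e ∷ es) = expand-linear f (D fs) x y z k e (D-column-linear fs x y z k es)

-- x is the pivot column: every y is x + k y′.
Pivoted : (H : List X → ℤ) (x : X) → List ℤ → List X → List X → Set
Pivoted H x [] [] [] = ⊤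
Pivoted H x (k ∷ ks) (y ∷ ys) (z ∷ zs) = ColumnLinear y x z k H × Pivoted H x ks ys zs
Pivoted H x _ _ _ = ⊥

Pivoted-cons : ∀ {H : List X → ℤ} {x} u ks ys zs → Pivoted H x ks ys zs → Pivoted (H ∘ (u ∷_)) x ks ys zs
Pivoted-cons u [] [] [] p = tt
Pivoted-cons u (k ∷ ks) (y ∷ ys) (z ∷ zs) (l , p) = (λ pre → l (u ∷ pre)) , Pivoted-cons u ks ys zs p

-- The part x of the next column y is a second copy of the pivot and contributes nothing, which
-- leaves k times z. Exchanging x and y first puts the pivot directly in front of the remaining
-- columns for the induction.
pivot : ∀ {H : List X → ℤ} {x} ks ys zs → Alternating H → Pivoted H x ks ys zs →
  H (x ∷ ys) ≡ ∏ ks id * H (x ∷ zs)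
pivot [] [] [] a p = sym (*-identityˡ _)
pivot {H = H} {x} (k ∷ ks) (y ∷ ys) (z ∷ zs) a (l , p) = begin
  H (x ∷ y ∷ ys)                                  ≡⟨ a [] x y ys ⟩
  - H (y ∷ x ∷ ys)
    ≡⟨ cong -_ (pivot ks ys zs (λ pre → a (y ∷ pre)) (Pivoted-cons y ks ys zs p)) ⟩
  - (∏ ks id * H (y ∷ x ∷ zs))                    ≡⟨ cong (λ t → - (∏ ks id * t)) (a [] y x zs) ⟩
  - (∏ ks id * - H (x ∷ y ∷ zs))                  ≡⟨ cong (λ t → - (∏ ks id * - t)) (l (x ∷ []) zs) ⟩
  - (∏ ks id * - (H (x ∷ x ∷ zs) + k * H (x ∷ z ∷ zs)))
    ≡⟨ cong (λ t → - (∏ ks id * - (t + k * H (x ∷ z ∷ zs)))) (x≡-x⇒x≡0 _ (a [] x x zs)) ⟩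
  - (∏ ks id * - (0ℤ + k * H (x ∷ z ∷ zs)))       ≡⟨ lem (∏ ks id) k _ ⟩
  k * ∏ ks id * H (x ∷ z ∷ zs)                    ∎
  where
  open ≡-Reasoning
  opaque
    unfolding ℤ
    lem : ∀ a k h → - (a * - (0ℤ + k * h)) ≡ k * a * h
    lem = solve-∀ ring

-- Polynomials of bounded degree and Vandermonde determinants

infixr 8 _^_
_^_ : ℤ → ℕ → ℤ
x ^ zero = 1ℤ
x ^ suc n = x * x ^ n

2ℤ : ℤ
2ℤ = 1ℤ + 1ℤ

-- f is a polynomial function of degree at most d, and ℓ is its coefficient of degree d.
data Degree : ℕ → ℤ → (ℤ → ℤ) → Set where
  const  : ∀ {ℓ f} → (∀ p → f p ≡ ℓ) → Degree zero ℓ f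
  horner : ∀ {d ℓ f g} c → Degree d ℓ g → (∀ p → f p ≡ p * g p + c) → Degree (suc d) ℓ f

degree-cong : ∀ {d ℓ ℓ′ f f′} → ℓ ≡ ℓ′ → (∀ p → f p ≡ f′ p) → Degree d ℓ f → Degree d ℓ′ f′
degree-cong refl e (const h) = const λ p → trans (sym (e p)) (h p)
degree-cong refl e (horner c g h) = horner c g λ p → trans (sym (e p)) (h p)

degree-+ : ∀ {d ℓ ℓ′ f f′} → Degree d ℓ f → Degree d ℓ′ f′ → Degree d (ℓ + ℓ′) (λ p → f p + f′ p)
degree-+ (const h) (const h′) = const λ p → cong₂ _+_ (h p) (h′ p)
degree-+ (horner c g h) (horner c′ g′ h′) = horner (c + c′) (degree-+ g g′)
  λ p → trans (cong₂ _+_ (h p) (h′ p)) (lem p _ _ c c′)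
  where
  opaque
    unfolding ℤ
    lem : ∀ p x y c c′ → p * x + c + (p * y + c′) ≡ p * (x + y) + (c + c′)
    lem = solve-∀ ring

degree-scale : ∀ {d ℓ f} a → Degree d ℓ f → Degree d (a * ℓ) (λ p → a * f p)
degree-scale a (const h) = const λ p → cong (a *_) (h p)
degree-scale a (horner c g h) = horner (a * c) (degree-scale a g) λ p → trans (cong (a *_) (h p)) (lem p _ c a)
  where
  opaque
    unfolding ℤ
    lem : ∀ p x c a → a * (p * x + c) ≡ p * (a * x) + a * c
    lem = solve-∀ ring

degree-shift : ∀ {d ℓ f} c → Degree (suc d) ℓ f → Degree (suc d) ℓ (λ p → f p + c)
degree-shift c (horner c′ g h) = horner (c′ + c) g λ p → trans (cong (_+ c) (h p)) (+-assoc _ c′ c)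

degree-linear : ∀ {d ℓ f} a b → Degree d ℓ f → Degree (suc d) (a * ℓ) (λ p → (p * a + b) * f p)
degree-linear {ℓ = ℓ} a b (const h) = horner (b * ℓ) (const λ p → refl) λ p →
  trans (cong ((p * a + b) *_) (h p)) (lem p a b ℓ)
  where
  opaque
    unfolding ℤ
    lem : ∀ p a b l → (p * a + b) * l ≡ p * (a * l) + b * l
    lem = solve-∀ ring
degree-linear a b (horner {g = g} c d h) =
  horner (b * c) (degree-shift (a * c) (degree-linear a b d)) λ p →
  trans (cong ((p * a + b) *_) (h p)) (lem p a b (g p) c)
  where
  opaque
    unfolding ℤ
    lem : ∀ p a b x c → (p * a + b) * (p * x + c) ≡ p * ((p * a + b) * x + a * c) + b * c
    lem = solve-∀ ring

degree-raise : ∀ {d ℓ f} → Degree d ℓ f → Degree (suc d) 0ℤ f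
degree-raise (const {ℓ} h) = horner ℓ (const λ p → refl) λ p →
  trans (h p) (sym (trans (cong (_+ ℓ) (zeroʳ p)) (+-identityˡ ℓ)))
degree-raise (horner c g h) = horner c (degree-raise g) h

degree-zero : ∀ d → Degree d 0ℤ (λ _ → 0ℤ)
degree-zero zero = const λ _ → refl
degree-zero (suc d) = degree-raise (degree-zero d)

-- The factor p² + 1 is c₂ in `rw w p 1ℤ`, the only one of these weights that is quadratic in p.
degree-quadratic : ∀ {d ℓ f} → Degree d ℓ f → Degree (2 ℕ.+ d) ℓ (λ p → (p * p + 1ℤ) * f p)
degree-quadratic {ℓ = ℓ} {f = f} g = degree-cong (lem₀ ℓ) (λ p → lem p (f p))
  (degree-+ (degree-linear 1ℤ 0ℤ (degree-linear 1ℤ 0ℤ g)) (degree-raise (degree-raise g)))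
  where
  opaque
    unfolding ℤ
    lem₀ : ∀ l → 1ℤ * (1ℤ * l) + 0ℤ ≡ l
    lem₀ = solve-∀ ring
    lem : ∀ p x → (p * 1ℤ + 0ℤ) * ((p * 1ℤ + 0ℤ) * x) + x ≡ (p * p + 1ℤ) * x
    lem = solve-∀ ring

degree-∑± : ∀ {d} {ℓ : X → List X → ℤ} {K : ℤ → X → List X → ℤ} →
  (∀ w vs → Degree d (ℓ w vs) (λ p → K p w vs)) → ∀ ws → Degree d (∑± ℓ ws) (λ p → ∑± (K p) ws)
degree-∑± {d = d} e [] = degree-zero d
degree-∑± e (w ∷ ws) = degree-cong (lem _ _) (λ p → lem _ _)
  (degree-+ (e w ws) (degree-scale (- 1ℤ) (degree-∑± (λ v vs → e v (w ∷ vs)) ws)))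
  where
  opaque
    unfolding ℤ
    lem : ∀ a b → a + - 1ℤ * b ≡ a - b
    lem = solve-∀ ring

degree-D : ∀ (rows : List ((X → ℤ) × (X → ℤ))) ws →
  Degree (length rows) (D (map proj₁ rows) ws) (λ p → D (map (λ r w → p * proj₁ r w + proj₂ r w) rows) ws)
degree-D [] ws = const λ _ → refl
degree-D ((f , g) ∷ rows) = degree-∑± λ w vs → degree-linear (f w) (g w) (degree-D rows vs)

data Pick {X : Set} (w : X) : List X → List X → Set where
  here  : ∀ {ws} → Pick w ws (w ∷ ws)
  there : ∀ {u vs ws} → Pick w vs ws → Pick w (u ∷ vs) (u ∷ ws)

∑±-cong-pick : ∀ {K K′ : X → List X → ℤ} ws → (∀ w vs → Pick w vs ws → K w vs ≡ K′ w vs) → ∑± K ws ≡ ∑± K′ ws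
∑±-cong-pick [] e = refl
∑±-cong-pick (w ∷ ws) e = cong₂ _-_ (e w ws here) (∑±-cong-pick ws (λ v vs p → e v (w ∷ vs) (there p)))

-- Bringing w to the front multiplies H and H′ by the same sign, which cancels from the cross
-- products and never has to be computed.
alternating-pick : ∀ {H H′ : List X → ℤ} → Alternating H → Alternating H′ → ∀ {w vs ws} → Pick w vs ws →
  H ws * H′ (w ∷ vs) ≡ H (w ∷ vs) * H′ ws
alternating-pick a a′ here = refl
alternating-pick {H = H} {H′} a a′ {w} (there {u} {vs} {ws} p) = begin
  H (u ∷ ws) * H′ (w ∷ u ∷ vs)     ≡⟨ cong (H (u ∷ ws) *_) (a′ [] w u vs) ⟩
  H (u ∷ ws) * - H′ (u ∷ w ∷ vs)   ≡⟨ lem _ _ ⟩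
  - (H (u ∷ ws) * H′ (u ∷ w ∷ vs)) ≡⟨ cong -_ (alternating-pick (λ pre → a (u ∷ pre)) (λ pre → a′ (u ∷ pre)) p) ⟩
  - (H (u ∷ w ∷ vs) * H′ (u ∷ ws)) ≡⟨ lem₂ _ _ ⟩
  - H (u ∷ w ∷ vs) * H′ (u ∷ ws)   ≡⟨ cong (_* H′ (u ∷ ws)) (sym (a [] w u vs)) ⟩
  H (w ∷ u ∷ vs) * H′ (u ∷ ws)     ∎
  where
  open ≡-Reasoning
  opaque
    unfolding ℤ
    lem : ∀ a b → a * - b ≡ - (a * b)
    lem = solve-∀ ring
    lem₂ : ∀ a b → - (a * b) ≡ - a * b
    lem₂ = solve-∀ ring

∏-zero : ∀ {h : X → ℤ} {x xs} → x ∈ xs → h x ≡ 0ℤ → ∏ xs h ≡ 0ℤ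
∏-zero {h = h} {xs = _ ∷ xs} (here refl) e = trans (cong (_* ∏ xs h) e) (zeroˡ _)
∏-zero {h = h} {xs = y ∷ xs} (there m) e = trans (cong (h y *_) (∏-zero m e)) (zeroʳ _)

∏-nonzero : ∀ {h : X → ℤ} {xs} → All (λ x → h x ≢ 0ℤ) xs → ∏ xs h ≢ 0ℤ
∏-nonzero [] = 1≢0
∏-nonzero (p ∷ ps) = *-nonzero p (∏-nonzero ps)

pick-∈ : ∀ {w : X} {vs ws} → Pick w vs ws → w ∈ ws
pick-∈ here = here refl
pick-∈ (there p) = there (pick-∈ p)

pick-sub : ∀ {w : X} {vs ws x} → Pick w vs ws → x ∈ vs → x ∈ ws
pick-sub here m = there m
pick-sub (there p) (here e) = here e
pick-sub (there p) (there m) = there (pick-sub p m)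

pick-∏ : ∀ {w : X} {vs ws} (h : X → ℤ) → Pick w vs ws → ∏ ws h ≡ h w * ∏ vs h
pick-∏ h here = refl
pick-∏ {w = w} h (there {u} {vs} p) = trans (cong (h u *_) (pick-∏ h p)) (*-exchange (h u) (h w) (∏ vs h))

pick-length : ∀ {w : X} {vs ws} → Pick w vs ws → length ws ≡ suc (length vs)
pick-length here = refl
pick-length (there p) = cong suc (pick-length p)

pick-unique : ∀ {w : X} {vs ws} → Pick w vs ws → Unique ws → All (w ≢_) vs × Unique vs
pick-unique here (a ∷ u) = a , u
pick-unique (there p) (a ∷ u) =
  ((λ e → All.lookup a (pick-∈ p) (sym e)) ∷ proj₁ (pick-unique p u)) ,
  (drop p a ∷ proj₂ (pick-unique p u))
  where
  drop : ∀ {Q : X → Set} {w vs ws} → Pick w vs ws → All Q ws → All Q vs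
  drop here (_ ∷ qs) = qs
  drop (there p) (q ∷ qs) = q ∷ drop p qs

module Points {X : Set} (val : X → ℤ) where

  monomials : ℕ → List (X → ℤ)
  monomials zero = []
  monomials (suc n) = (λ x → val x ^ n) ∷ monomials n

  V : ℕ → List X → ℤ
  V n = D (monomials n)

  monomial-∈ : ∀ {m n} → m ℕ.< n → (λ x → val x ^ m) ∈ monomials n
  monomial-∈ {m} {suc n} (s≤s m≤n) with ℕₚ.m≤n⇒m<n∨m≡n m≤n
  ... | inj₁ m<n = there (monomial-∈ m<n)
  ... | inj₂ refl = here refl

  -- The lower monomials are rows already, so only the leading term of the polynomial row matters.
  -- Expanded along that row, the left side is a sum over the values of f at the nodes: this is
  -- Lagrange interpolation of the leading coefficient without denominators.
  lagrange : ∀ {n ℓ f} → Degree n ℓ f → ∀ ws → D (f ∘ val ∷ monomials n) ws ≡ ℓ * V (suc n) ws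
  lagrange {n} {ℓ} {f} h ws = trans
    (at (D-cons {fs = monomials n} (λ x → sym (*-identityʳ _)) ≋-refl) ws) (go h 0 (ℕₚ.+-identityʳ n))
    where
    opaque
      unfolding ℤ
      lem : ∀ p x c q → (p * x + c) * q ≡ x * (p * q) + c * q
      lem = solve-∀ ring
    -- A Horner step turns f(x) x^m into g(x) x^(m+1) + c x^m, and x^m with m < n is one of the rows
    -- below.
    go : ∀ {d ℓ f} → Degree d ℓ f → ∀ m → d ℕ.+ m ≡ n →
      D ((λ x → f (val x) * val x ^ m) ∷ monomials n) ws ≡ ℓ * V (suc n) ws
    go {ℓ = ℓ} (const {f = f} h) m refl = trans
      (∑±-cong (λ w vs → trans (cong (λ t → t * val w ^ m * D (monomials m) vs) (h (val w))) (*-assoc ℓ _ _)) ws)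
      (∑±-scale _ ℓ ws)
    go {ℓ = ℓ} (horner {d} {f = f} {g} c h e) m refl = begin
      D ((λ x → f (val x) * val x ^ m) ∷ monomials n) ws
        ≡⟨ at (D-cons {fs = monomials n}
             (λ x → trans (cong (_* val x ^ m) (e (val x))) (lem (val x) (g (val x)) c (val x ^ m))) ≋-refl) ws ⟩
      D ((λ x → g (val x) * val x ^ suc m + c * val x ^ m) ∷ monomials n) ws
        ≡⟨ D-linear (λ x → g (val x) * val x ^ suc m) (λ x → val x ^ m) c (monomials n) ws ⟩
      D ((λ x → g (val x) * val x ^ suc m) ∷ monomials n) ws + c * D ((λ x → val x ^ m) ∷ monomials n) ws
        ≡⟨ cong₂ (λ s t → s + c * t) (go h (suc m) (ℕₚ.+-suc d m)) (D-repeat (monomial-∈ (s≤s (ℕₚ.m≤n+m m d))) ws) ⟩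
      ℓ * V (suc n) ws + c * 0ℤ
        ≡⟨ cong (λ t → ℓ * V (suc n) ws + t) (zeroʳ c) ⟩
      ℓ * V (suc n) ws + 0ℤ
        ≡⟨ +-identityʳ _ ⟩
      ℓ * V (suc n) ws ∎
      where open ≡-Reasoning

  degree-roots : ∀ vs → Degree (length vs) 1ℤ (λ p → ∏ vs (λ v → p - val v))
  degree-roots [] = const λ _ → refl
  degree-roots (v ∷ vs) = degree-cong (*-identityˡ 1ℤ)
    (λ p → cong (λ t → (t - val v) * ∏ vs (λ u → p - val u)) (*-identityʳ p))
    (degree-linear 1ℤ (- val v) (degree-roots vs))

  -- The monic polynomial with roots vs is interpolated at w ∷ vs. Its leading coefficient is 1 and
  -- it vanishes at all nodes except possibly w, so one term of the expansion remains.
  vandermonde : ∀ w vs → V (suc (length vs)) (w ∷ vs) ≡ ∏ vs (λ v → val w - val v) * V (length vs) vs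
  vandermonde w vs = begin
    V (suc n) (w ∷ vs)                    ≡⟨ sym (*-identityˡ _) ⟩
    1ℤ * V (suc n) (w ∷ vs)               ≡⟨ sym (lagrange (degree-roots vs) (w ∷ vs)) ⟩
    r w * V n vs - ∑± (λ v us → r v * V n (w ∷ us)) vs
      ≡⟨ cong (λ t → r w * V n vs - t) (trans (∑±-cong-pick vs (λ v us p →
           trans (cong (_* V n (w ∷ us)) (∏-zero (pick-∈ p) (-‿inverseʳ (val v)))) (zeroˡ _)))
           (∑±-zero (λ _ _ → refl) vs)) ⟩
    r w * V n vs - 0ℤ                     ≡⟨ trans (cong (λ t → r w * V n vs + t) -0≡0) (+-identityʳ _) ⟩
    r w * V n vs                          ∎
    where
    open ≡-Reasoning
    n : ℕ
    n = length vs
    r : X → ℤ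
    r x = ∏ vs (λ v → val x - val v)

-- The recursion of the determinant E

D-neg : ∀ (fs : List (X → ℤ)) ws → D (map (λ f x → - f x) fs) ws ≡ sgn (length fs) * D fs ws
D-neg [] ws = sym (*-identityˡ _)
D-neg (f ∷ fs) ws = trans
  (∑±-cong (λ w vs → trans (cong (- f w *_) (D-neg fs vs)) (lem (f w) _ _)) ws)
  (∑±-scale _ (- sgn (length fs)) ws)
  where
  opaque
    unfolding ℤ
    lem : ∀ a s d → - a * (s * d) ≡ - s * (a * d)
    lem = solve-∀ ring

sgn-square : ∀ n → sgn n * sgn n ≡ 1ℤ
sgn-square zero = *-identityˡ 1ℤ
sgn-square (suc n) = trans (lem (sgn n)) (sgn-square n)
  where
  opaque
    unfolding ℤ
    lem : ∀ a → - a * - a ≡ a * a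
    lem = solve-∀ ring

-- κ j k is (1-w)^(j+k+1) times the coefficient of ζ^k in (1+ζ²) / ((1-ζw) (1-ζ-(1+ζ)w)).
κ : ℕ → ℕ → ℤ → ℤ
κ j zero w = (1ℤ - w) ^ j
κ j (suc k) w = 2ℤ * (1ℤ + w) ^ k * (1ℤ - w) ^ j - (1ℤ - w) ^ (2 ℕ.+ (j ℕ.+ k)) * w ^ k

κ-suc : ∀ j k w → κ (suc j) k w ≡ (1ℤ - w) * κ j k w
κ-suc j zero w = refl
κ-suc j (suc k) w = lem (1ℤ - w) _ _ _ _
  where
  opaque
    unfolding ℤ
    lem : ∀ o p q r s → 2ℤ * p * (o * q) - o * (o * r) * s ≡ o * (2ℤ * p * q - o * r * s)
    lem = solve-∀ ring

δ₀ : ℕ → ℤ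
δ₀ zero = 1ℤ
δ₀ (suc _) = 0ℤ

-- The denominator of the generating function expands to (1-w) - (1+2w-w²)ζ + w(1+w)ζ². Multiplying
-- by it and comparing coefficients of ζ^(k+2) gives the recurrence; the numerator 1+ζ² has a term
-- of this degree only for k = 0.
κ-recurrence : ∀ j k w → w * (1ℤ + w) * κ (suc j) k w + κ j (2 ℕ.+ k) w
  ≡ (1ℤ + 2ℤ * w - w * w) * κ j (suc k) w + δ₀ k * (1ℤ - w) ^ (2 ℕ.+ (j ℕ.+ k))
κ-recurrence j zero w rewrite ℕₚ.+-identityʳ j | ℕₚ.+-comm j 1 = lem w ((1ℤ - w) ^ j)
  where
  opaque
    unfolding ℤ
    lem : ∀ w a → w * (1ℤ + w) * ((1ℤ - w) * a)
        + (2ℤ * ((1ℤ + w) * 1ℤ) * a - (1ℤ - w) * ((1ℤ - w) * ((1ℤ - w) * a)) * (w * 1ℤ))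
      ≡ (1ℤ + 2ℤ * w - w * w) * (2ℤ * 1ℤ * a - (1ℤ - w) * ((1ℤ - w) * a) * 1ℤ)
        + 1ℤ * ((1ℤ - w) * ((1ℤ - w) * a))
    lem = solve-∀ ring
κ-recurrence j (suc k) w rewrite ℕₚ.+-suc j (suc k) | ℕₚ.+-suc j k =
  lem w ((1ℤ - w) ^ j) ((1ℤ - w) ^ (j ℕ.+ k)) ((1ℤ + w) ^ k) (w ^ k)
  where
  opaque
    unfolding ℤ
    lem : ∀ w a b p q → w * (1ℤ + w) * (2ℤ * p * ((1ℤ - w) * a) - (1ℤ - w) * ((1ℤ - w) * ((1ℤ - w) * b)) * q)
        + (2ℤ * ((1ℤ + w) * ((1ℤ + w) * p)) * a
           - (1ℤ - w) * ((1ℤ - w) * ((1ℤ - w) * ((1ℤ - w) * b))) * (w * (w * q)))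
      ≡ (1ℤ + 2ℤ * w - w * w) * (2ℤ * ((1ℤ + w) * p) * a - (1ℤ - w) * ((1ℤ - w) * ((1ℤ - w) * b)) * (w * q))
        + 0ℤ * ((1ℤ - w) * ((1ℤ - w) * ((1ℤ - w) * b)))
    lem = solve-∀ ring

-- The six-vertex weight a of lines with parameters w and p; it is p - w for the weight b.
wa : ℤ → ℤ → ℤ
wa w p = p - 1ℤ - (p + 1ℤ) * w

-- The product of the weights a and b₁. It is p² times the denominator of the generating function of
-- κ at ζ = 1/p, which is why the recurrence of κ can lower the degree in p.
wab : ℤ → ℤ → ℤ
wab p w = (p - w) * wa w p

ρ : ℤ → ℕ → ℕ → ℤ → ℤ
ρ p j zero w = wab p w * κ j zero w
ρ p j (suc k) w = wab p w * κ j (suc k) w + p * ρ p (suc j) k w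

c-ρ : ℤ → ℕ → ℤ
c-ρ p zero = p * p
c-ρ p (suc k) = p * (c-ρ p k + δ₀ k)

-- The p² term of `wab p w * κ j (suc k) w` has the coefficient (1-w) κ, and p times the row below
-- contributes its negative through `κ-suc`. The recurrence makes the remaining terms linear in p,
-- up to a multiple of a power of 1-w that depends on j + k only.
ρ-modulo : ∀ p j k w → ρ p j k w
  ≡ (p * - κ j (suc k) w + w * (1ℤ + w) * κ j k w) + c-ρ p k * (1ℤ - w) ^ suc (j ℕ.+ k)
ρ-modulo p j zero w rewrite ℕₚ.+-identityʳ j = lem p w ((1ℤ - w) ^ j)
  where
  opaque
    unfolding ℤ
    lem : ∀ p w a → (p - w) * (p - 1ℤ - (p + 1ℤ) * w) * a
      ≡ (p * - (2ℤ * 1ℤ * a - (1ℤ - w) * ((1ℤ - w) * a) * 1ℤ) + w * (1ℤ + w) * a) + p * p * ((1ℤ - w) * a)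
    lem = solve-∀ ring
ρ-modulo p j (suc k) w = begin
  wab p w * κ j (suc k) w + p * ρ p (suc j) k w
    ≡⟨ cong (λ t → wab p w * κ j (suc k) w + p * t) (ρ-modulo p (suc j) k w) ⟩
  wab p w * κ j (suc k) w + p * ((p * - κ (suc j) (suc k) w + w * (1ℤ + w) * κ (suc j) k w) + c-ρ p k * (o * e))
    ≡⟨ cong (λ t → wab p w * κ j (suc k) w + p * ((p * - t + w * (1ℤ + w) * κ (suc j) k w) + c-ρ p k * (o * e)))
         (κ-suc j (suc k) w) ⟩
  wab p w * κ j (suc k) w + p * ((p * - (o * κ j (suc k) w) + w * (1ℤ + w) * κ (suc j) k w) + c-ρ p k * (o * e))
    ≡⟨ lem₁ p w (κ j (suc k) w) (w * (1ℤ + w) * κ (suc j) k w) (κ j (2 ℕ.+ k) w) (c-ρ p k * (o * e)) ⟩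
  p * (w * (1ℤ + w) * κ (suc j) k w + κ j (2 ℕ.+ k) w) - p * κ j (2 ℕ.+ k) w
    + (w * (1ℤ + w) - p * (1ℤ + 2ℤ * w - w * w)) * κ j (suc k) w + p * (c-ρ p k * (o * e))
    ≡⟨ cong (λ t → p * t - p * κ j (2 ℕ.+ k) w
         + (w * (1ℤ + w) - p * (1ℤ + 2ℤ * w - w * w)) * κ j (suc k) w + p * (c-ρ p k * (o * e)))
         (κ-recurrence j k w) ⟩
  p * ((1ℤ + 2ℤ * w - w * w) * κ j (suc k) w + δ₀ k * (o * e)) - p * κ j (2 ℕ.+ k) w
    + (w * (1ℤ + w) - p * (1ℤ + 2ℤ * w - w * w)) * κ j (suc k) w + p * (c-ρ p k * (o * e))
    ≡⟨ lem₂ p w (κ j (suc k) w) (κ j (2 ℕ.+ k) w) (c-ρ p k) (δ₀ k) (o * e) ⟩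
  (p * - κ j (2 ℕ.+ k) w + w * (1ℤ + w) * κ j (suc k) w) + p * (c-ρ p k + δ₀ k) * (o * e)
    ≡⟨ cong (λ t → (p * - κ j (2 ℕ.+ k) w + w * (1ℤ + w) * κ j (suc k) w) + p * (c-ρ p k + δ₀ k) * (o * o ^ t))
         (sym (ℕₚ.+-suc j k)) ⟩
  (p * - κ j (2 ℕ.+ k) w + w * (1ℤ + w) * κ j (suc k) w) + p * (c-ρ p k + δ₀ k) * (o * o ^ (j ℕ.+ suc k)) ∎
  where
  open ≡-Reasoning
  o e : ℤ
  o = 1ℤ - w
  e = o ^ suc (j ℕ.+ k)
  opaque
    unfolding ℤ
    lem₁ : ∀ p w x y z c → (p - w) * (p - 1ℤ - (p + 1ℤ) * w) * x + p * ((p * - ((1ℤ - w) * x) + y) + c)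
      ≡ p * (y + z) - p * z + (w * (1ℤ + w) - p * (1ℤ + 2ℤ * w - w * w)) * x + p * c
    lem₁ = solve-∀ ring
    lem₂ : ∀ p w x z c d e → p * ((1ℤ + 2ℤ * w - w * w) * x + d * e) - p * z
        + (w * (1ℤ + w) - p * (1ℤ + 2ℤ * w - w * w)) * x + p * (c * e)
      ≡ (p * - z + w * (1ℤ + w) * x) + p * (c + d) * e
    lem₂ = solve-∀ ring

module Recursion {X : Set} (val : X → ℤ) where
  open Points val

  κ-rows : ℕ → ℕ → List (X → ℤ)
  κ-rows j zero = []
  κ-rows j (suc k) = κ j k ∘ val ∷ κ-rows (suc j) k

  E : ℕ → List X → ℤ
  E n = D (κ-rows 0 n)

  κ-rows-suc : ∀ j k → κ-rows (suc j) k ≋ map (λ f x → (1ℤ - val x) * f x) (κ-rows j k)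
  κ-rows-suc j zero = ≋-refl
  κ-rows-suc j (suc k) = D-cons (λ x → κ-suc j k (val x)) (κ-rows-suc (suc j) k)

  -- The determinant Q p as a function of p has degree one less than its size, since up to row
  -- operations every row below α is linear in p.
  α : ℕ → X → ℤ
  α n x = (1ℤ - val x) ^ n

  Q : ℕ → ℤ → List X → ℤ
  Q m p = D (α (suc m) ∷ map (λ f x → wab p (val x) * f x) (κ-rows 1 m))

  ρ-rows : ℤ → ℕ → ℕ → List (X → ℤ)
  ρ-rows p j zero = []
  ρ-rows p j (suc k) = ρ p j k ∘ val ∷ ρ-rows p (suc j) k

  -- From the bottom row upwards, p times the row below, which has already been treated, is added to
  -- each row.
  wab-rows≋ρ-rows : ∀ p j k → map (λ f x → wab p (val x) * f x) (κ-rows j k) ≋ ρ-rows p j k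
  wab-rows≋ρ-rows p j zero = ≋-refl
  wab-rows≋ρ-rows p j (suc zero) = D-cons (λ _ → refl) ≋-refl
  wab-rows≋ρ-rows p j (suc (suc k)) .at ws = trans
    (at (D-cons (λ _ → refl) (wab-rows≋ρ-rows p (suc j) (suc k))) ws)
    (sym (at (D-add-next (λ x → wab p (val x) * κ j (suc k) (val x)) (ρ p (suc j) k ∘ val) p (ρ-rows p (suc (suc j)) k)) ws))

  linear-rows : ℕ → ℕ → List ((X → ℤ) × (X → ℤ))
  linear-rows j zero = []
  linear-rows j (suc k) =
    ((λ x → - κ j (suc k) (val x)) , (λ x → val x * (1ℤ + val x) * κ j k (val x))) ∷ linear-rows (suc j) k

  ρ-rows-modulo : ∀ p j k n → j ℕ.+ k ≡ n →
    Pointwise (Modulo (α n)) (ρ-rows p j k) (map (λ r w → p * proj₁ r w + proj₂ r w) (linear-rows j k))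
  ρ-rows-modulo p j zero n e = []
  ρ-rows-modulo p j (suc k) n e =
    (c-ρ p k , λ x → trans (ρ-modulo p j k (val x)) (cong (λ t → p * - κ j (suc k) (val x)
       + val x * (1ℤ + val x) * κ j k (val x) + c-ρ p k * (1ℤ - val x) ^ t) (trans (sym (ℕₚ.+-suc j k)) e)))
    ∷ ρ-rows-modulo p (suc j) k n (trans (sym (ℕₚ.+-suc j k)) e)

  -- The row α n is κ n 0, the last row of the block of κ. Moving it there from the top costs the
  -- same sign as the minus signs of the leading coefficients.
  leading-rows : ∀ j k n → j ℕ.+ k ≡ n → ∀ ws →
    D (α n ∷ map proj₁ (linear-rows j k)) ws ≡ D (κ-rows j (suc k)) ws
  leading-rows j k n e ws = begin
    D (α n ∷ map proj₁ (linear-rows j k)) ws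
      ≡⟨ ∑±-cong (λ w vs → trans (cong (α n w *_) (trans (cong (λ t → D t vs) (shape j k)) (D-neg (upper j k) vs)))
           (*-exchange _ _ _)) ws ⟩
    ∑± (λ w vs → sgn (length (upper j k)) * (α n w * D (upper j k) vs)) ws
      ≡⟨ ∑±-scale _ _ ws ⟩
    sgn (length (upper j k)) * D (α n ∷ upper j k) ws
      ≡⟨ sym (D-snoc (α n) (upper j k) ws) ⟩
    D (upper j k ++ α n ∷ []) ws
      ≡⟨ cong (λ t → D t ws) (shape₂ j k e) ⟩
    D (κ-rows j (suc k)) ws ∎
    where
    open ≡-Reasoning
    upper : ℕ → ℕ → List (X → ℤ)
    upper j zero = []
    upper j (suc k) = κ j (suc k) ∘ val ∷ upper (suc j) k
    shape : ∀ j k → map proj₁ (linear-rows j k) ≡ map (λ f x → - f x) (upper j k)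
    shape j zero = refl
    shape j (suc k) = cong (_ ∷_) (shape (suc j) k)
    shape₂ : ∀ j k → j ℕ.+ k ≡ n → upper j k ++ α n ∷ [] ≡ κ-rows j (suc k)
    shape₂ j zero e = cong (λ t → (α t ∷ [])) (trans (sym e) (ℕₚ.+-identityʳ j))
    shape₂ j (suc k) e = cong (_ ∷_) (shape₂ (suc j) k (trans (sym (ℕₚ.+-suc j k)) e))

  length-linear-rows : ∀ j k → length (linear-rows j k) ≡ k
  length-linear-rows j zero = refl
  length-linear-rows j (suc k) = cong suc (length-linear-rows (suc j) k)

  Q-degree : ∀ m ws → Degree m (∏ ws (λ x → 1ℤ - val x) * E (suc m) ws) (λ p → Q m p ws)
  Q-degree m ws = subst (λ d → Degree d (∏ ws (λ x → 1ℤ - val x) * E (suc m) ws) (λ p → Q m p ws)) (length-linear-rows 1 m)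
    (degree-cong lead (λ p → sym (reduce p))
      (degree-∑± {ℓ = λ w vs → α (suc m) w * D (map proj₁ (linear-rows 1 m)) vs}
        (λ w vs → degree-scale (α (suc m) w) (degree-D (linear-rows 1 m) vs)) ws))
    where
    lead : D (α (suc m) ∷ map proj₁ (linear-rows 1 m)) ws ≡ ∏ ws (λ x → 1ℤ - val x) * E (suc m) ws
    lead = trans (leading-rows 1 m (suc m) refl ws)
      (trans (at (κ-rows-suc 0 (suc m)) ws) (D-scale (λ x → 1ℤ - val x) (κ-rows 0 (suc m)) ws))
    reduce : ∀ p → Q m p ws ≡ D (α (suc m) ∷ map (λ r w → p * proj₁ r w + proj₂ r w) (linear-rows 1 m)) ws
    reduce p = trans (at (D-cons (λ _ → refl) (wab-rows≋ρ-rows p 1 m)) ws)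
      (at (D-modulo (α (suc m)) (ρ-rows-modulo p 1 m (suc m) refl)) ws)

  -- At p = val w the factor `wab` vanishes in the column w, where only the entry of the row α
  -- survives. The opposite minor is E of size m with scaled columns.
  Q-head : ∀ m w vs → Q m (val w) (w ∷ vs)
    ≡ α (suc m) w * (∏ vs (λ v → wab (val w) (val v)) * (∏ vs (λ v → 1ℤ - val v) * E m vs))
  Q-head m w vs = trans
    (cong₂ (λ s t → α (suc m) w * s - t)
      (trans (D-scale (λ x → wab (val w) (val x)) (κ-rows 1 m) vs)
        (cong (∏ vs (λ v → wab (val w) (val v)) *_)
          (trans (at (κ-rows-suc 0 m) vs) (D-scale (λ x → 1ℤ - val x) (κ-rows 0 m) vs))))
      (∑±-zero (λ v us → trans (cong (α (suc m) v *_)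
        (trans (D-scale (λ x → wab (val w) (val x)) (κ-rows 1 m) (w ∷ us))
          (trans (cong (λ t → t * wa (val w) (val w) * ∏ us (λ v → wab (val w) (val v)) * D (κ-rows 1 m) (w ∷ us))
              (-‿inverseʳ (val w)))
            (lem₀ _ _ _))))
        (zeroʳ _)) vs))
    (lem₁ _)
    where
    opaque
      unfolding ℤ
      lem₀ : ∀ a b c → 0ℤ * a * b * c ≡ 0ℤ
      lem₀ = solve-∀ ring
      lem₁ : ∀ a → a - 0ℤ ≡ a
      lem₁ = solve-∀ ring

  module _ (separated : ∀ {x y} → x ≢ y → val x - val y ≢ 0ℤ) (1-val≢0 : ∀ x → 1ℤ - val x ≢ 0ℤ) where

    V-nonzero : ∀ {ws} → Unique ws → V (length ws) ws ≢ 0ℤ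
    V-nonzero [] = 1≢0
    V-nonzero {w ∷ ws} (a ∷ u) e =
      *-nonzero (∏-nonzero (All.map separated a)) (V-nonzero u) (trans (sym (vandermonde w ws)) e)

    -- The leading coefficient of Q in p is interpolated from its values at the nodes themselves,
    -- and each value reduces to a smaller E by `Q-head`. The factors 1 - val w and the Vandermonde
    -- product are common to both sides and are cancelled.
    E-recursion : ∀ ws m → length ws ≡ suc m → Unique ws →
      E (suc m) ws ≡ ∑± (λ w vs → (1ℤ - val w) ^ m * ∏ vs (λ v → wa (val v) (val w)) * E m vs) ws
    E-recursion ws m len u = *-cancelˡ (o * V (suc m) ws)
      (*-nonzero (∏-nonzero (All.universal 1-val≢0 ws)) (subst (λ n → V n ws ≢ 0ℤ) len (V-nonzero u)))
      (begin
        o * V (suc m) ws * E (suc m) ws                        ≡⟨ lem₁ o (V (suc m) ws) (E (suc m) ws) ⟩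
        o * E (suc m) ws * V (suc m) ws                        ≡⟨ sym (lagrange (Q-degree m ws) ws) ⟩
        ∑± (λ w vs → Q m (val w) ws * V m vs) ws               ≡⟨ ∑±-cong-pick ws term ⟩
        ∑± (λ w vs → o * V (suc m) ws * summand w vs) ws             ≡⟨ ∑±-scale summand (o * V (suc m) ws) ws ⟩
        o * V (suc m) ws * ∑± summand ws                             ∎)
      where
      open ≡-Reasoning
      o : ℤ
      o = ∏ ws (λ x → 1ℤ - val x)
      summand : X → List X → ℤ
      summand w vs = (1ℤ - val w) ^ m * ∏ vs (λ v → wa (val v) (val w)) * E m vs
      opaque
        unfolding ℤ
        lem₁ : ∀ o v e → o * v * e ≡ o * e * v
        lem₁ = solve-∀ ring
        lem₃ : ∀ x y d a o e v → x * y * (d * a * (o * e)) * v ≡ d * (x * o * v * (y * a * e))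
        lem₃ = solve-∀ ring
      term : ∀ w vs → Pick w vs ws → Q m (val w) ws * V m vs ≡ o * V (suc m) ws * summand w vs
      term w vs p with ℕₚ.suc-injective (trans (sym (pick-length p)) len)
      -- The factor d completes V m vs to the Vandermonde product of w ∷ vs; on the other side it
      -- comes from the factors p - w in `wab`.
      ... | refl = *-cancelˡ d (∏-nonzero (All.map separated (proj₁ (pick-unique p u)))) (begin
        d * (Q m (val w) ws * V m vs)          ≡⟨ *-exchange d (Q m (val w) ws) (V m vs) ⟩
        Q m (val w) ws * (d * V m vs)          ≡⟨ cong (Q m (val w) ws *_) (sym (vandermonde w vs)) ⟩
        Q m (val w) ws * V (suc m) (w ∷ vs)
          ≡⟨ alternating-pick (D-alternating (α (suc m) ∷ map (λ f x → wab (val w) (val x) * f x) (κ-rows 1 m)))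
               (D-alternating (monomials (suc m))) p ⟩
        Q m (val w) (w ∷ vs) * V (suc m) ws    ≡⟨ cong (_* V (suc m) ws) (Q-head m w vs) ⟩
        α (suc m) w * (∏ vs (λ v → wab (val w) (val v)) * (∏ vs (λ v → 1ℤ - val v) * E m vs)) * V (suc m) ws
          ≡⟨ cong (λ t → α (suc m) w * (t * (∏ vs (λ v → 1ℤ - val v) * E m vs)) * V (suc m) ws)
               (∏-* (λ v → val w - val v) (λ v → wa (val v) (val w)) vs) ⟩
        α (suc m) w * (d * ∏ vs (λ v → wa (val v) (val w)) * (∏ vs (λ v → 1ℤ - val v) * E m vs)) * V (suc m) ws
          ≡⟨ lem₃ (1ℤ - val w) ((1ℤ - val w) ^ m) d _ (∏ vs (λ v → 1ℤ - val v)) (E m vs) (V (suc m) ws) ⟩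
        d * ((1ℤ - val w) * ∏ vs (λ v → 1ℤ - val v) * V (suc m) ws * summand w vs)
          ≡⟨ cong (λ t → d * (t * V (suc m) ws * summand w vs)) (sym (pick-∏ (λ x → 1ℤ - val x) p)) ⟩
        d * (o * V (suc m) ws * summand w vs) ∎)
        where
        d : ℤ
        d = ∏ vs (λ v → val w - val v)

-- Vertex operators

data Line : Set where
  hor ver dia : ℕ → Line

_==ᴸ_ : Line → Line → Bool
hor i ==ᴸ hor j = i ℕ.≡ᵇ j
ver i ==ᴸ ver j = i ℕ.≡ᵇ j
dia i ==ᴸ dia j = i ℕ.≡ᵇ j
_ ==ᴸ _ = false

≡ᵇ-refl : ∀ i → (i ℕ.≡ᵇ i) ≡ true
≡ᵇ-refl zero = refl
≡ᵇ-refl (suc i) = ≡ᵇ-refl i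

≡ᵇ-true : ∀ i j → (i ℕ.≡ᵇ j) ≡ true → i ≡ j
≡ᵇ-true zero zero e = refl
≡ᵇ-true (suc i) (suc j) e = cong suc (≡ᵇ-true i j e)

≡ᵇ-false : ∀ {i j} → i ≢ j → (i ℕ.≡ᵇ j) ≡ false
≡ᵇ-false {i} {j} ne with i ℕ.≡ᵇ j in e
... | true = ⊥-elim (ne (≡ᵇ-true i j e))
... | false = refl

==ᴸ-refl : ∀ k → (k ==ᴸ k) ≡ true
==ᴸ-refl (hor i) = ≡ᵇ-refl i
==ᴸ-refl (ver i) = ≡ᵇ-refl i
==ᴸ-refl (dia i) = ≡ᵇ-refl i

==ᴸ-true : ∀ k ℓ → (k ==ᴸ ℓ) ≡ true → k ≡ ℓ
==ᴸ-true (hor i) (hor j) e = cong hor (≡ᵇ-true i j e)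
==ᴸ-true (ver i) (ver j) e = cong ver (≡ᵇ-true i j e)
==ᴸ-true (dia i) (dia j) e = cong dia (≡ᵇ-true i j e)

==ᴸ-false : ∀ {k ℓ} → k ≢ ℓ → (k ==ᴸ ℓ) ≡ false
==ᴸ-false {k} {ℓ} ne with k ==ᴸ ℓ in e
... | true = ⊥-elim (ne (==ᴸ-true k ℓ e))
... | false = refl

State : Set
State = Line → Bool

opaque
  _[_≔_] : State → Line → Bool → State
  (s [ ℓ ≔ b ]) k = if k ==ᴸ ℓ then b else s k

  lookup-same : ∀ s ℓ b → (s [ ℓ ≔ b ]) ℓ ≡ b
  lookup-same s ℓ b rewrite ==ᴸ-refl ℓ = refl

  lookup-other : ∀ s {k ℓ} b → k ≢ ℓ → (s [ ℓ ≔ b ]) k ≡ s k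
  lookup-other s b ne rewrite ==ᴸ-false ne = refl

  update-cong : ∀ {s s′ : State} ℓ b → s ≗ s′ → s [ ℓ ≔ b ] ≗ s′ [ ℓ ≔ b ]
  update-cong ℓ b e k with k ==ᴸ ℓ
  ... | true = refl
  ... | false = e k

  update-comm : ∀ s {x y} a b → x ≢ y → (s [ x ≔ a ]) [ y ≔ b ] ≗ (s [ y ≔ b ]) [ x ≔ a ]
  update-comm s {x} {y} a b ne k with k ==ᴸ x in e | k ==ᴸ y in e′
  ... | true  | true  = ⊥-elim (ne (trans (sym (==ᴸ-true k x e)) (==ᴸ-true k y e′)))
  ... | true  | false = refl
  ... | false | true  = refl
  ... | false | false = refl

-- States that result from rearranged updates agree only pointwise, so a functional carries the
-- proof that it respects such agreement.
record Functional : Set where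
  no-eta-equality
  field
    ap  : State → ℤ
    ext : ∀ {s s′} → s ≗ s′ → ap s ≡ ap s′
open Functional

infix 4 _≈_
record _≈_ (f g : Functional) : Set where
  constructor pointwise
  field app : ∀ s → ap f s ≡ ap g s
open _≈_

-- A piece of the lattice turns a functional of the lines that leave it into one of the lines that
-- enter it, by summing over all ways through. Equations between operators can then be used in the
-- middle of a lattice, whatever follows.
record Operator : Set where
  no-eta-equality
  field
    act      : Functional → Functional
    act-cong : ∀ {f g} → f ≈ g → act f ≈ act g
open Operator

infix 4 _≈ᴼ_
record _≈ᴼ_ (P P′ : Operator) : Set where
  constructor opwise
  field appᴼ : ∀ f s → ap (act P f) s ≡ ap (act P′ f) s
open _≈ᴼ_

infixr 7 _⊙_
-- The left factor is the one crossed first.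
_⊙_ : Operator → Operator → Operator
(P ⊙ P′) .act f = act P (act P′ f)
(P ⊙ P′) .act-cong e = act-cong P (act-cong P′ e)

𝟙 : Operator
𝟙 .act f = f
𝟙 .act-cong e = e

⊙-congʳ : ∀ P {S S′} → S ≈ᴼ S′ → P ⊙ S ≈ᴼ P ⊙ S′
⊙-congʳ P {S} {S′} e .appᴼ f s = app (act-cong P {act S f} {act S′ f} (pointwise (appᴼ e f))) s

slide : ∀ {P A A′ B B′} → P ⊙ A ≈ᴼ A′ ⊙ P → P ⊙ B ≈ᴼ B′ ⊙ P → P ⊙ A ⊙ B ≈ᴼ (A′ ⊙ B′) ⊙ P
slide {A′ = A′} {B} c c′ .appᴼ f s = trans (appᴼ c (act B f) s) (appᴼ (⊙-congʳ A′ c′) f s)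

record Weights : Set where
  constructor weights
  field a b₁ b₂ c₁ c₂ : ℤ
open Weights

-- A path on the first line enters as the first Boolean, one on the second line as the second;
-- b₁ and b₂ are the weights of a lone path going straight on, c₁ and c₂ of one that turns.
vertex : Weights → Bool → Bool → (Bool → Bool → ℤ) → ℤ
vertex w true true F = a w * F true true
vertex w false false F = a w * F false false
vertex w true false F = b₁ w * F true false + c₁ w * F false true
vertex w false true F = b₂ w * F false true + c₂ w * F true false

vertex-cong : ∀ w {i i′ j j′} {F G} → i ≡ i′ → j ≡ j′ → (∀ o o′ → F o o′ ≡ G o o′) → vertex w i j F ≡ vertex w i′ j′ G
vertex-cong w {true} {_} {true} refl refl e = cong (a w *_) (e true true)
vertex-cong w {false} {_} {false} refl refl e = cong (a w *_) (e false false)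
vertex-cong w {true} {_} {false} refl refl e = cong₂ (λ x y → b₁ w * x + c₁ w * y) (e true false) (e false true)
vertex-cong w {false} {_} {true} refl refl e = cong₂ (λ x y → b₂ w * x + c₂ w * y) (e false true) (e true false)

vertex-linear : ∀ w i j x y F G → vertex w i j (λ o o′ → x * F o o′ + y * G o o′) ≡ x * vertex w i j F + y * vertex w i j G
vertex-linear w i j x y F G = go i j
  where
  opaque
    unfolding ℤ
    lem₁ : ∀ a x y f g → a * (x * f + y * g) ≡ x * (a * f) + y * (a * g)
    lem₁ = solve-∀ ring
    lem₂ : ∀ a b x y f g f′ g′ →
      a * (x * f + y * g) + b * (x * f′ + y * g′) ≡ x * (a * f + b * f′) + y * (a * g + b * g′)
    lem₂ = solve-∀ ring
  go : ∀ i j → vertex w i j (λ o o′ → x * F o o′ + y * G o o′) ≡ x * vertex w i j F + y * vertex w i j G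
  go true true = lem₁ _ _ _ _ _
  go false false = lem₁ _ _ _ _ _
  go true false = lem₂ _ _ _ _ _ _ _ _
  go false true = lem₂ _ _ _ _ _ _ _ _

vertex-scale : ∀ w i j x F → vertex w i j (λ o o′ → x * F o o′) ≡ x * vertex w i j F
vertex-scale w i j x F = trans
  (vertex-cong w {i} {i} {j} {j} refl refl λ o o′ → sym (trans (cong (λ t → x * F o o′ + t) (zeroˡ (F o o′))) (+-identityʳ _)))
  (trans (vertex-linear w i j x 0ℤ F F)
    (trans (cong (λ t → x * vertex w i j F + t) (zeroˡ (vertex w i j F))) (+-identityʳ _)))

vertex-comm : ∀ w i j w′ k l (F : Bool → Bool → Bool → Bool → ℤ) →
  vertex w i j (λ o o′ → vertex w′ k l (F o o′)) ≡ vertex w′ k l (λ u u′ → vertex w i j (λ o o′ → F o o′ u u′))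
vertex-comm w i j w′ true true F = vertex-scale w i j (a w′) _
vertex-comm w i j w′ false false F = vertex-scale w i j (a w′) _
vertex-comm w i j w′ true false F = vertex-linear w i j (b₁ w′) (c₁ w′) _ _
vertex-comm w i j w′ false true F = vertex-linear w i j (b₂ w′) (c₂ w′) _ _

R : Weights → Line → Line → Operator
R w x y .act f .ap s = vertex w (s x) (s y) (λ o o′ → ap f ((s [ x ≔ o ]) [ y ≔ o′ ]))
R w x y .act f .ext {s} {s′} e =
  vertex-cong w (e x) (e y) λ o o′ → ext f (update-cong y o′ (update-cong x o e))
R w x y .act-cong e .app s = vertex-cong w {s x} {s x} {s y} {s y} refl refl λ o o′ → app e _

R-comm : ∀ w w′ {x y z u} → x ≢ z → x ≢ u → y ≢ z → y ≢ u → R w x y ⊙ R w′ z u ≈ᴼ R w′ z u ⊙ R w x y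
R-comm w w′ {x} {y} {z} {u} xz xu yz yu .appᴼ f s = begin
  vertex w (s x) (s y) (λ o o′ → vertex w′ (at′ o o′ z) (at′ o o′ u)
      (λ v v′ → ap f (((at′ o o′) [ z ≔ v ]) [ u ≔ v′ ])))
    ≡⟨ vertex-cong w {s x} {s x} {s y} {s y} refl refl (λ o o′ → vertex-cong w′
         (trans (lookup-other _ o′ (yz ∘ sym)) (lookup-other s o (xz ∘ sym)))
         (trans (lookup-other _ o′ (yu ∘ sym)) (lookup-other s o (xu ∘ sym)))
         λ v v′ → ext f (swap o o′ v v′)) ⟩
  vertex w (s x) (s y) (λ o o′ → vertex w′ (s z) (s u)
      (λ v v′ → ap f ((((s [ z ≔ v ]) [ u ≔ v′ ]) [ x ≔ o ]) [ y ≔ o′ ])))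
    ≡⟨ vertex-comm w (s x) (s y) w′ (s z) (s u) _ ⟩
  vertex w′ (s z) (s u) (λ v v′ → vertex w (s x) (s y)
      (λ o o′ → ap f ((((s [ z ≔ v ]) [ u ≔ v′ ]) [ x ≔ o ]) [ y ≔ o′ ])))
    ≡⟨ vertex-cong w′ {s z} {s z} {s u} {s u} refl refl (λ v v′ → vertex-cong w
         (sym (trans (lookup-other _ v′ xu) (lookup-other s v xz)))
         (sym (trans (lookup-other _ v′ yu) (lookup-other s v yz)))
         λ _ _ → refl) ⟩
  _ ∎
  where
  open ≡-Reasoning
  at′ : Bool → Bool → State
  at′ o o′ = (s [ x ≔ o ]) [ y ≔ o′ ]
  swap : ∀ o o′ v v′ →
    ((((s [ x ≔ o ]) [ y ≔ o′ ]) [ z ≔ v ]) [ u ≔ v′ ]) ≗ ((((s [ z ≔ v ]) [ u ≔ v′ ]) [ x ≔ o ]) [ y ≔ o′ ])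
  swap o o′ v v′ k = begin
    _ ≡⟨ update-cong u v′ (update-comm (s [ x ≔ o ]) o′ v yz) k ⟩
    _ ≡⟨ update-cong u v′ (update-cong y o′ (update-comm s o v xz)) k ⟩
    _ ≡⟨ update-comm ((s [ z ≔ v ]) [ x ≔ o ]) o′ v′ yu k ⟩
    _ ≡⟨ update-cong y o′ (update-comm (s [ z ≔ v ]) o v′ xu) k ⟩
    _ ∎

triangle₁ triangle₂ : Weights → Weights → Weights → Bool → Bool → Bool → (Bool → Bool → Bool → ℤ) → ℤ
triangle₁ w₁₂ w₁₃ w₂₃ i j k F = vertex w₁₂ i j λ i′ j′ → vertex w₁₃ i′ k λ i″ k′ → vertex w₂₃ j′ k′ λ j″ k″ → F i″ j″ k″
triangle₂ w₁₂ w₁₃ w₂₃ i j k F = vertex w₂₃ j k λ j′ k′ → vertex w₁₃ i k′ λ i′ k″ → vertex w₁₂ i′ j′ λ i″ j″ → F i″ j″ k″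

-- With F arbitrary this is an equation between 8 by 8 matrices; the functional of the rest of the
-- lattice is later substituted for F.
YangBaxter : Weights → Weights → Weights → Set
YangBaxter w₁₂ w₁₃ w₂₃ = ∀ i j k F → triangle₁ w₁₂ w₁₃ w₂₃ i j k F ≡ triangle₂ w₁₂ w₁₃ w₂₃ i j k F

module _ {w₁₂ w₁₃ w₂₃ : Weights} {x y z : Line} (xy : x ≢ y) (xz : x ≢ z) (yz : y ≢ z) where

  R-triangle₁ : ∀ f s → ap (act (R w₁₂ x y ⊙ R w₁₃ x z ⊙ R w₂₃ y z) f) s
    ≡ triangle₁ w₁₂ w₁₃ w₂₃ (s x) (s y) (s z) (λ i j k → ap f (((s [ x ≔ i ]) [ y ≔ j ]) [ z ≔ k ]))
  R-triangle₁ f s = vertex-cong w₁₂ {s x} {s x} {s y} {s y} refl refl λ i′ j′ → vertex-cong w₁₃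
    (trans (lookup-other _ j′ xy) (lookup-same s x i′))
    (trans (lookup-other _ j′ (yz ∘ sym)) (lookup-other s i′ (xz ∘ sym)))
    λ i″ k′ → vertex-cong w₂₃
      (trans (lookup-other _ k′ yz) (trans (lookup-other _ i″ (xy ∘ sym)) (lookup-same _ y j′)))
      (lookup-same _ z k′)
      λ j″ k″ → ext f (collapse i′ j′ i″ k′ j″ k″)
    where
    opaque
      unfolding _[_≔_]
      collapse : ∀ i′ j′ i″ k′ j″ k″ → (((((s [ x ≔ i′ ]) [ y ≔ j′ ]) [ x ≔ i″ ]) [ z ≔ k′ ]) [ y ≔ j″ ]) [ z ≔ k″ ]
        ≗ ((s [ x ≔ i″ ]) [ y ≔ j″ ]) [ z ≔ k″ ]
      collapse i′ j′ i″ k′ j″ k″ ℓ with ℓ ==ᴸ x | ℓ ==ᴸ y | ℓ ==ᴸ z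
      ... | _     | _     | true  = refl
      ... | _     | true  | false = refl
      ... | true  | false | false = refl
      ... | false | false | false = refl

  R-triangle₂ : ∀ f s → ap (act (R w₂₃ y z ⊙ R w₁₃ x z ⊙ R w₁₂ x y) f) s
    ≡ triangle₂ w₁₂ w₁₃ w₂₃ (s x) (s y) (s z) (λ i j k → ap f (((s [ x ≔ i ]) [ y ≔ j ]) [ z ≔ k ]))
  R-triangle₂ f s = vertex-cong w₂₃ {s y} {s y} {s z} {s z} refl refl λ j′ k′ → vertex-cong w₁₃
    (trans (lookup-other _ k′ xz) (lookup-other s j′ xy))
    (lookup-same _ z k′)
    λ i′ k″ → vertex-cong w₁₂
      (trans (lookup-other _ k″ xz) (lookup-same _ x i′))
      (trans (lookup-other _ k″ yz) (trans (lookup-other _ i′ (xy ∘ sym))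
        (trans (lookup-other _ k′ yz) (lookup-same s y j′))))
      λ i″ j″ → ext f (collapse j′ k′ i′ k″ i″ j″)
    where
    opaque
      unfolding _[_≔_]
      collapse : ∀ j′ k′ i′ k″ i″ j″ → (((((s [ y ≔ j′ ]) [ z ≔ k′ ]) [ x ≔ i′ ]) [ z ≔ k″ ]) [ x ≔ i″ ]) [ y ≔ j″ ]
        ≗ ((s [ x ≔ i″ ]) [ y ≔ j″ ]) [ z ≔ k″ ]
      collapse j′ k′ i′ k″ i″ j″ ℓ with ℓ ==ᴸ x in ex | ℓ ==ᴸ y in ey | ℓ ==ᴸ z in ez
      ... | _     | true  | true  = ⊥-elim (yz (trans (sym (==ᴸ-true ℓ y ey)) (==ᴸ-true ℓ z ez)))
      ... | true  | _     | true  = ⊥-elim (xz (trans (sym (==ᴸ-true ℓ x ex)) (==ᴸ-true ℓ z ez)))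
      ... | false | false | true  = refl
      ... | _     | true  | false = refl
      ... | true  | false | false = refl
      ... | false | false | false = refl

  R-yangBaxter : YangBaxter w₁₂ w₁₃ w₂₃ →
    R w₁₂ x y ⊙ R w₁₃ x z ⊙ R w₂₃ y z ≈ᴼ R w₂₃ y z ⊙ R w₁₃ x z ⊙ R w₁₂ x y
  R-yangBaxter ybe .appᴼ f s = trans (R-triangle₁ f s)
    (trans (ybe (s x) (s y) (s z) (λ i j k → ap f (((s [ x ≔ i ]) [ y ≔ j ]) [ z ≔ k ]))) (sym (R-triangle₂ f s)))

-- The weights of a line with parameter w and a line with homogeneous parameter p : q.
rw : ℤ → ℤ → ℤ → Weights
rw w p q = weights (p - q - (p + q) * w) (p - q * w) (2ℤ * (p - q * w)) (1ℤ + w * w) (p * p + q * q)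

-- Apart from the signs of c₁ and c₂ these are the weights `rw w v 1ℤ`: the second row behaves like
-- a column with parameter v : 1.
rr : ℤ → ℤ → Weights
rr w v = weights (wa w v) (v - w) (2ℤ * (v - w)) (- (1ℤ + w * w)) (- (1ℤ + v * v))

-- With b = p - q w and t = q + p w one has a = b - t, b₁ b₂ = 2 b² and c₁ c₂ = b² + t², hence a² +
-- b₁ b₂ - c₁ c₂ = 2 a b₁ for all parameters. Each of the eight incoming states gives a polynomial
-- identity.
row-yangBaxter : ∀ w v p q → YangBaxter (rr w v) (rw w p q) (rw v p q)
row-yangBaxter w v p q = go
  where
  go : YangBaxter (rr w v) (rw w p q) (rw v p q)
  go true true true F = lem w v p q (F true true true)
    where
    opaque
      unfolding ℤ
      lem : ∀ w v p q f → (v - 1ℤ - (v + 1ℤ) * w) * ((p - q - (p + q) * w) * ((p - q - (p + q) * v) * f))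
        ≡ (p - q - (p + q) * v) * ((p - q - (p + q) * w) * ((v - 1ℤ - (v + 1ℤ) * w) * f))
      lem = solve-∀ ring
  go false false false F = lem w v p q (F false false false)
    where
    opaque
      unfolding ℤ
      lem : ∀ w v p q f → (v - 1ℤ - (v + 1ℤ) * w) * ((p - q - (p + q) * w) * ((p - q - (p + q) * v) * f))
        ≡ (p - q - (p + q) * v) * ((p - q - (p + q) * w) * ((v - 1ℤ - (v + 1ℤ) * w) * f))
      lem = solve-∀ ring
  go true true false F = lem w v p q (F true true false) (F true false true) (F false true true)
    where
    opaque
      unfolding ℤ
      lem : ∀ w v p q f110 f101 f011 →
        (v - 1ℤ - (v + 1ℤ) * w) * ((p - q * w) * ((p - q * v) * f110 + (1ℤ + v * v) * f101) + (1ℤ + w * w) * ((p - q - (p + q) * v) * f011))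
        ≡ ((p - q * v) * ((p - q * w) * ((v - 1ℤ - (v + 1ℤ) * w) * f110) + (1ℤ + w * w) * ((2ℤ * (v - w)) * f011 + (- (1ℤ + v * v)) * f101)) + (1ℤ + v * v) * ((p - q - (p + q) * w) * ((v - w) * f101 + (- (1ℤ + w * w)) * f011)))
      lem = solve-∀ ring
  go true false true F = lem w v p q (F true true false) (F true false true) (F false true true)
    where
    opaque
      unfolding ℤ
      lem : ∀ w v p q f110 f101 f011 →
        ((v - w) * ((p - q - (p + q) * w) * ((2ℤ * (p - q * v)) * f101 + (p * p + q * q) * f110)) + (- (1ℤ + w * w)) * ((2ℤ * (p - q * w)) * ((p - q - (p + q) * v) * f011) + (p * p + q * q) * ((p - q * v) * f110 + (1ℤ + v * v) * f101)))
        ≡ ((2ℤ * (p - q * v)) * ((p - q - (p + q) * w) * ((v - w) * f101 + (- (1ℤ + w * w)) * f011)) + (p * p + q * q) * ((p - q * w) * ((v - 1ℤ - (v + 1ℤ) * w) * f110) + (1ℤ + w * w) * ((2ℤ * (v - w)) * f011 + (- (1ℤ + v * v)) * f101)))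
      lem = solve-∀ ring
  go true false false F = lem w v p q (F true false false) (F false true false) (F false false true)
    where
    opaque
      unfolding ℤ
      lem : ∀ w v p q f100 f010 f001 →
        ((v - w) * ((p - q * w) * ((p - q - (p + q) * v) * f100) + (1ℤ + w * w) * ((2ℤ * (p - q * v)) * f001 + (p * p + q * q) * f010)) + (- (1ℤ + w * w)) * ((p - q - (p + q) * w) * ((p - q * v) * f010 + (1ℤ + v * v) * f001)))
        ≡ (p - q - (p + q) * v) * ((p - q * w) * ((v - w) * f100 + (- (1ℤ + w * w)) * f010) + (1ℤ + w * w) * ((v - 1ℤ - (v + 1ℤ) * w) * f001))
      lem = solve-∀ ring
  go false true true F = lem w v p q (F true true false) (F true false true) (F false true true)
    where
    opaque
      unfolding ℤ
      lem : ∀ w v p q f110 f101 f011 →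
        ((2ℤ * (v - w)) * ((2ℤ * (p - q * w)) * ((p - q - (p + q) * v) * f011) + (p * p + q * q) * ((p - q * v) * f110 + (1ℤ + v * v) * f101)) + (- (1ℤ + v * v)) * ((p - q - (p + q) * w) * ((2ℤ * (p - q * v)) * f101 + (p * p + q * q) * f110)))
        ≡ (p - q - (p + q) * v) * ((2ℤ * (p - q * w)) * ((2ℤ * (v - w)) * f011 + (- (1ℤ + v * v)) * f101) + (p * p + q * q) * ((v - 1ℤ - (v + 1ℤ) * w) * f110))
      lem = solve-∀ ring
  go false true false F = lem w v p q (F true false false) (F false true false) (F false false true)
    where
    opaque
      unfolding ℤ
      lem : ∀ w v p q f100 f010 f001 →
        ((2ℤ * (v - w)) * ((p - q - (p + q) * w) * ((p - q * v) * f010 + (1ℤ + v * v) * f001)) + (- (1ℤ + v * v)) * ((p - q * w) * ((p - q - (p + q) * v) * f100) + (1ℤ + w * w) * ((2ℤ * (p - q * v)) * f001 + (p * p + q * q) * f010)))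
        ≡ ((p - q * v) * ((p - q - (p + q) * w) * ((2ℤ * (v - w)) * f010 + (- (1ℤ + v * v)) * f100)) + (1ℤ + v * v) * ((2ℤ * (p - q * w)) * ((v - 1ℤ - (v + 1ℤ) * w) * f001) + (p * p + q * q) * ((v - w) * f100 + (- (1ℤ + w * w)) * f010)))
      lem = solve-∀ ring
  go false false true F = lem w v p q (F true false false) (F false true false) (F false false true)
    where
    opaque
      unfolding ℤ
      lem : ∀ w v p q f100 f010 f001 →
        (v - 1ℤ - (v + 1ℤ) * w) * ((2ℤ * (p - q * w)) * ((2ℤ * (p - q * v)) * f001 + (p * p + q * q) * f010) + (p * p + q * q) * ((p - q - (p + q) * v) * f100))
        ≡ ((2ℤ * (p - q * v)) * ((2ℤ * (p - q * w)) * ((v - 1ℤ - (v + 1ℤ) * w) * f001) + (p * p + q * q) * ((v - w) * f100 + (- (1ℤ + w * w)) * f010)) + (p * p + q * q) * ((p - q - (p + q) * w) * ((2ℤ * (v - w)) * f010 + (- (1ℤ + v * v)) * f100)))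
      lem = solve-∀ ring

-- The six-vertex model

⟦_⟧ : Bool → ℤ
⟦ true ⟧ = 1ℤ
⟦ false ⟧ = 0ℤ

Commute : Operator → Operator → Set
Commute P P′ = P ⊙ P′ ≈ᴼ P′ ⊙ P

commute-sym : ∀ {P Q} → Commute P Q → Commute Q P
commute-sym c = opwise λ f s → sym (appᴼ c f s)

update-self : ∀ s {ℓ b} → s ℓ ≡ b → s [ ℓ ≔ b ] ≗ s
update-self s {ℓ} {c} e k = go (k ==ᴸ ℓ) refl
  where
  opaque
    unfolding _[_≔_]
    go : ∀ b → (k ==ᴸ ℓ) ≡ b → (s [ ℓ ≔ c ]) k ≡ s k
    go true eq rewrite eq = sym (trans (cong s (==ᴸ-true k ℓ eq)) e)
    go false eq rewrite eq = refl

update₂-self : ∀ s {k ℓ b c} → s k ≡ b → s ℓ ≡ c → (s [ k ≔ b ]) [ ℓ ≔ c ] ≗ s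
update₂-self s {ℓ = ℓ} e e′ m = trans (update-cong ℓ _ (update-self s e) m) (update-self s e′ m)

on : Line → (Bool → ℤ) → Operator
on ℓ h .act f .ap s = h (s ℓ) * ap f s
on ℓ h .act f .ext e = cong₂ _*_ (cong h (e ℓ)) (ext f e)
on ℓ h .act-cong e .app s = cong (h (s ℓ) *_) (app e s)

on-commute : ∀ {ℓ h w x y} → ℓ ≢ x → ℓ ≢ y → Commute (R w x y) (on ℓ h)
on-commute {ℓ} {h} {w} {x} {y} lx ly .appᴼ f s = trans
  (vertex-cong w {s x} {s x} {s y} {s y} refl refl λ o o′ →
    cong (λ b → h b * ap f ((s [ x ≔ o ]) [ y ≔ o′ ])) (trans (lookup-other _ o′ ly) (lookup-other s o lx)))
  (vertex-scale w (s x) (s y) (h (s ℓ)) _)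

scalar : ℤ → Operator
scalar c .act f .ap s = c * ap f s
scalar c .act f .ext e = cong (c *_) (ext f e)
scalar c .act-cong e .app s = cong (c *_) (app e s)

scalar-R : ∀ c w x y → Commute (scalar c) (R w x y)
scalar-R c w x y .appᴼ f s = sym (vertex-scale w (s x) (s y) c _)

straight : ∀ {i j b} w f s → s i ≡ b → s j ≡ b → ap (act (R w i j) f) s ≡ a w * ap f s
straight {b = true} w f s ei ej = trans (vertex-cong w ei ej (λ _ _ → refl)) (cong (a w *_) (ext f (update₂-self s ei ej)))
straight {b = false} w f s ei ej = trans (vertex-cong w ei ej (λ _ _ → refl)) (cong (a w *_) (ext f (update₂-self s ei ej)))

-- The number of paths is conserved: if both lines have to leave in the state b, they also enter in
-- it, and only the weight a occurs.
R-final : ∀ w {x y} b f → x ≢ y → (∀ s → s x ≡ not b → ap f s ≡ 0ℤ) → (∀ s → s y ≡ not b → ap f s ≡ 0ℤ) →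
  act (R w x y) f ≈ act (scalar (a w)) f
R-final w {x} {y} b f xy fx fy .app s = go b (s x) (s y) refl refl fx fy
  where
  F : Bool → Bool → ℤ
  F o o′ = ap f ((s [ x ≔ o ]) [ y ≔ o′ ])
  at-x : ∀ o o′ → ((s [ x ≔ o ]) [ y ≔ o′ ]) x ≡ o
  at-x o o′ = trans (lookup-other (s [ x ≔ o ]) o′ xy) (lookup-same s x o)
  at-y : ∀ o o′ → ((s [ x ≔ o ]) [ y ≔ o′ ]) y ≡ o′
  at-y o o′ = lookup-same (s [ x ≔ o ]) y o′
  opaque
    unfolding ℤ
    lem : ∀ b c a → b * 0ℤ + c * 0ℤ ≡ a * 0ℤ
    lem = solve-∀ ring
  turn : ∀ {p q u v z} → u ≡ 0ℤ → v ≡ 0ℤ → z ≡ 0ℤ → p * u + q * v ≡ a w * z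
  turn refl refl refl = lem _ _ _
  go : ∀ b i j → s x ≡ i → s y ≡ j → (∀ s → s x ≡ not b → ap f s ≡ 0ℤ) → (∀ s → s y ≡ not b → ap f s ≡ 0ℤ) →
    vertex w i j F ≡ a w * ap f s
  go b true true ex ey fx fy = cong (a w *_) (ext f (update₂-self s ex ey))
  go b false false ex ey fx fy = cong (a w *_) (ext f (update₂-self s ex ey))
  go true true false ex ey fx fy = turn (fy _ (at-y true false)) (fx _ (at-x false true)) (fy s ey)
  go true false true ex ey fx fy = turn (fx _ (at-x false true)) (fy _ (at-y true false)) (fx s ex)
  go false true false ex ey fx fy = turn (fx _ (at-x true false)) (fy _ (at-y false true)) (fx s ex)
  go false false true ex ey fx fy = turn (fy _ (at-y false true)) (fx _ (at-x true false)) (fy s ey)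

module SixVertex (val : ℕ → ℤ) where
  open Points val
  open Recursion val

  cell : ℤ → ℤ → ℕ → ℕ → Operator
  cell p q x i = R (rw (val i) p q) (hor i) (ver x)

  column : ℤ → ℤ → ℕ → List ℕ → Operator
  column p q x [] = 𝟙
  column p q x (i ∷ is) = cell p q x i ⊙ column p q x is

  grid6 : List ℕ → List ℕ → Operator
  grid6 rows [] = 𝟙
  grid6 rows (x ∷ xs) = column 1ℤ 0ℤ x rows ⊙ grid6 rows xs

  finish : List ℕ → List ℕ → Functional
  finish rows cols .ap s = ∏ rows (λ i → ⟦ not (s (hor i)) ⟧) * ∏ cols (λ x → ⟦ s (ver x) ⟧)
  finish rows cols .ext e = cong₂ _*_ (∏-cong (λ i → cong (⟦_⟧ ∘ not) (e (hor i))) rows)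
                                      (∏-cong (λ x → cong ⟦_⟧ (e (ver x))) cols)

  -- The leftmost column has parameter p : q, the others 1 : 0.
  partition : ℤ → ℤ → ℕ → List ℕ → List ℕ → Functional
  partition p q x xs rows = act (column p q x rows) (act (grid6 rows xs) (finish rows (x ∷ xs)))

  crossing : ℕ → ℕ → Operator
  crossing i j = R (rr (val i) (val j)) (hor i) (hor j)

  cell-commute : ∀ {p q p′ q′ x y i j} → x ≢ y → i ≢ j → Commute (cell p q x i) (cell p′ q′ y j)
  cell-commute xy ij = R-comm _ _ (λ { refl → ij refl }) (λ ()) (λ ()) (λ { refl → xy refl })

  crossing-cell : ∀ {p q x i j k} → i ≢ k → j ≢ k → Commute (crossing i j) (cell p q x k)
  crossing-cell ik jk = R-comm _ _ (λ { refl → ik refl }) (λ ()) (λ { refl → jk refl }) (λ ())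

  crossing-column : ∀ {p q x i j} ks → i ∉ ks → j ∉ ks → Commute (crossing i j) (column p q x ks)
  crossing-column [] _ _ = opwise λ f s → refl
  crossing-column {p} {q} {x} (k ∷ ks) i∉ j∉ = slide
    (crossing-cell (λ e → i∉ (here e)) (λ e → j∉ (here e)))
    (crossing-column ks (λ m → i∉ (there m)) (λ m → j∉ (there m)))

  -- The crossing of the rows i and j passes their two vertices on the column x by the Yang-Baxter
  -- equation, which interchanges the rows, and commutes with the other vertices of the column.
  crossing-swap : ∀ {p q x i j} → i ≢ j → ∀ pre post → i ∉ pre → j ∉ pre → i ∉ post → j ∉ post →
    crossing i j ⊙ column p q x (pre ++ i ∷ j ∷ post) ≈ᴼ column p q x (pre ++ j ∷ i ∷ post) ⊙ crossing i j
  crossing-swap {p} {q} {x} {i} {j} ij [] post _ _ i∉ j∉ .appᴼ f s = trans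
    (appᴼ (R-yangBaxter (λ { refl → ij refl }) (λ ()) (λ ()) (row-yangBaxter (val i) (val j) p q)) (act (column p q x post) f) s)
    (appᴼ (⊙-congʳ (cell p q x j) (⊙-congʳ (cell p q x i) (crossing-column post i∉ j∉))) f s)
  crossing-swap ij (k ∷ pre) post i∉p j∉p i∉ j∉ = slide
    (crossing-cell (λ e → i∉p (here e)) (λ e → j∉p (here e)))
    (crossing-swap ij pre post (λ m → i∉p (there m)) (λ m → j∉p (there m)) i∉ j∉)

  crossing-grid : ∀ {i j} → i ≢ j → ∀ pre post → i ∉ pre → j ∉ pre → i ∉ post → j ∉ post → ∀ xs →
    crossing i j ⊙ grid6 (pre ++ i ∷ j ∷ post) xs ≈ᴼ grid6 (pre ++ j ∷ i ∷ post) xs ⊙ crossing i j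
  crossing-grid ij pre post a b c d [] = opwise λ f s → refl
  crossing-grid ij pre post a b c d (x ∷ xs) =
    slide (crossing-swap ij pre post a b c d) (crossing-grid ij pre post a b c d xs)

  scalar-column : ∀ {c p q} x rows → Commute (scalar c) (column p q x rows)
  scalar-column x [] = opwise λ f s → refl
  scalar-column {c} x (k ∷ rows) = slide (scalar-R c _ _ _) (scalar-column x rows)

  scalar-grid : ∀ {c} rows xs → Commute (scalar c) (grid6 rows xs)
  scalar-grid rows [] = opwise λ f s → refl
  scalar-grid rows (x ∷ xs) = slide (scalar-column x rows) (scalar-grid rows xs)

  finish-zero : ∀ {rows i} cols s → i ∈ rows → s (hor i) ≡ true → ap (finish rows cols) s ≡ 0ℤ
  finish-zero cols s m e = trans (cong (_* ∏ cols _) (∏-zero m (cong (⟦_⟧ ∘ not) e))) (zeroˡ _)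

  finish-swap : ∀ pre i j post cols s → ap (finish (pre ++ i ∷ j ∷ post) cols) s ≡ ap (finish (pre ++ j ∷ i ∷ post) cols) s
  finish-swap pre i j post cols s = cong (_* ∏ cols _) (go pre)
    where
    h : ℕ → ℤ
    h i = ⟦ not (s (hor i)) ⟧
    go : ∀ pre → ∏ (pre ++ i ∷ j ∷ post) h ≡ ∏ (pre ++ j ∷ i ∷ post) h
    go [] = *-exchange (h i) (h j) _
    go (k ∷ pre) = cong (h k *_) (go pre)

  ∈-second : ∀ {i j : ℕ} pre {post} → j ∈ pre ++ i ∷ j ∷ post
  ∈-second [] = there (here refl)
  ∈-second (_ ∷ pre) = there (∈-second pre)

  ∈-first : ∀ {i : ℕ} pre {post} → i ∈ pre ++ i ∷ post
  ∈-first [] = here refl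
  ∈-first (_ ∷ pre) = there (∈-first pre)

  crossing-finish : ∀ i j pre post → i ≢ j → ∀ cols →
    act (crossing i j) (finish (pre ++ i ∷ j ∷ post) cols) ≈ act (scalar (wa (val i) (val j))) (finish (pre ++ j ∷ i ∷ post) cols)
  crossing-finish i j pre post ij cols .app s = trans
    (app (R-final (rr (val i) (val j)) false (finish (pre ++ i ∷ j ∷ post) cols) (λ { refl → ij refl })
      (λ s → finish-zero cols s (∈-first pre)) (λ s → finish-zero cols s (∈-second pre))) s)
    (cong (wa (val i) (val j) *_) (finish-swap pre i j post cols s))

  module _ (wa≢0 : ∀ i j → wa (val i) (val j) ≢ 0ℤ) where

    -- Both rows carry a path on the left and are empty on the right. So the crossing weighs `wa` in
    -- front of the grid, and again `wa` behind it after it has been carried through; the common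
    -- factor is cancelled.
    partition-swap : ∀ {p q x xs i j} pre post → i ≢ j → i ∉ pre → j ∉ pre → i ∉ post → j ∉ post →
      ∀ s → s (hor i) ≡ true → s (hor j) ≡ true →
      ap (partition p q x xs (pre ++ i ∷ j ∷ post)) s ≡ ap (partition p q x xs (pre ++ j ∷ i ∷ post)) s
    partition-swap {p} {q} {x} {xs} {i} {j} pre post ij a b c d s ei ej = *-cancelˡ (wa (val i) (val j)) (wa≢0 i j) (begin
      wa (val i) (val j) * ap (partition p q x xs rows) s
        ≡⟨ cong (wa (val i) (val j) *_) (sym (ext (partition p q x xs rows) (update₂-self s ei ej))) ⟩
      vertex (rr (val i) (val j)) true true (λ o o′ → ap (partition p q x xs rows) ((s [ hor i ≔ o ]) [ hor j ≔ o′ ]))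
        ≡⟨ vertex-cong (rr (val i) (val j)) (sym ei) (sym ej) (λ _ _ → refl) ⟩
      ap (act (crossing i j) (partition p q x xs rows)) s
        ≡⟨ appᴼ (crossing-swap ij pre post a b c d) (act (grid6 rows xs) (finish rows (x ∷ xs))) s ⟩
      ap (act (column p q x rows′) (act (crossing i j) (act (grid6 rows xs) (finish rows (x ∷ xs))))) s
        ≡⟨ appᴼ (⊙-congʳ (column p q x rows′) (crossing-grid ij pre post a b c d xs)) (finish rows (x ∷ xs)) s ⟩
      ap (act (column p q x rows′) (act (grid6 rows′ xs) (act (crossing i j) (finish rows (x ∷ xs))))) s
        ≡⟨ app (act-cong (column p q x rows′) (act-cong (grid6 rows′ xs) (crossing-finish i j pre post ij (x ∷ xs)))) s ⟩
      ap (act (column p q x rows′) (act (grid6 rows′ xs) (act (scalar (wa (val i) (val j))) (finish rows′ (x ∷ xs))))) s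
        ≡⟨ sym (appᴼ (slide (scalar-column x rows′) (scalar-grid rows′ xs)) (finish rows′ (x ∷ xs)) s) ⟩
      wa (val i) (val j) * ap (partition p q x xs rows′) s ∎)
      where
      open ≡-Reasoning
      rows rows′ : List ℕ
      rows = pre ++ i ∷ j ∷ post
      rows′ = pre ++ j ∷ i ∷ post

    partition-pick : ∀ {p q x xs w vs ws} pre → Pick w vs ws → Unique (pre ++ ws) →
      ∀ s → All (λ i → s (hor i) ≡ true) ws →
      ap (partition p q x xs (pre ++ ws)) s ≡ ap (partition p q x xs (pre ++ w ∷ vs)) s
    partition-pick pre here u s a = refl
    partition-pick {p} {q} {x} {xs} {w} pre (there {u = u} {vs} {ws} π) uniq s (e ∷ a) = begin
      ap (partition p q x xs (pre ++ u ∷ ws)) s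
        ≡⟨ cong (λ l → ap (partition p q x xs l) s) (sym (++-assoc pre (u ∷ []) ws)) ⟩
      ap (partition p q x xs ((pre ++ u ∷ []) ++ ws)) s
        ≡⟨ partition-pick {xs = xs} (pre ++ u ∷ []) π (subst Unique (sym (++-assoc pre (u ∷ []) ws)) uniq) s a ⟩
      ap (partition p q x xs ((pre ++ u ∷ []) ++ w ∷ vs)) s
        ≡⟨ cong (λ l → ap (partition p q x xs l) s) (++-assoc pre (u ∷ []) (w ∷ vs)) ⟩
      ap (partition p q x xs (pre ++ u ∷ w ∷ vs)) s
        ≡⟨ partition-swap {xs = xs} pre vs (All.lookup u∉ (pick-∈ π)) (∉-pre (here refl)) (∉-pre (there (pick-∈ π)))
             (λ m → All.lookup u∉ (pick-sub π m) refl)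
             (λ m → All.lookup (proj₁ (pick-unique π (uniq-tail pre uniq))) m refl) s e (All.lookup a (pick-∈ π)) ⟩
      ap (partition p q x xs (pre ++ w ∷ u ∷ vs)) s ∎
      where
      open ≡-Reasoning
      uniq-tail : ∀ pre {u : ℕ} {ws} → Unique (pre ++ u ∷ ws) → Unique ws
      uniq-tail [] (_ ∷ u) = u
      uniq-tail (_ ∷ pre) (_ ∷ u) = uniq-tail pre u
      uniq-head : ∀ pre {u : ℕ} {ws} → Unique (pre ++ u ∷ ws) → All (u ≢_) ws
      uniq-head [] (a ∷ _) = a
      uniq-head (_ ∷ pre) (_ ∷ u) = uniq-head pre u
      u∉ : All (u ≢_) ws
      u∉ = uniq-head pre uniq
      uniq-pre : ∀ pre {ws : List ℕ} {y} → Unique (pre ++ ws) → y ∈ ws → y ∉ pre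
      uniq-pre (z ∷ pre) (a ∷ _) m (here e) = All.lookup a (∈-++⁺ʳ pre m) (sym e)
      uniq-pre (z ∷ pre) (_ ∷ u) m (there m′) = uniq-pre pre u m m′
      ∉-pre : ∀ {y} → y ∈ u ∷ ws → y ∉ pre
      ∉-pre = uniq-pre pre uniq

-- The partition function of the six-vertex model as a determinant

module SixVertexDeterminant (val : ℕ → ℤ)
  (wa≢0 : ∀ i j → wa (val i) (val j) ≢ 0ℤ)
  (separated : ∀ {x y} → x ≢ y → val x - val y ≢ 0ℤ)
  (1-val≢0 : ∀ x → 1ℤ - val x ≢ 0ℤ) where
  open Points val
  open Recursion val
  open SixVertex val

  row : ℕ → List ℕ → Operator
  row r [] = 𝟙
  row r (x ∷ xs) = cell 1ℤ 0ℤ x r ⊙ row r xs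

  cell-column : ∀ {p q x p′ q′ y r} vs → y ≢ x → r ∉ vs → Commute (cell p′ q′ y r) (column p q x vs)
  cell-column [] yx r∉ = opwise λ f s → refl
  cell-column (v ∷ vs) yx r∉ = slide (cell-commute yx (λ e → r∉ (here e))) (cell-column vs yx (λ m → r∉ (there m)))

  column-row : ∀ {p q x r} vs xs → x ∉ xs → r ∉ vs → Commute (column p q x vs) (row r xs)
  column-row vs [] x∉ r∉ = opwise λ f s → refl
  column-row {p} {q} {x} {r} vs (y ∷ xs) x∉ r∉ = slide
    (commute-sym {cell 1ℤ 0ℤ y r} (cell-column vs (λ e → x∉ (here (sym e))) r∉))
    (column-row vs xs (λ m → x∉ (there m)) r∉)

  -- Vertices that share neither row nor column commute, so the whole row r can be crossed ahead of
  -- the others.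
  split-row : ∀ {r vs xs} → r ∉ vs → Unique xs → grid6 (r ∷ vs) xs ≈ᴼ row r xs ⊙ grid6 vs xs
  split-row r∉ [] = opwise λ f s → refl
  split-row {r} {vs} {x ∷ xs} r∉ (x∉ ∷ u) .appᴼ f s = trans
    (appᴼ (⊙-congʳ (column 1ℤ 0ℤ x (r ∷ vs)) (split-row r∉ u)) f s)
    (appᴼ (⊙-congʳ (cell 1ℤ 0ℤ x r) (column-row vs xs (λ m → All.lookup x∉ m refl) r∉)) (act (grid6 vs xs) f) s)

  frozen-row : ∀ {r xs s} f → s (hor r) ≡ false → All (λ x → s (ver x) ≡ false) xs →
    ap (act (row r xs) f) s ≡ (1ℤ - val r) ^ length xs * ap f s
  frozen-row {s = s} f e [] = sym (*-identityˡ (ap f s))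
  frozen-row {r} {x ∷ xs} {s} f e (ex ∷ es) = begin
    ap (act (cell 1ℤ 0ℤ x r) (act (row r xs) f)) s
      ≡⟨ straight _ (act (row r xs) f) s e ex ⟩
    a (rw (val r) 1ℤ 0ℤ) * ap (act (row r xs) f) s
      ≡⟨ cong (a (rw (val r) 1ℤ 0ℤ) *_) (frozen-row {xs = xs} f e es) ⟩
    a (rw (val r) 1ℤ 0ℤ) * ((1ℤ - val r) ^ length xs * ap f s)
      ≡⟨ lem (val r) _ _ ⟩
    (1ℤ - val r) * (1ℤ - val r) ^ length xs * ap f s ∎
    where
    open ≡-Reasoning
    opaque
      unfolding ℤ
      lem : ∀ w x y → (1ℤ - 0ℤ - (1ℤ + 0ℤ) * w) * (x * y) ≡ (1ℤ - w) * x * y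
      lem = solve-∀ ring

  frozen-column : ∀ {p x vs s} f → s (ver x) ≡ true → All (λ v → s (hor v) ≡ true) vs →
    ap (act (column p 1ℤ x vs) f) s ≡ ∏ vs (λ v → wa (val v) p) * ap f s
  frozen-column {s = s} f e [] = sym (*-identityˡ (ap f s))
  frozen-column {p} {x} {v ∷ vs} {s} f e (ev ∷ es) = trans (straight _ (act (column p 1ℤ x vs) f) s ev e)
    (trans (cong (wa (val v) p *_) (frozen-column {vs = vs} f e es)) (sym (*-assoc (wa (val v) p) _ _)))

  on-column : ∀ {p q x ℓ h} vs → (∀ v → v ∈ vs → ℓ ≢ hor v) → ℓ ≢ ver x → Commute (on ℓ h) (column p q x vs)
  on-column [] _ _ = opwise λ f s → refl
  on-column {p} {q} {x} {ℓ} {h} (v ∷ vs) e e′ = slide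
    (commute-sym {cell p q x v} (on-commute (e v (here refl)) e′)) (on-column vs (λ u m → e u (there m)) e′)

  on-grid : ∀ {ℓ h} vs xs → (∀ v → v ∈ vs → ℓ ≢ hor v) → (∀ x → x ∈ xs → ℓ ≢ ver x) → Commute (on ℓ h) (grid6 vs xs)
  on-grid vs [] _ _ = opwise λ f s → refl
  on-grid vs (x ∷ xs) e e′ = slide (on-column vs e (e′ x (here refl))) (on-grid vs xs e (λ y m → e′ y (there m)))

  -- The lines r and x do not meet the remaining grid, so their exit conditions can be checked
  -- before it.
  finish-remove : ∀ r vs x xs s → r ∉ vs → x ∉ xs → s (hor r) ≡ false → s (ver x) ≡ true →
    ap (act (grid6 vs xs) (finish (r ∷ vs) (x ∷ xs))) s ≡ ap (act (grid6 vs xs) (finish vs xs)) s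
  finish-remove r vs x xs s r∉ x∉ er ex = begin
    ap (act (grid6 vs xs) (finish (r ∷ vs) (x ∷ xs))) s
      ≡⟨ app (act-cong (grid6 vs xs) factor) s ⟩
    ap (act (grid6 vs xs) (act onr (act onx (finish vs xs)))) s
      ≡⟨ sym (appᴼ (on-grid vs xs (λ { v m refl → r∉ m }) (λ { x m () })) (act onx (finish vs xs)) s) ⟩
    ⟦ not (s (hor r)) ⟧ * ap (act (grid6 vs xs) (act onx (finish vs xs))) s
      ≡⟨ cong (⟦ not (s (hor r)) ⟧ *_)
           (sym (appᴼ (on-grid vs xs (λ { v m () }) (λ { x m refl → x∉ m })) (finish vs xs) s)) ⟩
    ⟦ not (s (hor r)) ⟧ * (⟦ s (ver x) ⟧ * ap (act (grid6 vs xs) (finish vs xs)) s)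
      ≡⟨ cong₂ (λ b c → ⟦ not b ⟧ * (⟦ c ⟧ * ap (act (grid6 vs xs) (finish vs xs)) s)) er ex ⟩
    1ℤ * (1ℤ * ap (act (grid6 vs xs) (finish vs xs)) s)
      ≡⟨ trans (*-identityˡ _) (*-identityˡ _) ⟩
    ap (act (grid6 vs xs) (finish vs xs)) s ∎
    where
    open ≡-Reasoning
    onr onx : Operator
    onr = on (hor r) (⟦_⟧ ∘ not)
    onx = on (ver x) ⟦_⟧
    opaque
      unfolding ℤ
      lem : ∀ a b c d → a * b * (c * d) ≡ a * (c * (b * d))
      lem = solve-∀ ring
    factor : finish (r ∷ vs) (x ∷ xs) ≈ act onr (act onx (finish vs xs))
    factor .app s = lem _ _ _ _

  record Start (rows cols : List ℕ) (s : State) : Set where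
    constructor start
    field
      rows-in : All (λ i → s (hor i) ≡ true) rows
      cols-in : All (λ x → s (ver x) ≡ false) cols
  open Start

  all-update : ∀ {ℓ c b s} {g : ℕ → Line} {is} → (∀ i → i ∈ is → g i ≢ ℓ) → All (λ i → s (g i) ≡ b) is →
    All (λ i → (s [ ℓ ≔ c ]) (g i) ≡ b) is
  all-update e [] = []
  all-update {c = c} {s = s} e (p ∷ ps) =
    trans (lookup-other s c (e _ (here refl))) p ∷ all-update (λ i m → e i (there m)) ps

  -- For p = val r the weight b₁ of the first vertex vanishes, so the path of the row r turns down
  -- there with weight c₁. It fills the column x, the row r stays empty, the other vertices on these
  -- two lines have weight a, and a grid without r and x is left.
  frozen : ∀ {r vs x xs s} → Start (r ∷ vs) (x ∷ xs) s → r ∉ vs → x ∉ xs → Unique xs →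
    Σ State λ s′ → Start vs xs s′ × ap (partition (val r) 1ℤ x xs (r ∷ vs)) s
      ≡ (1ℤ + val r * val r) * (∏ vs (λ v → wa (val v) (val r)) * ((1ℤ - val r) ^ length xs
          * ap (act (grid6 vs xs) (finish vs xs)) s′))
  frozen {r} {vs} {x} {xs} {s} (start (er ∷ ers) (ex ∷ exs)) r∉ x∉ u = s′ , st , (begin
    vertex w (s (hor r)) (s (ver x)) (λ o o′ → ap g ((s [ hor r ≔ o ]) [ ver x ≔ o′ ]))
      ≡⟨ vertex-cong w er ex (λ _ _ → refl) ⟩
    (val r - 1ℤ * val r) * _ + (1ℤ + val r * val r) * ap g s′
      ≡⟨ lem (val r) _ (ap g s′) ⟩
    (1ℤ + val r * val r) * ap g s′
      ≡⟨ cong ((1ℤ + val r * val r) *_) (trans (frozen-column {vs = vs} h ex′ (rows-in st))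
           (cong (∏ vs (λ v → wa (val v) (val r)) *_) (trans (appᴼ (split-row r∉ u) (finish (r ∷ vs) (x ∷ xs)) s′)
             (trans (frozen-row {xs = xs} (act (grid6 vs xs) (finish (r ∷ vs) (x ∷ xs))) er′ (cols-in st))
               (cong ((1ℤ - val r) ^ length xs *_) (finish-remove r vs x xs s′ r∉ x∉ er′ ex′)))))) ⟩
    _ ∎)
    where
    open ≡-Reasoning
    w : Weights
    w = rw (val r) (val r) 1ℤ
    h g : Functional
    h = act (grid6 (r ∷ vs) xs) (finish (r ∷ vs) (x ∷ xs))
    g = act (column (val r) 1ℤ x vs) h
    s′ : State
    s′ = (s [ hor r ≔ false ]) [ ver x ≔ true ]
    er′ : s′ (hor r) ≡ false
    er′ = trans (lookup-other _ true (λ ())) (lookup-same s (hor r) false)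
    ex′ : s′ (ver x) ≡ true
    ex′ = lookup-same _ (ver x) true
    st : Start vs xs s′
    st = start (all-update (λ i m ()) (all-update (λ { i m refl → r∉ m }) ers))
               (all-update (λ { i m refl → x∉ m }) (all-update (λ i m ()) exs))
    opaque
      unfolding ℤ
      lem : ∀ w x y → (w - 1ℤ * w) * x + (1ℤ + w * w) * y ≡ (1ℤ + w * w) * y
      lem = solve-∀ ring

  module _ (x : ℕ) (g : Functional) (g-zero : ∀ s → s (ver x) ≡ false → ap g s ≡ 0ℤ) where

    C : ℤ → ℤ → List ℕ → State → ℤ
    C p q rs = ap (act (column p q x rs) g)

    step : ∀ {d i j} r rs s → s (hor r) ≡ i → s (ver x) ≡ j →
      let F = λ p q o o′ → C p q rs ((s [ hor r ≔ o ]) [ ver x ≔ o′ ]) in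
      Degree d (vertex (rw (val r) 1ℤ 0ℤ) i j (F 1ℤ 0ℤ)) (λ p → vertex (rw (val r) p 1ℤ) i j (F p 1ℤ)) →
      Degree d (C 1ℤ 0ℤ (r ∷ rs) s) (λ p → C p 1ℤ (r ∷ rs) s)
    step r rs s ei ej = degree-cong
      (vertex-cong (rw (val r) 1ℤ 0ℤ) (sym ei) (sym ej) (λ _ _ → refl))
      (λ p → vertex-cong (rw (val r) p 1ℤ) (sym ei) (sym ej) (λ _ _ → refl))

    opaque
      unfolding ℤ
      a-lead : ∀ w y → (1ℤ - w) * y ≡ (1ℤ - 0ℤ - (1ℤ + 0ℤ) * w) * y
      a-lead = solve-∀ ring
      a-linear : ∀ w p y → (p * (1ℤ - w) + - (1ℤ + w)) * y ≡ (p - 1ℤ - (p + 1ℤ) * w) * y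
      a-linear = solve-∀ ring
      b₁-lead : ∀ w y z → 1ℤ * y + (1ℤ + w * w) * z ≡ (1ℤ - 0ℤ * w) * y + (1ℤ + w * w) * z
      b₁-lead = solve-∀ ring
      b₁-linear : ∀ w p y z → (p * 1ℤ + - w) * y + (1ℤ + w * w) * z ≡ (p - 1ℤ * w) * y + (1ℤ + w * w) * z
      b₁-linear = solve-∀ ring
      b₂-lead : ∀ w y z → 2ℤ * y + z ≡ 2ℤ * (1ℤ - 0ℤ * w) * y + (1ℤ * 1ℤ + 0ℤ * 0ℤ) * z
      b₂-lead = solve-∀ ring
      b₂-linear : ∀ w p y z → (p * 2ℤ + - (2ℤ * w)) * y + (p * p + 1ℤ) * z
        ≡ 2ℤ * (p - 1ℤ * w) * y + (p * p + 1ℤ * 1ℤ) * z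
      b₂-linear = solve-∀ ring

    -- Down the column, turns with weight c₁, constant in p, and c₂, quadratic in p, alternate,
    -- while a, b₁ and b₂ are at most linear. By `g-zero` the column must leave occupied. So the
    -- degree is at most the number of rows if it enters occupied, and one less if it enters empty.
    degree-occupied : ∀ rs s → s (ver x) ≡ true → Degree (length rs) (C 1ℤ 0ℤ rs s) (λ p → C p 1ℤ rs s)
    degree-empty : ∀ r rs s → s (ver x) ≡ false → Degree (length rs) (C 1ℤ 0ℤ (r ∷ rs) s) (λ p → C p 1ℤ (r ∷ rs) s)

    degree-occupied [] s e = const λ p → refl
    degree-occupied (r ∷ rs) s e = go (s (hor r)) refl
      where
      occ : ∀ b → Degree (length rs) (C 1ℤ 0ℤ rs ((s [ hor r ≔ b ]) [ ver x ≔ true ]))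
        (λ p → C p 1ℤ rs ((s [ hor r ≔ b ]) [ ver x ≔ true ]))
      occ b = degree-occupied rs ((s [ hor r ≔ b ]) [ ver x ≔ true ]) (lookup-same (s [ hor r ≔ b ]) (ver x) true)
      turning : ∀ rs → Degree (suc (length rs)) (C 1ℤ 0ℤ rs ((s [ hor r ≔ true ]) [ ver x ≔ false ]))
        (λ p → (p * p + 1ℤ) * C p 1ℤ rs ((s [ hor r ≔ true ]) [ ver x ≔ false ]))
      turning [] = degree-cong (sym z) (λ p → sym (trans (cong ((p * p + 1ℤ) *_) z) (zeroʳ _))) (degree-zero 1)
        where
        z : ap g ((s [ hor r ≔ true ]) [ ver x ≔ false ]) ≡ 0ℤ
        z = g-zero ((s [ hor r ≔ true ]) [ ver x ≔ false ]) (lookup-same (s [ hor r ≔ true ]) (ver x) false)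
      turning (r′ ∷ rs′) = degree-quadratic
        (degree-empty r′ rs′ ((s [ hor r ≔ true ]) [ ver x ≔ false ]) (lookup-same (s [ hor r ≔ true ]) (ver x) false))
      go : ∀ b → s (hor r) ≡ b → Degree (suc (length rs)) (C 1ℤ 0ℤ (r ∷ rs) s) (λ p → C p 1ℤ (r ∷ rs) s)
      go true er = step r rs s er e (degree-cong (a-lead (val r) _) (λ p → a-linear (val r) p _)
        (degree-linear (1ℤ - val r) (- (1ℤ + val r)) (occ true)))
      go false er = step r rs s er e (degree-cong (b₂-lead (val r) _ _) (λ p → b₂-linear (val r) p _ _)
        (degree-+ (degree-linear 2ℤ (- (2ℤ * val r)) (occ false)) (turning rs)))

    degree-empty r rs s e = go (s (hor r)) refl
      where
      linear-empty : ∀ c d b rs → Degree (length rs) (c * C 1ℤ 0ℤ rs ((s [ hor r ≔ b ]) [ ver x ≔ false ]))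
        (λ p → (p * c + d) * C p 1ℤ rs ((s [ hor r ≔ b ]) [ ver x ≔ false ]))
      linear-empty c d b [] = const λ p → trans (cong ((p * c + d) *_) z) (trans (zeroʳ _) (sym (trans (cong (c *_) z) (zeroʳ c))))
        where
        z : ap g ((s [ hor r ≔ b ]) [ ver x ≔ false ]) ≡ 0ℤ
        z = g-zero ((s [ hor r ≔ b ]) [ ver x ≔ false ]) (lookup-same (s [ hor r ≔ b ]) (ver x) false)
      linear-empty c d b (r′ ∷ rs′) = degree-linear c d
        (degree-empty r′ rs′ ((s [ hor r ≔ b ]) [ ver x ≔ false ]) (lookup-same (s [ hor r ≔ b ]) (ver x) false))
      go : ∀ b → s (hor r) ≡ b → Degree (length rs) (C 1ℤ 0ℤ (r ∷ rs) s) (λ p → C p 1ℤ (r ∷ rs) s)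
      go true er = step r rs s er e (degree-cong (b₁-lead (val r) _ _) (λ p → b₁-linear (val r) p _ _)
        (degree-+ (linear-empty 1ℤ (- val r) true rs)
          (degree-scale (1ℤ + val r * val r) (degree-occupied rs ((s [ hor r ≔ false ]) [ ver x ≔ true ]) (lookup-same (s [ hor r ≔ false ]) (ver x) true)))))
      go false er = step r rs s er e (degree-cong (a-lead (val r) _) (λ p → a-linear (val r) p _)
        (linear-empty (1ℤ - val r) (- (1ℤ + val r)) false rs))

  -- The grid has parameter 1 : 0 in its first column, so it is the leading coefficient in p of the
  -- grid with p : 1 there. For p = val w the row w is brought to the top and frozen, and the
  -- induction applies to what is left.
  partition-determinant : ∀ n rows cols s → length rows ≡ n → length cols ≡ n → Unique rows → Unique cols →
    Start rows cols s →
    V n rows * ap (act (grid6 rows cols) (finish rows cols)) s ≡ ∏ rows (λ i → 1ℤ + val i * val i) * E n rows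
  partition-determinant zero [] [] s _ _ _ _ _ = cong (1ℤ *_) (*-identityˡ 1ℤ)
  partition-determinant (suc m) rows@(r ∷ rs) (x ∷ xs) s refl lc u (x∉ ∷ ux) st = begin
    V (suc m) rows * z                    ≡⟨ *-comm (V (suc m) rows) z ⟩
    z * V (suc m) rows                    ≡⟨ sym (lagrange degree rows) ⟩
    ∑± (λ w vs → f (val w) * V m vs) rows ≡⟨ ∑±-cong-pick rows term ⟩
    ∑± (λ w vs → ∏ rows h * ((1ℤ - val w) ^ m * ∏ vs (λ v → wa (val v) (val w)) * E m vs)) rows
                                          ≡⟨ ∑±-scale (λ w vs → (1ℤ - val w) ^ m * ∏ vs (λ v → wa (val v) (val w)) * E m vs) (∏ rows h) rows ⟩
    ∏ rows h * ∑± (λ w vs → (1ℤ - val w) ^ m * ∏ vs (λ v → wa (val v) (val w)) * E m vs) rows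
                                          ≡⟨ cong (∏ rows h *_) (sym (E-recursion separated 1-val≢0 rows m refl u)) ⟩
    ∏ rows h * E (suc m) rows             ∎
    where
    open ≡-Reasoning
    h : ℕ → ℤ
    h i = 1ℤ + val i * val i
    z : ℤ
    z = ap (act (grid6 rows (x ∷ xs)) (finish rows (x ∷ xs))) s
    f : ℤ → ℤ
    f p = ap (partition p 1ℤ x xs rows) s
    rest : Functional
    rest = act (grid6 rows xs) (finish rows (x ∷ xs))
    rest-zero : ∀ s → s (ver x) ≡ false → ap rest s ≡ 0ℤ
    rest-zero s e = trans (app (act-cong (grid6 rows xs) factor) s)
      (trans (sym (appᴼ (on-grid rows xs (λ { v m () }) (λ { y m refl → All.lookup x∉ m refl })) (finish rows xs) s))
        (trans (cong (λ b → ⟦ b ⟧ * ap (act (grid6 rows xs) (finish rows xs)) s) e) (zeroˡ _)))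
      where
      factor : finish rows (x ∷ xs) ≈ act (on (ver x) ⟦_⟧) (finish rows xs)
      factor .app s = *-exchange _ _ _
    degree : Degree m z f
    degree = degree-empty x rest rest-zero r rs s (All.head (cols-in st))
    opaque
      unfolding ℤ
      lem : ∀ h a b z v → h * (a * (b * z)) * v ≡ h * (a * b) * (v * z)
      lem = solve-∀ ring
      lem′ : ∀ h a b p e → h * (a * b) * (p * e) ≡ h * p * (b * a * e)
      lem′ = solve-∀ ring
    term : ∀ w vs → Pick w vs rows →
      f (val w) * V m vs ≡ ∏ rows h * ((1ℤ - val w) ^ m * ∏ vs (λ v → wa (val v) (val w)) * E m vs)
    term w vs π with pick-unique π u
    ... | w∉ , uv with frozen {w} {vs} {x} {xs} {s}
                         (start (All.lookup (rows-in st) (pick-∈ π) ∷ All.tabulate (λ m → All.lookup (rows-in st) (pick-sub π m)))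
                           (cols-in st))
                         (λ m → All.lookup w∉ m refl) (λ m → All.lookup x∉ m refl) ux
    ...   | s′ , st′ , e = begin
      f (val w) * V m vs
        ≡⟨ cong (_* V m vs) (trans (partition-pick wa≢0 {xs = xs} [] π u s (rows-in st)) e) ⟩
      h w * (A * ((1ℤ - val w) ^ length xs * z′)) * V m vs
        ≡⟨ lem (h w) A ((1ℤ - val w) ^ length xs) z′ (V m vs) ⟩
      h w * (A * (1ℤ - val w) ^ length xs) * (V m vs * z′)
        ≡⟨ cong₂ (λ k t → h w * (A * (1ℤ - val w) ^ k) * t) (ℕₚ.suc-injective lc)
             (partition-determinant m vs xs s′ (ℕₚ.suc-injective (sym (pick-length π))) (ℕₚ.suc-injective lc) uv ux st′) ⟩
      h w * (A * (1ℤ - val w) ^ m) * (∏ vs h * E m vs)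
        ≡⟨ lem′ (h w) A ((1ℤ - val w) ^ m) (∏ vs h) (E m vs) ⟩
      h w * ∏ vs h * ((1ℤ - val w) ^ m * A * E m vs)
        ≡⟨ cong (_* ((1ℤ - val w) ^ m * A * E m vs)) (sym (pick-∏ h π)) ⟩
      ∏ rows h * ((1ℤ - val w) ^ m * A * E m vs) ∎
      where
      A z′ : ℤ
      A = ∏ vs (λ v → wa (val v) (val w))
      z′ = ap (act (grid6 vs xs) (finish vs xs)) s′

-- The homogeneous limit

Poly : Set
Poly = List ℤ

eval : Poly → ℤ → ℤ
eval [] w = 0ℤ
eval (c ∷ P) w = c + w * eval P w

coeff : Poly → ℕ → ℤ
coeff [] k = 0ℤ
coeff (c ∷ P) zero = c
coeff (c ∷ P) (suc k) = coeff P k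

infixl 6 _⊕_
_⊕_ : Poly → Poly → Poly
[] ⊕ Q = Q
(c ∷ P) ⊕ [] = c ∷ P
(c ∷ P) ⊕ (d ∷ Q) = (c + d) ∷ (P ⊕ Q)

scale : ℤ → Poly → Poly
scale a P = map (a *_) P

eval-⊕ : ∀ P Q w → eval (P ⊕ Q) w ≡ eval P w + eval Q w
eval-⊕ [] Q w = sym (+-identityˡ _)
eval-⊕ (c ∷ P) [] w = sym (+-identityʳ _)
eval-⊕ (c ∷ P) (d ∷ Q) w = trans (cong (λ t → c + d + w * t) (eval-⊕ P Q w)) (lem c d w _ _)
  where
  opaque
    unfolding ℤ
    lem : ∀ c d w p q → c + d + w * (p + q) ≡ c + w * p + (d + w * q)
    lem = solve-∀ ring

eval-scale : ∀ a P w → eval (scale a P) w ≡ a * eval P w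
eval-scale a [] w = sym (zeroʳ a)
eval-scale a (c ∷ P) w = trans (cong (λ t → a * c + w * t) (eval-scale a P w)) (lem a c w _)
  where
  opaque
    unfolding ℤ
    lem : ∀ a c w p → a * c + w * (a * p) ≡ a * (c + w * p)
    lem = solve-∀ ring

coeff-⊕ : ∀ P Q k → coeff (P ⊕ Q) k ≡ coeff P k + coeff Q k
coeff-⊕ [] Q k = sym (+-identityˡ _)
coeff-⊕ (c ∷ P) [] k = sym (+-identityʳ _)
coeff-⊕ (c ∷ P) (d ∷ Q) zero = refl
coeff-⊕ (c ∷ P) (d ∷ Q) (suc k) = coeff-⊕ P Q k

coeff-scale : ∀ a P k → coeff (scale a P) k ≡ a * coeff P k
coeff-scale a [] k = sym (zeroʳ a)
coeff-scale a (c ∷ P) zero = refl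
coeff-scale a (c ∷ P) (suc k) = coeff-scale a P k

-- The quotient of P - P(v) by w - v.
quotient : ℤ → Poly → Poly
quotient v [] = []
quotient v (c ∷ P) = P ⊕ scale v (quotient v P)

eval-quotient : ∀ v P w → eval P w ≡ eval P v + (w - v) * eval (quotient v P) w
eval-quotient v [] w = sym (trans (+-identityˡ _) (zeroʳ _))
eval-quotient v (c ∷ P) w = begin
  c + w * eval P w
    ≡⟨ lem₁ c w v (eval P w) ⟩
  c + v * eval P w + (w - v) * eval P w
    ≡⟨ cong (λ t → c + v * t + (w - v) * eval P w) (eval-quotient v P w) ⟩
  c + v * (eval P v + (w - v) * eval (quotient v P) w) + (w - v) * eval P w
    ≡⟨ lem₂ c w v _ _ _ ⟩
  c + v * eval P v + (w - v) * (eval P w + v * eval (quotient v P) w)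
    ≡⟨ cong (λ t → c + v * eval P v + (w - v) * t)
         (sym (trans (eval-⊕ P (scale v (quotient v P)) w) (cong (λ t → eval P w + t) (eval-scale v (quotient v P) w)))) ⟩
  c + v * eval P v + (w - v) * eval (P ⊕ scale v (quotient v P)) w ∎
  where
  open ≡-Reasoning
  opaque
    unfolding ℤ
    lem₁ : ∀ c w v p → c + w * p ≡ c + v * p + (w - v) * p
    lem₁ = solve-∀ ring
    lem₂ : ∀ c w v x q p → c + v * (x + (w - v) * q) + (w - v) * p ≡ c + v * x + (w - v) * (p + v * q)
    lem₂ = solve-∀ ring

D-map : ∀ {X Y : Set} (φ : X → Y) (fs : List (Y → ℤ)) ws → D (map (λ f → f ∘ φ) fs) ws ≡ D fs (map φ ws)
D-map φ [] [] = refl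
D-map φ [] (w ∷ ws) = refl
D-map φ (f ∷ fs) ws = trans (∑±-cong (λ w vs → cong (f (φ w) *_) (D-map φ fs vs)) ws) (go (λ v us → f v * D fs us) ws)
  where
  go : ∀ K′ ws → ∑± (λ w vs → K′ (φ w) (map φ vs)) ws ≡ ∑± K′ (map φ ws)
  go K′ [] = refl
  go K′ (w ∷ ws) = cong (λ t → K′ (φ w) (map φ ws) - t) (go (λ v vs → K′ v (φ w ∷ vs)) ws)

-- Columns are functionals on polynomials, so that values, divided differences and coefficients can
-- all serve as columns for the same rows.
Evaluation : Set
Evaluation = Poly → ℤ

evaluated : Poly → Evaluation → ℤ
evaluated P x = x P

-- Newton's divided differences: the entry number k is P[v₀, ..., v_k]. The map ψ collects the
-- divisions by the nodes passed so far.
dividedDifferences : (Poly → Poly) → List ℤ → List Evaluation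
dividedDifferences ψ [] = []
dividedDifferences ψ (v ∷ ws) = (λ P → eval (ψ P) v) ∷ dividedDifferences (quotient v ∘ ψ) ws

differences : List ℤ → ℤ
differences [] = 1ℤ
differences (v ∷ ws) = ∏ ws (λ w → w - v) * differences ws

-- Every other column is the first one plus w - v times the divided difference at v and w. `pivot`
-- takes out these factors, and in total they form the Vandermonde product of the nodes.
newton : ∀ {H : List Evaluation → ℤ} → Alternating H →
  (∀ x y z k → (∀ P → x P ≡ y P + k * z P) → ColumnLinear x y z k H) → ∀ ψ ws →
  H (map (λ w P → eval (ψ P) w) ws) ≡ differences ws * H (dividedDifferences ψ ws)
newton a l ψ [] = sym (*-identityˡ _)
newton {H} a l ψ (v ∷ ws) = begin
  H (x ∷ map (λ w P → eval (ψ P) w) ws)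
    ≡⟨ pivot ks (map (λ w P → eval (ψ P) w) ws) (map (λ w P → eval (quotient v (ψ P)) w) ws) a (pivoted ws) ⟩
  ∏ ks id * H (x ∷ map (λ w P → eval (quotient v (ψ P)) w) ws)
    ≡⟨ cong₂ _*_ (∏-ks ws) (newton {H ∘ (x ∷_)} (λ pre → a (x ∷ pre)) (λ y z u k e pre → l y z u k e (x ∷ pre)) (quotient v ∘ ψ) ws) ⟩
  ∏ ws (λ w → w - v) * (differences ws * H (x ∷ dividedDifferences (quotient v ∘ ψ) ws))
    ≡⟨ sym (*-assoc _ _ _) ⟩
  ∏ ws (λ w → w - v) * differences ws * H (x ∷ dividedDifferences (quotient v ∘ ψ) ws) ∎
  where
  open ≡-Reasoning
  x : Evaluation
  x P = eval (ψ P) v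
  ks : List ℤ
  ks = map (λ w → w - v) ws
  ∏-ks : ∀ ws → ∏ (map (λ w → w - v) ws) id ≡ ∏ ws (λ w → w - v)
  ∏-ks [] = refl
  ∏-ks (w ∷ ws) = cong ((w - v) *_) (∏-ks ws)
  pivoted : ∀ ws → Pivoted H x (map (λ w → w - v) ws) (map (λ w P → eval (ψ P) w) ws)
    (map (λ w P → eval (quotient v (ψ P)) w) ws)
  pivoted [] = tt
  pivoted (w ∷ ws) = l _ _ _ (w - v) (λ P → eval-quotient v (ψ P) w) , pivoted ws

D-newton : ∀ Ps ws → D (map eval Ps) ws ≡ differences ws * D (map evaluated Ps) (dividedDifferences id ws)
D-newton Ps ws = trans (trans (cong (λ fs → D fs ws) (rows Ps)) (D-map (λ w P → eval P w) (map evaluated Ps) ws))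
  (newton {D (map evaluated Ps)} (D-alternating (map evaluated Ps)) (λ x y z k e → D-column-linear (map evaluated Ps) x y z k (everywhere e Ps)) id ws)
  where
  rows : ∀ Ps → map eval Ps ≡ map (λ f → f ∘ (λ w P → eval P w)) (map evaluated Ps)
  rows [] = refl
  rows (P ∷ Ps) = cong (eval P ∷_) (rows Ps)
  everywhere : ∀ {x y z : Evaluation} {k} → (∀ P → x P ≡ y P + k * z P) → ∀ Ps → All (λ f → f x ≡ f y + k * f z) (map evaluated Ps)
  everywhere e [] = []
  everywhere e (P ∷ Ps) = e P ∷ everywhere e Ps

range : ℕ → ℕ → List ℕ
range m zero = []
range m (suc n) = m ∷ range (suc m) n

D-congruent : ∀ {ε} Ps {xs ys : List Evaluation} → Pointwise (λ x y → ∀ P → x P ≡ y P [ ε ]) xs ys →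
  D (map evaluated Ps) xs ≡ D (map evaluated Ps) ys [ ε ]
D-congruent [] [] = ≡⇒congruent refl
D-congruent [] (_ ∷ _) = ≡⇒congruent refl
D-congruent {ε} (P ∷ Ps) es = go {D (map evaluated Ps)} {D (map evaluated Ps)} (D-congruent Ps) es
  where
  go : ∀ {H H′ : List Evaluation → ℤ} →
    (∀ {xs ys : List Evaluation} → Pointwise (λ x y → ∀ P → x P ≡ y P [ ε ]) xs ys → H xs ≡ H′ ys [ ε ]) →
    ∀ {xs ys : List Evaluation} → Pointwise (λ x y → ∀ P → x P ≡ y P [ ε ]) xs ys →
    ∑± (λ x vs → x P * H vs) xs ≡ ∑± (λ x vs → x P * H′ vs) ys [ ε ]
  go h [] = ≡⇒congruent refl
  go {H} {H′} h {x ∷ _} {y ∷ _} (e ∷ es) = +-congruent (*-congruent (e P) (h es))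
    (neg-congruent (go {H ∘ (x ∷_)} {H′ ∘ (y ∷_)} (λ es′ → h (e ∷ es′)) es))

-- For v congruent to 0, dividing by w - v amounts to dividing by w, which shifts the coefficients.
coeff-quotient : ∀ {ε v} → v ≡ 0ℤ [ ε ] → ∀ P k → coeff (quotient v P) k ≡ coeff P (suc k) [ ε ]
coeff-quotient e [] k = ≡⇒congruent refl
coeff-quotient {v = v} e (c ∷ P) k = congruent-trans
  (≡⇒congruent (trans (coeff-⊕ P _ k) (cong (λ t → coeff P k + t) (coeff-scale v (quotient v P) k))))
  (congruent-trans (+-congruent (≡⇒congruent {coeff P k} refl) (*-congruent e (≡⇒congruent {coeff (quotient v P) k} refl)))
    (≡⇒congruent (trans (cong (λ t → coeff P k + t) (zeroˡ _)) (+-identityʳ _))))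

eval-congruent : ∀ {ε v} → v ≡ 0ℤ [ ε ] → ∀ P → eval P v ≡ coeff P 0 [ ε ]
eval-congruent e [] = ≡⇒congruent refl
eval-congruent {v = v} e (c ∷ P) = congruent-trans
  (+-congruent (≡⇒congruent {c} refl) (*-congruent e (≡⇒congruent {eval P v} refl)))
  (≡⇒congruent (trans (cong (λ t → c + t) (zeroˡ _)) (+-identityʳ _)))

dividedDifferences-congruent : ∀ {ε ws} → All (λ w → w ≡ 0ℤ [ ε ]) ws → ∀ m ψ →
  (∀ P k → coeff (ψ P) k ≡ coeff P (m ℕ.+ k) [ ε ]) →
  Pointwise (λ x y → ∀ P → x P ≡ y P [ ε ]) (dividedDifferences ψ ws) (map (λ k P → coeff P k) (range m (length ws)))
dividedDifferences-congruent [] m ψ h = []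
dividedDifferences-congruent (e ∷ es) m ψ h =
  (λ P → congruent-trans (eval-congruent e (ψ P))
    (congruent-trans (h P 0) (≡⇒congruent (cong (coeff P) (ℕₚ.+-identityʳ m))))) ∷
  dividedDifferences-congruent es (suc m) _ λ P k →
    congruent-trans (coeff-quotient e (ψ P) k) (congruent-trans (h P (suc k)) (≡⇒congruent (cong (coeff P) (ℕₚ.+-suc m k))))

D-limit : ∀ {ε ws} → All (λ w → w ≡ 0ℤ [ ε ]) ws → ∀ Ps →
  D (map evaluated Ps) (dividedDifferences id ws) ≡ D (map coeff Ps) (range 0 (length ws)) [ ε ]
D-limit {ws = ws} es Ps = congruent-trans (D-congruent Ps (dividedDifferences-congruent es 0 id (λ P k → ≡⇒congruent refl)))
  (≡⇒congruent (sym (trans (cong (λ fs → D fs (range 0 (length ws))) (rows Ps))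
    (D-map (λ k P → coeff P k) (map evaluated Ps) (range 0 (length ws))))))
  where
  rows : ∀ Ps → map coeff Ps ≡ map (λ f → f ∘ (λ k P → coeff P k)) (map evaluated Ps)
  rows [] = refl
  rows (P ∷ Ps) = cong (coeff P ∷_) (rows Ps)

differences-nonzero : ∀ {X : Set} (val : X → ℤ) → (∀ {x y} → x ≢ y → val x - val y ≢ 0ℤ) →
  ∀ {xs} → Unique xs → differences (map val xs) ≢ 0ℤ
differences-nonzero val sep [] = 1≢0
differences-nonzero val sep {x ∷ xs} (a ∷ u) = *-nonzero (subst (_≢ 0ℤ) (sym (go xs)) (∏-nonzero (All.map (λ ne → sep (ne ∘ sym)) a)))
  (differences-nonzero val sep u)
  where
  go : ∀ xs → ∏ (map val xs) (λ w → w - val x) ≡ ∏ xs (λ y → val y - val x)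
  go [] = refl
  go (y ∷ xs) = cong ((val y - val x) *_) (go xs)

-- The rows as coefficient lists and their reduction modulo ε

times1-w times1+w timesw : Poly → Poly
timesw P = 0ℤ ∷ P
times1-w P = P ⊕ scale (- 1ℤ) (timesw P)
times1+w P = P ⊕ timesw P

iterate : ∀ {A : Set} → (A → A) → ℕ → A → A
iterate f zero a = a
iterate f (suc n) a = f (iterate f n a)

eval-timesw : ∀ P w → eval (timesw P) w ≡ w * eval P w
eval-timesw P w = +-identityˡ _

eval-times1-w : ∀ P w → eval (times1-w P) w ≡ (1ℤ - w) * eval P w
eval-times1-w P w = trans (eval-⊕ P _ w) (trans (cong (λ t → eval P w + t)
  (trans (eval-scale (- 1ℤ) (timesw P) w) (cong (- 1ℤ *_) (eval-timesw P w)))) (lem w _))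
  where
  opaque
    unfolding ℤ
    lem : ∀ w p → p + - 1ℤ * (w * p) ≡ (1ℤ - w) * p
    lem = solve-∀ ring

eval-times1+w : ∀ P w → eval (times1+w P) w ≡ (1ℤ + w) * eval P w
eval-times1+w P w = trans (eval-⊕ P _ w) (trans (cong (λ t → eval P w + t) (eval-timesw P w)) (lem w _))
  where
  opaque
    unfolding ℤ
    lem : ∀ w p → p + w * p ≡ (1ℤ + w) * p
    lem = solve-∀ ring

eval-iterate : ∀ (f : Poly → Poly) (c : ℤ → ℤ) → (∀ P w → eval (f P) w ≡ c w * eval P w) →
  ∀ n P w → eval (iterate f n P) w ≡ c w ^ n * eval P w
eval-iterate f c h zero P w = sym (*-identityˡ _)
eval-iterate f c h (suc n) P w = trans (h _ w) (trans (cong (c w *_) (eval-iterate f c h n P w)) (sym (*-assoc (c w) _ _)))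

κ-poly : ℕ → ℕ → Poly
κ-poly j zero = iterate times1-w j (1ℤ ∷ [])
κ-poly j (suc k) = scale 2ℤ (iterate times1+w k (iterate times1-w j (1ℤ ∷ [])))
  ⊕ scale (- 1ℤ) (iterate times1-w (2 ℕ.+ (j ℕ.+ k)) (iterate timesw k (1ℤ ∷ [])))

eval-1 : ∀ w → eval (1ℤ ∷ []) w ≡ 1ℤ
eval-1 w = trans (cong (λ t → 1ℤ + t) (zeroʳ w)) (+-identityʳ 1ℤ)

eval-κ-poly : ∀ j k w → eval (κ-poly j k) w ≡ κ j k w
eval-κ-poly j zero w = trans (eval-iterate times1-w (λ w → 1ℤ - w) eval-times1-w j _ w)
  (trans (cong ((1ℤ - w) ^ j *_) (eval-1 w)) (*-identityʳ _))
eval-κ-poly j (suc k) w = begin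
  eval (κ-poly j (suc k)) w
    ≡⟨ trans (eval-⊕ (scale 2ℤ A) (scale (- 1ℤ) B) w) (cong₂ _+_ (eval-scale 2ℤ A w) (eval-scale (- 1ℤ) B w)) ⟩
  2ℤ * eval A w + - 1ℤ * eval B w
    ≡⟨ cong₂ (λ x y → 2ℤ * x + - 1ℤ * y)
         (trans (eval-iterate times1+w (λ w → 1ℤ + w) eval-times1+w k _ w) (cong ((1ℤ + w) ^ k *_) (eval-κ-poly j zero w)))
         (trans (eval-iterate times1-w (λ w → 1ℤ - w) eval-times1-w (2 ℕ.+ (j ℕ.+ k)) _ w)
           (cong ((1ℤ - w) ^ (2 ℕ.+ (j ℕ.+ k)) *_)
             (trans (eval-iterate timesw (λ w → w) eval-timesw k _ w) (cong (w ^ k *_) (eval-1 w))))) ⟩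
  2ℤ * ((1ℤ + w) ^ k * (1ℤ - w) ^ j) + - 1ℤ * ((1ℤ - w) ^ (2 ℕ.+ (j ℕ.+ k)) * (w ^ k * 1ℤ))
    ≡⟨ lem _ _ _ _ ⟩
  κ j (suc k) w ∎
  where
  open ≡-Reasoning
  A B : Poly
  A = iterate times1+w k (iterate times1-w j (1ℤ ∷ []))
  B = iterate times1-w (2 ℕ.+ (j ℕ.+ k)) (iterate timesw k (1ℤ ∷ []))
  opaque
    unfolding ℤ
    lem : ∀ p q r s → 2ℤ * (p * q) + - 1ℤ * (r * (s * 1ℤ)) ≡ 2ℤ * p * q - r * s
    lem = solve-∀ ring

monomial-polys : ℕ → List Poly
monomial-polys zero = []
monomial-polys (suc n) = iterate timesw n (1ℤ ∷ []) ∷ monomial-polys n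

κ-polys : ℕ → ℕ → List Poly
κ-polys j zero = []
κ-polys j (suc k) = κ-poly j k ∷ κ-polys (suc j) k

module SixVertex₀ = SixVertex (λ _ → 0ℤ)

module _ (e : ℕ) where
  private
    ε : ℤ
    ε = ι (2 ℕ.+ e)
    val : ℕ → ℤ
    val i = ε * ι i

  open Points val
  open Recursion val
  open SixVertex val

  val-congruent : ∀ i → val i ≡ 0ℤ [ ε ]
  val-congruent i = ι i , sym (+-identityˡ _)

  ε≢0 : ε ≢ 0ℤ
  ε≢0 z with ι-injective (trans z (sym ι-0))
  ... | ()

  val-separated : ∀ {i j} → i ≢ j → val i - val j ≢ 0ℤ
  val-separated {i} {j} ne z = ne (ι-injective (*-cancelˡ ε ε≢0 (trans (lem (val i) (val j)) (trans (cong (λ t → val j + t) z) (+-identityʳ _)))))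
    where
    opaque
      unfolding ℤ
      lem : ∀ a b → a ≡ b + (a - b)
      lem = solve-∀ ring

  1-val≢0 : ∀ i → 1ℤ - val i ≢ 0ℤ
  1-val≢0 i = unit-nonzero e (- ι i , lem ε (ι i))
    where
    opaque
      unfolding ℤ
      lem : ∀ e i → 1ℤ - e * i ≡ 1ℤ + e * - i
      lem = solve-∀ ring

  wa-val≢0 : ∀ i j → wa (val i) (val j) ≢ 0ℤ
  wa-val≢0 i j z = unit-nonzero {x = - wa (val i) (val j)} e (_ , lem ε (ι i) (ι j)) (trans (cong -_ z) -0≡0)
    where
    opaque
      unfolding ℤ
      lem : ∀ e i j → - (e * j - 1ℤ - (e * j + 1ℤ) * (e * i)) ≡ 1ℤ + e * (- j + (e * j + 1ℤ) * i)
      lem = solve-∀ ring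

  D-polys : ∀ Ps rows → D (map (λ P → eval P ∘ val) Ps) rows
    ≡ differences (map val rows) * D (map evaluated Ps) (dividedDifferences id (map val rows))
  D-polys Ps rows = trans (trans (cong (λ fs → D fs rows) (shape Ps)) (D-map val (map eval Ps) rows)) (D-newton Ps (map val rows))
    where
    shape : ∀ Ps → map (λ P → eval P ∘ val) Ps ≡ map (λ f → f ∘ val) (map eval Ps)
    shape [] = refl
    shape (P ∷ Ps) = cong (_ ∷_) (shape Ps)

  monomials-polys : ∀ n → monomials n ≋ map (λ P → eval P ∘ val) (monomial-polys n)
  monomials-polys zero = ≋-refl
  monomials-polys (suc n) = D-cons (λ x → sym (trans (eval-iterate timesw (λ w → w) eval-timesw n _ (val x))
    (trans (cong (val x ^ n *_) (eval-1 (val x))) (*-identityʳ _)))) (monomials-polys n)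

  κ-rows-polys : ∀ j k → κ-rows j k ≋ map (λ P → eval P ∘ val) (κ-polys j k)
  κ-rows-polys j zero = ≋-refl
  κ-rows-polys j (suc k) = D-cons (λ x → sym (eval-κ-poly j k (val x))) (κ-rows-polys (suc j) k)

  vertex-congruent : ∀ {w w′} → a w ≡ a w′ [ ε ] → b₁ w ≡ b₁ w′ [ ε ] → b₂ w ≡ b₂ w′ [ ε ] → c₁ w ≡ c₁ w′ [ ε ] →
    c₂ w ≡ c₂ w′ [ ε ] → ∀ i j {F G} → (∀ o o′ → F o o′ ≡ G o o′ [ ε ]) → vertex w i j F ≡ vertex w′ i j G [ ε ]
  vertex-congruent ea e₁ e₂ e₃ e₄ true true h = *-congruent ea (h _ _)
  vertex-congruent ea e₁ e₂ e₃ e₄ false false h = *-congruent ea (h _ _)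
  vertex-congruent ea e₁ e₂ e₃ e₄ true false h = +-congruent (*-congruent e₁ (h _ _)) (*-congruent e₃ (h _ _))
  vertex-congruent ea e₁ e₂ e₃ e₄ false true h = +-congruent (*-congruent e₂ (h _ _)) (*-congruent e₄ (h _ _))

  column-congruent : ∀ x rows {f g} → (∀ s → ap f s ≡ ap g s [ ε ]) →
    ∀ s → ap (act (column 1ℤ 0ℤ x rows) f) s ≡ ap (act (SixVertex₀.column 1ℤ 0ℤ x rows) g) s [ ε ]
  column-congruent x [] h s = h s
  column-congruent x (i ∷ rows) h s = vertex-congruent {rw (val i) 1ℤ 0ℤ} {rw 0ℤ 1ℤ 0ℤ}
    (_ , lem₁ ε (ι i)) (_ , lem₂ ε (ι i)) (_ , lem₃ ε (ι i)) (_ , lem₄ ε (ι i)) (≡⇒congruent refl) (s (hor i)) (s (ver x))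
    λ o o′ → column-congruent x rows h _
    where
    opaque
      unfolding ℤ
      lem₁ : ∀ e i → 1ℤ - 0ℤ - (1ℤ + 0ℤ) * (e * i) ≡ 1ℤ - 0ℤ - (1ℤ + 0ℤ) * 0ℤ + e * - i
      lem₁ = solve-∀ ring
      lem₂ : ∀ e i → 1ℤ - 0ℤ * (e * i) ≡ 1ℤ - 0ℤ * 0ℤ + e * 0ℤ
      lem₂ = solve-∀ ring
      lem₃ : ∀ e i → 2ℤ * (1ℤ - 0ℤ * (e * i)) ≡ 2ℤ * (1ℤ - 0ℤ * 0ℤ) + e * 0ℤ
      lem₃ = solve-∀ ring
      lem₄ : ∀ e i → 1ℤ + e * i * (e * i) ≡ 1ℤ + 0ℤ * 0ℤ + e * (i * (e * i))
      lem₄ = solve-∀ ring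

  grid-congruent : ∀ rows xs {f g} → (∀ s → ap f s ≡ ap g s [ ε ]) →
    ∀ s → ap (act (grid6 rows xs) f) s ≡ ap (act (SixVertex₀.grid6 rows xs) g) s [ ε ]
  grid-congruent rows [] h = h
  grid-congruent rows (x ∷ xs) h = column-congruent x rows (grid-congruent rows xs h)

  open SixVertexDeterminant val wa-val≢0 val-separated 1-val≢0

  homogeneous-congruent : ∀ n rows cols s → length rows ≡ n → length cols ≡ n → Unique rows → Unique cols →
    All (λ i → s (hor i) ≡ true) rows → All (λ x → s (ver x) ≡ false) cols →
    D (map coeff (monomial-polys n)) (range 0 n) * ap (act (SixVertex₀.grid6 rows cols) (SixVertex₀.finish rows cols)) s
      ≡ D (map coeff (κ-polys 0 n)) (range 0 n) [ ε ]
  homogeneous-congruent n rows cols s refl lc ur uc ir ic = congruent-trans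
    (*-congruent (congruent-sym (limit (monomial-polys n)))
      (congruent-sym (grid-congruent rows cols {finish rows cols} (λ s → ≡⇒congruent refl) s)))
    -- As soon as there are two rows, d is divisible by ε, so it has to be cancelled between
    -- integers before anything is reduced.
    (congruent-trans (≡⇒congruent (*-cancelˡ d (differences-nonzero val val-separated ur) eq))
      (congruent-trans (*-congruent (one rows) (limit (κ-polys 0 n))) (≡⇒congruent (*-identityˡ _))))
    where
    open ≡-Reasoning
    ws : List ℤ
    ws = map val rows
    d z : ℤ
    d = differences ws
    z = ap (act (grid6 rows cols) (finish rows cols)) s
    DD : List Poly → ℤ
    DD Ps = D (map evaluated Ps) (dividedDifferences id ws)
    all-val : ∀ rows → All (λ w → w ≡ 0ℤ [ ε ]) (map val rows)
    all-val [] = []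
    all-val (i ∷ rows) = val-congruent i ∷ all-val rows
    length-val : ∀ rows → length (map val rows) ≡ length rows
    length-val [] = refl
    length-val (_ ∷ rows) = cong suc (length-val rows)
    limit : ∀ Ps → DD Ps ≡ D (map coeff Ps) (range 0 n) [ ε ]
    limit Ps = congruent-trans (D-limit (all-val rows) Ps) (≡⇒congruent (cong (λ k → D (map coeff Ps) (range 0 k)) (length-val rows)))
    one : ∀ rows → ∏ rows (λ i → 1ℤ + val i * val i) ≡ 1ℤ [ ε ]
    one [] = ≡⇒congruent refl
    one (i ∷ rows) = congruent-trans (*-congruent {x = 1ℤ + val i * val i} {x′ = 1ℤ} (_ , lem ε (ι i)) (one rows))
      (≡⇒congruent (*-identityˡ 1ℤ))
      where
      opaque
        unfolding ℤ
        lem : ∀ e i → 1ℤ + e * i * (e * i) ≡ 1ℤ + e * (i * (e * i))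
        lem = solve-∀ ring
    opaque
      unfolding ℤ
      lem₁ : ∀ a b c → a * (b * c) ≡ a * b * c
      lem₁ = solve-∀ ring
    eq : d * (DD (monomial-polys n) * z) ≡ d * (∏ rows (λ i → 1ℤ + val i * val i) * DD (κ-polys 0 n))
    eq = begin
      d * (DD (monomial-polys n) * z)   ≡⟨ lem₁ d _ z ⟩
      d * DD (monomial-polys n) * z     ≡⟨ cong (_* z) (sym (trans (at (monomials-polys n) rows) (D-polys (monomial-polys n) rows))) ⟩
      V n rows * z                      ≡⟨ partition-determinant n rows cols s refl lc ur uc (start ir ic) ⟩
      p * E n rows                      ≡⟨ cong (p *_) (trans (at (κ-rows-polys 0 n) rows) (D-polys (κ-polys 0 n) rows)) ⟩
      p * (d * DD (κ-polys 0 n))        ≡⟨ *-exchange p d _ ⟩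
      d * (p * DD (κ-polys 0 n))        ∎
      where
      p : ℤ
      p = ∏ rows (λ i → 1ℤ + val i * val i)

-- The two congruent sides do not mention ε and are therefore equal. The determinant of the
-- monomials is only a sign, as their coefficients form a permutation matrix.
homogeneous : ∀ n rows cols s → length rows ≡ n → length cols ≡ n → Unique rows → Unique cols →
  All (λ i → s (hor i) ≡ true) rows → All (λ x → s (ver x) ≡ false) cols →
  D (map coeff (monomial-polys n)) (range 0 n) * ap (act (SixVertex₀.grid6 rows cols) (SixVertex₀.finish rows cols)) s
    ≡ D (map coeff (κ-polys 0 n)) (range 0 n)
homogeneous n rows cols s lr lc ur uc ir ic = congruent⇒≡ λ e → homogeneous-congruent e n rows cols s lr lc ur uc ir ic

-- Generating functions

Seq : Set
Seq = ℕ → ℤ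

infixl 6 _+ˢ_
_+ˢ_ : Seq → Seq → Seq
(f +ˢ g) j = f j + g j

infixl 7 _·ˢ_
_·ˢ_ : ℤ → Seq → Seq
(a ·ˢ f) j = a * f j

-- A sequence stands for a power series in w. These are the multiplications by w, 1 - w and 1 + w;
-- `δ k` is the series w^k.
shift Δ Σ⁺ : Seq → Seq
shift f zero = 0ℤ
shift f (suc j) = f j
Δ f j = f j - shift f j
Σ⁺ f j = f j + shift f j

δ : ℕ → Seq
δ zero zero = 1ℤ
δ zero (suc j) = 0ℤ
δ (suc k) zero = 0ℤ
δ (suc k) (suc j) = δ k j

-- The coefficients of ((1+w)/(1-w))^k.
c : ℕ → Seq
c zero = δ 0
c (suc k) zero = c k zero
c (suc k) (suc j) = c (suc k) j + c k (suc j) + c k j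

shift-cong : ∀ {f g} → f ≗ g → shift f ≗ shift g
shift-cong e zero = refl
shift-cong e (suc j) = e j

Δ-cong : ∀ {f g} → f ≗ g → Δ f ≗ Δ g
Δ-cong e j = cong₂ _-_ (e j) (shift-cong e j)

Δ-linear : ∀ f a g → Δ (f +ˢ a ·ˢ g) ≗ Δ f +ˢ a ·ˢ Δ g
Δ-linear f a g zero = lem (f 0) a (g 0)
  where
  opaque
    unfolding ℤ
    lem : ∀ x a y → x + a * y - 0ℤ ≡ x - 0ℤ + a * (y - 0ℤ)
    lem = solve-∀ ring
Δ-linear f a g (suc j) = lem (f (suc j)) a (g (suc j)) (f j) (g j)
  where
  opaque
    unfolding ℤ
    lem : ∀ x a y z u → x + a * y - (z + a * u) ≡ x - z + a * (y - u)
    lem = solve-∀ ring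

Δ^-cong : ∀ n {f g} → f ≗ g → iterate Δ n f ≗ iterate Δ n g
Δ^-cong zero e = e
Δ^-cong (suc n) e = Δ-cong (Δ^-cong n e)

Δ^-linear : ∀ n f a g → iterate Δ n (f +ˢ a ·ˢ g) ≗ iterate Δ n f +ˢ a ·ˢ iterate Δ n g
Δ^-linear zero f a g j = refl
Δ^-linear (suc n) f a g j = trans (Δ-cong (Δ^-linear n f a g) j) (Δ-linear (iterate Δ n f) a (iterate Δ n g) j)

iterate-suc : ∀ {A : Set} (f : A → A) n x → iterate f (suc n) x ≡ iterate f n (f x)
iterate-suc f zero x = refl
iterate-suc f (suc n) x = cong f (iterate-suc f n x)

iterate-+ : ∀ {A : Set} (f : A → A) m n x → iterate f (m ℕ.+ n) x ≡ iterate f m (iterate f n x)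
iterate-+ f zero n x = refl
iterate-+ f (suc m) n x = cong f (iterate-+ f m n x)

Σ⁺≗ : ∀ f → Σ⁺ f ≗ f +ˢ 1ℤ ·ˢ shift f
Σ⁺≗ f j = cong (λ t → f j + t) (sym (*-identityˡ _))

Δ-shift : ∀ f → Δ (shift f) ≗ shift (Δ f)
Δ-shift f zero = -‿inverseʳ 0ℤ
Δ-shift f (suc zero) = refl
Δ-shift f (suc (suc j)) = refl

Δ^-Σ⁺ : ∀ n f → iterate Δ n (Σ⁺ f) ≗ Σ⁺ (iterate Δ n f)
Δ^-Σ⁺ zero f j = refl
Δ^-Σ⁺ (suc n) f j = begin
  Δ (iterate Δ n (Σ⁺ f)) j                           ≡⟨ Δ-cong (Δ^-Σ⁺ n f) j ⟩
  Δ (Σ⁺ (iterate Δ n f)) j                           ≡⟨ Δ-cong (Σ⁺≗ (iterate Δ n f)) j ⟩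
  Δ (iterate Δ n f +ˢ 1ℤ ·ˢ shift (iterate Δ n f)) j ≡⟨ Δ-linear (iterate Δ n f) 1ℤ (shift (iterate Δ n f)) j ⟩
  (g +ˢ 1ℤ ·ˢ Δ (shift (iterate Δ n f))) j           ≡⟨ cong (λ t → g j + 1ℤ * t) (Δ-shift (iterate Δ n f) j) ⟩
  (g +ˢ 1ℤ ·ˢ shift g) j                             ≡⟨ sym (Σ⁺≗ g j) ⟩
  Σ⁺ g j                                             ∎
  where
  open ≡-Reasoning
  g : Seq
  g = iterate Δ (suc n) f

Δ-c : ∀ k → Δ (c (suc k)) ≗ Σ⁺ (c k)
Δ-c k zero = cong (λ t → c k 0 + t) -0≡0
Δ-c k (suc j) = lem (c (suc k) j) (c k (suc j)) (c k j)
  where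
  opaque
    unfolding ℤ
    lem : ∀ x y z → x + y + z - x ≡ y + z
    lem = solve-∀ ring

Δ^-c : ∀ k → iterate Δ k (c k) ≗ iterate Σ⁺ k (δ 0)
Δ^-c zero j = refl
Δ^-c (suc k) j = begin
  iterate Δ (suc k) (c (suc k)) j   ≡⟨ cong (λ f → f j) (iterate-suc Δ k (c (suc k))) ⟩
  iterate Δ k (Δ (c (suc k))) j     ≡⟨ Δ^-cong k (Δ-c k) j ⟩
  iterate Δ k (Σ⁺ (c k)) j          ≡⟨ Δ^-Σ⁺ k (c k) j ⟩
  Σ⁺ (iterate Δ k (c k)) j          ≡⟨ cong₂ _+_ (Δ^-c k j) (shift-cong (Δ^-c k) j) ⟩
  Σ⁺ (iterate Σ⁺ k (δ 0)) j         ∎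
  where open ≡-Reasoning

δ-suc : ∀ k → δ (suc k) ≗ shift (δ k)
δ-suc k zero = refl
δ-suc k (suc j) = refl

δ-iterate : ∀ k → δ k ≗ iterate shift k (δ 0)
δ-iterate zero j = refl
δ-iterate (suc k) j = trans (δ-suc k j) (shift-cong (δ-iterate k) j)

-- `T4-row k` is the row k of 1 + M. The differences h are introduced because they, rather than the
-- rows themselves, agree with the polynomials κ up to powers of 1 - w.
T4-row h : ℕ → Seq
T4-row k j = δ k j + c k (suc j)
h zero = δ 0
h (suc k) j = T4-row (suc k) j - T4-row k j

-- With r = (1+w)/(1-w), the generating function of `T4-row k` is w^k + (r^k - 1)/w. Since (r - 1)/w
-- = 2/(1-w), the difference of successive rows times 1 - w is 2 r^k - (1-w)² w^k.
Δ-h : ∀ k → Δ (h (suc k)) ≗ 2ℤ ·ˢ c k +ˢ - 1ℤ ·ˢ Δ (Δ (δ k))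
Δ-h k j = trans (Δ-cong split j) (trans (Δ-linear (c (suc k) +ˢ 1ℤ ·ˢ c k) (- 1ℤ) (Δ (δ k)) j)
  (cong (λ t → t + - 1ℤ * Δ (Δ (δ k)) j) (trans (Δ-linear (c (suc k)) 1ℤ (c k) j)
    (trans (cong (λ t → t + 1ℤ * Δ (c k) j) (Δ-c k j)) (lem₂ (c k j) _)))))
  where
  opaque
    unfolding ℤ
    lem : ∀ d x y z s → s + (x + y + z) - (d + y) ≡ x + 1ℤ * z + - 1ℤ * (d - s)
    lem = solve-∀ ring
    lem₂ : ∀ x y → x + y + 1ℤ * (x - y) ≡ 2ℤ * x
    lem₂ = solve-∀ ring
  split : h (suc k) ≗ c (suc k) +ˢ 1ℤ ·ˢ c k +ˢ - 1ℤ ·ˢ Δ (δ k)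
  split i = trans (cong (λ s → s + c (suc k) (suc i) - (δ k i + c k (suc i))) (δ-suc k i)) (lem (δ k i) (c (suc k) i) (c k (suc i)) (c k i) _)

coeff-1 : coeff (1ℤ ∷ []) ≗ δ 0
coeff-1 zero = refl
coeff-1 (suc j) = refl

coeff-timesw : ∀ P → coeff (timesw P) ≗ shift (coeff P)
coeff-timesw P zero = refl
coeff-timesw P (suc j) = refl

coeff-times1-w : ∀ P → coeff (times1-w P) ≗ Δ (coeff P)
coeff-times1-w P j = trans (coeff-⊕ P _ j) (trans (cong (λ t → coeff P j + t) (coeff-scale (- 1ℤ) (timesw P) j))
  (trans (cong (λ t → coeff P j + - 1ℤ * t) (coeff-timesw P j)) (lem (coeff P j) _)))
  where
  opaque
    unfolding ℤ
    lem : ∀ x y → x + - 1ℤ * y ≡ x - y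
    lem = solve-∀ ring

coeff-times1+w : ∀ P → coeff (times1+w P) ≗ Σ⁺ (coeff P)
coeff-times1+w P j = trans (coeff-⊕ P _ j) (cong (λ t → coeff P j + t) (coeff-timesw P j))

Σ⁺-cong : ∀ {f g} → f ≗ g → Σ⁺ f ≗ Σ⁺ g
Σ⁺-cong e j = cong₂ _+_ (e j) (shift-cong e j)

coeff-iterate : ∀ (F : Poly → Poly) (G : Seq → Seq) → (∀ P → coeff (F P) ≗ G (coeff P)) →
  (∀ {f g} → f ≗ g → G f ≗ G g) → ∀ n P {f} → coeff P ≗ f → coeff (iterate F n P) ≗ iterate G n f
coeff-iterate F G h cg zero P e = e
coeff-iterate F G h cg (suc n) P e j = trans (h (iterate F n P) j) (cg (coeff-iterate F G h cg n P e) j)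

Δ^-Σ⁺^ : ∀ n k f → iterate Δ n (iterate Σ⁺ k f) ≗ iterate Σ⁺ k (iterate Δ n f)
Δ^-Σ⁺^ n zero f j = refl
Δ^-Σ⁺^ n (suc k) f j = trans (Δ^-Σ⁺ n (iterate Σ⁺ k f) j) (Σ⁺-cong (Δ^-Σ⁺^ n k f) j)

-- As a power series κ j k is (1-w)^(j+k) h k. All rows of E have the same j + k, so this common
-- power of 1 - w can be removed from the determinant.
coeff-κ : ∀ j k m → j ℕ.+ k ≡ m → coeff (κ-poly j k) ≗ iterate Δ m (h k)
coeff-κ j zero m e i = trans (coeff-iterate times1-w Δ coeff-times1-w Δ-cong j _ coeff-1 i)
  (cong (λ n → iterate Δ n (δ 0) i) (trans (sym (ℕₚ.+-identityʳ j)) e))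
coeff-κ j (suc k) .(j ℕ.+ suc k) refl i = begin
  coeff (κ-poly j (suc k)) i
    ≡⟨ trans (coeff-⊕ (scale 2ℤ A) (scale (- 1ℤ) B) i) (cong₂ _+_ (coeff-scale 2ℤ A i) (coeff-scale (- 1ℤ) B i)) ⟩
  2ℤ * coeff A i + - 1ℤ * coeff B i
    ≡⟨ cong₂ (λ x y → 2ℤ * x + - 1ℤ * y)
         (coeff-iterate times1+w Σ⁺ coeff-times1+w Σ⁺-cong k _ (coeff-iterate times1-w Δ coeff-times1-w Δ-cong j _ coeff-1) i)
         (coeff-iterate times1-w Δ coeff-times1-w Δ-cong (2 ℕ.+ (j ℕ.+ k)) _
           (λ l → trans (coeff-iterate timesw shift coeff-timesw shift-cong k _ coeff-1 l) (sym (δ-iterate k l))) i) ⟩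
  2ℤ * iterate Σ⁺ k (iterate Δ j (δ 0)) i + - 1ℤ * iterate Δ (2 ℕ.+ (j ℕ.+ k)) (δ k) i
    ≡⟨ cong₂ (λ x y → 2ℤ * x + - 1ℤ * y)
         (trans (sym (Δ^-Σ⁺^ j k (δ 0) i)) (trans (sym (Δ^-cong j (Δ^-c k) i)) (cong (λ f → f i) (sym (iterate-+ Δ j k (c k))))))
         (cong (λ f → f i) (trans (cong Δ (iterate-suc Δ (j ℕ.+ k) (δ k))) (iterate-suc Δ (j ℕ.+ k) (Δ (δ k))))) ⟩
  2ℤ * iterate Δ (j ℕ.+ k) (c k) i + - 1ℤ * iterate Δ (j ℕ.+ k) (Δ (Δ (δ k))) i
    ≡⟨ cong (λ t → t + - 1ℤ * iterate Δ (j ℕ.+ k) (Δ (Δ (δ k))) i) (sym (scaled (j ℕ.+ k) (c k) i)) ⟩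
  (iterate Δ (j ℕ.+ k) (2ℤ ·ˢ c k) +ˢ - 1ℤ ·ˢ iterate Δ (j ℕ.+ k) (Δ (Δ (δ k)))) i
    ≡⟨ sym (Δ^-linear (j ℕ.+ k) (2ℤ ·ˢ c k) (- 1ℤ) (Δ (Δ (δ k))) i) ⟩
  iterate Δ (j ℕ.+ k) (2ℤ ·ˢ c k +ˢ - 1ℤ ·ˢ Δ (Δ (δ k))) i
    ≡⟨ sym (Δ^-cong (j ℕ.+ k) (Δ-h k) i) ⟩
  iterate Δ (j ℕ.+ k) (Δ (h (suc k))) i
    ≡⟨ cong (λ f → f i) (sym (iterate-suc Δ (j ℕ.+ k) (h (suc k)))) ⟩
  iterate Δ (suc (j ℕ.+ k)) (h (suc k)) i
    ≡⟨ cong (λ n → iterate Δ n (h (suc k)) i) (sym (ℕₚ.+-suc j k)) ⟩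
  iterate Δ (j ℕ.+ suc k) (h (suc k)) i ∎
  where
  open ≡-Reasoning
  A B : Poly
  A = iterate times1+w k (iterate times1-w j (1ℤ ∷ []))
  B = iterate times1-w (2 ℕ.+ (j ℕ.+ k)) (iterate timesw k (1ℤ ∷ []))
  scaled : ∀ n f → iterate Δ n (2ℤ ·ˢ f) ≗ 2ℤ ·ˢ iterate Δ n f
  scaled zero f j = refl
  scaled (suc n) f j = trans (Δ-cong (scaled n f) j) (go (iterate Δ n f) j)
    where
    opaque
      unfolding ℤ
      lem₁ : ∀ x → 2ℤ * x - 0ℤ ≡ 2ℤ * (x - 0ℤ)
      lem₁ = solve-∀ ring
      lem₂ : ∀ x y → 2ℤ * x - 2ℤ * y ≡ 2ℤ * (x - y)
      lem₂ = solve-∀ ring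
    go : ∀ f → Δ (2ℤ ·ˢ f) ≗ 2ℤ ·ˢ Δ f
    go f zero = lem₁ (f 0)
    go f (suc j) = lem₂ (f (suc j)) (f j)

-- Multiplying all rows by 1-w subtracts from each column its predecessor.
D-Δ : ∀ (fs : List Seq) n → D (map Δ fs) (range 0 n) ≡ D fs (range 0 n)
D-Δ fs n = trans (D-Δ-functional fs (range 0 n))
    (trans (go n) (trans (sym (D-map (λ j f → f j) (map entry fs) (range 0 n))) (cong (λ gs → D gs (range 0 n)) (sym (unmap fs)))))
  where
  entry : Seq → (Seq → ℤ) → ℤ
  entry f x = x f
  unmap : ∀ fs → fs ≡ map (λ g → g ∘ (λ j f → f j)) (map entry fs)
  unmap [] = refl
  unmap (f ∷ fs) = cong (f ∷_) (unmap fs)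
  unmapΔ : ∀ fs → map Δ fs ≡ map (λ g → g ∘ (λ j f → Δ f j)) (map entry fs)
  unmapΔ [] = refl
  unmapΔ (f ∷ fs) = cong (Δ f ∷_) (unmapΔ fs)
  D-Δ-functional : ∀ fs js → D (map Δ fs) js ≡ D (map entry fs) (map (λ j f → Δ f j) js)
  D-Δ-functional fs js = trans (cong (λ gs → D gs js) (unmapΔ fs)) (D-map (λ j f → Δ f j) (map entry fs) js)
  everywhere : ∀ {x y z : Seq → ℤ} {k} → (∀ f → x f ≡ y f + k * z f) → ∀ fs → All (λ g → g x ≡ g y + k * g z) (map entry fs)
  everywhere e [] = []
  everywhere e (f ∷ fs) = e f ∷ everywhere e fs
  opaque
    unfolding ℤ
    lem₀ : ∀ x → x - 0ℤ ≡ x + 0ℤ * x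
    lem₀ = solve-∀ ring
    lem₁ : ∀ x y → x - y ≡ x + - 1ℤ * y
    lem₁ = solve-∀ ring
    lem₂ : ∀ x → x + - 1ℤ * 0ℤ ≡ x
    lem₂ = solve-∀ ring
    lem₃ : ∀ x → x + 0ℤ * x ≡ x
    lem₃ = solve-∀ ring
  col : ℕ → Seq → ℤ
  col j f = f j
  colΔ : ℕ → Seq → ℤ
  colΔ j f = Δ f j
  step : ∀ {H : List (Seq → ℤ) → ℤ} → Alternating H →
    (∀ x y z k → (∀ f → x f ≡ y f + k * z f) → ColumnLinear x y z k H) → ∀ m n →
    H (col m ∷ map colΔ (range (suc m) n)) ≡ H (map col (range m (suc n)))
  step a l m zero = refl
  step {H} a l m (suc n) = begin
    H (col m ∷ colΔ (suc m) ∷ map colΔ (range (2 ℕ.+ m) n))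
      ≡⟨ l (colΔ (suc m)) (col (suc m)) (col m) (- 1ℤ) (λ f → lem₁ (f (suc m)) (f m)) (col m ∷ []) (map colΔ (range (2 ℕ.+ m) n)) ⟩
    H (col m ∷ col (suc m) ∷ map colΔ (range (2 ℕ.+ m) n)) + - 1ℤ * H (col m ∷ col m ∷ map colΔ (range (2 ℕ.+ m) n))
      ≡⟨ cong (λ t → H (col m ∷ col (suc m) ∷ map colΔ (range (2 ℕ.+ m) n)) + - 1ℤ * t)
           (x≡-x⇒x≡0 _ (a [] (col m) (col m) (map colΔ (range (2 ℕ.+ m) n)))) ⟩
    H (col m ∷ col (suc m) ∷ map colΔ (range (2 ℕ.+ m) n)) + - 1ℤ * 0ℤ
      ≡⟨ lem₂ _ ⟩
    H (col m ∷ col (suc m) ∷ map colΔ (range (2 ℕ.+ m) n))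
      ≡⟨ step {H ∘ (col m ∷_)} (λ pre → a (col m ∷ pre)) (λ x y z k e pre → l x y z k e (col m ∷ pre)) (suc m) n ⟩
    H (col m ∷ map col (range (suc m) (suc n))) ∎
    where open ≡-Reasoning
  go : ∀ n → D (map entry fs) (map colΔ (range 0 n)) ≡ D (map entry fs) (map col (range 0 n))
  go zero = refl
  go (suc n) = trans
    -- The columns `colΔ 0` and `col 0` agree; linearity with the factor 0 replaces one by the
    -- other.
    (D-column-linear (map entry fs) (colΔ 0) (col 0) (col 0) 0ℤ (everywhere (λ f → lem₀ (f 0)) fs) [] (map colΔ (range 1 n)))
    (trans (lem₃ _)
      (step {D (map entry fs)} (D-alternating (map entry fs)) (λ x y z k e → D-column-linear (map entry fs) x y z k (everywhere e fs)) 0 n))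

D-Δ^ : ∀ k (fs : List Seq) n → D (map (iterate Δ k) fs) (range 0 n) ≡ D fs (range 0 n)
D-Δ^ zero fs n = cong (λ gs → D gs (range 0 n)) (map-id fs)
D-Δ^ (suc k) fs n = trans (cong (λ gs → D gs (range 0 n)) (map-∘ fs)) (trans (D-Δ (map (iterate Δ k) fs) n) (D-Δ^ k fs n))

descending : (ℕ → Seq) → ℕ → List Seq
descending f zero = []
descending f (suc n) = f n ∷ descending f n

κ-rows-descending : ∀ n → D (map coeff (κ-polys 0 n)) (range 0 n) ≡ D (descending h n) (range 0 n)
κ-rows-descending zero = refl
κ-rows-descending (suc m) = trans (at (go 0 (suc m) refl) (range 0 (suc m))) (D-Δ^ m (descending h (suc m)) (suc m))
  where
  go : ∀ j k → j ℕ.+ k ≡ suc m → map coeff (κ-polys j k) ≋ map (iterate Δ m) (descending h k)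
  go j zero e = ≋-refl
  go j (suc k) e = D-cons (coeff-κ j k m (ℕₚ.suc-injective (trans (sym (ℕₚ.+-suc j k)) e))) (go (suc j) k (trans (sym (ℕₚ.+-suc j k)) e))

monomials-descending : ∀ n → map coeff (monomial-polys n) ≋ descending δ n
monomials-descending zero = ≋-refl
monomials-descending (suc n) = D-cons
  (λ j → trans (coeff-iterate timesw shift coeff-timesw shift-cong n _ coeff-1 j) (sym (δ-iterate n j)))
  (monomials-descending n)

-- Adding to each row the one below telescopes the differences. The last row fits because c 0
-- vanishes in positive degrees, so that h 0 equals `T4-row 0`.
h-rows : ∀ n → descending h n ≋ descending T4-row n
h-rows zero = ≋-refl
h-rows (suc zero) = D-cons first ≋-refl
  where
  first : δ 0 ≗ T4-row 0
  first j = sym (+-identityʳ _)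
h-rows (suc (suc n)) = ≋-trans
  (D-cons (λ j → lem (T4-row (suc n) j) (T4-row n j)) (h-rows (suc n)))
  (D-add-next (T4-row (suc n)) (T4-row n) (- 1ℤ) (descending T4-row n))
  where
  opaque
    unfolding ℤ
    lem : ∀ x y → x - y ≡ x + - 1ℤ * y
    lem = solve-∀ ring

ascending : (ℕ → Seq) → ℕ → ℕ → List Seq
ascending f m n = map f (range m n)

-- The sign of reversing n rows. The monomials and the rows of E are both listed with the highest
-- index first, so the sign enters twice and cancels.
reversal : ℕ → ℤ
reversal zero = 1ℤ
reversal (suc n) = sgn n * reversal n

reversal-square : ∀ n → reversal n * reversal n ≡ 1ℤ
reversal-square zero = *-identityˡ 1ℤ
reversal-square (suc n) = trans (lem (sgn n) (reversal n))
  (trans (cong₂ _*_ (sgn-square n) (reversal-square n)) (*-identityˡ 1ℤ))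
  where
  opaque
    unfolding ℤ
    lem : ∀ a b → a * b * (a * b) ≡ a * a * (b * b)
    lem = solve-∀ ring

D-descending : ∀ f n ws → D (descending f n) ws ≡ reversal n * D (ascending f 0 n) ws
D-descending f zero ws = sym (*-identityˡ _)
D-descending f (suc n) ws = begin
  D (f n ∷ descending f n) ws
    ≡⟨ ∑±-cong (λ w vs → trans (cong (f n w *_) (D-descending f n vs)) (*-exchange (f n w) (reversal n) _)) ws ⟩
  ∑± (λ w vs → reversal n * (f n w * D (ascending f 0 n) vs)) ws
    ≡⟨ ∑±-scale (λ w vs → f n w * D (ascending f 0 n) vs) (reversal n) ws ⟩
  reversal n * D (f n ∷ ascending f 0 n) ws
    ≡⟨ sym (trans (cong (λ t → sgn n * t * (sgn n * D (f n ∷ ascending f 0 n) ws)) refl)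
         (trans (lem₂ (sgn n) (reversal n) _) (trans (cong (_* (reversal n * D (f n ∷ ascending f 0 n) ws)) (sgn-square n)) (*-identityˡ _)))) ⟩
  sgn n * reversal n * (sgn n * D (f n ∷ ascending f 0 n) ws)
    ≡⟨ cong (sgn n * reversal n *_) (sym (trans (D-snoc (f n) (ascending f 0 n) ws)
         (cong (λ k → sgn k * D (f n ∷ ascending f 0 n) ws) (length-ascending 0 n)))) ⟩
  sgn n * reversal n * D (ascending f 0 n ++ f n ∷ []) ws
    ≡⟨ cong (λ gs → sgn n * reversal n * D gs ws) (ascending-snoc 0 n) ⟩
  sgn n * reversal n * D (ascending f 0 (suc n)) ws ∎
  where
  open ≡-Reasoning
  opaque
    unfolding ℤ
    lem₂ : ∀ a b c → a * b * (a * c) ≡ a * a * (b * c)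
    lem₂ = solve-∀ ring
  length-ascending : ∀ m n → length (ascending f m n) ≡ n
  length-ascending m zero = refl
  length-ascending m (suc n) = cong suc (length-ascending (suc m) n)
  ascending-snoc : ∀ m n → ascending f m n ++ f (m ℕ.+ n) ∷ [] ≡ ascending f m (suc n)
  ascending-snoc m zero = cong (λ k → f k ∷ []) (ℕₚ.+-identityʳ m)
  ascending-snoc m (suc n) = cong (f m ∷_) (trans (cong (λ k → ascending f (suc m) n ++ f k ∷ []) (ℕₚ.+-suc m n)) (ascending-snoc (suc m) n))

D-identity : ∀ m n → D (ascending δ m n) (range m n) ≡ 1ℤ
D-identity m zero = refl
D-identity m (suc n) = begin
  δ m m * D (ascending δ (suc m) n) (range (suc m) n) - ∑± (λ j us → δ m j * D (ascending δ (suc m) n) (m ∷ us)) (range (suc m) n)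
    ≡⟨ cong₂ (λ x y → x * D (ascending δ (suc m) n) (range (suc m) n) - y) (δ-same m)
         (trans (∑±-cong-pick (range (suc m) n) (λ j us p → trans (cong (_* D (ascending δ (suc m) n) (m ∷ us))
           (δ-other (range-> (suc m) n (pick-∈ p)))) (zeroˡ _))) (∑±-zero (λ _ _ → refl) (range (suc m) n))) ⟩
  1ℤ * D (ascending δ (suc m) n) (range (suc m) n) - 0ℤ
    ≡⟨ cong (λ t → 1ℤ * t - 0ℤ) (D-identity (suc m) n) ⟩
  1ℤ * 1ℤ - 0ℤ
    ≡⟨ lem ⟩
  1ℤ ∎
  where
  open ≡-Reasoning
  opaque
    unfolding ℤ
    lem : 1ℤ * 1ℤ - 0ℤ ≡ 1ℤ
    lem = refl
  δ-same : ∀ m → δ m m ≡ 1ℤ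
  δ-same zero = refl
  δ-same (suc m) = δ-same m
  δ-other : ∀ {m j} → m ℕ.< j → δ m j ≡ 0ℤ
  δ-other {zero} {suc j} _ = refl
  δ-other {suc m} {suc j} (s≤s p) = δ-other p
  range-> : ∀ m n {j} → j ∈ range m n → m ℕ.≤ j
  range-> m (suc n) (here refl) = ℕₚ.≤-refl
  range-> m (suc n) (there p) = ℕₚ.≤-trans (ℕₚ.n≤1+n m) (range-> (suc m) n p)

six-vertex-determinant : ∀ n rows cols s → length rows ≡ n → length cols ≡ n → Unique rows → Unique cols →
  All (λ i → s (hor i) ≡ true) rows → All (λ x → s (ver x) ≡ false) cols →
  ap (act (SixVertex₀.grid6 rows cols) (SixVertex₀.finish rows cols)) s ≡ D (ascending T4-row 0 n) (range 0 n)
six-vertex-determinant n rows cols s lr lc ur uc ir ic = begin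
  z                                       ≡⟨ sym (*-identityˡ z) ⟩
  1ℤ * z                                  ≡⟨ cong (_* z) (sym (reversal-square n)) ⟩
  reversal n * reversal n * z             ≡⟨ *-assoc (reversal n) (reversal n) z ⟩
  reversal n * (reversal n * z)
    ≡⟨ cong (λ t → reversal n * (t * z)) (sym (trans (trans (at (monomials-descending n) (range 0 n)) (D-descending δ n (range 0 n)))
         (trans (cong (reversal n *_) (D-identity 0 n)) (*-identityʳ _)))) ⟩
  reversal n * (D (map coeff (monomial-polys n)) (range 0 n) * z)
    ≡⟨ cong (reversal n *_) (homogeneous n rows cols s lr lc ur uc ir ic) ⟩
  reversal n * D (map coeff (κ-polys 0 n)) (range 0 n)
    ≡⟨ cong (reversal n *_) (trans (κ-rows-descending n) (trans (at (h-rows n) (range 0 n)) (D-descending T4-row n (range 0 n)))) ⟩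
  reversal n * (reversal n * d)           ≡⟨ sym (*-assoc (reversal n) (reversal n) d) ⟩
  reversal n * reversal n * d             ≡⟨ cong (_* d) (reversal-square n) ⟩
  1ℤ * d                                  ≡⟨ *-identityˡ d ⟩
  d                                       ∎
  where
  open ≡-Reasoning
  z d : ℤ
  z = ap (act (SixVertex₀.grid6 rows cols) (SixVertex₀.finish rows cols)) s
  d = D (ascending T4-row 0 n) (range 0 n)

-- Families of disjoint paths

sumL : {A : Set} → List A → (A → ℤ) → ℤ
sumL [] f = 0ℤ
sumL (x ∷ xs) f = f x + sumL xs f

module _ {A : Set} where

  sumL-cong : ∀ {f g : A → ℤ} xs → (∀ x → x ∈ xs → f x ≡ g x) → sumL xs f ≡ sumL xs g
  sumL-cong [] e = refl
  sumL-cong (x ∷ xs) e = cong₂ _+_ (e x (here refl)) (sumL-cong xs (λ y m → e y (there m)))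

  sumL-++ : ∀ (xs ys : List A) f → sumL (xs ++ ys) f ≡ sumL xs f + sumL ys f
  sumL-++ [] ys f = sym (+-identityˡ _)
  sumL-++ (x ∷ xs) ys f = trans (cong (λ t → f x + t) (sumL-++ xs ys f)) (sym (+-assoc _ _ _))

  sumL-zero : ∀ {f : A → ℤ} xs → (∀ x → x ∈ xs → f x ≡ 0ℤ) → sumL xs f ≡ 0ℤ
  sumL-zero [] e = refl
  sumL-zero (x ∷ xs) e = trans (cong₂ _+_ (e x (here refl)) (sumL-zero xs (λ y m → e y (there m)))) (+-identityˡ 0ℤ)

  sumL-+ : ∀ (f g : A → ℤ) xs → sumL xs (λ x → f x + g x) ≡ sumL xs f + sumL xs g
  sumL-+ f g [] = sym (+-identityˡ 0ℤ)
  sumL-+ f g (x ∷ xs) = trans (cong (λ t → f x + g x + t) (sumL-+ f g xs)) (lem (f x) (g x) _ _)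
    where
    opaque
      unfolding ℤ
      lem : ∀ a b c d → a + b + (c + d) ≡ a + c + (b + d)
      lem = solve-∀ ring

  sumL-* : ∀ k (f : A → ℤ) xs → sumL xs (λ x → k * f x) ≡ k * sumL xs f
  sumL-* k f [] = sym (zeroʳ k)
  sumL-* k f (x ∷ xs) = trans (cong (λ t → k * f x + t) (sumL-* k f xs)) (sym (distribˡ k _ _))

sumL-map : ∀ {A B : Set} (φ : A → B) xs f → sumL (map φ xs) f ≡ sumL xs (f ∘ φ)
sumL-map φ [] f = refl
sumL-map φ (x ∷ xs) f = cong (λ t → f (φ x) + t) (sumL-map φ xs f)

sumL-concatMap : ∀ {A B : Set} (φ : A → List B) xs f → sumL (concatMap φ xs) f ≡ sumL xs (λ x → sumL (φ x) f)
sumL-concatMap φ [] f = refl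
sumL-concatMap φ (x ∷ xs) f = trans (sumL-++ (φ x) (concatMap φ xs) f) (cong (λ t → sumL (φ x) f + t) (sumL-concatMap φ xs f))

sumL-swap : ∀ {A B : Set} xs ys (f : A → B → ℤ) → sumL xs (λ x → sumL ys (f x)) ≡ sumL ys (λ y → sumL xs (λ x → f x y))
sumL-swap [] ys f = sym (sumL-zero ys (λ _ _ → refl))
sumL-swap (x ∷ xs) ys f = trans (cong (λ t → sumL ys (f x) + t) (sumL-swap xs ys f)) (sym (sumL-+ (f x) _ ys))

Path : Set
Path = List Point

bool-≡ : ∀ {b b′} → (b ≡ true → b′ ≡ true) → (b′ ≡ true → b ≡ true) → b ≡ b′
bool-≡ {true} {b′} f g = sym (f refl)
bool-≡ {false} {true} f g = g refl
bool-≡ {false} {false} f g = refl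

∧-true : ∀ {a b} → a ∧ b ≡ true → a ≡ true × b ≡ true
∧-true {true} {true} e = refl , refl

all-true : ∀ {A : Set} {p : A → Bool} xs → all p xs ≡ true → ∀ x → x ∈ xs → p x ≡ true
all-true (x ∷ xs) e .x (here refl) = proj₁ (∧-true e)
all-true {p = p} (x ∷ xs) e y (there m) = all-true xs (proj₂ (∧-true {p x} e)) y m

true-all : ∀ {A : Set} {p : A → Bool} xs → (∀ x → x ∈ xs → p x ≡ true) → all p xs ≡ true
true-all [] h = refl
true-all (x ∷ xs) h = cong₂ _∧_ (h x (here refl)) (true-all xs (λ y m → h y (there m)))

any-false : ∀ {A : Set} {p : A → Bool} xs → any p xs ≡ false → ∀ x → x ∈ xs → p x ≡ false
any-false {p = p} (x ∷ xs) e y m with p x in eq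
any-false (x ∷ xs) e .x (here refl) | false = eq
any-false (x ∷ xs) e y (there m) | false = any-false xs e y m

false-any : ∀ {A : Set} {p : A → Bool} xs → (∀ x → x ∈ xs → p x ≡ false) → any p xs ≡ false
false-any [] h = refl
false-any (x ∷ xs) h = cong₂ _∨_ (h x (here refl)) (false-any xs (λ y m → h y (there m)))

not-true : ∀ {b} → not b ≡ true → b ≡ false
not-true {false} e = refl

==-true : ∀ u v → (u == v) ≡ true → u ≡ v
==-true (a , b) (c , d) e = cong₂ _,_ (≡ᵇ-true a c (proj₁ (∧-true e))) (≡ᵇ-true b d (proj₂ (∧-true {a ℕ.≡ᵇ c} e)))

==-refl : ∀ u → (u == u) ≡ true
==-refl (a , b) = cong₂ _∧_ (≡ᵇ-refl a) (≡ᵇ-refl b)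

==-false : ∀ u v → u ≢ v → (u == v) ≡ false
==-false u v ne with u == v in e
... | true = ⊥-elim (ne (==-true u v e))
... | false = refl

Disjoint : Path → Path → Set
Disjoint p q = ∀ u → u ∈ p → u ∈ q → ⊥

noCommon-disjoint : ∀ p q → noCommon p q ≡ true → Disjoint p q
noCommon-disjoint p q e u m m′
  with trans (sym (any-false q (not-true (all-true p e u m)) u m′)) (==-refl u)
... | ()

disjoint-noCommon : ∀ p q → Disjoint p q → noCommon p q ≡ true
disjoint-noCommon p q d = true-all p λ u m → cong not (false-any q λ v m′ → ==-false u v λ { refl → d u m m′ })

noCommon-sym : ∀ p q → noCommon p q ≡ noCommon q p
noCommon-sym p q = bool-≡
  (λ e → disjoint-noCommon q p λ u m m′ → noCommon-disjoint p q e u m′ m)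
  (λ e → disjoint-noCommon p q λ u m m′ → noCommon-disjoint q p e u m′ m)

-- The number of disjoint families with one path from each set, each path weighted by u.
families± : (Path → ℤ) → List (List Path) → ℤ
families± u [] = 1ℤ
families± u (A ∷ As) = sumL A λ p → u p * families± (λ q → u q * ⟦ noCommon p q ⟧) As

families-cong : ∀ {u u′} As → (∀ A → A ∈ As → ∀ p → p ∈ A → u p ≡ u′ p) → families± u As ≡ families± u′ As
families-cong [] e = refl
families-cong (A ∷ As) e = sumL-cong A λ p m → cong₂ _*_ (e A (here refl) p m)
  (families-cong As λ B mB q mq → cong (_* ⟦ noCommon p q ⟧) (e B (there mB) q mq))

-- The sums over p and q are exchanged; disjointness is symmetric, and the later paths have to avoid
-- both p and q in either order.
families-swap : ∀ u A B Cs → families± u (A ∷ B ∷ Cs) ≡ families± u (B ∷ A ∷ Cs)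
families-swap u A B Cs = begin
  sumL A (λ p → u p * sumL B (λ q → u q * ⟦ noCommon p q ⟧ * rest p q))
    ≡⟨ sumL-cong A (λ p _ → sym (sumL-* (u p) _ B)) ⟩
  sumL A (λ p → sumL B (λ q → u p * (u q * ⟦ noCommon p q ⟧ * rest p q)))
    ≡⟨ sumL-swap A B _ ⟩
  sumL B (λ q → sumL A (λ p → u p * (u q * ⟦ noCommon p q ⟧ * rest p q)))
    ≡⟨ sumL-cong B (λ q _ → sumL-cong A (λ p _ → trans
         (cong₂ (λ b r → u p * (u q * ⟦ b ⟧ * r)) (noCommon-sym p q)
           (families-cong Cs λ _ _ r _ → lem (u r) ⟦ noCommon p r ⟧ ⟦ noCommon q r ⟧))
         (lem₂ (u p) (u q) _ _))) ⟩
  sumL B (λ q → sumL A (λ p → u q * (u p * ⟦ noCommon q p ⟧ * rest q p)))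
    ≡⟨ sumL-cong B (λ q _ → sumL-* (u q) _ A) ⟩
  sumL B (λ q → u q * sumL A (λ p → u p * ⟦ noCommon q p ⟧ * rest q p)) ∎
  where
  open ≡-Reasoning
  rest : Path → Path → ℤ
  rest p q = families± (λ r → u r * ⟦ noCommon p r ⟧ * ⟦ noCommon q r ⟧) Cs
  opaque
    unfolding ℤ
    lem : ∀ a b c → a * b * c ≡ a * c * b
    lem = solve-∀ ring
    lem₂ : ∀ a b c d → a * (b * c * d) ≡ b * (a * c * d)
    lem₂ = solve-∀ ring

infixr 5 _⟫_
-- A list with a cursor: xs is the part before the cursor, nearest element first.
_⟫_ : {A : Set} → List A → List A → List A
[] ⟫ ys = ys
(x ∷ xs) ⟫ ys = xs ⟫ (x ∷ ys)

map-⟫ : ∀ {A B : Set} (f : A → B) xs ys → map f (xs ⟫ ys) ≡ map f xs ⟫ map f ys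
map-⟫ f [] ys = refl
map-⟫ f (x ∷ xs) ys = map-⟫ f xs (x ∷ ys)

-- Paths chosen from the sets in front only change the weight of the later ones, so an identity that
-- holds for every weight u survives behind them.
families-prefix : ∀ {As As′} Ls → (∀ u → families± u As ≡ families± u As′) → ∀ u → families± u (Ls ⟫ As) ≡ families± u (Ls ⟫ As′)
families-prefix [] e = e
families-prefix (L ∷ Ls) e = families-prefix Ls λ u → sumL-cong L λ p _ → cong (u p *_) (e _)

families-front : ∀ Ls A Rs u → families± u (Ls ⟫ (A ∷ Rs)) ≡ families± u (A ∷ (Ls ⟫ Rs))
families-front [] A Rs u = refl
families-front (L ∷ Ls) A Rs u = trans (families-prefix Ls (λ u → families-swap u L A Rs) u) (families-front Ls A (L ∷ Rs) u)

families-zero : ∀ {As} Ls → (∀ u → families± u As ≡ 0ℤ) → ∀ u → families± u (Ls ⟫ As) ≡ 0ℤ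
families-zero [] e = e
families-zero (L ∷ Ls) e = families-zero Ls λ u → sumL-zero L λ p _ → trans (cong (u p *_) (e _)) (zeroʳ (u p))

families-meet : ∀ {v} A B Rs → (∀ p → p ∈ A → v ∈ p) → (∀ q → q ∈ B → v ∈ q) → ∀ u → families± u (A ∷ B ∷ Rs) ≡ 0ℤ
families-meet {v} A B Rs hA hB u = sumL-zero A λ p m → trans (cong (u p *_) (sumL-zero B λ q m′ →
    trans (cong (λ b → u q * ⟦ b ⟧ * families± (λ r → u r * ⟦ noCommon p r ⟧ * ⟦ noCommon q r ⟧) Rs) (meets p q (hA p m) (hB q m′))) (lem (u q) _))) (zeroʳ (u p))
  where
  opaque
    unfolding ℤ
    lem : ∀ a b → a * 0ℤ * b ≡ 0ℤ
    lem = solve-∀ ring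
  meets : ∀ p q → v ∈ p → v ∈ q → noCommon p q ≡ false
  meets p q m m′ with noCommon p q in e
  ... | true = ⊥-elim (noCommon-disjoint p q e v m m′)
  ... | false = refl

one : Path → ℤ
one _ = 1ℤ

-- No other path contains v, so prefixing it creates no new intersection.
families-extend : ∀ v A Bs → (∀ B → B ∈ Bs → ∀ q → q ∈ B → v ∉ q) → families± one (map (v ∷_) A ∷ Bs) ≡ families± one (A ∷ Bs)
families-extend v A Bs h = trans (sumL-map (v ∷_) A _) (sumL-cong A λ p _ → cong (1ℤ *_)
  (families-cong Bs λ B mB q mq → cong (λ b → 1ℤ * ⟦ b ⟧) (extend p q (h B mB q mq))))
  where
  extend : ∀ p q → v ∉ q → noCommon (v ∷ p) q ≡ noCommon p q
  extend p q v∉ = cong (_∧ noCommon p q) (cong not (false-any q λ w m → ==-false v w λ { refl → v∉ m }))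

families-union : ∀ A A′ Bs → families± one ((A ++ A′) ∷ Bs) ≡ families± one (A ∷ Bs) + families± one (A′ ∷ Bs)
families-union A A′ Bs = sumL-++ A A′ _

-- The paths from (x , y) to (0 , y + d).
walks : ℕ → ℕ → ℕ → List Path
walks zero y zero = ((0 , y) ∷ []) ∷ []
-- From x = 0 only vertical steps could follow, and the last step must not be vertical.
walks zero y (suc d) = []
walks (suc x) y zero = map ((suc x , y) ∷_) (walks x y zero)
walks (suc x) y (suc d) = map ((suc x , y) ∷_) (walks x y (suc d) ++ walks (suc x) (suc y) d ++ walks x (suc y) d)

-- A region that contains every point a walk from (x , y) can visit: the higher levels, and its own
-- level up to x.
After : ℕ → ℕ → Point → Set
After x y (u , v) = y ℕ.< v ⊎ (v ≡ y × u ℕ.≤ x)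

after-step : ∀ {x y v} → After x y v → After (suc x) y v
after-step (inj₁ l) = inj₁ l
after-step (inj₂ (e , l)) = inj₂ (e , ℕₚ.m≤n⇒m≤1+n l)

after-up : ∀ {x y x′ v} → After x (suc y) v → After x′ y v
after-up (inj₁ l) = inj₁ (ℕₚ.<-trans (ℕₚ.n<1+n _) l)
after-up (inj₂ (refl , _)) = inj₁ (ℕₚ.n<1+n _)

∈-map-cons : ∀ {v : Point} {A p} → p ∈ map (v ∷_) A → Σ Path λ p′ → p ≡ v ∷ p′ × p′ ∈ A
∈-map-cons {A = q ∷ A} (here refl) = q , refl , here refl
∈-map-cons {A = q ∷ A} (there m) with ∈-map-cons {A = A} m
... | p′ , e , m′ = p′ , e , there m′

walks-after : ∀ x y d p → p ∈ walks x y d → ∀ v → v ∈ p → After x y v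
walks-after zero y zero p (here refl) v (here refl) = inj₂ (refl , z≤n)
walks-after (suc x) y zero p m v mv with ∈-map-cons m
walks-after (suc x) y zero p m v (here refl) | p′ , refl , m′ = inj₂ (refl , ℕₚ.≤-refl)
walks-after (suc x) y zero p m v (there mv) | p′ , refl , m′ = after-step (walks-after x y zero p′ m′ v mv)
walks-after (suc x) y (suc d) p m v mv with ∈-map-cons m
walks-after (suc x) y (suc d) p m v (here refl) | p′ , refl , m′ = inj₂ (refl , ℕₚ.≤-refl)
walks-after (suc x) y (suc d) p m v (there mv) | p′ , refl , m′ with ∈-++⁻ (walks x y (suc d)) m′
... | inj₁ m₁ = after-step (walks-after x y (suc d) p′ m₁ v mv)
... | inj₂ m₂ with ∈-++⁻ (walks (suc x) (suc y) d) m₂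
...   | inj₁ m₃ = after-up (walks-after (suc x) (suc y) d p′ m₃ v mv)
...   | inj₂ m₄ = after-up (walks-after x (suc y) d p′ m₄ v mv)

walks-start : ∀ x y d p → p ∈ walks x y d → (x , y) ∈ p
walks-start zero y zero p (here refl) = here refl
walks-start (suc x) y zero p m with ∈-map-cons m
... | _ , refl , _ = here refl
walks-start (suc x) y (suc d) p m with ∈-map-cons m
... | _ , refl , _ = here refl

-- F x y t is c x (t - y) for t at least y and 0 otherwise, the number of walks from (x , y) to (0 ,
-- t). Without a subtraction, `F-step` holds for all t.
F : ℕ → ℕ → Seq
F x zero t = c x t
F x (suc y) zero = 0ℤ
F x (suc y) (suc t) = F x y t

F-step : ∀ x y t → F (suc x) y t ≡ F x y t + (F (suc x) (suc y) t + F x (suc y) t)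
F-step x zero zero = sym (trans (cong (λ s → c x 0 + s) (+-identityʳ 0ℤ)) (+-identityʳ _))
F-step x zero (suc t) = lem _ _ _
  where
  opaque
    unfolding ℤ
    lem : ∀ a b d → a + b + d ≡ b + (a + d)
    lem = solve-∀ ring
F-step x (suc y) zero = sym (trans (+-identityˡ _) (+-identityˡ 0ℤ))
F-step x (suc y) (suc t) = F-step x y t

F-below : ∀ x y t → t ℕ.< y → F x y t ≡ 0ℤ
F-below x (suc y) zero l = refl
F-below x (suc y) (suc t) (s≤s l) = F-below x y t l

F-end : ∀ y → F 0 y y ≡ 1ℤ
F-end zero = refl
F-end (suc y) = F-end y

F-above : ∀ y t → y ℕ.< t → F 0 y t ≡ 0ℤ
F-above zero (suc t) l = refl
F-above (suc y) (suc t) (s≤s l) = F-above y t l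

D-prefix-zero : ∀ {fs : List Seq} Ls → (∀ ws → D fs ws ≡ 0ℤ) → ∀ ws → D (Ls ⟫ fs) ws ≡ 0ℤ
D-prefix-zero [] e = e
D-prefix-zero {fs} (L ∷ Ls) e = D-prefix-zero Ls (D-zero-tail L fs e)

D-step : ∀ x y (fs : List Seq) ws →
  D (F (suc x) y ∷ fs) ws ≡ D (F x y ∷ fs) ws + (D (F (suc x) (suc y) ∷ fs) ws + D (F x (suc y) ∷ fs) ws)
D-step x y fs ws = begin
  D (F (suc x) y ∷ fs) ws
    ≡⟨ ∑±-cong (λ w vs → trans (cong (_* D fs vs) (F-step x y w)) (lem _ _ _ _)) ws ⟩
  ∑± (λ w vs → F x y w * D fs vs + 1ℤ * (F (suc x) (suc y) w * D fs vs + 1ℤ * (F x (suc y) w * D fs vs))) ws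
    ≡⟨ ∑±-linear _ _ 1ℤ ws ⟩
  D (F x y ∷ fs) ws + 1ℤ * ∑± (λ w vs → F (suc x) (suc y) w * D fs vs + 1ℤ * (F x (suc y) w * D fs vs)) ws
    ≡⟨ cong (λ t → D (F x y ∷ fs) ws + t) (trans (*-identityˡ _) (trans (∑±-linear _ _ 1ℤ ws)
         (cong (λ t → D (F (suc x) (suc y) ∷ fs) ws + t) (*-identityˡ _)))) ⟩
  _ ∎
  where
  open ≡-Reasoning
  opaque
    unfolding ℤ
    lem : ∀ a b d e → (a + (b + d)) * e ≡ a * e + 1ℤ * (b * e + 1ℤ * (d * e))
    lem = solve-∀ ring

D-zero-column : ∀ (fs : List Seq) f t ts → All (λ g → g t ≡ 0ℤ) (f ∷ fs) → D (f ∷ fs) (t ∷ ts) ≡ 0ℤ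
D-zero-column fs f t ts (e ∷ es) = trans
  (cong₂ _-_ (trans (cong (_* D fs ts) e) (zeroˡ _)) (rest fs es ts)) (-‿inverseʳ 0ℤ)
  where
  rest : ∀ fs → All (λ g → g t ≡ 0ℤ) fs → ∀ ts → ∑± (λ v vs → f v * D fs (t ∷ vs)) ts ≡ 0ℤ
  rest [] [] ts = ∑±-zero (λ v vs → zeroʳ (f v)) ts
  rest (g ∷ fs) es ts = ∑±-zero (λ v vs → trans (cong (f v *_) (D-zero-column fs g t vs es)) (zeroʳ (f v))) ts

-- The Lindström-Gessel-Viennot determinant

∈-⟫ : ∀ {A : Set} {b : A} xs ys → b ∈ xs ⟫ ys → b ∈ xs ⊎ b ∈ ys
∈-⟫ [] ys m = inj₂ m
∈-⟫ (x ∷ xs) ys m with ∈-⟫ xs (x ∷ ys) m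
... | inj₁ m′ = inj₁ (there m′)
... | inj₂ (here e) = inj₁ (here e)
... | inj₂ (there m′) = inj₂ m′

-- (x , y , d) is a path head at (x , y) whose path ends at (0 , y + d).
Head : Set
Head = ℕ × ℕ × ℕ

walksOf : Head → List Path
walksOf (x , y , d) = walks x y d

rowOf : Head → Seq
rowOf (x , y , d) = F x y

target level size : Head → ℕ
target (x , y , d) = y ℕ.+ d
level (x , y , d) = y
size (x , y , d) = suc (x ℕ.+ d)

μ : List Head → ℕ
μ [] = 0
μ (h ∷ hs) = size h ℕ.+ μ hs

μ-⟫ : ∀ ls rs → μ (ls ⟫ rs) ≡ μ ls ℕ.+ μ rs
μ-⟫ [] rs = refl
μ-⟫ (l ∷ ls) rs = trans (μ-⟫ ls (l ∷ rs)) (trans (sym (ℕₚ.+-assoc (μ ls) (size l) (μ rs))) (cong (ℕ._+ μ rs) (ℕₚ.+-comm (μ ls) (size l))))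

μ-decrease : ∀ {n} ls P P′ rs → size P′ ℕ.< size P → μ (ls ⟫ (P ∷ rs)) ℕ.≤ suc n → μ (ls ⟫ (P′ ∷ rs)) ℕ.≤ n
μ-decrease ls P P′ rs l b = ℕₚ.≤-pred (ℕₚ.≤-trans
  (subst₂ ℕ._<_ (sym (μ-⟫ ls (P′ ∷ rs))) (sym (μ-⟫ ls (P ∷ rs))) (ℕₚ.+-monoʳ-< (μ ls) (ℕₚ.+-monoˡ-< (μ rs) l))) b)

-- ⊏ orders the heads after the cursor: farther right on the same level, or on a higher level and
-- not farther left, and with a higher target. ▹ describes those before the cursor: all on the level
-- of the current head and to its left, with lower targets.
_⊏_ _▹_ : Head → Head → Set
P ⊏ P′ = ((level P ≡ level P′ × proj₁ P ℕ.< proj₁ P′) ⊎ (level P ℕ.< level P′ × proj₁ P ℕ.≤ proj₁ P′)) × target P ℕ.< target P′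
P ▹ P′ = level P ≡ level P′ × proj₁ P′ ℕ.< proj₁ P × target P′ ℕ.< target P

⊏-trans : ∀ {P Q R} → P ⊏ Q → Q ⊏ R → P ⊏ R
⊏-trans (inj₁ (refl , l) , t) (inj₁ (refl , l′) , t′) = inj₁ (refl , ℕₚ.<-trans l l′) , ℕₚ.<-trans t t′
⊏-trans (inj₁ (refl , l) , t) (inj₂ (m , l′) , t′) = inj₂ (m , ℕₚ.<⇒≤ (ℕₚ.<-≤-trans l l′)) , ℕₚ.<-trans t t′
⊏-trans (inj₂ (m , l) , t) (inj₁ (refl , l′) , t′) = inj₂ (m , ℕₚ.<⇒≤ (ℕₚ.≤-<-trans l l′)) , ℕₚ.<-trans t t′
⊏-trans (inj₂ (m , l) , t) (inj₂ (m′ , l′) , t′) = inj₂ (ℕₚ.<-trans m m′ , ℕₚ.≤-trans l l′) , ℕₚ.<-trans t t′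

▹-trans : ∀ {P Q R} → P ▹ Q → Q ▹ R → P ▹ R
▹-trans (refl , l , t) (refl , l′ , t′) = refl , ℕₚ.<-trans l′ l , ℕₚ.<-trans t′ t

⊏-cons : ∀ {P Q rs} → P ⊏ Q → AllPairs _⊏_ (Q ∷ rs) → AllPairs _⊏_ (P ∷ Q ∷ rs)
⊏-cons {P} {Q} p (q ∷ qs) = (p ∷ All.map (λ {R} r → ⊏-trans {P} {Q} {R} p r) q) ∷ q ∷ qs

▹-cons : ∀ {P Q rs} → P ▹ Q → AllPairs _▹_ (Q ∷ rs) → AllPairs _▹_ (P ∷ Q ∷ rs)
▹-cons {P} {Q} p (q ∷ qs) = (p ∷ All.map (λ {R} r → ▹-trans {P} {Q} {R} p r) q) ∷ q ∷ qs

LGV : List Head → List ℕ → Set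
LGV hs ts = families± one (map walksOf hs) ≡ D (map rowOf hs) ts

targets-⟫ : ∀ {P P′} ls rs → target P ≡ target P′ → map target (ls ⟫ (P ∷ rs)) ≡ map target (ls ⟫ (P′ ∷ rs))
targets-⟫ {P} {P′} ls rs e = trans (map-⟫ target ls (P ∷ rs))
  (trans (cong (λ t → map target ls ⟫ (t ∷ map target rs)) e) (sym (map-⟫ target ls (P′ ∷ rs))))

module _ (ls rs : List Head) where
  S-at : List Path → ℤ
  S-at A = families± one (map walksOf ls ⟫ (A ∷ map walksOf rs))

  D-at : Seq → List ℕ → ℤ
  D-at f ts = D (map rowOf ls ⟫ (f ∷ map rowOf rs)) ts

  LGV-at : ∀ {P ts} → LGV (ls ⟫ (P ∷ rs)) ts → S-at (walksOf P) ≡ D-at (rowOf P) ts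
  LGV-at {P} {ts} e = trans (cong (families± one) (sym (map-⟫ walksOf ls (P ∷ rs))))
    (trans e (cong (λ fs → D fs ts) (map-⟫ rowOf ls (P ∷ rs))))

  at-LGV : ∀ {P ts} → S-at (walksOf P) ≡ D-at (rowOf P) ts → LGV (ls ⟫ (P ∷ rs)) ts
  at-LGV {P} {ts} e = trans (cong (families± one) (map-⟫ walksOf ls (P ∷ rs)))
    (trans e (cong (λ fs → D fs ts) (sym (map-⟫ rowOf ls (P ∷ rs)))))

  S-union : ∀ A A′ → S-at (A ++ A′) ≡ S-at A + S-at A′
  S-union A A′ = trans (families-front Ls (A ++ A′) Rs one) (trans (families-union A A′ (Ls ⟫ Rs))
    (sym (cong₂ _+_ (families-front Ls A Rs one) (families-front Ls A′ Rs one))))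
    where
    Ls Rs : List (List Path)
    Ls = map walksOf ls
    Rs = map walksOf rs

  S-extend : ∀ v A → All (λ h → ∀ q → q ∈ walksOf h → v ∉ q) ls → All (λ h → ∀ q → q ∈ walksOf h → v ∉ q) rs →
    S-at (map (v ∷_) A) ≡ S-at A
  S-extend v A al ar = trans (families-front Ls (map (v ∷_) A) Rs one)
    (trans (families-extend v A (Ls ⟫ Rs) avoid) (sym (families-front Ls A Rs one)))
    where
    Ls Rs : List (List Path)
    Ls = map walksOf ls
    Rs = map walksOf rs
    in-map : ∀ {hs} → All (λ h → ∀ q → q ∈ walksOf h → v ∉ q) hs → ∀ B → B ∈ map walksOf hs → ∀ q → q ∈ B → v ∉ q
    in-map (a ∷ as) B (here refl) = a
    in-map (a ∷ as) B (there m) = in-map as B m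
    avoid : ∀ B → B ∈ Ls ⟫ Rs → ∀ q → q ∈ B → v ∉ q
    avoid B m with ∈-⟫ Ls Rs m
    ... | inj₁ m′ = in-map al B m′
    ... | inj₂ m′ = in-map ar B m′

  D-at-step : ∀ x y ts → D-at (F (suc x) y) ts ≡ D-at (F x y) ts + (D-at (F (suc x) (suc y)) ts + D-at (F x (suc y)) ts)
  D-at-step x y ts = trans
    (D-prefix-sum (map rowOf ls) (D-step x y (map rowOf rs)) ts)
    refl
    where
    Rs : List Seq
    Rs = map rowOf rs
    D-prefix-sum : ∀ {f f₁ f₂ f₃ : List Seq} Ls → (∀ ws → D f ws ≡ D f₁ ws + (D f₂ ws + D f₃ ws)) →
      ∀ ws → D (Ls ⟫ f) ws ≡ D (Ls ⟫ f₁) ws + (D (Ls ⟫ f₂) ws + D (Ls ⟫ f₃) ws)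
    D-prefix-sum [] e = e
    D-prefix-sum {f} {f₁} {f₂} {f₃} (L ∷ Ls) e = D-prefix-sum Ls λ ws → trans
      (∑±-cong (λ w vs → trans (cong (L w *_) (e vs)) (lem (L w) _ _ _)) ws)
      (trans (∑±-linear (λ w vs → L w * D f₁ vs) (λ w vs → L w * D f₂ vs + 1ℤ * (L w * D f₃ vs)) 1ℤ ws)
        (cong (λ t → D (L ∷ f₁) ws + t) (trans (*-identityˡ _)
          (trans (∑±-linear (λ w vs → L w * D f₂ vs) (λ w vs → L w * D f₃ vs) 1ℤ ws)
            (cong (λ t → D (L ∷ f₂) ws + t) (*-identityˡ _))))))
      where
      opaque
        unfolding ℤ
        lem : ∀ l x y z → l * (x + (y + z)) ≡ l * x + 1ℤ * (l * y + 1ℤ * (l * z))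
        lem = solve-∀ ring

-- Two heads at the same point leave no disjoint family, and the determinant has two equal rows.
meet-right : ∀ ls x y d d′ rs ts → LGV (ls ⟫ ((x , y , d) ∷ (x , y , d′) ∷ rs)) ts
meet-right ls x y d d′ rs ts = at-LGV ls ((x , y , d′) ∷ rs) (trans
  (families-zero (map walksOf ls) (families-meet (walks x y d) (walks x y d′) (map walksOf rs)
    (walks-start x y d) (walks-start x y d′)) one)
  (sym (D-prefix-zero (map rowOf ls) (D-dup (F x y) (map rowOf rs)) ts)))

-- Induction on μ, which decreases whenever a head moves. The cursor goes right as long as the next
-- head is on the same level; the head found there makes its step, which splits both sides into the
-- same cases.
lgv-zipper : ∀ n ls P rs ts → ts ≡ map target (ls ⟫ (P ∷ rs)) → AllPairs _▹_ (P ∷ ls) → AllPairs _⊏_ (P ∷ rs) →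
  μ (ls ⟫ (P ∷ rs)) ℕ.≤ n → LGV (ls ⟫ (P ∷ rs)) ts

-- The head to move is the one on the lowest level with the largest x: its path cannot be
-- met at its present position by a path coming from elsewhere.
lgv-move : ∀ n ls P rs ts → ts ≡ map target (ls ⟫ (P ∷ rs)) → AllPairs _▹_ (P ∷ ls) → AllPairs _⊏_ (P ∷ rs) →
  All (λ r → level P ℕ.< level r) rs → μ (ls ⟫ (P ∷ rs)) ℕ.≤ suc n → LGV (ls ⟫ (P ∷ rs)) ts

lgv-zipper zero ls P rs ts e va vb b = ⊥-elim (ℕₚ.<⇒≱ (ℕₚ.≤-trans (s≤s z≤n)
  (subst (size P ℕ.+ μ rs ℕ.≤_) (sym (μ-⟫ ls (P ∷ rs))) (ℕₚ.m≤n+m (size P ℕ.+ μ rs) (μ ls)))) b)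
lgv-zipper (suc n) ls P [] ts e va vb b = lgv-move n ls P [] ts e va vb [] b
lgv-zipper (suc n) ls P (r ∷ rs) ts e va (((inj₁ (l , x<) , t<) ∷ p) ∷ vb) b =
  lgv-zipper (suc n) (P ∷ ls) r rs ts e (▹-cons {r} {P} (sym l , x< , t<) va) vb b
lgv-zipper (suc n) ls P (r ∷ rs) ts e va vb@((pr@(inj₂ (l< , x≤) , t<) ∷ p) ∷ q ∷ vb′) b =
  lgv-move n ls P (r ∷ rs) ts e va vb (l< ∷ All.map (λ { (inj₁ (l , _) , _) → subst (level P ℕ.<_) l l<
                                                    ; (inj₂ (l , _) , _) → ℕₚ.<-trans l< l }) q) b

-- A head that has gone up lies above the heads to the left of the cursor, which are now the lowest,
-- so the cursor steps back to the nearest of them.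
lgv-rejoin : ∀ n ls P rs ts → ts ≡ map target (ls ⟫ (P ∷ rs)) → AllPairs _▹_ ls → All (_⊏ P) ls → AllPairs _⊏_ (P ∷ rs) →
  μ (ls ⟫ (P ∷ rs)) ℕ.≤ n → LGV (ls ⟫ (P ∷ rs)) ts
lgv-rejoin n [] P rs ts e va a vb b = lgv-zipper n [] P rs ts e ([] ∷ []) vb b
lgv-rejoin n (o ∷ ls) P rs ts e va (a ∷ as) vb b = lgv-zipper n ls o (P ∷ rs) ts e va (⊏-cons {o} {P} a vb) b

lgv-move n (o ∷ ls) (zero , y , d) rs ts e (((_ , () , _) ∷ _) ∷ _) vb up b
-- No walk is left for this head, and its row vanishes at all targets because they lie above y.
lgv-move n [] (zero , y , suc d) rs ts e va (vb ∷ _) up b = sym (trans (cong (D (F 0 y ∷ map rowOf rs)) e) (trans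
  (∑±-cong-pick {K = λ w vs → F 0 y w * D (map rowOf rs) vs} {λ _ _ → 0ℤ} (target (0 , y , suc d) ∷ map target rs)
    (λ w vs p → trans (cong (_* D (map rowOf rs) vs) (F-above y w (large (pick-∈ p)))) (zeroˡ _)))
  (∑±-zero (λ _ _ → refl) (target (0 , y , suc d) ∷ map target rs))))
  where
  large : ∀ {w} → w ∈ target (0 , y , suc d) ∷ map target rs → y ℕ.< w
  large (here refl) = subst (y ℕ.<_) (sym (ℕₚ.+-suc y d)) (s≤s (ℕₚ.m≤m+n y d))
  large (there m) with ∈-map⁻ target m
  ... | r , m′ , refl = ℕₚ.<-trans (large (here refl)) (proj₂ (All.lookup vb m′))
-- This path is complete. The row of the head is a unit vector at its own target, and all other
-- walks stay above the level y.
lgv-move n [] (zero , y , zero) rs ts e va (vb ∷ vbs) up b = begin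
  1ℤ * families± (λ q → 1ℤ * ⟦ noCommon ((0 , y) ∷ []) q ⟧) (map walksOf rs) + 0ℤ
    ≡⟨ trans (+-identityʳ _) (*-identityˡ _) ⟩
  families± (λ q → 1ℤ * ⟦ noCommon ((0 , y) ∷ []) q ⟧) (map walksOf rs)
    ≡⟨ families-cong (map walksOf rs) (λ A mA q mq → trans (*-identityˡ _) (cong ⟦_⟧ (apart A mA q mq))) ⟩
  families± one (map walksOf rs)
    ≡⟨ rest rs vbs (ℕₚ.≤-pred b) ⟩
  D (map rowOf rs) (map target rs)
    ≡⟨ sym (trans (cong₂ (λ s t → s * D (map rowOf rs) (map target rs) - t)
         (trans (cong (F 0 y) (ℕₚ.+-identityʳ y)) (F-end y))
         (trans (∑±-cong-pick (map target rs) (λ w vs p → trans (cong (_* D (map rowOf rs) (y ℕ.+ 0 ∷ vs)) (F-above y w (large (pick-∈ p)))) (zeroˡ _)))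
           (∑±-zero (λ _ _ → refl) (map target rs)))) (lem _)) ⟩
  D (F 0 y ∷ map rowOf rs) (y ℕ.+ 0 ∷ map target rs)
    ≡⟨ cong (D (F 0 y ∷ map rowOf rs)) (sym e) ⟩
  D (F 0 y ∷ map rowOf rs) ts ∎
  where
  open ≡-Reasoning
  opaque
    unfolding ℤ
    lem : ∀ x → 1ℤ * x - 0ℤ ≡ x
    lem = solve-∀ ring
  large : ∀ {w} → w ∈ map target rs → y ℕ.< w
  large m with ∈-map⁻ target m
  ... | r , m′ , refl = subst (ℕ._< target r) (ℕₚ.+-identityʳ y) (proj₂ (All.lookup vb m′))
  apart : ∀ A → A ∈ map walksOf rs → ∀ q → q ∈ A → noCommon ((0 , y) ∷ []) q ≡ true
  apart A mA q mq with ∈-map⁻ walksOf mA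
  ... | (x′ , y′ , d′) , m′ , refl = disjoint-noCommon ((0 , y) ∷ []) q λ { u (here refl) mu →
    case walks-after x′ y′ d′ q mq (0 , y) mu of λ
      { (inj₁ l) → ℕₚ.<-asym l (All.lookup up m′)
      ; (inj₂ (refl , _)) → ℕₚ.<-irrefl refl (All.lookup up m′) } }
  rest : ∀ rs → AllPairs _⊏_ rs → μ rs ℕ.≤ n → LGV rs (map target rs)
  rest [] _ _ = refl
  rest (r ∷ rs) v b = lgv-zipper n [] r rs _ refl ([] ∷ []) v b
lgv-move n ls P@(suc x , y , d) rs ts e va@(va₁ ∷ vas) vb@(vb₁ ∷ vbs) up b = at-LGV ls rs (main d refl)
  where
  avoid-left : All (λ h → ∀ q → q ∈ walksOf h → (suc x , y) ∉ q) ls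
  avoid-left = All.map (λ { {x′ , _ , d′} (refl , l , _) q mq mv → case walks-after x′ y d′ q mq _ mv of λ
    { (inj₁ l′) → ℕₚ.<-irrefl refl l′ ; (inj₂ (_ , l′)) → ℕₚ.<⇒≱ l l′ } }) va₁
  avoid-right : All (λ h → ∀ q → q ∈ walksOf h → (suc x , y) ∉ q) rs
  avoid-right = All.map (λ { {x′ , y′ , d′} l q mq mv → case walks-after x′ y′ d′ q mq _ mv of λ
    { (inj₁ l′) → ℕₚ.<-asym l l′ ; (inj₂ (refl , _)) → ℕₚ.<-irrefl refl l } }) up

  -- A step west may land on the left neighbour and a step north on the next head; `meet-right`
  -- covers both. A step northwest lands on no other head, since on the next level all heads have
  -- larger x.
  west : S-at ls rs (walks x y d) ≡ D-at ls rs (F x y) ts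
  west = LGV-at ls rs (go ls va₁ vas refl e b)
    where
    right : AllPairs _⊏_ ((x , y , d) ∷ rs)
    right = All.map (λ { (inj₁ (l , x<) , t) → inj₁ (l , ℕₚ.<-trans (ℕₚ.n<1+n x) x<) , t
                       ; (inj₂ (l , x≤) , t) → inj₂ (l , ℕₚ.≤-trans (ℕₚ.n≤1+n x) x≤) , t }) vb₁ ∷ vbs
    go : ∀ ls′ → All (P ▹_) ls′ → AllPairs _▹_ ls′ → ls′ ≡ ls → ts ≡ map target (ls′ ⟫ (P ∷ rs)) →
      μ (ls′ ⟫ (P ∷ rs)) ℕ.≤ suc n → LGV (ls′ ⟫ ((x , y , d) ∷ rs)) ts
    go [] _ _ _ e b = lgv-zipper n [] (x , y , d) rs ts e ([] ∷ []) right (μ-decrease [] P (x , y , d) rs ℕₚ.≤-refl b)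
    go (o@(x′ , y′ , d′) ∷ ls′) ((refl , l , t) ∷ _) vas _ e b with x′ ℕₚ.≟ x
    ... | yes refl = meet-right ls′ x y d′ d rs ts
    ... | no ne = lgv-zipper n (o ∷ ls′) (x , y , d) rs ts (trans e (targets-⟫ {P} {x , y , d} (o ∷ ls′) rs refl))
      (▹-cons {x , y , d} {o} (refl , ℕₚ.≤∧≢⇒< (ℕₚ.≤-pred l) ne , t) vas) right
      (μ-decrease (o ∷ ls′) P (x , y , d) rs ℕₚ.≤-refl b)

  north : ∀ d′ → d ≡ suc d′ → S-at ls rs (walks (suc x) (suc y) d′) ≡ D-at ls rs (F (suc x) (suc y)) ts
  north d′ refl = LGV-at ls rs (go rs vb₁ vbs up e b)
    where
    P′ : Head
    P′ = suc x , suc y , d′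
    left : All (_⊏ P′) ls
    left = All.map (λ { {x₀ , _ , d₀} (refl , l , t) → inj₂ (ℕₚ.n<1+n y , ℕₚ.<⇒≤ l) , subst (y ℕ.+ d₀ ℕ.<_) (ℕₚ.+-suc y d′) t }) va₁
    go : ∀ rs → All (P ⊏_) rs → AllPairs _⊏_ rs → All (λ r → y ℕ.< level r) rs → ts ≡ map target (ls ⟫ (P ∷ rs)) →
      μ (ls ⟫ (P ∷ rs)) ℕ.≤ suc n → LGV (ls ⟫ (P′ ∷ rs)) ts
    go [] _ _ _ e b = lgv-rejoin n ls P′ [] ts (trans e (targets-⟫ {P} {P′} ls [] (ℕₚ.+-suc y d′))) vas left ([] ∷ [])
      (μ-decrease ls P P′ [] (s≤s (ℕₚ.≤-reflexive (sym (ℕₚ.+-suc (suc x) d′)))) b)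
    go (r@(x₁ , y₁ , d₁) ∷ rs) ((inj₁ (refl , _) , _) ∷ _) _ (l ∷ _) e b = ⊥-elim (ℕₚ.<-irrefl refl l)
    go (r@(x₁ , y₁ , d₁) ∷ rs) ((inj₂ (l , x≤) , t) ∷ _) vbs _ e b with suc y ℕₚ.≟ y₁ | suc x ℕₚ.≟ x₁
    ... | yes refl | yes refl = meet-right ls (suc x) (suc y) d′ d₁ rs ts
    ... | yes refl | no ne = lgv-rejoin n ls P′ (r ∷ rs) ts (trans e (targets-⟫ {P} {P′} ls (r ∷ rs) (ℕₚ.+-suc y d′))) vas left
      (⊏-cons {P′} {r} (inj₁ (refl , ℕₚ.≤∧≢⇒< x≤ ne) , subst (ℕ._< suc y ℕ.+ d₁) (ℕₚ.+-suc y d′) t) vbs)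
      (μ-decrease ls P P′ (r ∷ rs) (s≤s (ℕₚ.≤-reflexive (sym (ℕₚ.+-suc (suc x) d′)))) b)
    ... | no ne | _ = lgv-rejoin n ls P′ (r ∷ rs) ts (trans e (targets-⟫ {P} {P′} ls (r ∷ rs) (ℕₚ.+-suc y d′))) vas left
      (⊏-cons {P′} {r} (inj₂ (ℕₚ.≤∧≢⇒< l ne , x≤) , subst (ℕ._< y₁ ℕ.+ d₁) (ℕₚ.+-suc y d′) t) vbs)
      (μ-decrease ls P P′ (r ∷ rs) (s≤s (ℕₚ.≤-reflexive (sym (ℕₚ.+-suc (suc x) d′)))) b)

  northwest : ∀ d′ → d ≡ suc d′ → S-at ls rs (walks x (suc y) d′) ≡ D-at ls rs (F x (suc y)) ts
  northwest d′ refl = LGV-at ls rs (lgv-rejoin n ls P′ rs ts (trans e (targets-⟫ {P} {P′} ls rs (ℕₚ.+-suc y d′))) vas left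
      (All.zipWith join (vb₁ , up) ∷ vbs)
      (μ-decrease ls P P′ rs (s≤s (s≤s (ℕₚ.+-monoʳ-≤ x (ℕₚ.n≤1+n d′)))) b))
    where
    P′ : Head
    P′ = x , suc y , d′
    left : All (_⊏ P′) ls
    left = All.map (λ { {x₀ , _ , d₀} (refl , l , t) → inj₂ (ℕₚ.n<1+n y , ℕₚ.≤-pred l) , subst (y ℕ.+ d₀ ℕ.<_) (ℕₚ.+-suc y d′) t }) va₁
    join : ∀ {r} → P ⊏ r × y ℕ.< level r → P′ ⊏ r
    join ((inj₁ (refl , _) , _) , l) = ⊥-elim (ℕₚ.<-irrefl refl l)
    join {x₁ , y₁ , d₁} ((inj₂ (l , x≤) , t) , _) with suc y ℕₚ.≟ y₁
    ... | yes refl = inj₁ (refl , x≤) , subst (ℕ._< suc y ℕ.+ d₁) (ℕₚ.+-suc y d′) t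
    ... | no ne = inj₂ (ℕₚ.≤∧≢⇒< l ne , ℕₚ.≤-trans (ℕₚ.n≤1+n x) x≤) , subst (ℕ._< y₁ ℕ.+ d₁) (ℕₚ.+-suc y d′) t

  -- For d = 0 the target of the head is y. A head to its left would have a target below its own
  -- level, so there is none, and after a step up all rows vanish in the column y.
  exhausted : ∀ x′ → d ≡ 0 → D-at ls rs (F x′ (suc y)) ts ≡ 0ℤ
  exhausted x′ refl = go ls va₁ e
    where
    go : ∀ ls → All (P ▹_) ls → ts ≡ map target (ls ⟫ (P ∷ rs)) → D-at ls rs (F x′ (suc y)) ts ≡ 0ℤ
    go ((x₀ , _ , d₀) ∷ _) ((refl , _ , t) ∷ _) e = ⊥-elim (ℕₚ.<⇒≱ t (ℕₚ.≤-trans (ℕₚ.≤-reflexive (ℕₚ.+-identityʳ y)) (ℕₚ.m≤m+n y d₀)))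
    go [] _ e = trans (cong (D (F x′ (suc y) ∷ map rowOf rs)) e)
      (D-zero-column (map rowOf rs) (F x′ (suc y)) (y ℕ.+ 0) (map target rs) (F-below x′ (suc y) (y ℕ.+ 0) (s≤s (ℕₚ.≤-reflexive (ℕₚ.+-identityʳ y))) ∷ below rs up))
      where
      below : ∀ rs → All (λ r → y ℕ.< level r) rs → All (λ g → g (y ℕ.+ 0) ≡ 0ℤ) (map rowOf rs)
      below [] [] = []
      below ((x₁ , y₁ , d₁) ∷ rs) (l ∷ ls) = F-below x₁ y₁ (y ℕ.+ 0) (subst (ℕ._< y₁) (sym (ℕₚ.+-identityʳ y)) l) ∷ below rs ls

  main : ∀ d₀ → d ≡ d₀ → S-at ls rs (walks (suc x) y d) ≡ D-at ls rs (F (suc x) y) ts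
  main zero refl = begin
    S-at ls rs (map ((suc x , y) ∷_) (walks x y 0))  ≡⟨ S-extend ls rs (suc x , y) (walks x y 0) avoid-left avoid-right ⟩
    S-at ls rs (walks x y 0)                          ≡⟨ west ⟩
    D-at ls rs (F x y) ts                             ≡⟨ sym (trans (cong (λ t → D-at ls rs (F x y) ts + t) (+-identityˡ 0ℤ)) (+-identityʳ _)) ⟩
    D-at ls rs (F x y) ts + (0ℤ + 0ℤ)
      ≡⟨ sym (cong₂ (λ s t → D-at ls rs (F x y) ts + (s + t)) (exhausted (suc x) refl) (exhausted x refl)) ⟩
    D-at ls rs (F x y) ts + (D-at ls rs (F (suc x) (suc y)) ts + D-at ls rs (F x (suc y)) ts)
      ≡⟨ sym (D-at-step ls rs x y ts) ⟩
    D-at ls rs (F (suc x) y) ts ∎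
    where open ≡-Reasoning
  main (suc d′) refl = begin
    S-at ls rs (map ((suc x , y) ∷_) (walks x y (suc d′) ++ walks (suc x) (suc y) d′ ++ walks x (suc y) d′))
      ≡⟨ S-extend ls rs (suc x , y) _ avoid-left avoid-right ⟩
    S-at ls rs (walks x y (suc d′) ++ walks (suc x) (suc y) d′ ++ walks x (suc y) d′)
      ≡⟨ trans (S-union ls rs (walks x y (suc d′)) _) (cong (λ t → S-at ls rs (walks x y (suc d′)) + t) (S-union ls rs (walks (suc x) (suc y) d′) _)) ⟩
    S-at ls rs (walks x y (suc d′)) + (S-at ls rs (walks (suc x) (suc y) d′) + S-at ls rs (walks x (suc y) d′))
      ≡⟨ cong₂ _+_ west (cong₂ _+_ (north d′ refl) (northwest d′ refl)) ⟩
    D-at ls rs (F x y) ts + (D-at ls rs (F (suc x) (suc y)) ts + D-at ls rs (F x (suc y)) ts)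
      ≡⟨ sym (D-at-step ls rs x y ts) ⟩
    D-at ls rs (F (suc x) y) ts ∎
    where open ≡-Reasoning

-- The number T4

applyUpTo-range : ∀ {m} (f : ℕ → ℕ) n → (∀ k → f k ≡ m ℕ.+ k) → applyUpTo f n ≡ range m n
applyUpTo-range f zero e = refl
applyUpTo-range {m} f (suc n) e = cong₂ _∷_ (trans (e 0) (ℕₚ.+-identityʳ m))
  (applyUpTo-range {suc m} (f ∘ suc) n (λ k → trans (e (suc k)) (ℕₚ.+-suc m k)))

upTo-range : ∀ n → upTo n ≡ range 0 n
upTo-range n = applyUpTo-range id n (λ _ → refl)

sumL-stepsUpTo : ∀ L g → sumL (stepsUpTo (suc L)) g
  ≡ g [] + (sumL (stepsUpTo L) (g ∘ (W ∷_)) + (sumL (stepsUpTo L) (g ∘ (N ∷_)) + sumL (stepsUpTo L) (g ∘ (NW ∷_))))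
sumL-stepsUpTo L g = begin
  sumL (stepsUpTo (suc L)) g
    ≡⟨ sumL-concatMap allSteps (upTo (2 ℕ.+ L)) g ⟩
  sumL (allSteps 0) g + sumL (applyUpTo suc (suc L)) (λ k → sumL (allSteps k) g)
    ≡⟨ cong₂ _+_ (+-identityʳ (g [])) (trans (cong (λ l → sumL l (λ k → sumL (allSteps k) g)) (map-upTo-suc (suc L)))
         (sumL-map suc (upTo (suc L)) _)) ⟩
  g [] + sumL (upTo (suc L)) (λ k → sumL (allSteps (suc k)) g)
    ≡⟨ cong (λ t → g [] + t) (sumL-cong (upTo (suc L)) (λ k _ → first k)) ⟩
  g [] + sumL (upTo (suc L)) (λ k → s W k + (s N k + s NW k))
    ≡⟨ cong (λ t → g [] + t) (trans (sumL-+ (s W) (λ k → s N k + s NW k) (upTo (suc L)))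
         (cong (λ t → sumL (upTo (suc L)) (s W) + t) (sumL-+ (s N) (s NW) (upTo (suc L))))) ⟩
  g [] + (sumL (upTo (suc L)) (s W) + (sumL (upTo (suc L)) (s N) + sumL (upTo (suc L)) (s NW)))
    ≡⟨ cong (λ t → g [] + t) (sym (cong₂ _+_ (back W) (cong₂ _+_ (back N) (back NW)))) ⟩
  _ ∎
  where
  open ≡-Reasoning
  s : Step → ℕ → ℤ
  s st k = sumL (allSteps k) (g ∘ (st ∷_))
  back : ∀ st → sumL (stepsUpTo L) (g ∘ (st ∷_)) ≡ sumL (upTo (suc L)) (s st)
  back st = sumL-concatMap allSteps (upTo (suc L)) _
  map-upTo-suc : ∀ n → applyUpTo suc n ≡ map suc (upTo n)
  map-upTo-suc n = sym (map-upTo suc n)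
  first : ∀ k → sumL (allSteps (suc k)) g ≡ s W k + (s N k + s NW k)
  first k = trans (sumL-concatMap (λ st → map (st ∷_) (allSteps k)) (W ∷ N ∷ NW ∷ []) g)
    (cong₂ _+_ (sumL-map (W ∷_) (allSteps k) g)
      (cong₂ _+_ (sumL-map (N ∷_) (allSteps k) g) (trans (+-identityʳ _) (sumL-map (NW ∷_) (allSteps k) g))))

accepts : ℕ → ℕ → List Step → Bool
accepts x d s = (xDec s ℕ.≡ᵇ x) ∧ ((yInc s ℕ.≡ᵇ d) ∧ lastNotN s)

∧-false : ∀ b → b ∧ false ≡ false
∧-false true = refl
∧-false false = refl

sumL-const-zero : ∀ {A : Set} (xs : List A) (b : A → Bool) (f : A → ℤ) → (∀ x → b x ≡ false) → sumL xs (λ x → ⟦ b x ⟧ * f x) ≡ 0ℤ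
sumL-const-zero xs b f e = sumL-zero xs λ x _ → trans (cong (λ t → ⟦ t ⟧ * f x) (e x)) (zeroˡ _)

-- A sequence that does not change x consists of steps N only, so a nonempty one ends with N.
no-vertical-end : ∀ d s → accepts 0 d (N ∷ s) ≡ false
no-vertical-end d [] = ∧-false (1 ℕ.≡ᵇ d)
no-vertical-end d (W ∷ s) = refl
no-vertical-end d (NW ∷ s) = refl
no-vertical-end zero (N ∷ s) with xDec s ℕ.≡ᵇ 0
... | true = refl
... | false = refl
no-vertical-end (suc d) (N ∷ s) = no-vertical-end d s

accepts-W : ∀ x d s → accepts (suc x) d (W ∷ s) ≡ accepts x d s
accepts-W x d [] = refl
accepts-W x d (_ ∷ _) = refl

accepts-NW : ∀ x d s → accepts (suc x) (suc d) (NW ∷ s) ≡ accepts x d s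
accepts-NW x d [] = refl
accepts-NW x d (_ ∷ _) = refl

accepts-N : ∀ x d s → accepts (suc x) (suc d) (N ∷ s) ≡ accepts (suc x) d s
accepts-N x d [] = refl
accepts-N x d (_ ∷ _) = refl

accepts-none : ∀ x s → accepts x 0 (NW ∷ s) ≡ false × accepts x 0 (N ∷ s) ≡ false
accepts-none x s = ∧-false (suc (xDec s) ℕ.≡ᵇ x) , ∧-false (xDec s ℕ.≡ᵇ x)

-- A walk has at most x + d steps, so the enumeration up to L finds it. Both sides are split by the
-- first step.
sumL-walks : ∀ L x y d → x ℕ.+ d ℕ.≤ L → ∀ (f : Path → ℤ) →
  sumL (stepsUpTo L) (λ s → ⟦ accepts x d s ⟧ * f (trace (x , y) s)) ≡ sumL (walks x y d) f
sumL-walks zero zero y zero l f = cong (λ t → t + 0ℤ) (*-identityˡ _)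
sumL-walks (suc L) zero y d l f = begin
  sumL (stepsUpTo (suc L)) g
    ≡⟨ sumL-stepsUpTo L g ⟩
  g [] + (sumL (stepsUpTo L) (g ∘ (W ∷_)) + (sumL (stepsUpTo L) (g ∘ (N ∷_)) + sumL (stepsUpTo L) (g ∘ (NW ∷_))))
    ≡⟨ cong (λ t → g [] + t) (cong₂ _+_ (sumL-const-zero (stepsUpTo L) _ _ (λ _ → refl))
         (cong₂ _+_ (sumL-const-zero (stepsUpTo L) _ _ (no-vertical-end d)) (sumL-const-zero (stepsUpTo L) _ _ (λ _ → refl)))) ⟩
  g [] + (0ℤ + (0ℤ + 0ℤ))
    ≡⟨ lem (g []) ⟩
  g [] + 0ℤ
    ≡⟨ empty d ⟩
  sumL (walks zero y d) f ∎
  where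
  open ≡-Reasoning
  g : List Step → ℤ
  g s = ⟦ accepts zero d s ⟧ * f (trace (zero , y) s)
  opaque
    unfolding ℤ
    lem : ∀ x → x + (0ℤ + (0ℤ + 0ℤ)) ≡ x + 0ℤ
    lem = solve-∀ ring
  empty : ∀ d → ⟦ accepts zero d [] ⟧ * f ((zero , y) ∷ []) + 0ℤ ≡ sumL (walks zero y d) f
  empty zero = cong (λ t → t + 0ℤ) (*-identityˡ _)
  empty (suc d) = trans (+-identityʳ _) (zeroˡ _)
sumL-walks (suc L) (suc x) y zero (s≤s l) f = begin
  sumL (stepsUpTo (suc L)) g
    ≡⟨ sumL-stepsUpTo L g ⟩
  g [] + (sumL (stepsUpTo L) (g ∘ (W ∷_)) + (sumL (stepsUpTo L) (g ∘ (N ∷_)) + sumL (stepsUpTo L) (g ∘ (NW ∷_))))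
    ≡⟨ cong₂ _+_ (zeroˡ _) (cong₂ _+_
         (trans (sumL-cong (stepsUpTo L) (λ s _ → cong (λ b → ⟦ b ⟧ * f ((suc x , y) ∷ trace (x , y) s)) (accepts-W x 0 s)))
           (sumL-walks L x y 0 l (f ∘ ((suc x , y) ∷_))))
         (cong₂ _+_ (sumL-const-zero (stepsUpTo L) _ _ (λ s → proj₂ (accepts-none (suc x) s)))
                    (sumL-const-zero (stepsUpTo L) _ _ (λ s → proj₁ (accepts-none (suc x) s))))) ⟩
  0ℤ + (sumL (walks x y 0) (f ∘ ((suc x , y) ∷_)) + (0ℤ + 0ℤ))
    ≡⟨ lem _ ⟩
  sumL (walks x y 0) (f ∘ ((suc x , y) ∷_))
    ≡⟨ sym (sumL-map ((suc x , y) ∷_) (walks x y 0) f) ⟩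
  sumL (walks (suc x) y zero) f ∎
  where
  open ≡-Reasoning
  g : List Step → ℤ
  g s = ⟦ accepts (suc x) 0 s ⟧ * f (trace (suc x , y) s)
  opaque
    unfolding ℤ
    lem : ∀ x → 0ℤ + (x + (0ℤ + 0ℤ)) ≡ x
    lem = solve-∀ ring
sumL-walks (suc L) (suc x) y (suc d) (s≤s l) f = begin
  sumL (stepsUpTo (suc L)) g
    ≡⟨ sumL-stepsUpTo L g ⟩
  g [] + (sumL (stepsUpTo L) (g ∘ (W ∷_)) + (sumL (stepsUpTo L) (g ∘ (N ∷_)) + sumL (stepsUpTo L) (g ∘ (NW ∷_))))
    ≡⟨ cong₂ _+_ (zeroˡ _) (cong₂ _+_
         (trans (sumL-cong (stepsUpTo L) (λ s _ → cong (λ b → ⟦ b ⟧ * f′ (trace (x , y) s)) (accepts-W x (suc d) s)))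
           (sumL-walks L x y (suc d) l f′))
         (cong₂ _+_
           (trans (sumL-cong (stepsUpTo L) (λ s _ → cong (λ b → ⟦ b ⟧ * f′ (trace (suc x , suc y) s)) (accepts-N x d s)))
             (sumL-walks L (suc x) (suc y) d (subst (ℕ._≤ L) (ℕₚ.+-suc x d) l) f′))
           (trans (sumL-cong (stepsUpTo L) (λ s _ → cong (λ b → ⟦ b ⟧ * f′ (trace (x , suc y) s)) (accepts-NW x d s)))
             (sumL-walks L x (suc y) d (ℕₚ.≤-trans (ℕₚ.+-monoʳ-≤ x (ℕₚ.n≤1+n d)) l) f′)))) ⟩
  0ℤ + (sumL (walks x y (suc d)) f′ + (sumL (walks (suc x) (suc y) d) f′ + sumL (walks x (suc y) d) f′))
    ≡⟨ trans (+-identityˡ _) (sym (trans (sumL-++ (walks x y (suc d)) _ f′)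
         (cong (λ t → sumL (walks x y (suc d)) f′ + t) (sumL-++ (walks (suc x) (suc y) d) _ f′)))) ⟩
  sumL (walks x y (suc d) ++ walks (suc x) (suc y) d ++ walks x (suc y) d) f′
    ≡⟨ sym (sumL-map ((suc x , y) ∷_) (walks x y (suc d) ++ walks (suc x) (suc y) d ++ walks x (suc y) d) f) ⟩
  sumL (walks (suc x) y (suc d)) f ∎
  where
  open ≡-Reasoning
  f′ : Path → ℤ
  f′ = f ∘ ((suc x , y) ∷_)
  g : List Step → ℤ
  g s = ⟦ accepts (suc x) (suc d) s ⟧ * f (trace (suc x , y) s)

module _ {A B : Set} (p : A → Bool) (t : A → B) (f : B → ℤ) where

  keep : A → List A → List A
  keep x ys = if p x then x ∷ ys else ys

  sumL-keep : ∀ x ys → sumL (map t (keep x ys)) f ≡ ⟦ p x ⟧ * f (t x) + sumL (map t ys) f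
  sumL-keep x ys with p x
  ... | true = cong (λ s → s + sumL (map t ys) f) (sym (*-identityˡ _))
  ... | false = sym (trans (cong (λ s → s + sumL (map t ys) f) (zeroˡ _)) (+-identityˡ _))

  sumL-filter : (filter : List A → List A) → filter [] ≡ [] → (∀ x xs → filter (x ∷ xs) ≡ keep x (filter xs)) →
    ∀ xs → sumL (map t (filter xs)) f ≡ sumL xs (λ x → ⟦ p x ⟧ * f (t x))
  sumL-filter filter e₀ e [] = cong (λ l → sumL (map t l) f) e₀
  sumL-filter filter e₀ e (x ∷ xs) = trans (cong (λ l → sumL (map t l) f) (e x xs))
    (trans (sumL-keep x (filter xs)) (cong (λ s → ⟦ p x ⟧ * f (t x) + s) (sumL-filter filter e₀ e xs)))

  -- At a length `suc L`, `stepsUpTo` unfolds to the four sequences with at most one step and a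
  -- remainder, and the filter has already computed at these four.
  sumL-filter₄ : (filter : List A → List A) → filter [] ≡ [] → (∀ x xs → filter (x ∷ xs) ≡ keep x (filter xs)) →
    ∀ x y z u xs → sumL (map t (keep x (keep y (keep z (keep u (filter xs)))))) f
      ≡ sumL (x ∷ y ∷ z ∷ u ∷ xs) (λ x → ⟦ p x ⟧ * f (t x))
  sumL-filter₄ filter e₀ e x y z u xs = trans (sumL-keep x _) (cong (λ s → ⟦ p x ⟧ * f (t x) + s)
    (trans (sumL-keep y _) (cong (λ s → ⟦ p y ⟧ * f (t y) + s)
      (trans (sumL-keep z _) (cong (λ s → ⟦ p z ⟧ * f (t z) + s)
        (trans (sumL-keep u _) (cong (λ s → ⟦ p u ⟧ * f (t u) + s) (sumL-filter filter e₀ e xs))))))))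

sumL-pathsFrom : ∀ i f → sumL (pathsFrom i) f ≡ sumL (walks i 0 (suc i)) f
sumL-pathsFrom i f = trans filtered (sumL-walks (suc (2 ℕ.* i)) i 0 (suc i)
    (ℕₚ.≤-reflexive (trans (ℕₚ.+-suc i i) (cong (λ k → suc (i ℕ.+ k)) (sym (ℕₚ.+-identityʳ i))))) f)
  where
  -- The local filter function of pathsFrom has no name here; it is found by unification once
  -- the list of the step sequences of length at least two is a variable.
  filter : List (List Step) → List (List Step)
  filter = _
  filtered : sumL (pathsFrom i) f ≡ sumL (stepsUpTo (suc (2 ℕ.* i))) (λ s → ⟦ isPath i s ⟧ * f (trace (i , 0) s))
  filtered with concatMap allSteps (applyUpTo (λ x → suc (suc x)) (2 ℕ.* i))
  ... | xs = sumL-filter₄ (isPath i) (trace (i , 0)) f filter refl (λ _ _ → refl) [] (W ∷ []) (N ∷ []) (NW ∷ []) xs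

pathsFrom-families : ∀ u I → families± u (map pathsFrom I) ≡ families± u (map (λ i → walks i 0 (suc i)) I)
pathsFrom-families u [] = refl
pathsFrom-families u (i ∷ I) = trans (sumL-pathsFrom i _) (sumL-cong (walks i 0 (suc i)) λ p _ → cong (u p *_) (pathsFrom-families _ I))

⟦∧⟧ : ∀ a b → ⟦ a ∧ b ⟧ ≡ ⟦ a ⟧ * ⟦ b ⟧
⟦∧⟧ true b = sym (*-identityˡ _)
⟦∧⟧ false b = sym (zeroˡ _)

⟦all⟧ : ∀ {A : Set} (p : A → Bool) xs → ⟦ all p xs ⟧ ≡ ∏ xs (λ x → ⟦ p x ⟧)
⟦all⟧ p [] = refl
⟦all⟧ p (x ∷ xs) = trans (⟦∧⟧ (p x) (all p xs)) (cong (⟦ p x ⟧ *_) (⟦all⟧ p xs))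

ι-countB : ∀ {A : Set} (p : A → Bool) xs → ι (countB p xs) ≡ sumL xs (λ x → ⟦ p x ⟧)
ι-countB p [] = ι-0
ι-countB p (x ∷ xs) with p x
... | true = trans (ι-+ 1 (countB p xs)) (cong₂ _+_ ι-1 (ι-countB p xs))
... | false = trans (ι-countB p xs) (sym (+-identityˡ _))

sumL-families : ∀ u I → sumL (families I) (λ ps → ∏ ps u * ⟦ pairwiseDisjoint ps ⟧) ≡ families± u (map pathsFrom I)
sumL-families u [] = trans (+-identityʳ _) (*-identityˡ 1ℤ)
sumL-families u (i ∷ I) = begin
  sumL (concatMap (λ p → map (p ∷_) (families I)) (pathsFrom i)) w
    ≡⟨ sumL-concatMap _ (pathsFrom i) w ⟩
  sumL (pathsFrom i) (λ p → sumL (map (p ∷_) (families I)) w)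
    ≡⟨ sumL-cong (pathsFrom i) (λ p _ → trans (sumL-map (p ∷_) (families I) w)
         (trans (sumL-cong (families I) (λ ps _ → term p ps)) (trans (sumL-* (u p) _ (families I))
           (cong (u p *_) (sumL-families (λ q → u q * ⟦ noCommon p q ⟧) I))))) ⟩
  families± u (map pathsFrom (i ∷ I)) ∎
  where
  open ≡-Reasoning
  w : List Path → ℤ
  w ps = ∏ ps u * ⟦ pairwiseDisjoint ps ⟧
  opaque
    unfolding ℤ
    lem : ∀ a b c d → a * b * (c * d) ≡ a * (b * c * d)
    lem = solve-∀ ring
  term : ∀ p ps → w (p ∷ ps) ≡ u p * (∏ ps (λ q → u q * ⟦ noCommon p q ⟧) * ⟦ pairwiseDisjoint ps ⟧)
  term p ps = trans (cong (u p * ∏ ps u *_) (trans (⟦∧⟧ (all (noCommon p) ps) (pairwiseDisjoint ps))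
      (cong (_* ⟦ pairwiseDisjoint ps ⟧) (⟦all⟧ (noCommon p) ps))))
    (trans (lem (u p) (∏ ps u) _ _) (cong (λ t → u p * (t * ⟦ pairwiseDisjoint ps ⟧)) (sym (∏-* u (λ q → ⟦ noCommon p q ⟧) ps))))

M : ℕ → Seq
M i j = c i (suc j)

Increasing : List ℕ → Set
Increasing = AllPairs ℕ._<_

families-determinant : ∀ I → Increasing I → ι (countB pairwiseDisjoint (families I)) ≡ D (map M I) I
families-determinant I inc = begin
  ι (countB pairwiseDisjoint (families I))
    ≡⟨ ι-countB pairwiseDisjoint (families I) ⟩
  sumL (families I) (λ ps → ⟦ pairwiseDisjoint ps ⟧)
    ≡⟨ sumL-cong (families I) (λ ps _ → sym (trans (cong (_* ⟦ pairwiseDisjoint ps ⟧) (∏-one ps)) (*-identityˡ _))) ⟩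
  sumL (families I) (λ ps → ∏ ps one * ⟦ pairwiseDisjoint ps ⟧)
    ≡⟨ trans (sumL-families one I) (pathsFrom-families one I) ⟩
  families± one (map (λ i → walks i 0 (suc i)) I)
    ≡⟨ cong (families± one) (map-∘ I) ⟩
  families± one (map walksOf (heads I))
    ≡⟨ lgv I inc ⟩
  D (map rowOf (heads I)) (map target (heads I))
    ≡⟨ cong₂ D (rows I) (targets I) ⟩
  D (map (λ i → F i 0) I) (map suc I)
    ≡⟨ sym (trans (cong (λ fs → D fs I) (map-∘ I)) (D-map suc (map (λ i → F i 0) I) I)) ⟩
  D (map M I) I ∎
  where
  open ≡-Reasoning
  heads : List ℕ → List Head
  heads = map (λ i → i , 0 , suc i)
  ∏-one : ∀ ps → ∏ ps one ≡ 1ℤ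
  ∏-one [] = refl
  ∏-one (p ∷ ps) = trans (*-identityˡ _) (∏-one ps)
  rows : ∀ I → map rowOf (heads I) ≡ map (λ i → F i 0) I
  rows [] = refl
  rows (i ∷ I) = cong (_ ∷_) (rows I)
  targets : ∀ I → map target (heads I) ≡ map suc I
  targets [] = refl
  targets (i ∷ I) = cong (_ ∷_) (targets I)
  above : ∀ {i} I → All (i ℕ.<_) I → All ((i , 0 , suc i) ⊏_) (heads I)
  above [] [] = []
  above (j ∷ I) (l ∷ ls) = (inj₁ (refl , l) , s≤s l) ∷ above I ls
  ordered : ∀ I → Increasing I → AllPairs _⊏_ (heads I)
  ordered [] [] = []
  ordered (i ∷ I) (a ∷ inc) = above I a ∷ ordered I inc
  lgv : ∀ I → Increasing I → LGV (heads I) (map target (heads I))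
  lgv [] _ = refl
  lgv (i ∷ I) inc = lgv-zipper _ [] (i , 0 , suc i) (heads I) _ refl ([] ∷ []) (ordered (i ∷ I) inc) ℕₚ.≤-refl

-- Expansion of det(1 + M) into principal minors

alternating-rotate : ∀ {H : List X → ℤ} → Alternating H → ∀ w ws → H (ws ++ w ∷ []) ≡ sgn (length ws) * H (w ∷ ws)
alternating-rotate a w [] = sym (*-identityˡ _)
alternating-rotate {H = H} a w (v ∷ ws) = begin
  H (v ∷ ws ++ w ∷ [])                  ≡⟨ alternating-rotate {H = H ∘ (v ∷_)} (λ pre → a (v ∷ pre)) w ws ⟩
  sgn (length ws) * H (v ∷ w ∷ ws)      ≡⟨ cong (sgn (length ws) *_) (a [] v w ws) ⟩
  sgn (length ws) * - H (w ∷ v ∷ ws)    ≡⟨ lem _ _ ⟩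
  - sgn (length ws) * H (w ∷ v ∷ ws)    ∎
  where
  open ≡-Reasoning
  opaque
    unfolding ℤ
    lem : ∀ a b → a * - b ≡ - a * b
    lem = solve-∀ ring

-- Row and column travel equally far, so the two signs cancel.
D-rotate : ∀ (f : X → ℤ) fs w ws → length fs ≡ length ws → D (fs ++ f ∷ []) (ws ++ w ∷ []) ≡ D (f ∷ fs) (w ∷ ws)
D-rotate f fs w ws e = trans (D-snoc f fs (ws ++ w ∷ [])) (trans (cong (sgn (length fs) *_)
    (alternating-rotate {H = D (f ∷ fs)} (D-alternating (f ∷ fs)) w ws))
  (trans (sym (*-assoc _ _ _)) (trans (cong (λ n → sgn (length fs) * sgn n * D (f ∷ fs) (w ∷ ws)) (sym e))
    (trans (cong (_* D (f ∷ fs) (w ∷ ws)) (sgn-square (length fs))) (*-identityˡ _)))))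

δ-same : ∀ m → δ m m ≡ 1ℤ
δ-same zero = refl
δ-same (suc m) = δ-same m

δ-other : ∀ {m j} → m ≢ j → δ m j ≡ 0ℤ
δ-other {zero} {zero} ne = ⊥-elim (ne refl)
δ-other {zero} {suc j} ne = refl
δ-other {suc m} {zero} ne = refl
δ-other {suc m} {suc j} ne = δ-other (ne ∘ cong suc)

-- The row of i is δ i + M i. The part δ i deletes i from the rows and columns; the part M i keeps
-- it, and i moves to the end, among the indices fs kept so far. The two parts match the two halves
-- of `subsets`.
principal-minors : ∀ is fs → Unique (is ++ fs) →
  D (map T4-row is ++ map M fs) (is ++ fs) ≡ sumL (subsets is) (λ I → D (map M (fs ++ I)) (fs ++ I))
principal-minors [] fs u = sym (trans (+-identityʳ _) (cong (λ l → D (map M l) l) (++-identityʳ fs)))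
principal-minors (i ∷ is) fs (a ∷ u) = begin
  D (T4-row i ∷ rows) (i ∷ is ++ fs)
    ≡⟨ trans (∑±-cong (λ w vs → lem (δ i w) (M i w) (D rows vs)) (i ∷ is ++ fs)) (∑±-linear (λ w vs → δ i w * D rows vs) (λ w vs → M i w * D rows vs) 1ℤ (i ∷ is ++ fs)) ⟩
  D (δ i ∷ rows) (i ∷ is ++ fs) + 1ℤ * D (M i ∷ rows) (i ∷ is ++ fs)
    ≡⟨ cong₂ _+_ unit (trans (*-identityˡ _) (sym (D-rotate (M i) rows i (is ++ fs) lengths))) ⟩
  D rows (is ++ fs) + D (rows ++ M i ∷ []) ((is ++ fs) ++ i ∷ [])
    ≡⟨ cong₂ (λ s t → s + t) (principal-minors is fs u)
         (cong₂ D (trans (++-assoc (map T4-row is) (map M fs) (M i ∷ [])) (cong (map T4-row is ++_) (sym (map-++ M fs (i ∷ [])))))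
           (++-assoc is fs (i ∷ []))) ⟩
  sumL (subsets is) G + D (map T4-row is ++ map M (fs ++ i ∷ [])) (is ++ fs ++ i ∷ [])
    ≡⟨ cong (λ t → sumL (subsets is) G + t) (trans (principal-minors is (fs ++ i ∷ []) (subst Unique (++-assoc is fs (i ∷ [])) (unique-rotate (is ++ fs) a u)))
         (trans (sumL-cong (subsets is) (λ I _ → cong (λ l → D (map M l) l) (++-assoc fs (i ∷ []) I)))
           (sym (sumL-map (i ∷_) (subsets is) G)))) ⟩
  sumL (subsets is) G + sumL (map (i ∷_) (subsets is)) G
    ≡⟨ sym (sumL-++ (subsets is) (map (i ∷_) (subsets is)) G) ⟩
  sumL (subsets (i ∷ is)) G ∎
  where
  open ≡-Reasoning
  G : List ℕ → ℤ
  G I = D (map M (fs ++ I)) (fs ++ I)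
  rows : List Seq
  rows = map T4-row is ++ map M fs
  opaque
    unfolding ℤ
    lem : ∀ a b d → (a + b) * d ≡ a * d + 1ℤ * (b * d)
    lem = solve-∀ ring
    lem₂ : ∀ x → 1ℤ * x - 0ℤ ≡ x
    lem₂ = solve-∀ ring
  lengths : length rows ≡ length (is ++ fs)
  lengths = trans (length-++ (map T4-row is)) (trans (cong₂ ℕ._+_ (length-map T4-row is) (length-map M fs)) (sym (length-++ is)))
  unit : D (δ i ∷ rows) (i ∷ is ++ fs) ≡ D rows (is ++ fs)
  unit = trans (cong₂ (λ s t → s * D rows (is ++ fs) - t) (δ-same i)
    (trans (∑±-cong-pick (is ++ fs) (λ w vs p → trans (cong (_* D rows (i ∷ vs)) (δ-other (All.lookup a (pick-∈ p)))) (zeroˡ _)))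
      (∑±-zero (λ _ _ → refl) (is ++ fs)))) (lem₂ _)
  unique-rotate : ∀ {i : ℕ} js → All (i ≢_) js → Unique js → Unique (js ++ i ∷ [])
  unique-rotate [] _ _ = [] ∷ []
  unique-rotate (j ∷ js) (ne ∷ a) (b ∷ u) = All-snoc b (ne ∘ sym) ∷ unique-rotate js a u
    where
    All-snoc : ∀ {P : ℕ → Set} {x xs} → All P xs → P x → All P (xs ++ x ∷ [])
    All-snoc [] p = p ∷ []
    All-snoc (q ∷ qs) p = q ∷ All-snoc qs p

range-above : ∀ m n → All (m ℕ.≤_) (range m n)
range-above m zero = []
range-above m (suc n) = ℕₚ.≤-refl ∷ All.map (ℕₚ.≤-trans (ℕₚ.n≤1+n m)) (range-above (suc m) n)

range-increasing : ∀ m n → Increasing (range m n)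
range-increasing m zero = []
range-increasing m (suc n) = range-above (suc m) n ∷ range-increasing (suc m) n

increasing-unique : ∀ {js} → Increasing js → Unique js
increasing-unique [] = []
increasing-unique (a ∷ inc) = All.map ℕₚ.<⇒≢ a ∷ increasing-unique inc

subsets-all : ∀ {P : ℕ → Set} is → All P is → ∀ I → I ∈ subsets is → All P I
subsets-all [] [] I (here refl) = []
subsets-all (i ∷ is) (p ∷ ps) I m with ∈-++⁻ (subsets is) m
... | inj₁ m′ = subsets-all is ps I m′
... | inj₂ m′ with ∈-map⁻ (i ∷_) m′
...   | J , mJ , refl = p ∷ subsets-all is ps J mJ

subsets-increasing : ∀ is → Increasing is → ∀ I → I ∈ subsets is → Increasing I
subsets-increasing [] [] I (here refl) = []
subsets-increasing (i ∷ is) (a ∷ inc) I m with ∈-++⁻ (subsets is) m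
... | inj₁ m′ = subsets-increasing is inc I m′
... | inj₂ m′ with ∈-map⁻ (i ∷_) m′
...   | J , mJ , refl = subsets-all is a J mJ ∷ subsets-increasing is inc J mJ

ι-sum : ∀ {A : Set} (f : A → ℕ) xs → ι (sum (map f xs)) ≡ sumL xs (ι ∘ f)
ι-sum f [] = ι-0
ι-sum f (x ∷ xs) = trans (ι-+ (f x) (sum (map f xs))) (cong (λ t → ι (f x) + t) (ι-sum f xs))

T4-determinant : ∀ n → ι (T4 n) ≡ D (ascending T4-row 0 n) (range 0 n)
T4-determinant n = begin
  ι (T4 n)
    ≡⟨ ι-sum (λ I → countB pairwiseDisjoint (families I)) (subsets (upTo n)) ⟩
  sumL (subsets (upTo n)) (λ I → ι (countB pairwiseDisjoint (families I)))
    ≡⟨ cong (λ l → sumL (subsets l) (λ I → ι (countB pairwiseDisjoint (families I)))) (upTo-range n) ⟩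
  sumL (subsets (range 0 n)) (λ I → ι (countB pairwiseDisjoint (families I)))
    ≡⟨ sumL-cong (subsets (range 0 n)) (λ I m → families-determinant I (subsets-increasing (range 0 n) (range-increasing 0 n) I m)) ⟩
  sumL (subsets (range 0 n)) (λ I → D (map M I) I)
    ≡⟨ sym (principal-minors (range 0 n) [] (subst Unique (sym (++-identityʳ (range 0 n))) (increasing-unique (range-increasing 0 n)))) ⟩
  D (map T4-row (range 0 n) ++ []) (range 0 n ++ [])
    ≡⟨ cong₂ D (++-identityʳ (map T4-row (range 0 n))) (++-identityʳ (range 0 n)) ⟩
  D (ascending T4-row 0 n) (range 0 n) ∎
  where open ≡-Reasoning

-- Unravelling the twenty-vertex model

-- With these weights a triple crossing of a horizontal, a diagonal and a vertical line weighs
-- 4 · 2^(v - h) for v = 1 if a path enters from above and h = 1 if one leaves to the right.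
hv hd dv : Weights
hv = rw 0ℤ 1ℤ 0ℤ
hd = weights 2ℤ 1ℤ 2ℤ 2ℤ 1ℤ
dv = weights 2ℤ 1ℤ 2ℤ 1ℤ 2ℤ

-- The triple crossing does not depend on the side on which the horizontal and the vertical line
-- pass the diagonal one. Like `hv`, the weights `hd` and `dv` satisfy a² + b₁ b₂ - c₁ c₂ = 2 a b₁.
ice-yangBaxter : YangBaxter hd hv dv
ice-yangBaxter true true true F = lem (F true true true)
  where
  opaque
    unfolding ℤ
    lem : ∀ f111 →
      2ℤ * ((1ℤ - 0ℤ - (1ℤ + 0ℤ) * 0ℤ) * (2ℤ * f111))
      ≡ 2ℤ * ((1ℤ - 0ℤ - (1ℤ + 0ℤ) * 0ℤ) * (2ℤ * f111))
    lem = solve-∀ ring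
ice-yangBaxter true true false F = lem (F true true false) (F true false true) (F false true true)
  where
  opaque
    unfolding ℤ
    lem : ∀ f110 f101 f011 →
      2ℤ * ((1ℤ - 0ℤ * 0ℤ) * (1ℤ * f110 + 1ℤ * f101) + (1ℤ + 0ℤ * 0ℤ) * (2ℤ * f011))
      ≡ (1ℤ * ((1ℤ - 0ℤ * 0ℤ) * (2ℤ * f110) + (1ℤ + 0ℤ * 0ℤ) * (2ℤ * f011 + 1ℤ * f101)) + 1ℤ * ((1ℤ - 0ℤ - (1ℤ + 0ℤ) * 0ℤ) * (1ℤ * f101 + 2ℤ * f011)))
    lem = solve-∀ ring
ice-yangBaxter true false true F = lem (F true true false) (F true false true) (F false true true)
  where
  opaque
    unfolding ℤ
    lem : ∀ f110 f101 f011 →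
      (1ℤ * ((1ℤ - 0ℤ - (1ℤ + 0ℤ) * 0ℤ) * (2ℤ * f101 + 2ℤ * f110)) + 2ℤ * ((2ℤ * (1ℤ - 0ℤ * 0ℤ)) * (2ℤ * f011) + (1ℤ * 1ℤ + 0ℤ * 0ℤ) * (1ℤ * f110 + 1ℤ * f101)))
      ≡ (2ℤ * ((1ℤ - 0ℤ - (1ℤ + 0ℤ) * 0ℤ) * (1ℤ * f101 + 2ℤ * f011)) + 2ℤ * ((1ℤ - 0ℤ * 0ℤ) * (2ℤ * f110) + (1ℤ + 0ℤ * 0ℤ) * (2ℤ * f011 + 1ℤ * f101)))
    lem = solve-∀ ring
ice-yangBaxter true false false F = lem (F true false false) (F false true false) (F false false true)
  where
  opaque
    unfolding ℤ
    lem : ∀ f100 f010 f001 →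
      (1ℤ * ((1ℤ - 0ℤ * 0ℤ) * (2ℤ * f100) + (1ℤ + 0ℤ * 0ℤ) * (2ℤ * f001 + 2ℤ * f010)) + 2ℤ * ((1ℤ - 0ℤ - (1ℤ + 0ℤ) * 0ℤ) * (1ℤ * f010 + 1ℤ * f001)))
      ≡ 2ℤ * ((1ℤ - 0ℤ * 0ℤ) * (1ℤ * f100 + 2ℤ * f010) + (1ℤ + 0ℤ * 0ℤ) * (2ℤ * f001))
    lem = solve-∀ ring
ice-yangBaxter false true true F = lem (F true true false) (F true false true) (F false true true)
  where
  opaque
    unfolding ℤ
    lem : ∀ f110 f101 f011 →
      (2ℤ * ((2ℤ * (1ℤ - 0ℤ * 0ℤ)) * (2ℤ * f011) + (1ℤ * 1ℤ + 0ℤ * 0ℤ) * (1ℤ * f110 + 1ℤ * f101)) + 1ℤ * ((1ℤ - 0ℤ - (1ℤ + 0ℤ) * 0ℤ) * (2ℤ * f101 + 2ℤ * f110)))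
      ≡ 2ℤ * ((2ℤ * (1ℤ - 0ℤ * 0ℤ)) * (2ℤ * f011 + 1ℤ * f101) + (1ℤ * 1ℤ + 0ℤ * 0ℤ) * (2ℤ * f110))
    lem = solve-∀ ring
ice-yangBaxter false true false F = lem (F true false false) (F false true false) (F false false true)
  where
  opaque
    unfolding ℤ
    lem : ∀ f100 f010 f001 →
      (2ℤ * ((1ℤ - 0ℤ - (1ℤ + 0ℤ) * 0ℤ) * (1ℤ * f010 + 1ℤ * f001)) + 1ℤ * ((1ℤ - 0ℤ * 0ℤ) * (2ℤ * f100) + (1ℤ + 0ℤ * 0ℤ) * (2ℤ * f001 + 2ℤ * f010)))
      ≡ (1ℤ * ((1ℤ - 0ℤ - (1ℤ + 0ℤ) * 0ℤ) * (2ℤ * f010 + 1ℤ * f100)) + 1ℤ * ((2ℤ * (1ℤ - 0ℤ * 0ℤ)) * (2ℤ * f001) + (1ℤ * 1ℤ + 0ℤ * 0ℤ) * (1ℤ * f100 + 2ℤ * f010)))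
    lem = solve-∀ ring
ice-yangBaxter false false true F = lem (F true false false) (F false true false) (F false false true)
  where
  opaque
    unfolding ℤ
    lem : ∀ f100 f010 f001 →
      2ℤ * ((2ℤ * (1ℤ - 0ℤ * 0ℤ)) * (2ℤ * f001 + 2ℤ * f010) + (1ℤ * 1ℤ + 0ℤ * 0ℤ) * (2ℤ * f100))
      ≡ (2ℤ * ((2ℤ * (1ℤ - 0ℤ * 0ℤ)) * (2ℤ * f001) + (1ℤ * 1ℤ + 0ℤ * 0ℤ) * (1ℤ * f100 + 2ℤ * f010)) + 2ℤ * ((1ℤ - 0ℤ - (1ℤ + 0ℤ) * 0ℤ) * (2ℤ * f010 + 1ℤ * f100)))
    lem = solve-∀ ring
ice-yangBaxter false false false F = lem (F false false false)
  where
  opaque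
    unfolding ℤ
    lem : ∀ f000 →
      2ℤ * ((1ℤ - 0ℤ - (1ℤ + 0ℤ) * 0ℤ) * (2ℤ * f000))
      ≡ 2ℤ * ((1ℤ - 0ℤ - (1ℤ + 0ℤ) * 0ℤ) * (2ℤ * f000))
    lem = solve-∀ ring

-- The vertex (x , y) lies on the diagonal line x + y. `vertexV` is the resolved triple crossing,
-- `vertexA` the crossing left when the diagonal line has been moved away.
vertexA vertexV : ℕ → ℕ → Operator
vertexA x y = SixVertex₀.cell 1ℤ 0ℤ x y

crossB crossC : ℕ → ℕ → Operator
crossB y s = R hd (hor y) (dia s)
crossC x s = R dv (dia s) (ver x)

vertexV x y = crossB y (x ℕ.+ y) ⊙ vertexA x y ⊙ crossC x (x ℕ.+ y)

data Crossing : Set where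
  horizontal vertical : ℕ → ℕ → Crossing

cross : Crossing → Operator
cross (horizontal y s) = crossB y s
cross (vertical x s) = crossC x s

crosses : List Crossing → Operator
crosses [] = 𝟙
crosses (k ∷ ks) = cross k ⊙ crosses ks

crosses-++ : ∀ ks ls f s → ap (act (crosses (ks ++ ls)) f) s ≡ ap (act (crosses ks) (act (crosses ls) f)) s
crosses-++ [] ls f s = refl
crosses-++ (k ∷ ks) ls f s = appᴼ (⊙-congʳ (cross k) {crosses (ks ++ ls)} {crosses ks ⊙ crosses ls} (opwise (crosses-++ ks ls))) f s

along : ℕ → List ℕ → List Crossing
along s ys = map (λ y → horizontal y s) ys

down-along : ℕ → List ℕ → List Crossing
down-along s xs = map (λ x → vertical x s) xs

exchange : ∀ x y s → crossC x s ⊙ vertexA x y ⊙ crossB y s ≈ᴼ crossB y s ⊙ vertexA x y ⊙ crossC x s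
exchange x y s .appᴼ f t = sym (appᴼ (R-yangBaxter {hd} {hv} {dv} {hor y} {dia s} {ver x} (λ ()) (λ ()) (λ ()) ice-yangBaxter) f t)

vertexA-crossB : ∀ {x y y′ s} → y ≢ y′ → Commute (vertexA x y) (crossB y′ s)
vertexA-crossB ne = R-comm _ _ (λ { refl → ne refl }) (λ ()) (λ ()) (λ ())

vertexA-crossC : ∀ {x x′ y s} → x ≢ x′ → Commute (vertexA x y) (crossC x′ s)
vertexA-crossC ne = R-comm _ _ (λ ()) (λ ()) (λ ()) (λ { refl → ne refl })

commute-⊙ˡ : ∀ {P Q S} → Commute P S → Commute Q S → Commute (P ⊙ Q) S
commute-⊙ˡ {P} {Q} {S} c c′ .appᴼ f s = trans (appᴼ (⊙-congʳ P c′) f s) (appᴼ c (act Q f) s)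

vertexV-crossB : ∀ {x y y′ s} → y ≢ y′ → x ℕ.+ y ≢ s → Commute (vertexV x y) (crossB y′ s)
vertexV-crossB {x} {y} ny ns = commute-⊙ˡ {crossB y (x ℕ.+ y)} (R-comm _ _ (λ { refl → ny refl }) (λ ()) (λ ()) (λ { refl → ns refl }))
  (commute-⊙ˡ {vertexA x y} (vertexA-crossB ny) (R-comm _ _ (λ ()) (λ { refl → ns refl }) (λ ()) (λ ())))

vertexV-crossC : ∀ {x x′ y s} → x ≢ x′ → x ℕ.+ y ≢ s → Commute (vertexV x y) (crossC x′ s)
vertexV-crossC {x} {x′} {y} nx ns = commute-⊙ˡ {crossB y (x ℕ.+ y)} (R-comm _ _ (λ ()) (λ ()) (λ { refl → ns refl }) (λ ()))
  (commute-⊙ˡ {vertexA x y} (vertexA-crossC nx) (R-comm _ _ (λ { refl → ns refl }) (λ ()) (λ ()) (λ { refl → nx refl })))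

columnOf : (ℕ → ℕ → Operator) → ℕ → List ℕ → Operator
columnOf g x [] = 𝟙
columnOf g x (y ∷ ys) = g x y ⊙ columnOf g x ys

gridOf : (ℕ → ℕ → Operator) → List ℕ → List ℕ → Operator
gridOf g ys [] = 𝟙
gridOf g ys (x ∷ xs) = columnOf g x ys ⊙ gridOf g ys xs

within : ∀ P {Q Q′} S → Q ≈ᴼ Q′ → ∀ f s → ap (act P (act Q (act S f))) s ≡ ap (act P (act Q′ (act S f))) s
within P S e f s = appᴼ (⊙-congʳ P e) (act S f) s

commute-along : ∀ {P s} ys → (∀ y → y ∈ ys → Commute P (crossB y s)) → Commute P (crosses (along s ys))
commute-along [] c = opwise λ f s → refl
commute-along {s = s} (y ∷ ys) c = slide (c y (here refl)) (commute-along ys (λ y′ m → c y′ (there m)))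

commute-down : ∀ {P s} xs → (∀ x → x ∈ xs → Commute P (crossC x s)) → Commute P (crosses (down-along s xs))
commute-down [] c = opwise λ f s → refl
commute-down (x ∷ xs) c = slide (c x (here refl)) (commute-down xs (λ x′ m → c x′ (there m)))

column-commute : ∀ {g P x} ys → (∀ y → y ∈ ys → Commute (g x y) P) → Commute (columnOf g x ys) P
column-commute [] c = opwise λ f s → refl
column-commute {g} {P} {x} (y ∷ ys) c = commute-⊙ˡ {g x y} (c y (here refl)) (column-commute ys (λ y′ m → c y′ (there m)))

grid-commute : ∀ {g P ys} xs → (∀ x → x ∈ xs → ∀ y → y ∈ ys → Commute (g x y) P) → Commute (gridOf g ys xs) P
grid-commute [] c = opwise λ f s → refl
grid-commute {g} {P} {ys} (x ∷ xs) c = commute-⊙ˡ {columnOf g x ys} (column-commute ys (c x (here refl)))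
  (grid-commute xs (λ x′ m → c x′ (there m)))

column-cong : ∀ {g g′ : ℕ → ℕ → Operator} {x} ys → (∀ y → y ∈ ys → g x y ≡ g′ x y) → columnOf g x ys ≡ columnOf g′ x ys
column-cong [] e = refl
column-cong (y ∷ ys) e = cong₂ _⊙_ (e y (here refl)) (column-cong ys (λ y′ m → e y′ (there m)))

grid-cong : ∀ {g g′ : ℕ → ℕ → Operator} {ys} xs → (∀ x → x ∈ xs → ∀ y → y ∈ ys → g x y ≡ g′ x y) → gridOf g ys xs ≡ gridOf g′ ys xs
grid-cong [] e = refl
grid-cong {ys = ys} (x ∷ xs) e = cong₂ _⊙_ (column-cong ys (e x (here refl))) (grid-cong xs (λ x′ m → e x′ (there m)))

column-++ : ∀ g x ys zs f s → ap (act (columnOf g x (ys ++ zs)) f) s ≡ ap (act (columnOf g x ys) (act (columnOf g x zs) f)) s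
column-++ g x [] zs f s = refl
column-++ g x (y ∷ ys) zs f s = appᴼ (⊙-congʳ (g x y) {columnOf g x (ys ++ zs)} {columnOf g x ys ⊙ columnOf g x zs} (opwise (column-++ g x ys zs))) f s

grid-++ : ∀ g ys xs xs′ f s → ap (act (gridOf g ys (xs ++ xs′)) f) s ≡ ap (act (gridOf g ys xs) (act (gridOf g ys xs′) f)) s
grid-++ g ys [] xs′ f s = refl
grid-++ g ys (x ∷ xs) xs′ f s = appᴼ (⊙-congʳ (columnOf g x ys) {gridOf g ys (xs ++ xs′)} {gridOf g ys xs ⊙ gridOf g ys xs′} (opwise (grid-++ g ys xs xs′))) f s

-- A diagonal line that crosses the column x above the rows ys, and then these rows behind the
-- column, is moved over the vertices one by one with `exchange`: it then crosses the rows in front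
-- of the column and the column below them.
train : ∀ x s ys → Unique ys →
  crossC x s ⊙ columnOf vertexA x ys ⊙ crosses (along s ys) ≈ᴼ crosses (along s ys) ⊙ columnOf vertexA x ys ⊙ crossC x s
train x s [] u = opwise λ f t → refl
train x s (y ∷ ys) (a ∷ u) .appᴼ f t = begin
  ap (act Cx (act Ay (act cA (act By (act bs f))))) t
    ≡⟨ within (Cx ⊙ Ay) bs (column-commute {vertexA} {By} {x} ys (λ y′ m → vertexA-crossB (λ e → All.lookup a m (sym e)))) f t ⟩
  ap (act Cx (act Ay (act By (act cA (act bs f))))) t
    ≡⟨ appᴼ (exchange x y s) (act cA (act bs f)) t ⟩
  ap (act By (act Ay (act Cx (act cA (act bs f))))) t
    ≡⟨ within (By ⊙ Ay) 𝟙 (train x s ys u) f t ⟩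
  ap (act By (act Ay (act bs (act cA (act Cx f))))) t
    ≡⟨ within By (cA ⊙ Cx) (commute-along {Ay} ys (λ y′ m → vertexA-crossB (All.lookup a m))) f t ⟩
  ap (act By (act bs (act Ay (act cA (act Cx f))))) t ∎
  where
  open ≡-Reasoning
  Cx Ay By cA bs : Operator
  Cx = crossC x s
  Ay = vertexA x y
  By = crossB y s
  cA = columnOf vertexA x ys
  bs = crosses (along s ys)

module _ {g g′ : ℕ → ℕ → Operator} {x s y : ℕ} (x+y≡s : x ℕ.+ y ≡ s) (diagonal : g x y ≡ vertexV x y) (diagonal′ : g′ x y ≡ vertexA x y) where

  -- The line s runs through the vertex at y and, behind the column x, through the rows ls below it.
  -- `train` moves it in front of the column, where it crosses y and ls; then it crosses the column
  -- at its lower end.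
  lower-column : ∀ ts ls → Unique (y ∷ ls) → (∀ l → l ∈ ls → g x l ≡ vertexA x l × g′ x l ≡ vertexA x l) →
    (∀ t → t ∈ ts → g x t ≡ g′ x t × (∀ y′ → y′ ∈ y ∷ ls → Commute (g x t) (crossB y′ s))) →
    columnOf g x (ts ++ y ∷ ls) ⊙ crosses (along s ls) ≈ᴼ crosses (along s (y ∷ ls)) ⊙ columnOf g′ x (ts ++ y ∷ ls) ⊙ crossC x s
  lower-column [] ls (a ∷ u) low top .appᴼ f t
    rewrite diagonal | diagonal′ | column-cong {g} {vertexA} {x} ls (λ l m → proj₁ (low l m))
          | column-cong {g′} {vertexA} {x} ls (λ l m → proj₂ (low l m)) | x+y≡s = trans
    (within (crossB y s ⊙ vertexA x y) 𝟙 (train x s ls u) f t)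
    (within (crossB y s) (columnOf vertexA x ls ⊙ crossC x s) (commute-along {vertexA x y} ls (λ y′ m → vertexA-crossB (All.lookup a m))) f t)
  lower-column (z ∷ ts) ls u low top .appᴼ f t = trans
    (appᴼ (⊙-congʳ (g x z) (lower-column ts ls u low (λ t′ m → top t′ (there m)))) f t)
    (trans (appᴼ (commute-along {g x z} (y ∷ ls) (proj₂ (top z (here refl)))) (act (columnOf g′ x (ts ++ y ∷ ls)) (act (crossC x s) f)) t)
      (cong (λ P → ap (act (crosses (along s (y ∷ ls))) (act P (act (columnOf g′ x (ts ++ y ∷ ls)) (act (crossC x s) f)))) t)
        (proj₁ (top z (here refl)))))

  -- The counterpart at the other end: the line s, which crosses the rows ts above y in front of the
  -- column x, is moved to the upper end of the column and then crosses these rows and y behind it.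
  upper-column : ∀ ts ls → Unique (ts ++ y ∷ []) → (∀ t → t ∈ ts → g x t ≡ vertexA x t × g′ x t ≡ vertexA x t) →
    (∀ l → l ∈ ls → g x l ≡ g′ x l × (∀ y′ → y′ ∈ ts ++ y ∷ [] → Commute (g′ x l) (crossB y′ s))) →
    crosses (along s ts) ⊙ columnOf g x (ts ++ y ∷ ls) ≈ᴼ crossC x s ⊙ columnOf g′ x (ts ++ y ∷ ls) ⊙ crosses (along s (ts ++ y ∷ []))
  upper-column ts ls u top low .appᴼ f t = begin
    ap (act bs (act (columnOf g x (ts ++ y ∷ ls)) f)) t
      ≡⟨ appᴼ (⊙-congʳ bs {columnOf g x (ts ++ y ∷ ls)} {columnOf g x ts ⊙ g x y ⊙ columnOf g x ls} (opwise (column-++ g x ts (y ∷ ls)))) f t ⟩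
    ap (act bs (act (columnOf g x ts) (act (g x y) (act (columnOf g x ls) f)))) t
      ≡⟨ cong₂ (λ P Q → ap (act bs (act P (act (g x y) (act Q f)))) t) (column-cong ts (λ t′ m → proj₁ (top t′ m)))
           (column-cong ls (λ l m → proj₁ (low l m))) ⟩
    ap (act bs (act cA (act (g x y) (act cL f)))) t
      ≡⟨ cong (λ P → ap (act bs (act cA (act P (act cL f)))) t) (trans diagonal (cong (λ k → crossB y k ⊙ vertexA x y ⊙ crossC x k) x+y≡s)) ⟩
    ap (act bs (act cA (act (crossB y s ⊙ vertexA x y ⊙ crossC x s) (act cL f)))) t
      ≡⟨ sym (within (bs ⊙ cA) cL (exchange x y s) f t) ⟩
    ap (act bs (act cA (act (crossC x s) (act (vertexA x y) (act (crossB y s) (act cL f)))))) t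
      ≡⟨ sym (appᴼ (train x s ts (unique-init ts u)) (act (vertexA x y) (act (crossB y s) (act cL f))) t) ⟩
    ap (act (crossC x s) (act cA (act bs (act (vertexA x y) (act (crossB y s) (act cL f)))))) t
      ≡⟨ within (crossC x s ⊙ cA) (crossB y s ⊙ cL) (commute-sym {vertexA x y} (commute-along {vertexA x y} ts (λ y′ m → vertexA-crossB (λ e → unique-last ts u m (sym e))))) f t ⟩
    ap (act (crossC x s) (act cA (act (vertexA x y) (act bs (act (crossB y s) (act cL f)))))) t
      ≡⟨ appᴼ (⊙-congʳ (crossC x s ⊙ cA ⊙ vertexA x y) {bs ⊙ crossB y s} {crosses (along s (ts ++ y ∷ []))}
           (opwise λ f t → sym (trans (cong (λ l → ap (act (crosses l) f) t) (map-++ (λ y → horizontal y s) ts (y ∷ [])))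
             (crosses-++ (along s ts) (along s (y ∷ [])) f t)))) (act cL f) t ⟩
    ap (act (crossC x s) (act cA (act (vertexA x y) (act (crosses (along s (ts ++ y ∷ []))) (act cL f))))) t
      ≡⟨ within (crossC x s ⊙ cA ⊙ vertexA x y) 𝟙 (commute-sym {cL} (commute-along {cL} (ts ++ y ∷ [])
           (λ y′ m → column-commute {g′} {crossB y′ s} {x} ls (λ l ml → proj₂ (low l ml) y′ m)))) f t ⟩
    ap (act (crossC x s) (act cA (act (vertexA x y) (act cL (act (crosses (along s (ts ++ y ∷ []))) f))))) t
      ≡⟨ cong₂ (λ P Q → ap (act (crossC x s) (act P (act Q (act cL (act (crosses (along s (ts ++ y ∷ []))) f))))) t)
           (sym (column-cong ts (λ t′ m → proj₂ (top t′ m)))) (sym diagonal′) ⟩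
    ap (act (crossC x s) (act (columnOf g′ x ts) (act (g′ x y) (act cL (act (crosses (along s (ts ++ y ∷ []))) f))))) t
      ≡⟨ sym (within (crossC x s) {columnOf g′ x (ts ++ y ∷ ls)} {columnOf g′ x ts ⊙ g′ x y ⊙ cL} (crosses (along s (ts ++ y ∷ [])))
           (opwise (column-++ g′ x ts (y ∷ ls))) f t) ⟩
    ap (act (crossC x s) (act (columnOf g′ x (ts ++ y ∷ ls)) (act (crosses (along s (ts ++ y ∷ []))) f))) t ∎
    where
    open ≡-Reasoning
    bs cA cL : Operator
    bs = crosses (along s ts)
    cA = columnOf vertexA x ts
    cL = columnOf g′ x ls
    unique-init : ∀ ts → Unique (ts ++ y ∷ []) → Unique ts
    unique-init [] _ = []
    unique-init (t ∷ ts) (a ∷ u) = All.tabulate (λ m → All.lookup a (∈-++⁺ˡ m)) ∷ unique-init ts u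
    unique-last : ∀ ts → Unique (ts ++ y ∷ []) → ∀ {t} → t ∈ ts → t ≢ y
    unique-last (t ∷ ts) (a ∷ u) (here refl) = All.lookup a (∈-++⁺ʳ ts (here refl))
    unique-last (t ∷ ts) (a ∷ u) (there m) = unique-last ts u m

≤ᵇ-true : ∀ {m n} → m ℕ.≤ n → (m ℕ.≤ᵇ n) ≡ true
≤ᵇ-true {m} {n} l with m ℕ.≤ᵇ n | ℕₚ.≤⇒≤ᵇ l
... | true | _ = refl

≤ᵇ-false : ∀ {m n} → n ℕ.< m → (m ℕ.≤ᵇ n) ≡ false
≤ᵇ-false {m} {n} l with m ℕ.≤ᵇ n in e
... | false = refl
... | true = ⊥-elim (ℕₚ.<⇒≱ l (ℕₚ.≤ᵇ⇒≤ m n (subst T (sym e) tt)))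

-- Rows are listed from top to bottom, the order in which a path in a column meets them.
down : ℕ → List ℕ
down zero = []
down (suc n) = suc n ∷ down n

down-≤ : ∀ {n y} → y ∈ down n → y ℕ.≤ n
down-≤ {suc n} (here refl) = ℕₚ.≤-refl
down-≤ {suc n} (there m) = ℕₚ.m≤n⇒m≤1+n (down-≤ m)

down-pos : ∀ {n y} → y ∈ down n → 1 ℕ.≤ y
down-pos {suc n} (here refl) = s≤s z≤n
down-pos {suc n} (there m) = down-pos m

down-unique : ∀ n → Unique (down n)
down-unique zero = []
down-unique (suc n) = All.tabulate (λ { m refl → ℕₚ.1+n≰n (down-≤ m) }) ∷ down-unique n

range-≥ : ∀ {m n j} → j ∈ range m n → m ℕ.≤ j
range-≥ {m} {n} p = All.lookup (range-above m n) p

range-< : ∀ {m n j} → j ∈ range m n → j ℕ.< m ℕ.+ n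
range-< {m} {suc n} (here refl) = ℕₚ.m<m+n m (s≤s z≤n)
range-< {m} {suc n} {j} (there p) = subst (j ℕ.<_) (sym (ℕₚ.+-suc m n)) (range-< p)

range-∈ : ∀ {m n j} → m ℕ.≤ j → j ℕ.< m ℕ.+ n → j ∈ range m n
range-∈ {m} {zero} {j} l u = ⊥-elim (ℕₚ.<⇒≱ u (subst (ℕ._≤ j) (sym (ℕₚ.+-identityʳ m)) l))
range-∈ {m} {suc n} {j} l u with m ℕₚ.≟ j
... | yes refl = here refl
... | no ne = there (range-∈ (ℕₚ.≤∧≢⇒< l ne) (subst (j ℕ.<_) (ℕₚ.+-suc m n) u))

range-++ : ∀ m n k → range m (n ℕ.+ k) ≡ range m n ++ range (m ℕ.+ n) k
range-++ m zero k = cong (λ t → range t k) (sym (ℕₚ.+-identityʳ m))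
range-++ m (suc n) k = cong (m ∷_) (trans (range-++ (suc m) n k) (cong (λ t → range (suc m) n ++ range t k) (sym (ℕₚ.+-suc m n))))

down-range : ∀ n → down n ↭ range 1 n
down-range zero = ↭.refl
down-range (suc n) = ↭.trans (↭.prep _ (down-range n)) (↭.trans (↭ₚ.∷↭∷ʳ (suc n) (range 1 n))
  (↭.↭-reflexive (trans (sym (range-++ 1 n 1)) (cong (range 1) (ℕₚ.+-comm n 1)))))

-- Vertices on a diagonal at most lo or at least hi have already lost their diagonal line.
cellAt : ℕ → ℕ → ℕ → ℕ → Operator
cellAt lo hi x y = if (x ℕ.+ y ℕ.≤ᵇ lo) ∨ (hi ℕ.≤ᵇ x ℕ.+ y) then vertexA x y else vertexV x y

∨-true : ∀ b → b ∨ true ≡ true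
∨-true true = refl
∨-true false = refl

module _ {lo hi x y : ℕ} where

  cellAt-lo : x ℕ.+ y ℕ.≤ lo → cellAt lo hi x y ≡ vertexA x y
  cellAt-lo l rewrite ≤ᵇ-true l = refl

  cellAt-hi : hi ℕ.≤ x ℕ.+ y → cellAt lo hi x y ≡ vertexA x y
  cellAt-hi l rewrite ≤ᵇ-true l | ∨-true (x ℕ.+ y ℕ.≤ᵇ lo) = refl

  cellAt-mid : lo ℕ.< x ℕ.+ y → x ℕ.+ y ℕ.< hi → cellAt lo hi x y ≡ vertexV x y
  cellAt-mid l h rewrite ≤ᵇ-false l | ≤ᵇ-false h = refl

  cellAt-B : ∀ {y′ s} → y ≢ y′ → x ℕ.+ y ≢ s → Commute (cellAt lo hi x y) (crossB y′ s)
  cellAt-B ny ns with (x ℕ.+ y ℕ.≤ᵇ lo) ∨ (hi ℕ.≤ᵇ x ℕ.+ y)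
  ... | true = vertexA-crossB ny
  ... | false = vertexV-crossB ny ns

  cellAt-C : ∀ {x′ s} → x ≢ x′ → x ℕ.+ y ≢ s → Commute (cellAt lo hi x y) (crossC x′ s)
  cellAt-C nx ns with (x ℕ.+ y ℕ.≤ᵇ lo) ∨ (hi ℕ.≤ᵇ x ℕ.+ y)
  ... | true = vertexA-crossC nx
  ... | false = vertexV-crossC nx ns

cellAt-agree-lo : ∀ {lo hi} x y → x ℕ.+ y ≢ suc lo → cellAt lo hi x y ≡ cellAt (suc lo) hi x y
cellAt-agree-lo {lo} {hi} x y ne = cong (λ b → if b ∨ (hi ℕ.≤ᵇ x ℕ.+ y) then vertexA x y else vertexV x y) go
  where
  go : (x ℕ.+ y ℕ.≤ᵇ lo) ≡ (x ℕ.+ y ℕ.≤ᵇ suc lo)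
  go with x ℕ.+ y ℕₚ.≤? lo
  ... | yes l = trans (≤ᵇ-true l) (sym (≤ᵇ-true (ℕₚ.m≤n⇒m≤1+n l)))
  ... | no nl = trans (≤ᵇ-false (ℕₚ.≰⇒> nl)) (sym (≤ᵇ-false (ℕₚ.≤∧≢⇒< (ℕₚ.≰⇒> nl) (ne ∘ sym))))

cellAt-agree-hi : ∀ {lo s} x y → x ℕ.+ y ≢ s → cellAt lo (suc s) x y ≡ cellAt lo s x y
cellAt-agree-hi {lo} {s} x y ne = cong (λ b → if (x ℕ.+ y ℕ.≤ᵇ lo) ∨ b then vertexA x y else vertexV x y) go
  where
  go : (suc s ℕ.≤ᵇ x ℕ.+ y) ≡ (s ℕ.≤ᵇ x ℕ.+ y)
  go with s ℕₚ.≤? x ℕ.+ y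
  ... | yes l = trans (≤ᵇ-true (ℕₚ.≤∧≢⇒< l (ne ∘ sym))) (sym (≤ᵇ-true l))
  ... | no nl = trans (≤ᵇ-false (s≤s (ℕₚ.<⇒≤ (ℕₚ.≰⇒> nl)))) (sym (≤ᵇ-false (ℕₚ.≰⇒> nl)))

gap : ℕ → ℕ → List ℕ
gap m zero = []
gap m (suc k) = suc (m ℕ.+ k) ∷ gap m k

gap-> : ∀ {m k t} → t ∈ gap m k → m ℕ.< t
gap-> {m} {suc k} (here refl) = s≤s (ℕₚ.m≤m+n m k)
gap-> {m} {suc k} (there p) = gap-> p

down-gap : ∀ m k → down (m ℕ.+ k) ≡ gap m k ++ down m
down-gap m zero = cong down (ℕₚ.+-identityʳ m)
down-gap m (suc k) = trans (cong down (ℕₚ.+-suc m k)) (cong (suc (m ℕ.+ k) ∷_) (down-gap m k))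

module Lower (n s hi : ℕ) (s<hi : suc s ℕ.< hi) where
  g g′ : ℕ → ℕ → Operator
  g = cellAt s hi
  g′ = cellAt (suc s) hi

  g′-C : ∀ {x y x′} → x ≢ x′ → Commute (g′ x y) (crossC x′ (suc s))
  g′-C {x} {y} {x′} nx with x ℕ.+ y ℕₚ.≟ suc s
  ... | yes e = subst (λ P → Commute P (crossC x′ (suc s))) (sym (cellAt-lo {suc s} {hi} {x} {y} (ℕₚ.≤-reflexive e))) (vertexA-crossC nx)
  ... | no ne = cellAt-C {suc s} {hi} nx ne

  -- The column x meets the line s + 1 in the row m. By induction the part of the line to the right
  -- has been moved in front of the later columns, which is directly behind the column x, where
  -- `lower-column` takes it up.
  lower-grid : ∀ m x j → m ℕ.≤ j → m ℕ.≤ n → x ℕ.+ m ≡ suc s →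
    gridOf g (down n) (range x j) ≈ᴼ crosses (along (suc s) (down m)) ⊙ gridOf g′ (down n) (range x j) ⊙ crosses (down-along (suc s) (range x m))
  lower-grid zero x j _ _ e = opwise λ f t → cong (λ P → ap (act P f) t) (grid-cong (range x j) λ x′ mx y my →
    cellAt-agree-lo {s} {hi} x′ y λ e′ → ℕₚ.<-irrefl (trans (sym (ℕₚ.+-identityʳ x)) (trans e (sym e′)))
      (ℕₚ.≤-trans (ℕₚ.≤-reflexive (ℕₚ.+-comm 1 x)) (ℕₚ.+-mono-≤ (range-≥ mx) (down-pos my))))
  lower-grid (suc m) x (suc j) (s≤s m≤j) m<n e .appᴼ f t = begin
    ap (act (columnOf g x (down n)) (act (gridOf g (down n) (range (suc x) j)) f)) t
      ≡⟨ appᴼ (⊙-congʳ (columnOf g x (down n)) (lower-grid m (suc x) j m≤j (ℕₚ.<⇒≤ m<n) (trans (sym (ℕₚ.+-suc x m)) e))) f t ⟩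
    ap (act (columnOf g x (down n)) (act (crosses (along (suc s) (down m))) (act grid′ (act Cs f)))) t
      ≡⟨ cong (λ l → ap (act (columnOf g x l) (act (crosses (along (suc s) (down m))) (act grid′ (act Cs f)))) t) split ⟩
    ap (act (columnOf g x (gap (suc m) k ++ suc m ∷ down m)) (act (crosses (along (suc s) (down m))) (act grid′ (act Cs f)))) t
      ≡⟨ appᴼ (lower-column {g} {g′} {x} {suc s} {suc m} e
           (cellAt-mid {s} {hi} (ℕₚ.≤-reflexive (sym e)) (subst (ℕ._< hi) (sym e) s<hi)) (cellAt-lo {suc s} {hi} (ℕₚ.≤-reflexive e))
           (gap (suc m) k) (down m) (down-unique (suc m)) low top) (act grid′ (act Cs f)) t ⟩
    ap (act (crosses (along (suc s) (down (suc m)))) (act (columnOf g′ x (gap (suc m) k ++ suc m ∷ down m)) (act (crossC x (suc s)) (act grid′ (act Cs f))))) t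
      ≡⟨ cong (λ l → ap (act (crosses (along (suc s) (down (suc m)))) (act (columnOf g′ x l) (act (crossC x (suc s)) (act grid′ (act Cs f))))) t) (sym split) ⟩
    ap (act (crosses (along (suc s) (down (suc m)))) (act (columnOf g′ x (down n)) (act (crossC x (suc s)) (act grid′ (act Cs f))))) t
      ≡⟨ sym (within (crosses (along (suc s) (down (suc m))) ⊙ columnOf g′ x (down n)) Cs
           (grid-commute {g′} {crossC x (suc s)} {down n} (range (suc x) j) (λ x′ mx y _ → g′-C (λ e → ℕₚ.<-irrefl (sym e) (range-≥ mx)))) f t) ⟩
    _ ∎
    where
    open ≡-Reasoning
    k : ℕ
    k = n ℕ.∸ suc m
    split : down n ≡ gap (suc m) k ++ suc m ∷ down m
    split = trans (cong down (sym (ℕₚ.m+[n∸m]≡n m<n))) (down-gap (suc m) k)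
    grid′ Cs : Operator
    grid′ = gridOf g′ (down n) (range (suc x) j)
    Cs = crosses (down-along (suc s) (range (suc x) m))
    low : ∀ l → l ∈ down m → g x l ≡ vertexA x l × g′ x l ≡ vertexA x l
    low l ml = cellAt-lo {s} {hi} below , cellAt-lo {suc s} {hi} (ℕₚ.m≤n⇒m≤1+n below)
      where
      below : x ℕ.+ l ℕ.≤ s
      below = ℕₚ.≤-pred (subst (x ℕ.+ l ℕ.<_) e (ℕₚ.+-monoʳ-< x (s≤s (down-≤ ml))))
    top : ∀ t → t ∈ gap (suc m) k → g x t ≡ g′ x t × (∀ y′ → y′ ∈ suc m ∷ down m → Commute (g x t) (crossB y′ (suc s)))
    top t mt = cellAt-agree-lo {s} {hi} x t ne , λ y′ my → cellAt-B {s} {hi} (λ e → ℕₚ.<-irrefl (sym e) (ℕₚ.≤-<-trans (down-≤ {suc m} my) (gap-> mt))) ne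
      where
      ne : x ℕ.+ t ≢ suc s
      ne e′ = ℕₚ.<-irrefl (trans e (sym e′)) (ℕₚ.+-monoʳ-< x (gap-> mt))

module Upper (n lo s : ℕ) (lo<s : lo ℕ.< s) where
  g g′ : ℕ → ℕ → Operator
  g = cellAt lo (suc s)
  g′ = cellAt lo s

  g′-C : ∀ {x y x′} → x ≢ x′ → Commute (g′ x y) (crossC x′ s)
  g′-C {x} {y} {x′} nx with x ℕ.+ y ℕₚ.≟ s
  ... | yes e = subst (λ P → Commute P (crossC x′ s)) (sym (cellAt-hi {lo} {s} {x} {y} (ℕₚ.≤-reflexive (sym e)))) (vertexA-crossC nx)
  ... | no ne = cellAt-C {lo} {s} nx ne

  crossed : ℕ → ℕ → List ℕ → List ℕ
  crossed zero r ts = ts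
  crossed (suc j) r ts = crossed j r (ts ++ suc (j ℕ.+ r) ∷ [])

  crossed-down : ∀ j r ts → ts ++ down (j ℕ.+ r) ≡ down n → crossed j r ts ++ down r ≡ down n
  crossed-down zero r ts e = e
  crossed-down (suc j) r ts e = crossed-down j r _ (trans (++-assoc ts (suc (j ℕ.+ r) ∷ []) (down (j ℕ.+ r))) e)

  -- Here the line is carried to the right: ts are the rows that it crosses in front of the column
  -- x, and every column adds the next row below.
  upper-grid : ∀ j x r ts → ts ++ down (j ℕ.+ r) ≡ down n → (∀ t → t ∈ ts → j ℕ.+ r ℕ.< t) → x ℕ.+ (j ℕ.+ r) ≡ s →
    crosses (along s ts) ⊙ gridOf g (down n) (range x j)
      ≈ᴼ crosses (down-along s (range x j)) ⊙ gridOf g′ (down n) (range x j) ⊙ crosses (along s (crossed j r ts))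
  upper-grid zero x r ts e _ _ = opwise λ f t → refl
  upper-grid (suc j) x r ts e above es .appᴼ f t = begin
    ap (act (crosses (along s ts)) (act (columnOf g x (down n)) (act rest f))) t
      ≡⟨ cong (λ l → ap (act (crosses (along s ts)) (act (columnOf g x l) (act rest f))) t) (sym e) ⟩
    ap (act (crosses (along s ts)) (act (columnOf g x (ts ++ m ∷ down (j ℕ.+ r))) (act rest f))) t
      ≡⟨ appᴼ (upper-column {g} {g′} {x} {s} {m} es
           (cellAt-mid {lo} {suc s} (subst (lo ℕ.<_) (sym es) lo<s) (ℕₚ.≤-reflexive (cong suc es))) (cellAt-hi {lo} {s} (ℕₚ.≤-reflexive (sym es)))
           ts (down (j ℕ.+ r)) unique top low) (act rest f) t ⟩
    ap (act (crossC x s) (act (columnOf g′ x (ts ++ m ∷ down (j ℕ.+ r))) (act (crosses (along s (ts ++ m ∷ []))) (act rest f)))) t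
      ≡⟨ cong (λ l → ap (act (crossC x s) (act (columnOf g′ x l) (act (crosses (along s (ts ++ m ∷ []))) (act rest f)))) t) e ⟩
    ap (act (crossC x s) (act (columnOf g′ x (down n)) (act (crosses (along s (ts ++ m ∷ []))) (act rest f)))) t
      ≡⟨ appᴼ (⊙-congʳ (crossC x s ⊙ columnOf g′ x (down n))
           (upper-grid j (suc x) r (ts ++ m ∷ []) (trans (++-assoc ts (m ∷ []) (down (j ℕ.+ r))) e) above′
             (trans (sym (ℕₚ.+-suc x (j ℕ.+ r))) es))) f t ⟩
    ap (act (crossC x s) (act (columnOf g′ x (down n)) (act Cs (act grid′ (act Bs f))))) t
      ≡⟨ within (crossC x s) (grid′ ⊙ Bs) (column-commute {g′} {Cs} {x} (down n) (λ y _ →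
           commute-down {g′ x y} (range (suc x) j) (λ x′ mx → g′-C (λ e → ℕₚ.<-irrefl e (range-≥ mx))))) f t ⟩
    ap (act (crossC x s) (act Cs (act (columnOf g′ x (down n)) (act grid′ (act Bs f))))) t ∎
    where
    open ≡-Reasoning
    m : ℕ
    m = suc (j ℕ.+ r)
    rest grid′ Cs Bs : Operator
    rest = gridOf g (down n) (range (suc x) j)
    grid′ = gridOf g′ (down n) (range (suc x) j)
    Cs = crosses (down-along s (range (suc x) j))
    Bs = crosses (along s (crossed j r (ts ++ m ∷ [])))
    above′ : ∀ t → t ∈ ts ++ m ∷ [] → j ℕ.+ r ℕ.< t
    above′ t mt with ∈-++⁻ ts mt
    ... | inj₁ m₁ = ℕₚ.<-trans (ℕₚ.n<1+n _) (above t m₁)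
    ... | inj₂ (here refl) = ℕₚ.≤-refl
    prefix : ∀ (ts : List ℕ) {us vs} → Unique (ts ++ us ++ vs) → Unique (ts ++ us)
    prefix [] {[]} u = []
    prefix [] {_ ∷ us} (a ∷ u) = All.tabulate (λ m → All.lookup a (∈-++⁺ˡ m)) ∷ prefix [] {us} u
    prefix (t ∷ ts) {us} {vs} (a ∷ u) = All.tabulate (λ m → All.lookup a (subst (_ ∈_) (++-assoc ts us vs) (∈-++⁺ˡ m))) ∷ prefix ts u
    unique : Unique (ts ++ m ∷ [])
    unique = prefix ts {m ∷ []} {down (j ℕ.+ r)} (subst Unique (sym e) (down-unique n))
    top : ∀ t → t ∈ ts → g x t ≡ vertexA x t × g′ x t ≡ vertexA x t
    top t mt = cellAt-hi {lo} {suc s} {x} {t} after , cellAt-hi {lo} {s} {x} {t} (ℕₚ.<⇒≤ after)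
      where
      after : s ℕ.< x ℕ.+ t
      after = subst (ℕ._< x ℕ.+ t) es (ℕₚ.+-monoʳ-< x (above t mt))
    low : ∀ l → l ∈ down (j ℕ.+ r) → g x l ≡ g′ x l × (∀ y′ → y′ ∈ ts ++ m ∷ [] → Commute (g′ x l) (crossB y′ s))
    low l ml = cellAt-agree-hi {lo} {s} x l ne , λ y′ my → cellAt-B {lo} {s} (λ e → ℕₚ.<-irrefl e (ℕₚ.≤-<-trans (down-≤ ml) (above′ y′ my))) ne
      where
      ne : x ℕ.+ l ≢ s
      ne e′ = ℕₚ.<-irrefl (trans e′ (sym es)) (ℕₚ.+-monoʳ-< x (s≤s (down-≤ ml)))

InRange : ℕ → ℕ → Set
InRange n s = 2 ℕ.≤ s × s ℕ.≤ n ℕ.+ n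

-- The full lines, s ≤ S, cross the rows on the left and the columns below; the empty ones, S < s,
-- cross the columns above and the rows on the right. In all four places the two lines are in the
-- same state.
LeftOK RightOK : ℕ → ℕ → Crossing → Set
LeftOK n S (horizontal y s) = y ∈ down n × InRange n s × s ℕ.≤ S
LeftOK n S (vertical x s) = x ∈ range 1 n × InRange n s × S ℕ.< s
RightOK n S (horizontal y s) = y ∈ down n × InRange n s × S ℕ.< s
RightOK n S (vertical x s) = x ∈ range 1 n × InRange n s × s ℕ.≤ S

record Unravelled (n S : ℕ) (P Q : Operator) : Set where
  field
    left right : List Crossing
    left-ok    : All (LeftOK n S) left
    right-ok   : All (RightOK n S) right
    equal      : P ≈ᴼ crosses left ⊙ Q ⊙ crosses right
open Unravelled

unravelled-refl : ∀ {n S P} → Unravelled n S P P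
unravelled-refl = record { left = [] ; right = [] ; left-ok = [] ; right-ok = [] ; equal = opwise λ f s → refl }

unravelled-trans : ∀ {n S P Q U} → Unravelled n S P Q → Unravelled n S Q U → Unravelled n S P U
unravelled-trans {P = P} {Q} {U} u v = record
  { left = left u ++ left v ; right = right v ++ right u
  ; left-ok = Allₚ.++⁺ (left-ok u) (left-ok v) ; right-ok = Allₚ.++⁺ (right-ok v) (right-ok u)
  ; equal = opwise λ f s → trans (appᴼ (equal u) f s) (trans (within (crosses (left u)) (crosses (right u)) (equal v) f s)
      (trans (appᴼ (⊙-congʳ (crosses (left u) ⊙ crosses (left v) ⊙ U) {crosses (right v) ⊙ crosses (right u)} {crosses (right v ++ right u)}
               (opwise λ f s → sym (crosses-++ (right v) (right u) f s))) f s)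
        (sym (crosses-++ (left u) (left v) (act U (act (crosses (right v ++ right u)) f)) s)))) }

down-∈ : ∀ {n y} → 1 ℕ.≤ y → y ℕ.≤ n → y ∈ down n
down-∈ {zero} l u = ⊥-elim (ℕₚ.<⇒≱ l u)
down-∈ {suc n} {y} l u with y ℕₚ.≟ suc n
... | yes refl = here refl
... | no ne = there (down-∈ l (ℕₚ.≤-pred (ℕₚ.≤∧≢⇒< u ne)))

all-map : ∀ {A B : Set} {P : B → Set} {f : A → B} xs → (∀ x → x ∈ xs → P (f x)) → All P (map f xs)
all-map [] h = []
all-map (x ∷ xs) h = h x (here refl) ∷ all-map xs (λ y m → h y (there m))

square : (ℕ → ℕ → Operator) → ℕ → Operator
square g n = gridOf g (down n) (range 1 n)

lower-step : ∀ {n S hi} s → 1 ℕ.≤ s → s ℕ.≤ n → suc s ℕ.≤ S → suc s ℕ.< hi →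
  Unravelled n S (square (cellAt s hi) n) (square (cellAt (suc s) hi) n)
lower-step {n} {S} {hi} s 1≤s s≤n s<S s<hi = record
  { left = along (suc s) (down s) ; right = down-along (suc s) (range 1 s)
  ; left-ok = all-map (down s) (λ y m → down-∈ (down-pos m) (ℕₚ.≤-trans (down-≤ m) s≤n) , bounds , s<S)
  ; right-ok = all-map (range 1 s) (λ x m → range-∈ (range-≥ m) (ℕₚ.≤-trans (range-< m) (s≤s s≤n)) , bounds , s<S)
  ; equal = Lower.lower-grid n s hi s<hi s 1 n s≤n s≤n refl }
  where
  bounds : InRange n (suc s)
  bounds = s≤s 1≤s , ℕₚ.+-mono-≤ (ℕₚ.≤-trans 1≤s s≤n) s≤n

lower-steps : ∀ {n S hi} t → t ℕ.≤ n → suc t ℕ.≤ S → suc t ℕ.< hi →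
  Unravelled n S (square (cellAt 1 hi) n) (square (cellAt (suc t) hi) n)
lower-steps zero _ _ _ = unravelled-refl
lower-steps (suc t) t≤n t<S t<hi = unravelled-trans
  (lower-steps t (ℕₚ.<⇒≤ t≤n) (ℕₚ.<⇒≤ t<S) (ℕₚ.<-trans (ℕₚ.n<1+n _) t<hi))
  (lower-step (suc t) (s≤s z≤n) t≤n t<S t<hi)

-- The line p + 1 + n has its first vertex in the column p + 1. The columns 1 to p contain none of
-- its vertices, and its crossings with the later columns move past them to the front.
upper-step : ∀ {n S} p j → p ℕ.+ suc j ≡ n → S ℕ.< suc p ℕ.+ n →
  Unravelled n S (square (cellAt S (suc (suc p ℕ.+ n))) n) (square (cellAt S (suc p ℕ.+ n)) n)
upper-step {n} {S} p j e S<s = record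
  { left = down-along s (range (suc p) (suc j)) ; right = along s ts
  ; left-ok = all-map (range (suc p) (suc j)) (λ x m → range-∈ (ℕₚ.≤-trans (s≤s z≤n) (range-≥ m))
      (ℕₚ.≤-trans (range-< m) (ℕₚ.≤-reflexive (cong suc e))) , bounds , S<s)
  ; right-ok = all-map ts (λ y m → subst (y ∈_) (U.crossed-down (suc j) p [] (cong down e′)) (∈-++⁺ˡ m) , bounds , S<s)
  ; equal = opwise λ f t → begin
      ap (act (gridOf U.g (down n) (range 1 n)) f) t
        ≡⟨ trans (cong (λ l → ap (act (gridOf U.g (down n) l) f) t) split) (grid-++ U.g (down n) (range 1 p) (range (suc p) (suc j)) f t) ⟩
      ap (act (gridOf U.g (down n) (range 1 p)) (act (gridOf U.g (down n) (range (suc p) (suc j))) f)) t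
        ≡⟨ cong (λ P → ap (act P (act (gridOf U.g (down n) (range (suc p) (suc j))) f)) t) (grid-cong (range 1 p) (λ x mx y my →
             cellAt-agree-hi {S} {s} x y λ e″ → ℕₚ.<-irrefl e″ (ℕₚ.+-mono-≤ (range-< mx) (down-≤ my)))) ⟩
      ap (act first (act (gridOf U.g (down n) (range (suc p) (suc j))) f)) t
        ≡⟨ appᴼ (⊙-congʳ first (U.upper-grid (suc j) (suc p) p [] (cong down e′) (λ t ()) (cong (suc p ℕ.+_) e′))) f t ⟩
      ap (act first (act Cs (act second (act (crosses (along s ts)) f)))) t
        ≡⟨ appᴼ (grid-commute {U.g′} {Cs} {down n} (range 1 p) (λ x mx y _ → commute-down {U.g′ x y} (range (suc p) (suc j))
             (λ x′ mx′ → U.g′-C (λ e → ℕₚ.<-irrefl e (ℕₚ.<-≤-trans (range-< mx) (range-≥ mx′)))))) (act second (act (crosses (along s ts)) f)) t ⟩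
      ap (act Cs (act first (act second (act (crosses (along s ts)) f)))) t
        ≡⟨ sym (within Cs {square U.g′ n} {first ⊙ second} (crosses (along s ts)) (opwise λ f t →
             trans (cong (λ l → ap (act (gridOf U.g′ (down n) l) f) t) split) (grid-++ U.g′ (down n) (range 1 p) (range (suc p) (suc j)) f t)) f t) ⟩
      ap (act Cs (act (square U.g′ n) (act (crosses (along s ts)) f))) t ∎ }
  where
  open ≡-Reasoning
  s : ℕ
  s = suc p ℕ.+ n
  module U = Upper n S s S<s
  e′ : suc j ℕ.+ p ≡ n
  e′ = trans (ℕₚ.+-comm (suc j) p) e
  ts : List ℕ
  ts = U.crossed (suc j) p []
  bounds : InRange n s
  bounds = ℕₚ.+-mono-≤ {1} {suc p} (s≤s z≤n) (subst (1 ℕ.≤_) e (ℕₚ.≤-trans (s≤s z≤n) (ℕₚ.m≤n+m (suc j) p))) ,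
    ℕₚ.+-monoˡ-≤ n (subst (suc p ℕ.≤_) e (ℕₚ.≤-trans (ℕₚ.≤-reflexive (ℕₚ.+-comm 1 p)) (ℕₚ.+-monoʳ-≤ p (s≤s z≤n))))
  split : range 1 n ≡ range 1 p ++ range (suc p) (suc j)
  split = trans (cong (range 1) (sym e)) (range-++ 1 p (suc j))
  first second Cs : Operator
  first = gridOf U.g′ (down n) (range 1 p)
  second = gridOf U.g′ (down n) (range (suc p) (suc j))
  Cs = crosses (down-along s (range (suc p) (suc j)))

upper-steps : ∀ {n S} k p → p ℕ.+ k ℕ.≤ n → S ℕ.< suc p ℕ.+ n →
  Unravelled n S (square (cellAt S (suc (p ℕ.+ k) ℕ.+ n)) n) (square (cellAt S (suc p ℕ.+ n)) n)
upper-steps {n} {S} zero p _ _ = subst (λ q → Unravelled n S (square (cellAt S (suc q ℕ.+ n)) n) (square (cellAt S (suc p ℕ.+ n)) n))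
  (sym (ℕₚ.+-identityʳ p)) unravelled-refl
upper-steps {n} {S} (suc k) p le S<s = subst (λ q → Unravelled n S (square (cellAt S (suc q ℕ.+ n)) n) (square (cellAt S (suc p ℕ.+ n)) n))
  (sym (ℕₚ.+-suc p k))
  (unravelled-trans
    (upper-step (p ℕ.+ k) (n ℕ.∸ suc (p ℕ.+ k))
      (trans (ℕₚ.+-suc (p ℕ.+ k) _) (ℕₚ.m+[n∸m]≡n (subst (ℕ._≤ n) (ℕₚ.+-suc p k) le)))
      (ℕₚ.<-≤-trans S<s (s≤s (ℕₚ.+-monoˡ-≤ n (ℕₚ.m≤m+n p k)))))
    (upper-steps k p (ℕₚ.≤-trans (ℕₚ.+-monoʳ-≤ p (ℕₚ.n≤1+n k)) le) S<s))

-- The diagonals up to S = p + n carry a path at both ends, where p is 1 for DWBC1 and 0 for DWBC2.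
unravel : ∀ m p → p ℕ.≤ 1 → Unravelled (suc m) (p ℕ.+ suc m) (square vertexV (suc m)) (square vertexA (suc m))
unravel m p p≤1 = subst₂ (Unravelled n S) start-V end-A (unravelled-trans lower upper)
  where
  n S : ℕ
  n = suc m
  S = p ℕ.+ n
  bound : ∀ {x y} → x ∈ range 1 n → y ∈ down n → 1 ℕ.< x ℕ.+ y × x ℕ.+ y ℕ.< suc n ℕ.+ n
  bound mx my = ℕₚ.+-mono-≤ (range-≥ mx) (down-pos my) , ℕₚ.≤-trans (ℕₚ.+-monoˡ-≤ _ (range-< mx)) (ℕₚ.+-monoʳ-≤ (suc n) (down-≤ my))
  start-V : square (cellAt 1 (suc n ℕ.+ n)) n ≡ square vertexV n
  start-V = grid-cong (range 1 n) λ x mx y my → cellAt-mid {1} {suc n ℕ.+ n} {x} {y} (proj₁ (bound mx my)) (proj₂ (bound mx my))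
  end-A : square (cellAt S (suc p ℕ.+ n)) n ≡ square vertexA n
  end-A = grid-cong (range 1 n) λ x _ y _ → go x y
    where
    go : ∀ x y → cellAt S (suc p ℕ.+ n) x y ≡ vertexA x y
    go x y with x ℕ.+ y ℕₚ.≤? S
    ... | yes l = cellAt-lo {S} {suc p ℕ.+ n} {x} {y} l
    ... | no nl = cellAt-hi {S} {suc p ℕ.+ n} {x} {y} (ℕₚ.≰⇒> nl)
  S≤ : S ℕ.≤ suc n
  S≤ = ℕₚ.+-monoˡ-≤ n p≤1
  lower : Unravelled n S (square (cellAt 1 (suc n ℕ.+ n)) n) (square (cellAt S (suc n ℕ.+ n)) n)
  lower = subst (λ t → Unravelled n S (square (cellAt 1 (suc n ℕ.+ n)) n) (square (cellAt t (suc n ℕ.+ n)) n)) (sym (ℕₚ.+-suc p m))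
    (lower-steps (p ℕ.+ m) (ℕₚ.+-monoˡ-≤ m p≤1) (ℕₚ.≤-reflexive (sym (ℕₚ.+-suc p m)))
      (ℕₚ.≤-trans (s≤s (ℕₚ.≤-trans (ℕₚ.≤-reflexive (sym (ℕₚ.+-suc p m))) S≤)) (ℕₚ.≤-trans (ℕₚ.≤-reflexive (ℕₚ.+-comm 1 (suc n))) (ℕₚ.+-monoʳ-≤ (suc n) (s≤s z≤n)))))
  upper : Unravelled n S (square (cellAt S (suc n ℕ.+ n)) n) (square (cellAt S (suc p ℕ.+ n)) n)
  upper = subst (λ q → Unravelled n S (square (cellAt S (suc q ℕ.+ n)) n) (square (cellAt S (suc p ℕ.+ n)) n))
    (ℕₚ.m+[n∸m]≡n {p} (ℕₚ.≤-trans p≤1 (s≤s z≤n)))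
    (upper-steps (n ℕ.∸ p) p (ℕₚ.≤-reflexive (ℕₚ.m+[n∸m]≡n (ℕₚ.≤-trans p≤1 (s≤s z≤n)))) ℕₚ.≤-refl)

-- Boundary states and the value of the unravelled square

first-line second-line : Crossing → Line
first-line (horizontal y s) = hor y
first-line (vertical x s) = dia s
second-line (horizontal y s) = dia s
second-line (vertical x s) = ver x

crosses-straight : ∀ ks s f → All (λ k → Σ Bool λ b → s (first-line k) ≡ b × s (second-line k) ≡ b) ks →
  ap (act (crosses ks) f) s ≡ 2ℤ ^ length ks * ap f s
crosses-straight [] s f [] = sym (*-identityˡ _)
crosses-straight (horizontal y t ∷ ks) s f ((b , e , e′) ∷ es) = trans (straight hd (act (crosses ks) f) s e e′)
  (trans (cong (2ℤ *_) (crosses-straight ks s f es)) (sym (*-assoc 2ℤ _ _)))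
crosses-straight (vertical x t ∷ ks) s f ((b , e , e′) ∷ es) = trans (straight dv (act (crosses ks) f) s e e′)
  (trans (cong (2ℤ *_) (crosses-straight ks s f es)) (sym (*-assoc 2ℤ _ _)))

matches : Bool → Bool → Bool
matches true b = b
matches false b = not b

matches-not : ∀ b → matches b (not b) ≡ false
matches-not true = refl
matches-not false = refl

matches-self : ∀ b → matches b b ≡ true
matches-self true = refl
matches-self false = refl

-- The exit condition of the diagonal lines: as on entry, the line d is full exactly for d ≤ S.
guards : ℕ → List ℕ → Operator
guards S [] = 𝟙
guards S (d ∷ ds) = on (dia d) (λ b → ⟦ matches (d ℕ.≤ᵇ S) b ⟧) ⊙ guards S ds

guards-∏ : ∀ S ds f s → ap (act (guards S ds) f) s ≡ ∏ ds (λ d → ⟦ matches (d ℕ.≤ᵇ S) (s (dia d)) ⟧) * ap f s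
guards-∏ S [] f s = sym (*-identityˡ _)
guards-∏ S (d ∷ ds) f s = trans (cong (⟦ matches (d ℕ.≤ᵇ S) (s (dia d)) ⟧ *_) (guards-∏ S ds f s)) (sym (*-assoc _ _ _))

diagonals : ℕ → List ℕ
diagonals n = range 2 (n ℕ.+ n ℕ.∸ 1)

initial : ℕ → State
initial S (hor y) = true
initial S (ver x) = false
initial S (dia d) = d ℕ.≤ᵇ S

final : ℕ → ℕ → Functional
final n S = act (guards S (diagonals n)) (SixVertex₀.finish (down n) (range 1 n))

module _ {n S : ℕ} where
  private
    fin : Functional
    fin = final n S

  final-hor : ∀ {y} → y ∈ down n → ∀ s → s (hor y) ≡ true → ap fin s ≡ 0ℤ
  final-hor m s e = trans (guards-∏ S (diagonals n) _ s)
    (trans (cong (∏ (diagonals n) _ *_) (SixVertex₀.finish-zero (range 1 n) s m e)) (zeroʳ _))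

  final-ver : ∀ {x} → x ∈ range 1 n → ∀ s → s (ver x) ≡ false → ap fin s ≡ 0ℤ
  final-ver m s e = trans (guards-∏ S (diagonals n) _ s)
    (trans (cong (∏ (diagonals n) _ *_) (trans (cong (∏ (down n) _ *_) (∏-zero m (cong ⟦_⟧ e))) (zeroʳ _))) (zeroʳ _))

  final-dia : ∀ {d} → InRange n d → ∀ s → s (dia d) ≡ not (d ℕ.≤ᵇ S) → ap fin s ≡ 0ℤ
  final-dia {d} (l , u) s e = trans (guards-∏ S (diagonals n) _ s) (trans (cong (_* ap (SixVertex₀.finish (down n) (range 1 n)) s) (∏-zero
    {xs = diagonals n} (range-∈ l (ℕₚ.≤-trans (s≤s u) (s≤s (ℕₚ.m≤n+m∸n (n ℕ.+ n) 1)))) (cong ⟦_⟧ (trans (cong (matches (d ℕ.≤ᵇ S)) e) (matches-not (d ℕ.≤ᵇ S)))))) (zeroˡ _))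

  cross-final : ∀ k → RightOK n S k → act (cross k) fin ≈ act (scalar 2ℤ) fin
  cross-final (horizontal y d) (my , r , u) = R-final hd false fin (λ ()) (final-hor my)
    (λ s e → final-dia r s (trans e (cong not (sym (≤ᵇ-false u)))))
  cross-final (vertical x d) (mx , r , u) = R-final dv true fin (λ ())
    (λ s e → final-dia r s (trans e (cong not (sym (≤ᵇ-true u))))) (final-ver mx)

  crosses-final : ∀ ks → All (RightOK n S) ks → act (crosses ks) fin ≈ act (scalar (2ℤ ^ length ks)) fin
  crosses-final [] [] .app s = sym (*-identityˡ _)
  crosses-final (k ∷ ks) (r ∷ rs) .app s = begin
    ap (act (cross k) (act (crosses ks) fin)) s
      ≡⟨ app (act-cong (cross k) (crosses-final ks rs)) s ⟩
    ap (act (cross k) (act (scalar (2ℤ ^ length ks)) fin)) s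
      ≡⟨ sym (appᴼ (scalar-cross k) fin s) ⟩
    2ℤ ^ length ks * ap (act (cross k) fin) s
      ≡⟨ cong (2ℤ ^ length ks *_) (app (cross-final k r) s) ⟩
    2ℤ ^ length ks * (2ℤ * ap fin s)
      ≡⟨ trans (sym (*-assoc _ _ _)) (cong (_* ap fin s) (*-comm _ 2ℤ)) ⟩
    2ℤ * 2ℤ ^ length ks * ap fin s ∎
    where
    open ≡-Reasoning
    scalar-cross : ∀ {c} k → Commute (scalar c) (cross k)
    scalar-cross (horizontal y t) = scalar-R _ _ _ _
    scalar-cross (vertical x t) = scalar-R _ _ _ _

  initial-straight : ∀ k → LeftOK n S k → Σ Bool λ b → initial S (first-line k) ≡ b × initial S (second-line k) ≡ b
  initial-straight (horizontal y t) (_ , _ , l) = true , refl , ≤ᵇ-true l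
  initial-straight (vertical x t) (_ , _ , l) = false , ≤ᵇ-false l , refl

vertexA-grid : ∀ ys xs → gridOf vertexA ys xs ≡ SixVertex₀.grid6 ys xs
vertexA-grid ys [] = refl
vertexA-grid ys (x ∷ xs) = cong₂ _⊙_ (go ys) (vertexA-grid ys xs)
  where
  go : ∀ ys → columnOf vertexA x ys ≡ SixVertex₀.column 1ℤ 0ℤ x ys
  go [] = refl
  go (y ∷ ys) = cong (vertexA x y ⊙_) (go ys)

guards-grid : ∀ S ds ys xs → Commute (gridOf vertexA ys xs) (guards S ds)
guards-grid S [] ys xs = opwise λ f s → refl
guards-grid S (d ∷ ds) ys xs = slide
  (grid-commute {vertexA} {on (dia d) (λ b → ⟦ matches (d ℕ.≤ᵇ S) b ⟧)} {ys} xs (λ x _ y _ → on-commute (λ ()) (λ ())))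
  (guards-grid S ds ys xs)

ones : State
ones _ = true

unit : Functional
unit .ap s = 1ℤ
unit .ext e = refl

a-hv : a hv ≡ 1ℤ
a-hv = lem
  where
  opaque
    unfolding ℤ
    lem : 1ℤ - 0ℤ - (1ℤ + 0ℤ) * 0ℤ ≡ 1ℤ
    lem = refl

straight-grid : ∀ (g : ℕ → ℕ → Operator) k → (∀ x y f → ap (act (g x y) f) ones ≡ k * ap f ones) →
  ∀ ys xs f → ap (act (gridOf g ys xs) f) ones ≡ (k ^ length ys) ^ length xs * ap f ones
straight-grid g k h ys [] f = sym (*-identityˡ _)
straight-grid g k h ys (x ∷ xs) f = trans (go ys (act (gridOf g ys xs) f))
  (trans (cong (k ^ length ys *_) (straight-grid g k h ys xs f)) (sym (*-assoc _ _ _)))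
  where
  go : ∀ ys f → ap (act (columnOf g x ys) f) ones ≡ k ^ length ys * ap f ones
  go [] f = sym (*-identityˡ _)
  go (y ∷ ys) f = trans (h x y (act (columnOf g x ys) f)) (trans (cong (k *_) (go ys f)) (sym (*-assoc k _ _)))

4ℤ : ℤ
4ℤ = 2ℤ * 2ℤ

-- Each crossing that was pulled out joins two lines in the same state and weighs 2, so only the
-- number of these crossings matters.
unravelled-value : ∀ m p → p ℕ.≤ 1 → let n = suc m ; S = p ℕ.+ n in
  ap (act (square vertexV n) (final n S)) (initial S) ≡ (4ℤ ^ length (down n)) ^ length (range 1 n)
    * ap (act (SixVertex₀.grid6 (down n) (range 1 n)) (SixVertex₀.finish (down n) (range 1 n))) (initial S)
unravelled-value m p p≤1 = begin
  ap (act (square vertexV n) fin) s₀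
    ≡⟨ appᴼ (equal u) fin s₀ ⟩
  ap (act (crosses (left u)) (act (square vertexA n) (act (crosses (right u)) fin))) s₀
    ≡⟨ crosses-straight (left u) s₀ _ (All.map (λ {k} → initial-straight k) (left-ok u)) ⟩
  2ℤ ^ length (left u) * ap (act (square vertexA n) (act (crosses (right u)) fin)) s₀
    ≡⟨ cong (2ℤ ^ length (left u) *_) (trans (app (act-cong (square vertexA n) (crosses-final (right u) (right-ok u))) s₀)
         (appᴼ (grid-commute {vertexA} {scalar (2ℤ ^ length (right u))} {down n} (range 1 n) (λ x _ y _ → commute-sym {scalar _} (scalar-R _ _ _ _))) fin s₀)) ⟩
  2ℤ ^ length (left u) * (2ℤ ^ length (right u) * ap (act (square vertexA n) fin) s₀)
    ≡⟨ trans (sym (*-assoc _ _ _)) (cong₂ _*_ power core) ⟩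
  _ ∎
  where
  open ≡-Reasoning
  n S : ℕ
  n = suc m
  S = p ℕ.+ n
  s₀ : State
  s₀ = initial S
  fin : Functional
  fin = final n S
  u : Unravelled n S (square vertexV n) (square vertexA n)
  u = unravel m p p≤1
  core : ap (act (square vertexA n) fin) s₀ ≡ ap (act (SixVertex₀.grid6 (down n) (range 1 n)) (SixVertex₀.finish (down n) (range 1 n))) s₀
  core = trans (appᴼ (guards-grid S (diagonals n) (down n) (range 1 n)) _ s₀)
    (trans (guards-∏ S (diagonals n) (act (square vertexA n) (SixVertex₀.finish (down n) (range 1 n))) s₀)
      (trans (cong₂ (λ c P → c * ap (act P (SixVertex₀.finish (down n) (range 1 n))) s₀) (all-one (diagonals n)) (vertexA-grid (down n) (range 1 n)))
        (*-identityˡ _)))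
    where
    all-one : ∀ ds → ∏ ds (λ d → ⟦ matches (d ℕ.≤ᵇ S) (d ℕ.≤ᵇ S) ⟧) ≡ 1ℤ
    all-one [] = refl
    all-one (d ∷ ds) = trans (cong₂ (λ b c → ⟦ b ⟧ * c) (matches-self (d ℕ.≤ᵇ S)) (all-one ds)) (*-identityˡ 1ℤ)
  every : ∀ ks → All (λ k → Σ Bool λ b → ones (first-line k) ≡ b × ones (second-line k) ≡ b) ks
  every [] = []
  every (k ∷ ks) = (true , refl , refl) ∷ every ks
  -- The power of 2 is found by evaluating the same identity at the state full of paths.
  power : 2ℤ ^ length (left u) * 2ℤ ^ length (right u) ≡ (4ℤ ^ length (down n)) ^ length (range 1 n)
  power = begin
    2ℤ ^ length (left u) * 2ℤ ^ length (right u)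
      ≡⟨ cong (2ℤ ^ length (left u) *_) (sym (trans (straight-grid vertexA 1ℤ (λ x y f →
           trans (straight hv f ones refl refl) (cong (_* ap f ones) a-hv)) (down n) (range 1 n) _)
           (trans (cong₂ _*_ (trans (cong (_^ length (range 1 n)) (1^ (length (down n)))) (1^ (length (range 1 n))))
             (trans (crosses-straight (right u) ones unit (every (right u))) (*-identityʳ _))) (*-identityˡ _)))) ⟩
    2ℤ ^ length (left u) * ap (act (square vertexA n) (act (crosses (right u)) unit)) ones
      ≡⟨ sym (trans (appᴼ (equal u) unit ones) (crosses-straight (left u) ones _ (every (left u)))) ⟩
    ap (act (square vertexV n) unit) ones
      ≡⟨ trans (straight-grid vertexV 4ℤ cell (down n) (range 1 n) unit) (*-identityʳ _) ⟩
    (4ℤ ^ length (down n)) ^ length (range 1 n) ∎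
    where
    1^ : ∀ k → 1ℤ ^ k ≡ 1ℤ
    1^ zero = refl
    1^ (suc k) = trans (*-identityˡ _) (1^ k)
    opaque
      unfolding ℤ
      lem : ∀ x → 2ℤ * ((1ℤ - 0ℤ - (1ℤ + 0ℤ) * 0ℤ) * (2ℤ * x)) ≡ 2ℤ * 2ℤ * x
      lem = solve-∀ ring
    cell : ∀ x y f → ap (act (vertexV x y) f) ones ≡ 4ℤ * ap f ones
    cell x y f = trans (straight hd (act (vertexA x y ⊙ crossC x (x ℕ.+ y)) f) ones refl refl)
      (trans (cong (2ℤ *_) (trans (straight hv (act (crossC x (x ℕ.+ y)) f) ones refl refl)
        (cong (a hv *_) (straight dv f ones refl refl)))) (lem (ap f ones)))

-- Removing the gauge

-- All ways through that conserve the number of paths count once. For 0, 1, 2 and 3 paths there are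
-- 1, 9, 9 and 1 of them, the twenty vertices.
ice : Bool → Bool → Bool → (Bool → Bool → Bool → ℤ) → ℤ
ice true true true F = F true true true
ice false false false F = F false false false
ice true false false F = F true false false + (F false true false + F false false true)
ice false true false F = F true false false + (F false true false + F false false true)
ice false false true F = F true false false + (F false true false + F false false true)
ice true true false F = F true true false + (F true false true + F false true true)
ice true false true F = F true true false + (F true false true + F false true true)
ice false true true F = F true true false + (F true false true + F false true true)

ice-cong : ∀ i j k {F G} → (∀ o p q → F o p q ≡ G o p q) → ice i j k F ≡ ice i j k G
ice-cong true true true e = e _ _ _
ice-cong false false false e = e _ _ _
ice-cong true false false e = cong₂ _+_ (e _ _ _) (cong₂ _+_ (e _ _ _) (e _ _ _))
ice-cong false true false e = cong₂ _+_ (e _ _ _) (cong₂ _+_ (e _ _ _) (e _ _ _))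
ice-cong false false true e = cong₂ _+_ (e _ _ _) (cong₂ _+_ (e _ _ _) (e _ _ _))
ice-cong true true false e = cong₂ _+_ (e _ _ _) (cong₂ _+_ (e _ _ _) (e _ _ _))
ice-cong true false true e = cong₂ _+_ (e _ _ _) (cong₂ _+_ (e _ _ _) (e _ _ _))
ice-cong false true true e = cong₂ _+_ (e _ _ _) (cong₂ _+_ (e _ _ _) (e _ _ _))

ice-scale : ∀ i j k r F → ice i j k (λ o p q → r * F o p q) ≡ r * ice i j k F
ice-scale true true true r F = refl
ice-scale false false false r F = refl
ice-scale true false false r F = sym (trans (distribˡ r _ _) (cong (λ t → r * F true false false + t) (distribˡ r _ _)))
ice-scale false true false r F = sym (trans (distribˡ r _ _) (cong (λ t → r * F true false false + t) (distribˡ r _ _)))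
ice-scale false false true r F = sym (trans (distribˡ r _ _) (cong (λ t → r * F true false false + t) (distribˡ r _ _)))
ice-scale true true false r F = sym (trans (distribˡ r _ _) (cong (λ t → r * F true true false + t) (distribˡ r _ _)))
ice-scale true false true r F = sym (trans (distribˡ r _ _) (cong (λ t → r * F true true false + t) (distribˡ r _ _)))
ice-scale false true true r F = sym (trans (distribˡ r _ _) (cong (λ t → r * F true true false + t) (distribˡ r _ _)))

vertexI : ℕ → ℕ → Operator
vertexI x y .act f .ap s = ice (s (hor y)) (s (dia (x ℕ.+ y))) (s (ver x))
  (λ o p q → ap f (((s [ hor y ≔ o ]) [ dia (x ℕ.+ y) ≔ p ]) [ ver x ≔ q ]))
vertexI x y .act f .ext {s} {s′} e rewrite e (hor y) | e (dia (x ℕ.+ y)) | e (ver x) =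
  ice-cong (s′ (hor y)) (s′ (dia (x ℕ.+ y))) (s′ (ver x)) λ o p q →
    ext f (update-cong (ver x) q (update-cong (dia (x ℕ.+ y)) p (update-cong (hor y) o e)))
vertexI x y .act-cong e .app s = ice-cong (s (hor y)) (s (dia (x ℕ.+ y))) (s (ver x)) λ o p q → app e _

power : Bool → ℤ → ℤ
power b z = if b then z else 1ℤ

-- The triple crossing is 4 · 2^(v - h) times the ice rule. The extra 2 on a horizontal exit and on
-- a vertical entry absorbs 2^(v - h), and the powers of u agree on both sides because the number of
-- paths is conserved.
gauge : ∀ u i j k F → triangle₁ hd hv dv i j k (λ o p q → power o (2ℤ * u) * (power p u * power q u) * F o p q)
  ≡ 4ℤ * (power i u * (power j u * power k (2ℤ * u))) * ice i j k F
gauge u true true true F = lem u (F true true true)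
  where
  opaque
    unfolding ℤ
    lem : ∀ u f111 →
      2ℤ * ((1ℤ - 0ℤ - (1ℤ + 0ℤ) * 0ℤ) * (2ℤ * ((2ℤ * u) * (u * u) * f111)))
      ≡ 2ℤ * 2ℤ * (u * (u * (2ℤ * u))) * f111
    lem = solve-∀ ring
gauge u true true false F = lem u (F true true false) (F true false true) (F false true true)
  where
  opaque
    unfolding ℤ
    lem : ∀ u f110 f101 f011 →
      2ℤ * ((1ℤ - 0ℤ * 0ℤ) * (1ℤ * ((2ℤ * u) * (u * 1ℤ) * f110) + 1ℤ * ((2ℤ * u) * (1ℤ * u) * f101)) + (1ℤ + 0ℤ * 0ℤ) * (2ℤ * (1ℤ * (u * u) * f011)))
      ≡ 2ℤ * 2ℤ * (u * (u * 1ℤ)) * (f110 + (f101 + f011))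
    lem = solve-∀ ring
gauge u true false true F = lem u (F true true false) (F true false true) (F false true true)
  where
  opaque
    unfolding ℤ
    lem : ∀ u f110 f101 f011 →
      (1ℤ * ((1ℤ - 0ℤ - (1ℤ + 0ℤ) * 0ℤ) * (2ℤ * ((2ℤ * u) * (1ℤ * u) * f101) + 2ℤ * ((2ℤ * u) * (u * 1ℤ) * f110))) + 2ℤ * ((2ℤ * (1ℤ - 0ℤ * 0ℤ)) * (2ℤ * (1ℤ * (u * u) * f011)) + (1ℤ * 1ℤ + 0ℤ * 0ℤ) * (1ℤ * ((2ℤ * u) * (u * 1ℤ) * f110) + 1ℤ * ((2ℤ * u) * (1ℤ * u) * f101))))
      ≡ 2ℤ * 2ℤ * (u * (1ℤ * (2ℤ * u))) * (f110 + (f101 + f011))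
    lem = solve-∀ ring
gauge u true false false F = lem u (F true false false) (F false true false) (F false false true)
  where
  opaque
    unfolding ℤ
    lem : ∀ u f100 f010 f001 →
      (1ℤ * ((1ℤ - 0ℤ * 0ℤ) * (2ℤ * ((2ℤ * u) * (1ℤ * 1ℤ) * f100)) + (1ℤ + 0ℤ * 0ℤ) * (2ℤ * (1ℤ * (1ℤ * u) * f001) + 2ℤ * (1ℤ * (u * 1ℤ) * f010))) + 2ℤ * ((1ℤ - 0ℤ - (1ℤ + 0ℤ) * 0ℤ) * (1ℤ * (1ℤ * (u * 1ℤ) * f010) + 1ℤ * (1ℤ * (1ℤ * u) * f001))))
      ≡ 2ℤ * 2ℤ * (u * (1ℤ * 1ℤ)) * (f100 + (f010 + f001))
    lem = solve-∀ ring
gauge u false true true F = lem u (F true true false) (F true false true) (F false true true)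
  where
  opaque
    unfolding ℤ
    lem : ∀ u f110 f101 f011 →
      (2ℤ * ((2ℤ * (1ℤ - 0ℤ * 0ℤ)) * (2ℤ * (1ℤ * (u * u) * f011)) + (1ℤ * 1ℤ + 0ℤ * 0ℤ) * (1ℤ * ((2ℤ * u) * (u * 1ℤ) * f110) + 1ℤ * ((2ℤ * u) * (1ℤ * u) * f101))) + 1ℤ * ((1ℤ - 0ℤ - (1ℤ + 0ℤ) * 0ℤ) * (2ℤ * ((2ℤ * u) * (1ℤ * u) * f101) + 2ℤ * ((2ℤ * u) * (u * 1ℤ) * f110))))
      ≡ 2ℤ * 2ℤ * (1ℤ * (u * (2ℤ * u))) * (f110 + (f101 + f011))
    lem = solve-∀ ring
gauge u false true false F = lem u (F true false false) (F false true false) (F false false true)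
  where
  opaque
    unfolding ℤ
    lem : ∀ u f100 f010 f001 →
      (2ℤ * ((1ℤ - 0ℤ - (1ℤ + 0ℤ) * 0ℤ) * (1ℤ * (1ℤ * (u * 1ℤ) * f010) + 1ℤ * (1ℤ * (1ℤ * u) * f001))) + 1ℤ * ((1ℤ - 0ℤ * 0ℤ) * (2ℤ * ((2ℤ * u) * (1ℤ * 1ℤ) * f100)) + (1ℤ + 0ℤ * 0ℤ) * (2ℤ * (1ℤ * (1ℤ * u) * f001) + 2ℤ * (1ℤ * (u * 1ℤ) * f010))))
      ≡ 2ℤ * 2ℤ * (1ℤ * (u * 1ℤ)) * (f100 + (f010 + f001))
    lem = solve-∀ ring
gauge u false false true F = lem u (F true false false) (F false true false) (F false false true)
  where
  opaque
    unfolding ℤ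
    lem : ∀ u f100 f010 f001 →
      2ℤ * ((2ℤ * (1ℤ - 0ℤ * 0ℤ)) * (2ℤ * (1ℤ * (1ℤ * u) * f001) + 2ℤ * (1ℤ * (u * 1ℤ) * f010)) + (1ℤ * 1ℤ + 0ℤ * 0ℤ) * (2ℤ * ((2ℤ * u) * (1ℤ * 1ℤ) * f100)))
      ≡ 2ℤ * 2ℤ * (1ℤ * (1ℤ * (2ℤ * u))) * (f100 + (f010 + f001))
    lem = solve-∀ ring
gauge u false false false F = lem (F false false false)
  where
  opaque
    unfolding ℤ
    lem : ∀ f000 →
      2ℤ * ((1ℤ - 0ℤ - (1ℤ + 0ℤ) * 0ℤ) * (2ℤ * (1ℤ * (1ℤ * 1ℤ) * f000)))
      ≡ 2ℤ * 2ℤ * (1ℤ * (1ℤ * 1ℤ)) * f000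
    lem = solve-∀ ring

ℤ-power-nonzero : ∀ k → 2ℤ ^ k ≢ 0ℤ
ℤ-power-nonzero zero = 1≢0
ℤ-power-nonzero (suc k) = *-nonzero two (ℤ-power-nonzero k)
  where
  opaque
    unfolding ℤ
    two : 2ℤ ≢ 0ℤ
    two ()

∏-↭ : ∀ {X : Set} (g : X → ℤ) {xs ys} → xs ↭ ys → ∏ xs g ≡ ∏ ys g
∏-↭ g ↭.refl = refl
∏-↭ g (↭.prep x e) = cong (g x *_) (∏-↭ g e)
∏-↭ g (↭.trans e e′) = trans (∏-↭ g e) (∏-↭ g e′)
∏-↭ g (↭.swap {xs} {ys} x y e) = trans (cong (λ t → g x * (g y * t)) (∏-↭ g e)) (*-exchange (g x) (g y) (∏ ys g))

∈-pick : ∀ {A : Set} {x : A} {xs} → x ∈ xs → Σ (List A) λ ys → Pick x ys xs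
∈-pick (here refl) = _ , here
∈-pick (there m) with ∈-pick m
... | ys , p = _ , there p

∏-cong-∈ : ∀ {h h′ : X → ℤ} xs → (∀ x → x ∈ xs → h x ≡ h′ x) → ∏ xs h ≡ ∏ xs h′
∏-cong-∈ [] e = refl
∏-cong-∈ (x ∷ xs) e = cong₂ _*_ (e x (here refl)) (∏-cong-∈ xs (λ y m → e y (there m)))

module Gauge (n : ℕ) where

  -- A path on an edge carries the weight 2^(x+y) of the position of the edge, so that the
  -- gauge factor of a vertex is the quotient of the potentials before and after it.
  potential : (ℕ → ℕ) → (ℕ → ℕ) → State → ℤ
  potential φ ψ s = ∏ (down n) (λ y → power (s (hor y)) (2ℤ ^ φ y))
    * (∏ (range 1 n) (λ x → power (s (ver x)) (2ℤ ^ ψ x)) * ∏ (diagonals n) (λ d → power (s (dia d)) (2ℤ ^ d)))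

  -- The vertex changes only the factors of its own three lines, to which `gauge` applies with u =
  -- 2^(x+y); the factors of the other lines form `rest`.
  cell-gauge : ∀ {x y φ φ′ ψ ψ′} {f f′ : Functional} → x ∈ range 1 n → y ∈ down n → x ℕ.+ y ∈ diagonals n →
    φ y ≡ x ℕ.+ y → φ′ y ≡ suc (x ℕ.+ y) → ψ x ≡ suc (x ℕ.+ y) → ψ′ x ≡ x ℕ.+ y →
    (∀ z → z ≢ y → φ z ≡ φ′ z) → (∀ z → z ≢ x → ψ z ≡ ψ′ z) →
    (∀ s → ap f′ s ≡ potential φ′ ψ′ s * ap f s) →
    ∀ s → ap (act (vertexV x y) f′) s ≡ 4ℤ * (potential φ ψ s * ap (act (vertexI x y) f) s)
  cell-gauge {x} {y} {φ} {φ′} {ψ} {ψ′} {f} {f′} mx my md e₁ e₂ e₃ e₄ eφ eψ h s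
    with ∈-pick mx | ∈-pick my | ∈-pick md
  ... | xs , πx | ys , πy | ds , πd = begin
    ap (act (vertexV x y) f′) s
      ≡⟨ R-triangle₁ {hd} {hv} {dv} {hor y} {dia m} {ver x} (λ ()) (λ ()) (λ ()) f′ s ⟩
    triangle₁ hd hv dv (s (hor y)) (s (dia m)) (s (ver x)) (λ o p q → ap f′ (new o p q))
      ≡⟨ triangle-cong (λ o p q → trans (h (new o p q)) (trans (cong (_* ap f (new o p q)) (after o p q)) (lem₁ _ _ _))) ⟩
    triangle₁ hd hv dv (s (hor y)) (s (dia m)) (s (ver x))
      (λ o p q → power o (2ℤ * u) * (power p u * power q u) * (rest * ap f (new o p q)))
      ≡⟨ gauge u (s (hor y)) (s (dia m)) (s (ver x)) (λ o p q → rest * ap f (new o p q)) ⟩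
    4ℤ * (power (s (hor y)) u * (power (s (dia m)) u * power (s (ver x)) (2ℤ * u)))
      * ice (s (hor y)) (s (dia m)) (s (ver x)) (λ o p q → rest * ap f (new o p q))
      ≡⟨ cong (4ℤ * (power (s (hor y)) u * (power (s (dia m)) u * power (s (ver x)) (2ℤ * u))) *_)
           (ice-scale (s (hor y)) (s (dia m)) (s (ver x)) rest (λ o p q → ap f (new o p q))) ⟩
    4ℤ * (power (s (hor y)) u * (power (s (dia m)) u * power (s (ver x)) (2ℤ * u))) * (rest * ap (act (vertexI x y) f) s)
      ≡⟨ trans (lem₂ _ _ _ _) (cong (λ t → 4ℤ * (t * ap (act (vertexI x y) f) s)) (sym before)) ⟩
    4ℤ * (potential φ ψ s * ap (act (vertexI x y) f) s) ∎
    where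
    open ≡-Reasoning
    m : ℕ
    m = x ℕ.+ y
    u : ℤ
    u = 2ℤ ^ m
    new : Bool → Bool → Bool → State
    new o p q = ((s [ hor y ≔ o ]) [ dia m ≔ p ]) [ ver x ≔ q ]
    rest : ℤ
    rest = ∏ ys (λ z → power (s (hor z)) (2ℤ ^ φ z)) * (∏ xs (λ z → power (s (ver z)) (2ℤ ^ ψ z)) * ∏ ds (λ d → power (s (dia d)) (2ℤ ^ d)))
    opaque
      unfolding ℤ
      lem₁ : ∀ a b c → a * b * c ≡ a * (b * c)
      lem₁ = solve-∀ ring
      lem₂ : ∀ k a r f → k * a * (r * f) ≡ k * (a * r * f)
      lem₂ = solve-∀ ring
      lem₃ : ∀ a a′ b b′ c c′ → a * a′ * (b * b′ * (c * c′)) ≡ a * (c * b) * (a′ * (b′ * c′))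
      lem₃ = solve-∀ ring
    uniq-x : All (x ≢_) xs
    uniq-x = proj₁ (pick-unique πx (increasing-unique (range-increasing 1 n)))
    uniq-y : All (y ≢_) ys
    uniq-y = proj₁ (pick-unique πy (down-unique n))
    uniq-d : All (m ≢_) ds
    uniq-d = proj₁ (pick-unique πd (increasing-unique (range-increasing 2 (n ℕ.+ n ℕ.∸ 1))))
    before : potential φ ψ s ≡ power (s (hor y)) u * (power (s (dia m)) u * power (s (ver x)) (2ℤ * u)) * rest
    before = trans (cong₂ _*_ (pick-∏ _ πy) (cong₂ _*_ (pick-∏ _ πx) (pick-∏ _ πd)))
      (trans (lem₃ _ _ _ _ _ _)
        (cong₂ (λ a b → power (s (hor y)) (2ℤ ^ a) * (power (s (dia m)) u * power (s (ver x)) (2ℤ ^ b)) * rest) e₁ e₃))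
    hor-new : ∀ o p q z → new o p q (hor z) ≡ (s [ hor y ≔ o ]) (hor z)
    hor-new o p q z = trans (lookup-other ((s [ hor y ≔ o ]) [ dia m ≔ p ]) q (λ ())) (lookup-other (s [ hor y ≔ o ]) p (λ ()))
    ver-new : ∀ o p q z → z ≢ x → new o p q (ver z) ≡ s (ver z)
    ver-new o p q z ne = trans (lookup-other ((s [ hor y ≔ o ]) [ dia m ≔ p ]) q (λ { refl → ne refl }))
      (trans (lookup-other (s [ hor y ≔ o ]) p (λ ())) (lookup-other s o (λ ())))
    after : ∀ o p q → potential φ′ ψ′ (new o p q) ≡ power o (2ℤ * u) * (power p u * power q u) * rest
    after o p q = trans (cong₂ _*_ (pick-∏ _ πy) (cong₂ _*_ (pick-∏ _ πx) (pick-∏ _ πd)))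
      (trans (lem₃ _ _ _ _ _ _) (cong₂ _*_
        (cong₂ _*_ (cong₂ (λ b k → power b (2ℤ ^ k)) (trans (hor-new o p q y) (lookup-same s (hor y) o)) e₂)
          (cong₂ _*_ (cong (λ b → power b u) (trans (lookup-other ((s [ hor y ≔ o ]) [ dia m ≔ p ]) q (λ ())) (lookup-same (s [ hor y ≔ o ]) (dia m) p)))
            (cong₂ (λ b k → power b (2ℤ ^ k)) (lookup-same ((s [ hor y ≔ o ]) [ dia m ≔ p ]) (ver x) q) e₄)))
        (cong₂ _*_ (∏-cong-∈ ys λ z mz → cong₂ (λ b k → power b (2ℤ ^ k))
            (trans (hor-new o p q z) (lookup-other s o (λ { refl → All.lookup uniq-y mz refl }))) (sym (eφ z (λ e → All.lookup uniq-y mz (sym e)))))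
          (cong₂ _*_ (∏-cong-∈ xs λ z mz → cong₂ (λ b k → power b (2ℤ ^ k))
              (ver-new o p q z (λ e → All.lookup uniq-x mz (sym e))) (sym (eψ z (λ e → All.lookup uniq-x mz (sym e)))))
            (∏-cong-∈ ds λ z mz → cong (λ b → power b (2ℤ ^ z))
              (trans (lookup-other ((s [ hor y ≔ o ]) [ dia m ≔ p ]) q (λ ()))
                (trans (lookup-other (s [ hor y ≔ o ]) p (λ { refl → All.lookup uniq-d mz refl })) (lookup-other s o (λ ())))))))))
    triangle-cong : ∀ {F G : Bool → Bool → Bool → ℤ} → (∀ o p q → F o p q ≡ G o p q) →
      triangle₁ hd hv dv (s (hor y)) (s (dia m)) (s (ver x)) F ≡ triangle₁ hd hv dv (s (hor y)) (s (dia m)) (s (ver x)) G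
    triangle-cong e = vertex-cong hd {s (hor y)} refl refl λ i j → vertex-cong hv {i} refl refl λ i′ k → vertex-cong dv {j} refl refl λ j′ k′ → e i′ j′ k′

  -- The positions of the edges reached on the lines when the rows above k of column x are done.
  φ ψ : ℕ → ℕ → ℕ → ℕ
  φ x k y = if y ℕ.≤ᵇ k then x ℕ.+ y else suc (x ℕ.+ y)
  ψ x k z = if z ℕ.<ᵇ x then suc z else (if z ℕ.≡ᵇ x then suc (x ℕ.+ k) else suc (z ℕ.+ n))

  <ᵇ-true : ∀ {a b} → a ℕ.< b → (a ℕ.<ᵇ b) ≡ true
  <ᵇ-true = ≤ᵇ-true

  <ᵇ-false : ∀ {a b} → b ℕ.≤ a → (a ℕ.<ᵇ b) ≡ false
  <ᵇ-false l = ≤ᵇ-false (s≤s l)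

  column-gauge : ∀ x → x ∈ range 1 n → ∀ k → k ℕ.≤ n → ∀ {f f′ : Functional} →
    (∀ s → ap f′ s ≡ potential (φ x 0) (ψ x 0) s * ap f s) →
    ∀ s → ap (act (columnOf vertexV x (down k)) f′) s ≡ 4ℤ ^ k * (potential (φ x k) (ψ x k) s * ap (act (columnOf vertexI x (down k)) f) s)
  column-gauge x mx zero k≤n h s = trans (h s) (sym (*-identityˡ _))
  column-gauge x mx (suc k) k≤n {f} {f′} h s = begin
    ap (act (vertexV x (suc k)) (act (columnOf vertexV x (down k)) f′)) s
      ≡⟨ cell-gauge {φ = φ x (suc k)} {φ x k} {ψ x (suc k)} {ψ x k} {act (scalar (4ℤ ^ k)) rest} {act (columnOf vertexV x (down k)) f′} mx (down-∈ (s≤s z≤n) k≤n) diagonal-∈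
           (cong (if_then x ℕ.+ suc k else suc (x ℕ.+ suc k)) (≤ᵇ-true (ℕₚ.≤-refl {suc k})))
           (cong (if_then x ℕ.+ suc k else suc (x ℕ.+ suc k)) (≤ᵇ-false (ℕₚ.n<1+n k)))
           (ψ-at (suc k)) (trans (ψ-at k) (sym (ℕₚ.+-suc x k))) φ-same ψ-same
           (λ t → trans (column-gauge x mx k (ℕₚ.<⇒≤ k≤n) {f} {f′} h t) (*-exchange (4ℤ ^ k) _ _)) s ⟩
    4ℤ * (potential (φ x (suc k)) (ψ x (suc k)) s * ap (act (vertexI x (suc k)) (act (scalar (4ℤ ^ k)) rest)) s)
      ≡⟨ cong (λ t → 4ℤ * (potential (φ x (suc k)) (ψ x (suc k)) s * t)) (ice-scale (s (hor (suc k))) (s (dia (x ℕ.+ suc k))) (s (ver x)) (4ℤ ^ k) _) ⟩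
    4ℤ * (potential (φ x (suc k)) (ψ x (suc k)) s * (4ℤ ^ k * ap (act (vertexI x (suc k)) rest) s))
      ≡⟨ lem₂ 4ℤ (4ℤ ^ k) _ _ ⟩
    4ℤ * 4ℤ ^ k * (potential (φ x (suc k)) (ψ x (suc k)) s * ap (act (vertexI x (suc k)) rest) s) ∎
    where
    open ≡-Reasoning
    rest : Functional
    rest = act (columnOf vertexI x (down k)) f
    opaque
      unfolding ℤ
      lem₂ : ∀ a b c d → a * (c * (b * d)) ≡ a * b * (c * d)
      lem₂ = solve-∀ ring
    diagonal-∈ : x ℕ.+ suc k ∈ diagonals n
    diagonal-∈ = range-∈ (ℕₚ.+-mono-≤ (range-≥ mx) (s≤s z≤n))
      (ℕₚ.≤-trans (s≤s (ℕₚ.+-mono-≤ (ℕₚ.≤-pred (range-< mx)) k≤n)) (s≤s (ℕₚ.m≤n+m∸n (n ℕ.+ n) 1)))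
    ψ-at : ∀ k → ψ x k x ≡ suc (x ℕ.+ k)
    ψ-at k rewrite <ᵇ-false (ℕₚ.≤-refl {x}) | ≡ᵇ-refl x = refl
    φ-same : ∀ z → z ≢ suc k → φ x (suc k) z ≡ φ x k z
    φ-same z ne with z ℕₚ.≤? k
    ... | yes l rewrite ≤ᵇ-true l | ≤ᵇ-true (ℕₚ.m≤n⇒m≤1+n l) = refl
    ... | no nl rewrite ≤ᵇ-false (ℕₚ.≰⇒> nl) | ≤ᵇ-false (ℕₚ.≤∧≢⇒< (ℕₚ.≰⇒> nl) (ne ∘ sym)) = refl
    ψ-same : ∀ z → z ≢ x → ψ x (suc k) z ≡ ψ x k z
    ψ-same z ne rewrite ≡ᵇ-false ne = refl

  potential-cong : ∀ {φ φ′ ψ ψ′ : ℕ → ℕ} → (∀ y → 1 ℕ.≤ y → y ℕ.≤ n → φ y ≡ φ′ y) → (∀ z → ψ z ≡ ψ′ z) → ∀ s → potential φ ψ s ≡ potential φ′ ψ′ s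
  potential-cong eφ eψ s = cong₂ _*_
    (∏-cong-∈ (down n) λ y m → cong (λ k → power (s (hor y)) (2ℤ ^ k)) (eφ y (down-pos m) (down-≤ m)))
    (cong (_* ∏ (diagonals n) (λ d → power (s (dia d)) (2ℤ ^ d))) (∏-cong (λ z → cong (λ k → power (s (ver z)) (2ℤ ^ k)) (eψ z)) (range 1 n)))

  φ-seam : ∀ x y → 1 ℕ.≤ y → y ℕ.≤ n → φ x 0 y ≡ φ (suc x) n y
  φ-seam x y l u rewrite ≤ᵇ-false l | ≤ᵇ-true u = refl

  ψ-seam : ∀ x z → ψ x 0 z ≡ ψ (suc x) n z
  ψ-seam x z with ℕₚ.<-cmp z x
  ... | tri< l ne _ rewrite <ᵇ-true l | <ᵇ-true (ℕₚ.m≤n⇒m≤1+n l) = refl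
  ... | tri≈ _ refl _ rewrite <ᵇ-false (ℕₚ.≤-refl {x}) | ≡ᵇ-refl x | <ᵇ-true (ℕₚ.n<1+n x) = cong suc (ℕₚ.+-identityʳ x)
  ... | tri> _ ne g rewrite <ᵇ-false (ℕₚ.<⇒≤ g) | ≡ᵇ-false ne | <ᵇ-false g with z ℕ.≡ᵇ suc x in e
  ...   | true rewrite ≡ᵇ-true z (suc x) e = refl
  ...   | false = refl

  grid-gauge : ∀ j x → x ℕ.+ j ≡ suc n → 1 ℕ.≤ x → ∀ {f f′ : Functional} →
    (∀ s → ap f′ s ≡ potential (φ (suc n) n) (ψ (suc n) n) s * ap f s) →
    ∀ s → ap (act (gridOf vertexV (down n) (range x j)) f′) s
      ≡ (4ℤ ^ n) ^ j * (potential (φ x n) (ψ x n) s * ap (act (gridOf vertexI (down n) (range x j)) f) s)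
  grid-gauge zero x e 1≤x {f} h s = trans (h s) (trans
    (cong (λ x → potential (φ x n) (ψ x n) s * ap f s) (trans (sym e) (ℕₚ.+-identityʳ x))) (sym (*-identityˡ _)))
  grid-gauge (suc j) x e 1≤x {f} {f′} h s = begin
    ap (act (columnOf vertexV x (down n)) (act (gridOf vertexV (down n) (range (suc x) j)) f′)) s
      ≡⟨ column-gauge x (range-∈ 1≤x (ℕₚ.<-≤-trans (ℕₚ.m<m+n x (s≤s z≤n)) (ℕₚ.≤-reflexive e))) n ℕₚ.≤-refl {act (scalar total) rest}
           {act (gridOf vertexV (down n) (range (suc x) j)) f′}
           (λ t → trans (grid-gauge j (suc x) (trans (sym (ℕₚ.+-suc x j)) e) (s≤s z≤n) {f} {f′} h t)
             (trans (cong (λ p → total * (p * ap rest t)) (sym (potential-cong (φ-seam x) (ψ-seam x) t))) (*-exchange total _ _))) s ⟩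
    4ℤ ^ n * (potential (φ x n) (ψ x n) s * ap (act (columnOf vertexI x (down n)) (act (scalar total) rest)) s)
      ≡⟨ cong (λ t → 4ℤ ^ n * (potential (φ x n) (ψ x n) s * t)) (appᴼ (column-commute {vertexI} {scalar total} {x} (down n)
           (λ y _ → opwise λ f s → ice-scale (s (hor y)) (s (dia (x ℕ.+ y))) (s (ver x)) total _)) rest s) ⟩
    4ℤ ^ n * (potential (φ x n) (ψ x n) s * (total * ap (act (columnOf vertexI x (down n)) rest) s))
      ≡⟨ lem₂ _ total _ _ ⟩
    4ℤ ^ n * total * (potential (φ x n) (ψ x n) s * ap (act (columnOf vertexI x (down n)) rest) s) ∎
    where
    open ≡-Reasoning
    total : ℤ
    total = (4ℤ ^ n) ^ j
    rest : Functional
    rest = act (gridOf vertexI (down n) (range (suc x) j)) f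
    opaque
      unfolding ℤ
      lem₂ : ∀ a b c d → a * (c * (b * d)) ≡ a * b * (c * d)
      lem₂ = solve-∀ ring

  module _ (S : ℕ) where

    -- The potential is the same in front of the grid and behind it: the rows enter with exponents y
    -- + 1, the columns leave with exponents x + 1, and a diagonal line keeps its exponent d. So it
    -- can be cancelled.
    edges : ℤ
    edges = ∏ (range 1 n) (λ x → 2ℤ ^ suc x) * ∏ (diagonals n) (λ d → power (d ℕ.≤ᵇ S) (2ℤ ^ d))

    edges-nonzero : edges ≢ 0ℤ
    edges-nonzero = *-nonzero (∏-nonzero (All.universal (λ x → ℤ-power-nonzero (suc x)) (range 1 n)))
      (∏-nonzero (All.universal (λ d → nonzero (d ℕ.≤ᵇ S) d) (diagonals n)))
      where
      nonzero : ∀ b d → power b (2ℤ ^ d) ≢ 0ℤ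
      nonzero true d = ℤ-power-nonzero d
      nonzero false d = 1≢0

    ∏-1 : ∀ {X : Set} (xs : List X) → ∏ xs (λ _ → 1ℤ) ≡ 1ℤ
    ∏-1 [] = refl
    ∏-1 (_ ∷ xs) = trans (*-identityˡ _) (∏-1 xs)

    initial-potential : potential (φ 1 n) (ψ 1 n) (initial S) ≡ edges
    initial-potential = cong₂ _*_
      (trans (∏-cong-∈ (down n) λ y m → cong (2ℤ ^_) (cong (if_then suc y else suc (suc y)) (≤ᵇ-true (down-≤ m)))) (∏-↭ (λ y → 2ℤ ^ suc y) (down-range n)))
      (trans (cong (_* ∏ (diagonals n) (λ d → power (d ℕ.≤ᵇ S) (2ℤ ^ d))) (∏-1 (range 1 n))) (*-identityˡ _))

    final-potential : ∀ s → potential (φ (suc n) n) (ψ (suc n) n) s * ap (final n S) s ≡ edges * ap (final n S) s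
    final-potential s = begin
      potential (φ (suc n) n) (ψ (suc n) n) s * ap (final n S) s
        ≡⟨ trans (cong (potential (φ (suc n) n) (ψ (suc n) n) s *_) (guards-∏ S (diagonals n) _ s)) (lem₁ _ _ _ _ _ _) ⟩
      _ ≡⟨ cong₂ (λ a b → a * b) (absorb (down n) λ y m → not-absorb (s (hor y)))
             (cong₂ (λ a b → a * b) (absorb (range 1 n) λ z m → trans (absorbᵇ (s (ver z)) _)
                 (cong (λ b → 2ℤ ^ (if b then suc z else (if z ℕ.≡ᵇ suc n then suc (suc n ℕ.+ n) else suc (z ℕ.+ n))) * ⟦ s (ver z) ⟧) (<ᵇ-true (range-< m))))
               (absorb (diagonals n) λ d m → match-absorb (d ℕ.≤ᵇ S) (s (dia d)) (2ℤ ^ d))) ⟩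
      _ ≡⟨ sym (trans (cong (edges *_) (guards-∏ S (diagonals n) _ s)) (trans (lem₂ _ _ _ _ _)
             (cong (λ t → t * ∏ (down n) (λ i → ⟦ not (s (hor i)) ⟧) * (verticals * rest)) (sym (∏-1 (down n)))))) ⟩
      edges * ap (final n S) s ∎
      where
      open ≡-Reasoning
      verticals rest : ℤ
      verticals = ∏ (range 1 n) (λ x → 2ℤ ^ suc x) * ∏ (range 1 n) (λ x → ⟦ s (ver x) ⟧)
      rest = ∏ (diagonals n) (λ d → power (d ℕ.≤ᵇ S) (2ℤ ^ d)) * ∏ (diagonals n) (λ d → ⟦ matches (d ℕ.≤ᵇ S) (s (dia d)) ⟧)
      absorb : ∀ {X : Set} {g h k : X → ℤ} xs → (∀ x → x ∈ xs → g x * h x ≡ k x * h x) → ∏ xs g * ∏ xs h ≡ ∏ xs k * ∏ xs h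
      absorb {g = g} {h} {k} xs e = trans (sym (∏-* g h xs)) (trans (∏-cong-∈ xs e) (∏-* k h xs))
      not-absorb : ∀ b {z} → power b z * ⟦ not b ⟧ ≡ 1ℤ * ⟦ not b ⟧
      not-absorb true = trans (zeroʳ _) (sym (zeroʳ _))
      not-absorb false = refl
      absorbᵇ : ∀ b z → power b z * ⟦ b ⟧ ≡ z * ⟦ b ⟧
      absorbᵇ true z = refl
      absorbᵇ false z = trans (zeroʳ _) (sym (zeroʳ _))
      match-absorb : ∀ β b z → power b z * ⟦ matches β b ⟧ ≡ power β z * ⟦ matches β b ⟧
      match-absorb true b z = absorbᵇ b z
      match-absorb false b z = not-absorb b
      opaque
        unfolding ℤ
        lem₁ : ∀ a b c a′ b′ c′ → a * (b * c) * (c′ * (a′ * b′)) ≡ (a * a′) * ((b * b′) * (c * c′))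
        lem₁ = solve-∀ ring
        lem₂ : ∀ b c a′ b′ c′ → b * c * (c′ * (a′ * b′)) ≡ (1ℤ * a′) * ((b * b′) * (c * c′))
        lem₂ = solve-∀ ring

    gauge-free : ap (act (square vertexV n) (final n S)) (initial S) ≡ (4ℤ ^ n) ^ n * ap (act (square vertexI n) (final n S)) (initial S)
    gauge-free = *-cancelˡ edges edges-nonzero (begin
      edges * ap (act (square vertexV n) (final n S)) (initial S)
        ≡⟨ sym (appᴼ (grid-commute {vertexV} {scalar edges} {down n} (range 1 n) (λ x _ y _ → commute-⊙ˡ {crossB y (x ℕ.+ y)} (commute-sym {scalar edges} (scalar-R _ _ _ _))
             (commute-⊙ˡ {vertexA x y} (commute-sym {scalar edges} (scalar-R _ _ _ _)) (commute-sym {scalar edges} (scalar-R _ _ _ _))))) (final n S) (initial S)) ⟩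
      ap (act (square vertexV n) (act (scalar edges) (final n S))) (initial S)
        ≡⟨ grid-gauge n 1 refl (s≤s z≤n) {final n S} {act (scalar edges) (final n S)} (λ s → sym (final-potential s)) (initial S) ⟩
      (4ℤ ^ n) ^ n * (potential (φ 1 n) (ψ 1 n) (initial S) * ap (act (square vertexI n) (final n S)) (initial S))
        ≡⟨ trans (cong (λ p → (4ℤ ^ n) ^ n * (p * ap (act (square vertexI n) (final n S)) (initial S))) initial-potential) (*-exchange _ _ _) ⟩
      edges * ((4ℤ ^ n) ^ n * ap (act (square vertexI n) (final n S)) (initial S)) ∎)
      where
      open ≡-Reasoning

-- Sums over orientations

data Edge : Set where
  east south southeast : ℕ → ℕ → Edge

arrow : Edge → DEdge
arrow (east x y) = (x , y) , (suc x , y)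
arrow (south x y) = (x , suc y) , (x , y)
arrow (southeast x y) = (x , suc y) , (suc x , y)

arrow-injective : ∀ {e e′} → arrow e ≡ arrow e′ → e ≡ e′
arrow-injective {east _ _} {east _ _} refl = refl
arrow-injective {south _ _} {south _ _} refl = refl
arrow-injective {southeast _ _} {southeast _ _} refl = refl

opaque
  _≟ᴱ_ : (e e′ : Edge) → Dec (e ≡ e′)
  e ≟ᴱ e′ = map′ arrow-injective (cong arrow) (≡-dec (≡-dec ℕₚ._≟_ ℕₚ._≟_) (≡-dec ℕₚ._≟_ ℕₚ._≟_) (arrow e) (arrow e′))

-- true means that the edge points to the right, down, or both.
Orientation : Set
Orientation = Edge → Bool

opaque
  _[_↦_] : Orientation → Edge → Bool → Orientation
  (σ [ e ↦ b ]) e′ = if does (e′ ≟ᴱ e) then b else σ e′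

  at-same : ∀ σ e b → (σ [ e ↦ b ]) e ≡ b
  at-same σ e b with e ≟ᴱ e
  ... | yes _ = refl
  ... | no ne = ⊥-elim (ne refl)

  at-other : ∀ σ {e e′} b → e′ ≢ e → (σ [ e ↦ b ]) e′ ≡ σ e′
  at-other σ {e} {e′} b ne with e′ ≟ᴱ e
  ... | yes eq = ⊥-elim (ne eq)
  ... | no _ = refl

  ↦-cong : ∀ {σ τ : Orientation} e b → σ ≗ τ → σ [ e ↦ b ] ≗ τ [ e ↦ b ]
  ↦-cong e b eq e′ with e′ ≟ᴱ e
  ... | yes _ = refl
  ... | no _ = eq e′

  ↦-comm : ∀ σ {e e′} b b′ → e ≢ e′ → (σ [ e ↦ b ]) [ e′ ↦ b′ ] ≗ (σ [ e′ ↦ b′ ]) [ e ↦ b ]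
  ↦-comm σ {e} {e′} b b′ ne k with k ≟ᴱ e | k ≟ᴱ e′
  ... | yes refl | yes refl = ⊥-elim (ne refl)
  ... | yes _ | no _ = refl
  ... | no _ | yes _ = refl
  ... | no _ | no _ = refl

∑ᴼ : List Edge → (Orientation → ℤ) → Orientation → ℤ
∑ᴼ [] F σ = F σ
∑ᴼ (e ∷ es) F σ = ∑ᴼ es F (σ [ e ↦ true ]) + ∑ᴼ es F (σ [ e ↦ false ])

Extensional : (Orientation → ℤ) → Set
Extensional F = ∀ {σ τ} → σ ≗ τ → F σ ≡ F τ

∑ᴼ-extensional : ∀ {F} es → Extensional F → Extensional (∑ᴼ es F)
∑ᴼ-extensional [] x eq = x eq
∑ᴼ-extensional (e ∷ es) x eq = cong₂ _+_ (∑ᴼ-extensional es x (↦-cong e true eq)) (∑ᴼ-extensional es x (↦-cong e false eq))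

∑ᴼ-cong : ∀ {F G} es {σ} → (∀ τ → (∀ e → e ∉ es → τ e ≡ σ e) → F τ ≡ G τ) → ∑ᴼ es F σ ≡ ∑ᴼ es G σ
∑ᴼ-cong [] h = h _ (λ _ _ → refl)
∑ᴼ-cong {F} {G} (e ∷ es) {σ} h = cong₂ _+_ (branch true) (branch false)
  where
  branch : ∀ b → ∑ᴼ es F (σ [ e ↦ b ]) ≡ ∑ᴼ es G (σ [ e ↦ b ])
  branch b = ∑ᴼ-cong es λ τ agree → h τ λ e′ n → trans (agree e′ (n ∘ there)) (at-other σ b (n ∘ here))

∑ᴼ-scale : ∀ c F es σ → ∑ᴼ es (λ τ → c * F τ) σ ≡ c * ∑ᴼ es F σ
∑ᴼ-scale c F [] σ = refl
∑ᴼ-scale c F (e ∷ es) σ = trans (cong₂ _+_ (∑ᴼ-scale c F es _) (∑ᴼ-scale c F es _)) (sym (distribˡ c _ _))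

∑ᴼ-factor : ∀ {F} (g : Orientation → ℤ) es {σ} → (∀ τ → (∀ e → e ∉ es → τ e ≡ σ e) → g τ ≡ g σ) →
  ∑ᴼ es (λ τ → g τ * F τ) σ ≡ g σ * ∑ᴼ es F σ
∑ᴼ-factor {F} g es {σ} h = trans (∑ᴼ-cong es λ τ agree → cong (_* F τ) (h τ agree)) (∑ᴼ-scale (g σ) F es σ)

∑ᴼ-++ : ∀ {F} es es′ σ → ∑ᴼ (es ++ es′) F σ ≡ ∑ᴼ es (∑ᴼ es′ F) σ
∑ᴼ-++ [] es′ σ = refl
∑ᴼ-++ (e ∷ es) es′ σ = cong₂ _+_ (∑ᴼ-++ es es′ _) (∑ᴼ-++ es es′ _)

∑ᴼ-↭ : ∀ {F} → Extensional F → ∀ {es es′} → es ↭ es′ → ∀ σ → ∑ᴼ es F σ ≡ ∑ᴼ es′ F σ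
∑ᴼ-↭ x ↭.refl σ = refl
∑ᴼ-↭ x (↭.prep e p) σ = cong₂ _+_ (∑ᴼ-↭ x p _) (∑ᴼ-↭ x p _)
∑ᴼ-↭ x (↭.trans p q) σ = trans (∑ᴼ-↭ x p σ) (∑ᴼ-↭ x q σ)
∑ᴼ-↭ {F} x (↭.swap {es} {es′} e e′ p) σ with e ≟ᴱ e′
... | yes refl = cong₂ _+_ (cong₂ _+_ (∑ᴼ-↭ x p _) (∑ᴼ-↭ x p _)) (cong₂ _+_ (∑ᴼ-↭ x p _) (∑ᴼ-↭ x p _))
... | no ne = trans (lem _ _ _ _) (cong₂ _+_ (cong₂ _+_ (go true true) (go false true)) (cong₂ _+_ (go true false) (go false false)))
  where
  opaque
    unfolding ℤ
    lem : ∀ a b c d → (a + b) + (c + d) ≡ (a + c) + (b + d)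
    lem = solve-∀ ring
  go : ∀ b b′ → ∑ᴼ es F ((σ [ e ↦ b ]) [ e′ ↦ b′ ]) ≡ ∑ᴼ es′ F ((σ [ e′ ↦ b′ ]) [ e ↦ b ])
  go b b′ = trans (∑ᴼ-extensional es x (↦-comm σ b b′ ne)) (∑ᴼ-↭ x p _)

-- The product admits a single orientation of the edges es, and σ already has it.
∑ᴼ-collapse : ∀ {F} (β : Orientation) es {σ} → Extensional F → Unique es → (∀ e → e ∈ es → σ e ≡ β e) →
  ∑ᴼ es (λ τ → ∏ es (λ e → ⟦ matches (β e) (τ e) ⟧) * F τ) σ ≡ F σ
∑ᴼ-collapse β [] x u h = *-identityˡ _
∑ᴼ-collapse {F} β (e ∷ es) {σ} x (a ∷ u) h = trans (cong₂ _+_ (branch true) (branch false)) (choose (β e) (h e (here refl)))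
  where
  branch : ∀ b → ∑ᴼ es (λ τ → ⟦ matches (β e) (τ e) ⟧ * ∏ es (λ e → ⟦ matches (β e) (τ e) ⟧) * F τ) (σ [ e ↦ b ])
    ≡ ⟦ matches (β e) b ⟧ * F (σ [ e ↦ b ])
  branch b = trans (∑ᴼ-cong es λ τ agree → trans (*-assoc _ _ _) (cong (λ c → ⟦ matches (β e) c ⟧ * (∏ es (λ e → ⟦ matches (β e) (τ e) ⟧) * F τ))
      (trans (agree e (λ m → All.lookup a m refl)) (at-same σ e b))))
    (trans (∑ᴼ-scale _ _ es _) (cong (⟦ matches (β e) b ⟧ *_) (∑ᴼ-collapse β es x u λ e′ m →
      trans (at-other σ b (λ eq → All.lookup a m (sym eq))) (h e′ (there m)))))
  unchanged : ∀ {b} → σ e ≡ b → σ [ e ↦ b ] ≗ σ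
  unchanged {b} eq e′ with e′ ≟ᴱ e
  ... | yes refl = trans (at-same σ e b) (sym eq)
  ... | no ne = at-other σ b ne
  choose : ∀ b → σ e ≡ b → ⟦ matches b true ⟧ * F (σ [ e ↦ true ]) + ⟦ matches b false ⟧ * F (σ [ e ↦ false ]) ≡ F σ
  choose true eq = trans (cong₂ _+_ (*-identityˡ _) (zeroˡ _)) (trans (+-identityʳ _) (x (unchanged eq)))
  choose false eq = trans (cong₂ _+_ (zeroˡ _) (*-identityˡ _)) (trans (+-identityˡ _) (x (unchanged eq)))

bit : Bool → ℕ
bit true = 1
bit false = 0

-- The arguments are the edges to the left, upper left, above, right, lower right and below.
incoming outgoing : Bool → Bool → Bool → Bool → Bool → Bool → ℕ
incoming i j k o p q = (bit i ℕ.+ bit (not o)) ℕ.+ ((bit k ℕ.+ bit (not q)) ℕ.+ (bit j ℕ.+ bit (not p)))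
outgoing i j k o p q = (bit o ℕ.+ bit (not i)) ℕ.+ ((bit q ℕ.+ bit (not k)) ℕ.+ (bit p ℕ.+ bit (not j)))

balanced : Bool → Bool → Bool → Bool → Bool → Bool → Bool
balanced i j k o p q = (incoming i j k o p q ℕ.≡ᵇ 3) ∧ (outgoing i j k o p q ℕ.≡ᵇ 3)

sum₈ : (Bool → Bool → Bool → ℤ) → ℤ
sum₈ F = ((F true true true + F true true false) + (F true false true + F true false false))
  + ((F false true true + F false true false) + (F false false true + F false false false))

sum₈-cong : ∀ {F G} → (∀ o p q → F o p q ≡ G o p q) → sum₈ F ≡ sum₈ G
sum₈-cong e = cong₂ _+_ (cong₂ _+_ (cong₂ _+_ (e _ _ _) (e _ _ _)) (cong₂ _+_ (e _ _ _) (e _ _ _)))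
  (cong₂ _+_ (cong₂ _+_ (e _ _ _) (e _ _ _)) (cong₂ _+_ (e _ _ _) (e _ _ _)))

-- An edge points into the vertex if it is a path that enters or a missing path on the exit side. So
-- three edges point in exactly when as many paths leave as enter.
ice-balanced : ∀ i j k F → ice i j k F ≡ sum₈ (λ o p q → ⟦ balanced i j k o p q ⟧ * F o p q)
ice-balanced i j k F = go i j k
  where
  opaque
    unfolding ℤ
    lem₃ : ∀ a b c d e f g h → a ≡ ((1ℤ * a + 0ℤ * b) + (0ℤ * c + 0ℤ * d)) + ((0ℤ * e + 0ℤ * f) + (0ℤ * g + 0ℤ * h))
    lem₃ = solve-∀ ring
    lem₂ : ∀ a b c d e f g h → b + (c + e) ≡ ((0ℤ * a + 1ℤ * b) + (1ℤ * c + 0ℤ * d)) + ((1ℤ * e + 0ℤ * f) + (0ℤ * g + 0ℤ * h))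
    lem₂ = solve-∀ ring
    lem₁ : ∀ a b c d e f g h → d + (f + g) ≡ ((0ℤ * a + 0ℤ * b) + (0ℤ * c + 1ℤ * d)) + ((0ℤ * e + 1ℤ * f) + (1ℤ * g + 0ℤ * h))
    lem₁ = solve-∀ ring
    lem₀ : ∀ a b c d e f g h → h ≡ ((0ℤ * a + 0ℤ * b) + (0ℤ * c + 0ℤ * d)) + ((0ℤ * e + 0ℤ * f) + (0ℤ * g + 1ℤ * h))
    lem₀ = solve-∀ ring
  Goal : Bool → Bool → Bool → Set
  Goal i j k = ice i j k F ≡ sum₈ (λ o p q → ⟦ balanced i j k o p q ⟧ * F o p q)
  go : ∀ i j k → Goal i j k
  go true true true = lem₃ _ _ _ _ _ _ _ _
  go true true false = lem₂ _ _ _ _ _ _ _ _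
  go true false true = lem₂ _ _ _ _ _ _ _ _
  go false true true = lem₂ _ _ _ _ _ _ _ _
  go true false false = lem₁ _ _ _ _ _ _ _ _
  go false true false = lem₁ _ _ _ _ _ _ _ _
  go false false true = lem₁ _ _ _ _ _ _ _ _
  go false false false = lem₀ _ _ _ _ _ _ _ _

-- The operator of the grid as a sum over orientations

run : List Point → Operator
run [] = 𝟙
run ((x , y) ∷ cs) = vertexI x y ⊙ run cs

outs : Point → List Edge
outs (x , y) = east x y ∷ southeast x (y ℕ.∸ 1) ∷ south x (y ℕ.∸ 1) ∷ []

okᵇ : Point → Orientation → Bool
okᵇ (x , y) τ = balanced (τ (east (x ℕ.∸ 1) y)) (τ (southeast (x ℕ.∸ 1) y)) (τ (south x y))
  (τ (east x y)) (τ (southeast x (y ℕ.∸ 1))) (τ (south x (y ℕ.∸ 1)))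

ok : Point → Orientation → ℤ
ok c τ = ⟦ okᵇ c τ ⟧

-- The edges at which the lines of a vertex stand before and after it is crossed.
record Passes (x y : ℕ) (cur cur′ : Line → Edge) : Set where
  field
    x-pos   : 1 ℕ.≤ x
    y-pos   : 1 ℕ.≤ y
    hor-in  : cur (hor y) ≡ east (x ℕ.∸ 1) y
    dia-in  : cur (dia (x ℕ.+ y)) ≡ southeast (x ℕ.∸ 1) y
    ver-in  : cur (ver x) ≡ south x y
    hor-out : cur′ (hor y) ≡ east x y
    dia-out : cur′ (dia (x ℕ.+ y)) ≡ southeast x (y ℕ.∸ 1)
    ver-out : cur′ (ver x) ≡ south x (y ℕ.∸ 1)
    others  : ∀ ℓ → ℓ ≢ hor y → ℓ ≢ dia (x ℕ.+ y) → ℓ ≢ ver x → cur′ ℓ ≡ cur ℓ × cur ℓ ∉ outs (x , y)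

data Follows : (Line → Edge) → List Point → (Line → Edge) → Set where
  done : ∀ {cur cur′} → cur ≗ cur′ → Follows cur [] cur′
  pass : ∀ {x y cs cur cur₁ cur′} → Passes x y cur cur₁ → Follows cur₁ cs cur′ → Follows cur ((x , y) ∷ cs) cur′

follows-resp : ∀ {cs cur cur₁ cur₂} → cur ≗ cur₁ → Follows cur₁ cs cur₂ → Follows cur cs cur₂
follows-resp e (done e′) = done (λ ℓ → trans (e ℓ) (e′ ℓ))
follows-resp e (pass p f) = pass (record
  { x-pos = x-pos ; y-pos = y-pos ; hor-in = trans (e _) hor-in ; dia-in = trans (e _) dia-in ; ver-in = trans (e _) ver-in
  ; hor-out = hor-out ; dia-out = dia-out ; ver-out = ver-out
  ; others = λ ℓ a b c → trans (proj₁ (others ℓ a b c)) (sym (e ℓ)) , λ m → proj₂ (others ℓ a b c) (subst (_∈ outs _) (e ℓ) m) }) f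
  where open Passes p

follows-++ : ∀ {cs cs′ cur cur₁ cur₂} → Follows cur cs cur₁ → Follows cur₁ cs′ cur₂ → Follows cur (cs ++ cs′) cur₂
follows-++ (done e) g = follows-resp e g
follows-++ (pass p f) g = pass p (follows-++ f g)

-- The order of crossing: columns from left to right, each from top to bottom. Positive coordinates
-- make the truncated subtractions in `ins` and `outs` genuine.
record Precedes (c c′ : Point) : Set where
  constructor precedes
  field
    x-pos : 1 ℕ.≤ proj₁ c
    y-pos : 1 ℕ.≤ proj₂ c
    y′-pos : 1 ℕ.≤ proj₂ c′
    order : proj₁ c ℕ.< proj₁ c′ ⊎ (proj₁ c ≡ proj₁ c′ × proj₂ c′ ℕ.< proj₂ c)

ins : Point → List Edge
ins (x , y) = east (x ℕ.∸ 1) y ∷ southeast (x ℕ.∸ 1) y ∷ south x y ∷ []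

Leaves : ℕ → ℕ → Edge → Set
Leaves x y (east i j) = i ≡ x × j ≡ y
Leaves x y (southeast i j) = i ≡ x × j ≡ y ℕ.∸ 1
Leaves x y (south i j) = i ≡ x × j ≡ y ℕ.∸ 1

outs-leave : ∀ {x y e} → e ∈ outs (x , y) → Leaves x y e
outs-leave (here refl) = refl , refl
outs-leave (there (here refl)) = refl , refl
outs-leave (there (there (here refl))) = refl , refl

-- The edges that leave c′ lead to the right or down, away from every vertex crossed earlier, so the
-- edges at c keep the values they had when it was crossed.
precedes-fresh : ∀ {c c′} → Precedes c c′ → ∀ {e} → e ∈ ins c ++ outs c → e ∉ outs c′
precedes-fresh {suc x , suc y} {x′ , suc y′} (precedes _ _ _ o) m m′ = go o m (outs-leave m′)
  where
  go : ∀ {e} → suc x ℕ.< x′ ⊎ (suc x ≡ x′ × suc y′ ℕ.< suc y) → e ∈ ins (suc x , suc y) ++ outs (suc x , suc y) → ¬ Leaves x′ (suc y′) e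
  go (inj₁ l) (here refl) (refl , _) = ℕₚ.<-irrefl refl (ℕₚ.<-trans (ℕₚ.n<1+n _) l)
  go (inj₁ l) (there (here refl)) (refl , _) = ℕₚ.<-irrefl refl (ℕₚ.<-trans (ℕₚ.n<1+n _) l)
  go (inj₁ l) (there (there (here refl))) (refl , _) = ℕₚ.<-irrefl refl l
  go (inj₁ l) (there (there (there (here refl)))) (refl , _) = ℕₚ.<-irrefl refl l
  go (inj₁ l) (there (there (there (there (here refl))))) (refl , _) = ℕₚ.<-irrefl refl l
  go (inj₁ l) (there (there (there (there (there (here refl)))))) (refl , _) = ℕₚ.<-irrefl refl l
  go (inj₂ (refl , l)) (there (there (here refl))) (_ , refl) = ℕₚ.<-irrefl refl (ℕₚ.<-trans l (ℕₚ.n<1+n _))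
  go (inj₂ (refl , l)) (here refl) (e , _) = ℕₚ.1+n≢n (sym e)
  go (inj₂ (refl , l)) (there (here refl)) (e , _) = ℕₚ.1+n≢n (sym e)
  go (inj₂ (refl , l)) (there (there (there (here refl)))) (_ , refl) = ℕₚ.<-irrefl refl l
  go (inj₂ (refl , l)) (there (there (there (there (here refl))))) (_ , refl) = ℕₚ.<-irrefl refl l
  go (inj₂ (refl , l)) (there (there (there (there (there (here refl)))))) (_ , refl) = ℕₚ.<-irrefl refl l

ins-outs : ∀ {x y} → 1 ℕ.≤ x → 1 ℕ.≤ y → ∀ {e} → e ∈ ins (x , y) → e ∉ outs (x , y)
ins-outs {suc x} {suc y} _ _ m m′ = go m (outs-leave m′)
  where
  go : ∀ {e} → e ∈ ins (suc x , suc y) → ¬ Leaves (suc x) (suc y) e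
  go (here refl) (e , _) = ℕₚ.1+n≢n (sym e)
  go (there (here refl)) (e , _) = ℕₚ.1+n≢n (sym e)
  go (there (there (here refl))) (_ , e) = ℕₚ.1+n≢n e

all-fresh : ∀ {c cs} → All (Precedes c) cs → ∀ {e} → e ∈ ins c ++ outs c → e ∉ concatMap outs cs
all-fresh {cs = c′ ∷ cs} (a ∷ as) m m′ with ∈-++⁻ (outs c′) m′
... | inj₁ m₁ = precedes-fresh a m m₁
... | inj₂ m₂ = all-fresh as m m₂

_≟ᴸ_ : (k ℓ : Line) → Dec (k ≡ ℓ)
k ≟ᴸ ℓ with k ==ᴸ ℓ in e
... | true = yes (==ᴸ-true k ℓ e)
... | false = no λ { refl → case trans (sym e) (==ᴸ-refl k) of λ () }

-- A state is the restriction of an orientation to the edges at which the lines stand. Crossing a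
-- vertex sums over three fresh edges; the indicator of the vertex depends on edges that no later
-- vertex changes, so it can be pulled into the remaining sums.
transfer : ∀ {cs cur cur′} → Follows cur cs cur′ → AllPairs Precedes cs → ∀ f σ s → s ≗ σ ∘ cur →
  ap (act (run cs) f) s ≡ ∑ᴼ (concatMap outs cs) (λ τ → ∏ cs (λ c → ok c τ) * ap f (τ ∘ cur′)) σ
transfer (done e) _ f σ s h = trans (ext f (λ ℓ → trans (h ℓ) (cong σ (e ℓ)))) (sym (*-identityˡ _))
transfer {(x , y) ∷ cs} {cur} {cur′} (pass {cur₁ = cur₁} p r) (a ∷ as) f σ s h = begin
  ice (s (hor y)) (s (dia (x ℕ.+ y))) (s (ver x)) (λ o p q → ap (act (run cs) f) (((s [ hor y ≔ o ]) [ dia (x ℕ.+ y) ≔ p ]) [ ver x ≔ q ]))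
    ≡⟨ ice-cong (s (hor y)) (s (dia (x ℕ.+ y))) (s (ver x)) (λ o p q → transfer r as f (new o p q) _ (moved o p q)) ⟩
  ice (s (hor y)) (s (dia (x ℕ.+ y))) (s (ver x)) (λ o p q → ∑ᴼ (concatMap outs cs) rest (new o p q))
    ≡⟨ ice-at (trans (h _) (cong σ hor-in)) (trans (h _) (cong σ dia-in)) (trans (h _) (cong σ ver-in)) ⟩
  ice (σ (east (x ℕ.∸ 1) y)) (σ (southeast (x ℕ.∸ 1) y)) (σ (south x y)) (λ o p q → ∑ᴼ (concatMap outs cs) rest (new o p q))
    ≡⟨ ice-balanced (σ (east (x ℕ.∸ 1) y)) (σ (southeast (x ℕ.∸ 1) y)) (σ (south x y)) _ ⟩
  sum₈ (λ o p q → ⟦ balanced (σ (east (x ℕ.∸ 1) y)) (σ (southeast (x ℕ.∸ 1) y)) (σ (south x y)) o p q ⟧ * ∑ᴼ (concatMap outs cs) rest (new o p q))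
    ≡⟨ sum₈-cong (λ o p q → trans (cong (λ b → ⟦ b ⟧ * ∑ᴼ (concatMap outs cs) rest (new o p q)) (sym (ok-new o p q)))
         (trans (sym (∑ᴼ-factor (ok (x , y)) (concatMap outs cs) (ok-later o p q)))
           (∑ᴼ-cong (concatMap outs cs) λ τ _ → sym (*-assoc _ _ _)))) ⟩
  ∑ᴼ (concatMap outs ((x , y) ∷ cs)) (λ τ → ∏ ((x , y) ∷ cs) (λ c → ok c τ) * ap f (τ ∘ cur′)) σ ∎
  where
  open ≡-Reasoning
  open Passes p
  new : Bool → Bool → Bool → Orientation
  new o p q = ((σ [ east x y ↦ o ]) [ southeast x (y ℕ.∸ 1) ↦ p ]) [ south x (y ℕ.∸ 1) ↦ q ]
  rest : Orientation → ℤ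
  rest τ = ∏ cs (λ c → ok c τ) * ap f (τ ∘ cur′)
  ice-at : ∀ {i i′ j j′ k k′ F} → i ≡ i′ → j ≡ j′ → k ≡ k′ → ice i j k F ≡ ice i′ j′ k′ F
  ice-at refl refl refl = refl
  new-east : ∀ o p q → new o p q (east x y) ≡ o
  new-east o p q = trans (at-other ((σ [ east x y ↦ o ]) [ southeast x (y ℕ.∸ 1) ↦ p ]) q (λ ())) (trans (at-other (σ [ east x y ↦ o ]) p (λ ())) (at-same σ _ o))
  new-southeast : ∀ o p q → new o p q (southeast x (y ℕ.∸ 1)) ≡ p
  new-southeast o p q = trans (at-other ((σ [ east x y ↦ o ]) [ southeast x (y ℕ.∸ 1) ↦ p ]) q (λ ())) (at-same (σ [ east x y ↦ o ]) _ p)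
  new-south : ∀ o p q → new o p q (south x (y ℕ.∸ 1)) ≡ q
  new-south o p q = at-same ((σ [ east x y ↦ o ]) [ southeast x (y ℕ.∸ 1) ↦ p ]) _ q
  new-other : ∀ {e} o p q → e ∉ outs (x , y) → new o p q e ≡ σ e
  new-other o p q n = trans (at-other ((σ [ east x y ↦ o ]) [ southeast x (y ℕ.∸ 1) ↦ p ]) q (λ eq → n (there (there (here eq)))))
    (trans (at-other (σ [ east x y ↦ o ]) p (λ eq → n (there (here eq)))) (at-other σ o (λ eq → n (here eq))))
  moved : ∀ o p q → ((s [ hor y ≔ o ]) [ dia (x ℕ.+ y) ≔ p ]) [ ver x ≔ q ] ≗ new o p q ∘ cur₁
  moved o p q ℓ with ℓ ≟ᴸ ver x
  ... | yes refl = trans (lookup-same ((s [ hor y ≔ o ]) [ dia (x ℕ.+ y) ≔ p ]) (ver x) q) (sym (trans (cong (new o p q) ver-out) (new-south o p q)))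
  ... | no nv with ℓ ≟ᴸ dia (x ℕ.+ y)
  ...   | yes refl = trans (lookup-other ((s [ hor y ≔ o ]) [ dia (x ℕ.+ y) ≔ p ]) q nv)
    (trans (lookup-same (s [ hor y ≔ o ]) (dia (x ℕ.+ y)) p) (sym (trans (cong (new o p q) dia-out) (new-southeast o p q))))
  ...   | no nd with ℓ ≟ᴸ hor y
  ...     | yes refl = trans (lookup-other ((s [ hor y ≔ o ]) [ dia (x ℕ.+ y) ≔ p ]) q nv)
    (trans (lookup-other (s [ hor y ≔ o ]) p nd) (trans (lookup-same s (hor y) o) (sym (trans (cong (new o p q) hor-out) (new-east o p q)))))
  ...     | no nh = trans (lookup-other ((s [ hor y ≔ o ]) [ dia (x ℕ.+ y) ≔ p ]) q nv)
    (trans (lookup-other (s [ hor y ≔ o ]) p nd) (trans (lookup-other s o nh) (trans (h ℓ)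
      (sym (trans (cong (new o p q) (proj₁ (others ℓ nh nd nv))) (new-other o p q (proj₂ (others ℓ nh nd nv))))))))
  ok-cong : ∀ {i i′ j j′ k k′ o o′ p p′ q q′} → i ≡ i′ → j ≡ j′ → k ≡ k′ → o ≡ o′ → p ≡ p′ → q ≡ q′ →
    balanced i j k o p q ≡ balanced i′ j′ k′ o′ p′ q′
  ok-cong refl refl refl refl refl refl = refl
  old : ∀ {e} → e ∈ ins (x , y) → e ∉ outs (x , y)
  old = ins-outs x-pos y-pos
  ok-new : ∀ o p q → okᵇ (x , y) (new o p q) ≡ balanced (σ (east (x ℕ.∸ 1) y)) (σ (southeast (x ℕ.∸ 1) y)) (σ (south x y)) o p q
  ok-new o p q = ok-cong (new-other o p q (old (here refl))) (new-other o p q (old (there (here refl)))) (new-other o p q (old (there (there (here refl)))))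
    (new-east o p q) (new-southeast o p q) (new-south o p q)
  ok-later : ∀ o p q τ → (∀ e → e ∉ concatMap outs cs → τ e ≡ new o p q e) → ok (x , y) τ ≡ ok (x , y) (new o p q)
  ok-later o p q τ agree = cong ⟦_⟧ (ok-cong (go (here refl)) (go (there (here refl))) (go (there (there (here refl))))
    (go (there (there (there (here refl))))) (go (there (there (there (there (here refl)))))) (go (there (there (there (there (there (here refl))))))))
    where
    go : ∀ {e} → e ∈ ins (x , y) ++ outs (x , y) → τ e ≡ new o p q e
    go m = agree _ (all-fresh a m)

cells : List ℕ → List ℕ → List Point
cells ys xs = concatMap (λ x → map (x ,_) ys) xs

run-++ : ∀ cs ds f s → ap (act (run (cs ++ ds)) f) s ≡ ap (act (run cs) (act (run ds) f)) s
run-++ [] ds f s = refl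
run-++ ((x , y) ∷ cs) ds f s = appᴼ (⊙-congʳ (vertexI x y) {run (cs ++ ds)} {run cs ⊙ run ds} (opwise (run-++ cs ds))) f s

gridOf-run : ∀ ys xs f s → ap (act (gridOf vertexI ys xs) f) s ≡ ap (act (run (cells ys xs)) f) s
gridOf-run ys [] f s = refl
gridOf-run ys (x ∷ xs) f s = trans (cong (λ P → ap (act P (act (gridOf vertexI ys xs) f)) s) (column ys))
  (trans (appᴼ (⊙-congʳ (run (map (x ,_) ys)) {gridOf vertexI ys xs} {run (cells ys xs)} (opwise (gridOf-run ys xs))) f s)
    (sym (run-++ (map (x ,_) ys) (cells ys xs) f s)))
  where
  column : ∀ ys → columnOf vertexI x ys ≡ run (map (x ,_) ys)
  column [] = refl
  column (y ∷ ys) = cong (vertexI x y ⊙_) (column ys)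

unique-outs : ∀ {cs} → AllPairs Precedes cs → Unique (concatMap outs cs)
unique-outs [] = []
unique-outs {(x , y) ∷ cs} (a ∷ as) = AllPairsₚ.++⁺ (((λ ()) ∷ (λ ()) ∷ []) ∷ ((λ ()) ∷ []) ∷ [] ∷ [])
  (unique-outs as) (All.tabulate λ {e} m → All.tabulate λ m′ eq → all-fresh a (∈-++⁺ʳ (ins (x , y)) m) (subst (_∈ concatMap outs cs) (sym eq) m′))

column-ordered : ∀ x k → 1 ℕ.≤ x → AllPairs Precedes (map (x ,_) (down k))
column-ordered x zero l = []
column-ordered x (suc k) l = all-map (down k) (λ y m → precedes l (s≤s z≤n) (down-pos m) (inj₂ (refl , s≤s (down-≤ m)))) ∷ column-ordered x k l

cells-∈ : ∀ {ys xs x y} → (x , y) ∈ cells ys xs → x ∈ xs × y ∈ ys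
cells-∈ {ys} {x′ ∷ xs} m with ∈-++⁻ (map (x′ ,_) ys) m
... | inj₂ m₂ = there (proj₁ (cells-∈ {ys} {xs} m₂)) , proj₂ (cells-∈ {ys} {xs} m₂)
... | inj₁ m₁ with ∈-map⁻ (x′ ,_) m₁
...   | y , my , refl = here refl , my

cells-ordered : ∀ n x j → 1 ℕ.≤ x → AllPairs Precedes (cells (down n) (range x j))
cells-ordered n x zero l = []
cells-ordered n x (suc j) l = AllPairsₚ.++⁺ (column-ordered x n l) (cells-ordered n (suc x) j (s≤s z≤n))
  (all-map (down n) λ y m → All.tabulate λ m′ → let mx , my = cells-∈ {down n} {range (suc x) j} m′ in
    precedes l (down-pos m) (down-pos my) (inj₁ (range-≥ mx)))

module Frontier (n : ℕ) where

  -- The x-coordinate of the edge at which the line d stands. In the order of the cases, the line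
  -- has left the grid at the bottom, waits in front of the column x, has passed the column x, or
  -- has not yet entered at the top.
  index : ℕ → ℕ → ℕ → ℕ
  index x k d = if d ℕ.≤ᵇ x then d ℕ.∸ 1 else (if d ℕ.≤ᵇ x ℕ.+ k then x ℕ.∸ 1 else (if d ℕ.≤ᵇ x ℕ.+ n then x else d ℕ.∸ 1 ℕ.∸ n))

  -- The edges at which the lines stand when the rows above k of column x are done; lines
  -- that do not meet the grid get arbitrary edges.
  frontier : ℕ → ℕ → Line → Edge
  frontier x k (hor zero) = east 0 0
  frontier x k (hor (suc y)) = east (if y ℕ.<ᵇ k then x ℕ.∸ 1 else (if y ℕ.<ᵇ n then x else 0)) (suc y)
  frontier x k (ver z) = south z (if z ℕ.<ᵇ x then 0 else (if z ℕ.≡ᵇ x then k else n))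
  frontier x k (dia d) = southeast (index x k d) (d ℕ.∸ suc (index x k d))

  module _ {x k d : ℕ} where

    index-below : d ℕ.≤ x → index x k d ≡ d ℕ.∸ 1
    index-below l rewrite ≤ᵇ-true l = refl

    index-before : x ℕ.< d → d ℕ.≤ x ℕ.+ k → index x k d ≡ x ℕ.∸ 1
    index-before l u rewrite ≤ᵇ-false l | ≤ᵇ-true u = refl

    index-after : x ℕ.+ k ℕ.< d → d ℕ.≤ x ℕ.+ n → index x k d ≡ x
    index-after l u rewrite ≤ᵇ-false (ℕₚ.≤-<-trans (ℕₚ.m≤m+n x k) l) | ≤ᵇ-false l | ≤ᵇ-true u = refl

    index-above : x ℕ.+ k ℕ.< d → x ℕ.+ n ℕ.< d → index x k d ≡ d ℕ.∸ 1 ℕ.∸ n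
    index-above l u rewrite ≤ᵇ-false (ℕₚ.≤-<-trans (ℕₚ.m≤m+n x k) l) | ≤ᵇ-false l | ≤ᵇ-false u = refl

  data Position (x k d : ℕ) : Set where
    below  : d ℕ.≤ x → Position x k d
    before : x ℕ.< d → d ℕ.≤ x ℕ.+ k → Position x k d
    behind : x ℕ.+ k ℕ.< d → d ℕ.≤ x ℕ.+ n → Position x k d
    above  : x ℕ.+ k ℕ.< d → x ℕ.+ n ℕ.< d → Position x k d

  position : ∀ x k d → Position x k d
  position x k d with d ℕₚ.≤? x
  ... | yes l = below l
  ... | no nl with d ℕₚ.≤? x ℕ.+ k
  ...   | yes u = before (ℕₚ.≰⇒> nl) u
  ...   | no nu with d ℕₚ.≤? x ℕ.+ n
  ...     | yes v = behind (ℕₚ.≰⇒> nu) v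
  ...     | no nv = above (ℕₚ.≰⇒> nu) (ℕₚ.≰⇒> nv)

  index-step : ∀ {x k d} → suc k ℕ.≤ n → d ≢ x ℕ.+ suc k → index x k d ≡ index x (suc k) d
  index-step {x} {k} {d} k<n ne with position x k d
  ... | below l = trans (index-below {x} {k} l) (sym (index-below {x} {suc k} l))
  ... | before l u = trans (index-before {x} {k} l u) (sym (index-before {x} {suc k} l (ℕₚ.≤-trans u (ℕₚ.+-monoʳ-≤ x (ℕₚ.n≤1+n k)))))
  ... | behind l u = trans (index-after {x} {k} l u) (sym (index-after {x} {suc k}
      (ℕₚ.≤∧≢⇒< (subst (ℕ._≤ d) (sym (ℕₚ.+-suc x k)) l) (ne ∘ sym)) u))
  ... | above l u = trans (index-above {x} {k} l u) (sym (index-above {x} {suc k} (ℕₚ.≤-<-trans (ℕₚ.+-monoʳ-≤ x k<n) u) u))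

  passes : ∀ {x k} → 1 ℕ.≤ x → suc k ℕ.≤ n → Passes x (suc k) (frontier x (suc k)) (frontier x k)
  passes {suc w} {k} _ k<n = record
    { x-pos = s≤s z≤n ; y-pos = s≤s z≤n
    ; hor-in = cong (λ b → east (if b then w else (if k ℕ.<ᵇ n then x else 0)) (suc k)) (≤ᵇ-true (ℕₚ.n<1+n k))
    ; dia-in = trans (cong (λ i → southeast i (x ℕ.+ suc k ℕ.∸ suc i)) (index-before {x} {suc k} (ℕₚ.m<m+n x (s≤s z≤n)) ℕₚ.≤-refl))
        (cong (southeast w) (ℕₚ.m+n∸m≡n w (suc k)))
    ; ver-in = ver-at (suc k)
    ; hor-out = cong₂ (λ b b′ → east (if b then w else (if b′ then x else 0)) (suc k)) (≤ᵇ-false (ℕₚ.n<1+n k)) (≤ᵇ-true k<n)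
    ; dia-out = trans (cong (λ i → southeast i (x ℕ.+ suc k ℕ.∸ suc i)) (index-after {x} {k} (ℕₚ.+-monoʳ-< x (ℕₚ.n<1+n k)) (ℕₚ.+-monoʳ-≤ x k<n)))
        (cong (southeast x) (trans (cong (ℕ._∸ x) (ℕₚ.+-suc w k)) (ℕₚ.m+n∸m≡n w k)))
    ; ver-out = ver-at k
    ; others = λ ℓ nh nd nv → others ℓ nh nd nv , λ m → apart ℓ nh nd nv (outs-leave m) }
    where
    x : ℕ
    x = suc w
    ver-at : ∀ k → frontier x k (ver x) ≡ south x k
    ver-at k rewrite ≤ᵇ-false (ℕₚ.n<1+n x) | ≡ᵇ-refl w = refl
    others : ∀ ℓ → ℓ ≢ hor (suc k) → ℓ ≢ dia (x ℕ.+ suc k) → ℓ ≢ ver x → frontier x k ℓ ≡ frontier x (suc k) ℓ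
    others (hor zero) _ _ _ = refl
    others (hor (suc y)) nh _ _ = cong (λ b → east (if b then w else (if y ℕ.<ᵇ n then x else 0)) (suc y)) same
      where
      same : (y ℕ.<ᵇ k) ≡ (y ℕ.<ᵇ suc k)
      same with y ℕₚ.<? k
      ... | yes l = trans (≤ᵇ-true l) (sym (≤ᵇ-true (ℕₚ.m≤n⇒m≤1+n l)))
      ... | no nl = trans (≤ᵇ-false (s≤s (ℕₚ.≮⇒≥ nl))) (sym (≤ᵇ-false (s≤s (ℕₚ.≤∧≢⇒< (ℕₚ.≮⇒≥ nl) λ { refl → nh refl }))))
    others (ver z) _ _ nv rewrite ≡ᵇ-false {z} {x} (λ { refl → nv refl }) = refl
    others (dia d) _ nd _ = cong (λ i → southeast i (d ℕ.∸ suc i)) (index-step {x} {k} {d} k<n λ { refl → nd refl })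
    apart : ∀ ℓ → ℓ ≢ hor (suc k) → ℓ ≢ dia (x ℕ.+ suc k) → ℓ ≢ ver x → ¬ Leaves x (suc k) (frontier x (suc k) ℓ)
    apart (hor (suc y)) nh _ _ (_ , refl) = nh refl
    apart (ver z) _ _ nv (refl , _) = nv refl
    apart (dia d) _ nd _ (e , e′) with d ℕₚ.≤? x
    ... | yes l = ℕₚ.<⇒≢ (subst (λ i → i ℕ.< x) (sym (index-below {x} {suc k} l)) (ℕₚ.≤-<-trans (ℕₚ.∸-monoˡ-≤ 1 l) (ℕₚ.n<1+n w))) e
    ... | no nl = nd (cong dia (trans (sym (ℕₚ.m+[n∸m]≡n (ℕₚ.≰⇒> nl)))
      (trans (cong (suc x ℕ.+_) (trans (cong (λ i → d ℕ.∸ suc i) (sym e)) e′)) (sym (ℕₚ.+-suc x k)))))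

  index-seam : ∀ x d → index x 0 d ≡ index (suc x) n d
  index-seam x d with position x 0 d
  ... | below l = trans (index-below {x} {0} l) (sym (index-below {suc x} {n} (ℕₚ.m≤n⇒m≤1+n l)))
  ... | before l u = ⊥-elim (ℕₚ.<⇒≱ l (subst (d ℕ.≤_) (ℕₚ.+-identityʳ x) u))
  ... | behind l u with position (suc x) n d
  ...   | below l′ = trans (index-after {x} {0} l u) (trans (ℕₚ.≤-antisym (ℕₚ.∸-monoˡ-≤ 1 (subst (ℕ._< d) (ℕₚ.+-identityʳ x) l)) (ℕₚ.∸-monoˡ-≤ 1 l′)) (sym (index-below {suc x} {n} l′)))
  ...   | before l′ u′ = trans (index-after {x} {0} l u) (sym (index-before {suc x} {n} l′ u′))
  ...   | behind l′ _ = ⊥-elim (ℕₚ.<⇒≱ l′ (ℕₚ.m≤n⇒m≤1+n u))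
  ...   | above l′ _ = ⊥-elim (ℕₚ.<⇒≱ l′ (ℕₚ.m≤n⇒m≤1+n u))
  index-seam x d | above l u with position (suc x) n d
  ...   | below l′ = trans (index-above {x} {0} l u) (trans (cong (d ℕ.∸ 1 ℕ.∸_) (n-zero l′)) (sym (index-below {suc x} {n} l′)))
    where
    n-zero : d ℕ.≤ suc x → n ≡ 0
    n-zero l′ = ℕₚ.n≤0⇒n≡0 (ℕₚ.+-cancelˡ-≤ x n 0 (subst (x ℕ.+ n ℕ.≤_) (sym (ℕₚ.+-identityʳ x)) (ℕₚ.≤-pred (ℕₚ.≤-trans u l′))))
  ...   | before l′ u′ = trans (index-above {x} {0} l u) (trans (cong (λ d → d ℕ.∸ 1 ℕ.∸ n) (ℕₚ.≤-antisym u′ u)) (trans (ℕₚ.m+n∸n≡m x n) (sym (index-before {suc x} {n} l′ u′))))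
  ...   | behind l′ u′ = ⊥-elim (ℕₚ.<⇒≱ l′ u′)
  ...   | above l′ u′ = trans (index-above {x} {0} l u) (sym (index-above {suc x} {n} l′ u′))

  frontier-seam : ∀ x → frontier x 0 ≗ frontier (suc x) n
  frontier-seam x (hor zero) = refl
  frontier-seam x (hor (suc y)) with y ℕ.<ᵇ n
  ... | true = refl
  ... | false = refl
  frontier-seam x (ver z) = cong (south z) seam
    where
    seam : (if z ℕ.<ᵇ x then 0 else (if z ℕ.≡ᵇ x then 0 else n)) ≡ (if z ℕ.<ᵇ suc x then 0 else (if z ℕ.≡ᵇ suc x then n else n))
    seam with ℕₚ.<-cmp z x
    ... | tri< l ne _ rewrite ≤ᵇ-true l | ≤ᵇ-true (ℕₚ.m≤n⇒m≤1+n l) = refl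
    ... | tri≈ _ refl _ rewrite ≤ᵇ-false (ℕₚ.n<1+n x) | ≡ᵇ-refl x | ≤ᵇ-true (ℕₚ.n<1+n x) = refl
    ... | tri> _ ne g rewrite ≤ᵇ-false (s≤s (ℕₚ.<⇒≤ g)) | ≡ᵇ-false ne | ≤ᵇ-false (s≤s g) with z ℕ.≡ᵇ suc x
    ...   | true = refl
    ...   | false = refl
  frontier-seam x (dia d) = cong (λ i → southeast i (d ℕ.∸ suc i)) (index-seam x d)

  follows-column : ∀ x k → 1 ℕ.≤ x → k ℕ.≤ n → Follows (frontier x k) (map (x ,_) (down k)) (frontier x 0)
  follows-column x zero _ _ = done λ _ → refl
  follows-column x (suc k) l u = pass (passes l u) (follows-column x k l (ℕₚ.<⇒≤ u))

  follows-grid : ∀ x j → 1 ℕ.≤ x → Follows (frontier x n) (cells (down n) (range x j)) (frontier (x ℕ.+ j) n)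
  follows-grid x zero l = done λ ℓ → cong (λ x → frontier x n ℓ) (sym (ℕₚ.+-identityʳ x))
  follows-grid x (suc j) l = follows-++ (follows-column x n l ℕₚ.≤-refl) (follows-resp (frontier-seam x)
    (subst (λ y → Follows (frontier (suc x) n) (cells (down n) (range (suc x) j)) (frontier y n)) (sym (ℕₚ.+-suc x j)) (follows-grid (suc x) j (s≤s z≤n))))

-- Boundary edges

∏-++ : ∀ {X : Set} (g : X → ℤ) xs ys → ∏ (xs ++ ys) g ≡ ∏ xs g * ∏ ys g
∏-++ g [] ys = sym (*-identityˡ _)
∏-++ g (x ∷ xs) ys = trans (cong (g x *_) (∏-++ g xs ys)) (sym (*-assoc _ _ _))

∏-map : ∀ {X Y : Set} (g : Y → ℤ) (f : X → Y) xs → ∏ (map f xs) g ≡ ∏ xs (g ∘ f)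
∏-map g f [] = refl
∏-map g f (x ∷ xs) = cong (g (f x) *_) (∏-map g f xs)

range-suc : ∀ m n → map suc (range m n) ≡ range (suc m) n
range-suc m zero = refl
range-suc m (suc n) = cong (suc m ∷_) (range-suc (suc m) n)

map-range-suc : ∀ {A : Set} (f : ℕ → A) m n → map f (range (suc m) n) ≡ map (f ∘ suc) (range m n)
map-range-suc f m n = trans (cong (map f) (sym (range-suc m n))) (sym (map-∘ (range m n)))

concatMap-↭ : ∀ {A B : Set} {f g : A → List B} xs → (∀ x → f x ↭ g x) → concatMap f xs ↭ concatMap g xs
concatMap-↭ [] e = ↭.refl
concatMap-↭ (x ∷ xs) e = ↭ₚ.++⁺ (e x) (concatMap-↭ xs e)

concatMap-split : ∀ {A : Set} (f g : A → List Edge) xs → concatMap (λ x → f x ++ g x) xs ↭ concatMap f xs ++ concatMap g xs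
concatMap-split f g [] = ↭.refl
concatMap-split f g (x ∷ xs) = ↭.trans (↭ₚ.++⁺ˡ (f x ++ g x) (concatMap-split f g xs))
  (solve 4 (λ a b c d → ((a ⊞ b) ⊞ (c ⊞ d)) ⊜ ((a ⊞ c) ⊞ (b ⊞ d))) ↭.refl (f x) (g x) (concatMap f xs) (concatMap g xs))
  where open Algebra.Solver.CommutativeMonoid (↭ₚ.++-commutativeMonoid {A = Edge}) using (solve; _⊜_) renaming (_⊕_ to _⊞_)

concatMap-single : ∀ {A : Set} (f : A → Edge) xs → concatMap (λ x → f x ∷ []) xs ≡ map f xs
concatMap-single f [] = refl
concatMap-single f (x ∷ xs) = cong (f x ∷_) (concatMap-single f xs)

-- The orientation of the boundary; only S = n and S = n + 1 agree with the boundary conditions.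
boundary : ℕ → Orientation
boundary S (east i y) = i ℕ.≡ᵇ 0
boundary S (south zero j) = false
boundary S (south (suc x) j) = j ℕ.≡ᵇ 0
boundary S (southeast i j) = suc (i ℕ.+ j) ℕ.≤ᵇ S

module Boundary (m S : ℕ) (1≤S : 1 ℕ.≤ S) where
  private
    n : ℕ
    n = suc m
  open Frontier n

  start exit : Line → Edge
  start = frontier 1 n
  exit = frontier (suc n) n

  index-≤ : ∀ x k d → index (suc x) k (suc d) ℕ.≤ d
  index-≤ x k d with position (suc x) k (suc d)
  ... | below l = ℕₚ.≤-reflexive (index-below {suc x} {k} l)
  ... | before l u = subst (ℕ._≤ d) (sym (index-before {suc x} {k} l u)) (ℕₚ.≤-trans (ℕₚ.n≤1+n x) (ℕₚ.≤-pred l))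
  ... | behind l u = subst (ℕ._≤ d) (sym (index-after {suc x} {k} l u)) (ℕₚ.≤-trans (ℕₚ.m≤m+n (suc x) k) (ℕₚ.≤-pred l))
  ... | above l u = subst (ℕ._≤ d) (sym (index-above {suc x} {k} l u)) (ℕₚ.m∸n≤m d n)

  boundary-dia : ∀ x k d → boundary S (frontier (suc x) k (dia (suc d))) ≡ (suc d ℕ.≤ᵇ S)
  boundary-dia x k d = cong (λ t → suc t ℕ.≤ᵇ S) (ℕₚ.m+[n∸m]≡n (index-≤ x k d))

  initial-boundary : initial S ≗ boundary S ∘ start
  initial-boundary (hor zero) = refl
  initial-boundary (hor (suc y)) with y ℕ.<ᵇ n
  ... | true = refl
  ... | false = refl
  initial-boundary (ver zero) = refl
  initial-boundary (ver (suc z)) with z ℕ.≡ᵇ 0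
  ... | true = refl
  ... | false = refl
  initial-boundary (dia zero) = sym (≤ᵇ-true 1≤S)
  initial-boundary (dia (suc d)) = sym (boundary-dia 0 n d)

  exits : List Edge
  exits = map (exit ∘ dia) (diagonals n) ++ (map (exit ∘ hor) (down n) ++ map (exit ∘ ver) (range 1 n))

  exit-hor : ∀ {y} → y ∈ down n → exit (hor y) ≡ east n y
  exit-hor {zero} my = ⊥-elim (ℕₚ.<⇒≱ (s≤s z≤n) (down-pos my))
  exit-hor {suc y} my = cong (λ b → east (if b then n else (if b then suc n else 0)) (suc y)) (≤ᵇ-true (down-≤ my))

  exit-ver : ∀ {x} → x ∈ range 1 n → exit (ver x) ≡ south x 0
  exit-ver {x} mx = cong (λ b → south x (if b then 0 else (if x ℕ.≡ᵇ suc n then n else n))) (≤ᵇ-true (range-< mx))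

  exit-lower : ∀ {d} → suc d ∈ range 2 n → exit (dia (suc d)) ≡ southeast d 0
  exit-lower {d} md = trans (cong (λ i → southeast i (d ℕ.∸ i)) (index-below {suc n} {n} (ℕₚ.≤-pred (range-< md)))) (cong (southeast d) (ℕₚ.n∸n≡0 d))

  exit-upper : ∀ {j} → j ∈ range 1 m → exit (dia (suc n ℕ.+ j)) ≡ southeast n j
  exit-upper {j} mj = trans (cong (λ i → southeast i (n ℕ.+ j ℕ.∸ i)) (index-before {suc n} {n} {suc n ℕ.+ j} (ℕₚ.m<m+n (suc n) (range-≥ mj))
      (ℕₚ.+-monoʳ-≤ (suc n) (ℕₚ.<⇒≤ (range-< mj))))) (cong (southeast n) (ℕₚ.m+n∸m≡n n j))

  final-exits : ∀ τ → ap (final n S) (τ ∘ exit) ≡ ∏ exits (λ e → ⟦ matches (boundary S e) (τ e) ⟧)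
  final-exits τ = trans (guards-∏ S (diagonals n) _ (τ ∘ exit)) (sym (trans (∏-++ _ (map (exit ∘ dia) (diagonals n)) _) (cong₂ _*_
    (trans (∏-map _ (exit ∘ dia) (diagonals n)) (∏-cong-∈ (diagonals n) λ { zero md → ⊥-elim (ℕₚ.<⇒≱ (s≤s z≤n) (range-≥ md))
      ; (suc d) _ → cong (λ b → ⟦ matches b (τ (exit (dia (suc d)))) ⟧) (boundary-dia n n d) }))
    (trans (∏-++ _ (map (exit ∘ hor) (down n)) _) (cong₂ _*_
      (trans (∏-map _ (exit ∘ hor) (down n)) (∏-cong-∈ (down n) λ y my →
        cong (λ e → ⟦ matches (boundary S e) (τ (exit (hor y))) ⟧) (exit-hor my)))
      (trans (∏-map _ (exit ∘ ver) (range 1 n)) (∏-cong-∈ (range 1 n) λ { zero mx → ⊥-elim (ℕₚ.<⇒≱ (s≤s z≤n) (range-≥ mx))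
        ; (suc x) mx → cong (λ e → ⟦ matches (boundary S e) (τ (exit (ver (suc x)))) ⟧) (exit-ver mx) })))))))

  map-cong-∈ : ∀ {X : Set} {f g : X → Edge} xs → (∀ x → x ∈ xs → f x ≡ g x) → map f xs ≡ map g xs
  map-cong-∈ [] h = refl
  map-cong-∈ (x ∷ xs) h = cong₂ _∷_ (h x (here refl)) (map-cong-∈ xs (λ y m → h y (there m)))

  exits-≡ : exits ≡ (map (λ i → southeast i 0) (range 1 n) ++ map (southeast n) (range 1 m)) ++ (map (east n) (down n) ++ map (λ x → south x 0) (range 1 n))
  exits-≡ = cong₂ _++_ diagonal (cong₂ _++_ (map-cong-∈ (down n) (λ y → exit-hor)) (map-cong-∈ (range 1 n) (λ x → exit-ver)))
    where
    map-range-shift : ∀ (f : ℕ → Edge) k {a} l → map f (range (k ℕ.+ a) l) ≡ map (λ i → f (k ℕ.+ i)) (range a l)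
    map-range-shift f zero l = refl
    map-range-shift f (suc k) {a} l = trans (map-range-suc f (k ℕ.+ a) l) (map-range-shift (f ∘ suc) k l)
    diagonal : map (exit ∘ dia) (diagonals n) ≡ map (λ i → southeast i 0) (range 1 n) ++ map (southeast n) (range 1 m)
    diagonal = trans (cong (map (exit ∘ dia)) (trans (cong (range 2) (ℕₚ.+-comm m n)) (range-++ 2 n m)))
      (trans (map-++ (exit ∘ dia) (range 2 n) (range (2 ℕ.+ n) m)) (cong₂ _++_
        (trans (map-range-suc (exit ∘ dia) 1 n) (map-cong-∈ (range 1 n) (λ d md → exit-lower (subst (suc d ∈_) (range-suc 1 n) (∈-map⁺ suc md)))))
        (trans (cong (λ a → map (exit ∘ dia) (range a m)) (ℕₚ.+-comm 1 (suc n))) (trans (map-range-shift (exit ∘ dia) (suc n) m) (map-cong-∈ (range 1 m) (λ j → exit-upper))))))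

  -- Listed in the order of `innerEdges`, so that the enumeration by lists of Booleans can be
  -- matched with it.
  inner : List Edge
  inner = concatMap (λ x → map (east x) (range 1 n)) (range 1 m)
    ++ (concatMap (λ x → map (south x) (range 1 m)) (range 1 n) ++ concatMap (λ x → map (southeast x) (range 1 m)) (range 1 m))

  range-snoc : range 1 n ≡ range 1 m ++ n ∷ []
  range-snoc = trans (cong (range 1) (ℕₚ.+-comm 1 m)) (range-++ 1 m 1)

  concatMap-snoc : ∀ (f : ℕ → List Edge) → concatMap f (range 1 n) ≡ concatMap f (range 1 m) ++ f n
  concatMap-snoc f = trans (cong (concatMap f) range-snoc) (trans (concatMap-++ f (range 1 m) (n ∷ [])) (cong (concatMap f (range 1 m) ++_) (++-identityʳ (f n))))

  column-outs : ∀ x ys → concatMap outs (map (x ,_) ys) ↭ map (east x) ys ++ (map (λ y → southeast x (y ℕ.∸ 1)) ys ++ map (λ y → south x (y ℕ.∸ 1)) ys)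
  column-outs x [] = ↭.refl
  column-outs x (y ∷ ys) = ↭.prep _ (↭.trans (↭ₚ.++⁺ˡ (southeast x (y ℕ.∸ 1) ∷ south x (y ℕ.∸ 1) ∷ []) (column-outs x ys))
    (solve 5 (λ a b c d e → ((a ⊞ b) ⊞ (c ⊞ (d ⊞ e))) ⊜ (c ⊞ ((a ⊞ d) ⊞ (b ⊞ e)))) ↭.refl
      (southeast x (y ℕ.∸ 1) ∷ []) (south x (y ℕ.∸ 1) ∷ []) (map (east x) ys) (map (λ y → southeast x (y ℕ.∸ 1)) ys) (map (λ y → south x (y ℕ.∸ 1)) ys)))
    where open Algebra.Solver.CommutativeMonoid (↭ₚ.++-commutativeMonoid {A = Edge}) using (solve; _⊜_) renaming (_⊕_ to _⊞_)

  grid-outs : ∀ xs → concatMap outs (cells (down n) xs) ↭ concatMap (λ x → map (east x) (down n)) xs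
    ++ (concatMap (λ x → map (λ y → southeast x (y ℕ.∸ 1)) (down n)) xs ++ concatMap (λ x → map (λ y → south x (y ℕ.∸ 1)) (down n)) xs)
  grid-outs xs = ↭.trans (↭.↭-reflexive (flatten xs)) (↭.trans (concatMap-↭ xs (λ x → column-outs x (down n)))
    (↭.trans (concatMap-split _ _ xs) (↭ₚ.++⁺ˡ (concatMap (λ x → map (east x) (down n)) xs) (concatMap-split _ _ xs))))
    where
    flatten : ∀ xs → concatMap outs (cells (down n) xs) ≡ concatMap (λ x → concatMap outs (map (x ,_) (down n))) xs
    flatten [] = refl
    flatten (x ∷ xs) = trans (concatMap-++ outs (map (x ,_) (down n)) (cells (down n) xs)) (cong (concatMap outs (map (x ,_) (down n)) ++_) (flatten xs))

  lower-split : ∀ (f : ℕ → ℕ → Edge) xs → concatMap (λ x → map (λ y → f x (y ℕ.∸ 1)) (down n)) xs ↭ map (λ x → f x 0) xs ++ concatMap (λ x → map (f x) (range 1 m)) xs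
  lower-split f xs = ↭.trans (concatMap-↭ xs λ x → ↭.trans (↭ₚ.map⁺ (λ y → f x (y ℕ.∸ 1)) (down-range n))
      (↭.prep (f x 0) (↭.↭-reflexive (map-range-suc (λ y → f x (y ℕ.∸ 1)) 1 m))))
    (↭.trans (concatMap-split (λ x → f x 0 ∷ []) (λ x → map (f x) (range 1 m)) xs)
      (↭ₚ.++⁺ʳ (concatMap (λ x → map (f x) (range 1 m)) xs) (↭.↭-reflexive (concatMap-single (λ x → f x 0) xs))))

  -- Every inner edge and every exit edge is an output of exactly one vertex; the entry edges are
  -- outputs of none.
  outs-inner : concatMap outs (cells (down n) (range 1 n)) ↭ inner ++ exits
  outs-inner = ↭.trans (grid-outs (range 1 n)) (↭.trans
    (↭ₚ.++⁺ (↭.trans (↭.↭-reflexive (concatMap-snoc (λ x → map (east x) (down n))))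
        (↭ₚ.++⁺ʳ (map (east n) (down n)) (concatMap-↭ (range 1 m) (λ x → ↭ₚ.map⁺ (east x) (down-range n)))))
      (↭ₚ.++⁺ (↭.trans (lower-split southeast (range 1 n)) (↭ₚ.++⁺ˡ (map (λ x → southeast x 0) (range 1 n))
          (↭.↭-reflexive (concatMap-snoc (λ x → map (southeast x) (range 1 m))))))
        (lower-split south (range 1 n))))
    (↭.trans (solve 7 (λ a b c d e f g → ((a ⊞ b) ⊞ ((c ⊞ (d ⊞ e)) ⊞ (f ⊞ g))) ⊜ ((a ⊞ (g ⊞ d)) ⊞ ((c ⊞ e) ⊞ (b ⊞ f)))) ↭.refl
        (concatMap (λ x → map (east x) (range 1 n)) (range 1 m)) (map (east n) (down n))
        (map (λ x → southeast x 0) (range 1 n)) (concatMap (λ x → map (southeast x) (range 1 m)) (range 1 m)) (map (southeast n) (range 1 m))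
        (map (λ x → south x 0) (range 1 n)) (concatMap (λ x → map (south x) (range 1 m)) (range 1 n)))
      (↭.↭-reflexive (cong (inner ++_) (sym exits-≡)))))
    where open Algebra.Solver.CommutativeMonoid (↭ₚ.++-commutativeMonoid {A = Edge}) using (solve; _⊜_) renaming (_⊕_ to _⊞_)

-- Degrees

sumL-only : ∀ {A : Set} (h : A → ℤ) {a xs} → Unique xs → a ∈ xs → (∀ x → x ≢ a → h x ≡ 0ℤ) → sumL xs h ≡ h a
sumL-only h {xs = a ∷ xs} (u ∷ _) (here refl) z = trans (cong (λ t → h a + t) (sumL-zero xs (λ x m → z x (λ e → All.lookup u m (sym e))))) (+-identityʳ _)
sumL-only h {xs = x ∷ xs} (u ∷ us) (there m) z = trans (cong (_+ sumL xs h) (z x (All.lookup u m))) (trans (+-identityˡ _) (sumL-only h us m z))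

-- Among the parallel edges of one direction only two touch a given vertex: one of them points to it
-- when oriented along its arrow, the other when oriented against it.
sumL-two : ∀ (t : ℕ → ℕ → Bool) {a b a′ b′ is js} → Unique is → Unique js → a ∈ is → b ∈ js → a′ ∈ is → b′ ∈ js →
  sumL is (λ i → sumL js (λ j → ⟦ if t i j then (i ℕ.≡ᵇ a) ∧ (j ℕ.≡ᵇ b) else ((i ℕ.≡ᵇ a′) ∧ (j ℕ.≡ᵇ b′)) ⟧))
    ≡ ⟦ t a b ⟧ + ⟦ not (t a′ b′) ⟧
sumL-two t {a} {b} {a′} {b′} {is} {js} ui uj ma mb ma′ mb′ = begin
  sumL is (λ i → sumL js (λ j → ⟦ if t i j then (i ℕ.≡ᵇ a) ∧ (j ℕ.≡ᵇ b) else ((i ℕ.≡ᵇ a′) ∧ (j ℕ.≡ᵇ b′)) ⟧))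
    ≡⟨ sumL-cong is (λ i _ → trans (sumL-cong js (λ j _ → split (t i j) _ _)) (sumL-+ _ _ js)) ⟩
  sumL is (λ i → sumL js (λ j → ⟦ t i j ⟧ * ⟦ (i ℕ.≡ᵇ a) ∧ (j ℕ.≡ᵇ b) ⟧) + sumL js (λ j → ⟦ not (t i j) ⟧ * ⟦ (i ℕ.≡ᵇ a′) ∧ (j ℕ.≡ᵇ b′) ⟧))
    ≡⟨ trans (sumL-+ _ _ is) (cong₂ _+_ (single (λ i j → ⟦ t i j ⟧) ma mb) (single (λ i j → ⟦ not (t i j) ⟧) ma′ mb′)) ⟩
  ⟦ t a b ⟧ + ⟦ not (t a′ b′) ⟧ ∎
  where
  open ≡-Reasoning
  split : ∀ c u v → ⟦ if c then u else v ⟧ ≡ ⟦ c ⟧ * ⟦ u ⟧ + ⟦ not c ⟧ * ⟦ v ⟧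
  split true u v = sym (trans (cong₂ _+_ (*-identityˡ _) (zeroˡ _)) (+-identityʳ _))
  split false u v = sym (trans (cong₂ _+_ (zeroˡ _) (*-identityˡ _)) (+-identityˡ _))
  single : ∀ (w : ℕ → ℕ → ℤ) {a b} → a ∈ is → b ∈ js → sumL is (λ i → sumL js (λ j → w i j * ⟦ (i ℕ.≡ᵇ a) ∧ (j ℕ.≡ᵇ b) ⟧)) ≡ w a b
  single w {a} {b} ma mb = trans
    (sumL-only _ ui ma λ i ne → sumL-zero js λ j _ → trans (cong (λ c → w i j * ⟦ c ∧ (j ℕ.≡ᵇ b) ⟧) (≡ᵇ-false ne)) (zeroʳ _))
    (trans (sumL-only _ uj mb λ j ne → trans (cong (λ c → w a j * ⟦ c ⟧) (trans (cong ((a ℕ.≡ᵇ a) ∧_) (≡ᵇ-false ne)) (∧-zeroʳ _))) (zeroʳ _))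
      (trans (cong₂ (λ c d → w a b * ⟦ c ∧ d ⟧) (≡ᵇ-refl a) (≡ᵇ-refl b)) (*-identityʳ _)))

-- `innerEdges` directs the vertical edges upwards, `arrow` downwards; the other two kinds agree.
reference : Edge → DEdge
reference (east x y) = (x , y) , (suc x , y)
reference (south x y) = (x , y) , (x , suc y)
reference (southeast x y) = (x , suc y) , (suc x , y)

orientedᵇ : Bool → Edge → DEdge
orientedᵇ b e = if b then arrow e else (proj₂ (arrow e) , proj₁ (arrow e))

oriented : Orientation → Edge → DEdge
oriented τ e = orientedᵇ (τ e) e

sumL-orient : ∀ ks → Unique ks → ∀ (G : List DEdge → ℤ) σ →
  sumL (allBools (length (map reference ks))) (λ bs → G (orient (map reference ks) bs)) ≡ ∑ᴼ ks (λ τ → G (map (oriented τ) ks)) σ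
sumL-orient [] _ G σ = +-identityʳ _
sumL-orient (k ∷ ks) (u ∷ us) G σ = trans (sumL-++ (map (true ∷_) bss) (map (false ∷_) bss) _) (trans (both k) (cong₂ _+_ (branch true) (branch false)))
  where
  bss : List (List Bool)
  bss = allBools (length (map reference ks))
  part : Edge → Bool → ℤ
  part k b = sumL bss (λ bs → G (orientedᵇ b k ∷ orient (map reference ks) bs))
  both : ∀ k → sumL (map (true ∷_) bss) (λ bs → G (orient (reference k ∷ map reference ks) bs))
    + sumL (map (false ∷_) bss) (λ bs → G (orient (reference k ∷ map reference ks) bs)) ≡ part k true + part k false
  both (east x y) = cong₂ _+_ (sumL-map (true ∷_) bss _) (sumL-map (false ∷_) bss _)
  -- For vertical edges the two Booleans are interchanged by the opposite reference direction, hence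
  -- the commutation.
  both (south x y) = trans (cong₂ _+_ (sumL-map (true ∷_) bss _) (sumL-map (false ∷_) bss _)) (+-comm _ _)
  both (southeast x y) = cong₂ _+_ (sumL-map (true ∷_) bss _) (sumL-map (false ∷_) bss _)
  branch : ∀ b → part k b ≡ ∑ᴼ ks (λ τ → G (oriented τ k ∷ map (oriented τ) ks)) (σ [ k ↦ b ])
  branch b = trans (sumL-orient ks us (λ l → G (orientedᵇ b k ∷ l)) (σ [ k ↦ b ]))
    (∑ᴼ-cong ks λ τ agree → cong (λ c → G (orientedᵇ c k ∷ map (oriented τ) ks))
      (sym (trans (agree k (λ m → All.lookup u m refl)) (at-same σ k b))))

rng1-range : ∀ k → rng1 k ≡ range 1 k
rng1-range k = trans (cong (map suc) (upTo-range k)) (range-suc 0 k)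

module Degrees (m p : ℕ) (p≤1 : p ℕ.≤ 1) where
  private
    n S : ℕ
    n = suc m
    S = p ℕ.+ n
  open Boundary m S (ℕₚ.≤-trans (s≤s z≤n) (ℕₚ.m≤n+m n p)) using (inner)

  -- Only the coordinates that tell an inner edge from a boundary edge are tested.
  Inner : Edge → Set
  Inner (east i j) = i ∈ range 1 m
  Inner (south i j) = j ∈ range 1 m
  Inner (southeast i j) = i ∈ range 1 m × j ∈ range 1 m

  all-inner : All Inner inner
  all-inner = Allₚ.++⁺ (rows (range 1 m) (λ i mi j _ → mi))
    (Allₚ.++⁺ (rows (range 1 n) (λ i _ j mj → mj)) (rows (range 1 m) (λ i mi j mj → mi , mj)))
    where
    rows : ∀ {f : ℕ → ℕ → Edge} {js} is → (∀ i → i ∈ is → ∀ j → j ∈ js → Inner (f i j)) → All Inner (concatMap (λ i → map (f i) js) is)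
    rows [] h = []
    rows {js = js} (i ∷ is) h = Allₚ.++⁺ (all-map js (h i (here refl))) (rows is (λ i′ m → h i′ (there m)))

  0∉ : 0 ∉ range 1 m
  0∉ m₀ = ℕₚ.<⇒≱ (s≤s z≤n) (range-≥ m₀)

  n∉ : n ∉ range 1 m
  n∉ mₙ = ℕₚ.<-irrefl refl (range-< mₙ)

  -- Both corner edges belong to the diagonal line n + 1, so a single Boolean orients them.
  corners : Bool → List DEdge
  corners b = orientedᵇ b (southeast 0 n) ∷ orientedᵇ b (southeast n 0) ∷ []

  boundaryList : Bool → List DEdge
  boundaryList b =
    map (λ y → orientedᵇ true (east 0 y)) (range 1 n) ++ (map (λ y → orientedᵇ false (east n y)) (range 1 n)
    ++ (map (λ y → orientedᵇ true (southeast 0 y)) (range 1 m) ++ (map (λ y → orientedᵇ false (southeast n y)) (range 1 m)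
    ++ (map (λ x → orientedᵇ true (south x 0)) (range 1 n) ++ (map (λ x → orientedᵇ false (south x n)) (range 1 n)
    ++ (map (λ x → orientedᵇ true (southeast x 0)) (range 1 m) ++ (map (λ x → orientedᵇ false (southeast x n)) (range 1 m)
    ++ corners b)))))))

  module _ (τ : Orientation) (agree : ∀ e → ¬ Inner e → τ e ≡ boundary S e) where

    S≤ : S ℕ.≤ suc n
    S≤ = ℕₚ.+-monoˡ-≤ n p≤1

    lower-true : ∀ {i j} → suc (i ℕ.+ j) ℕ.≤ n → ¬ Inner (southeast i j) → τ (southeast i j) ≡ true
    lower-true l ¬i = trans (agree _ ¬i) (≤ᵇ-true (ℕₚ.≤-trans l (ℕₚ.m≤n+m n p)))

    upper-false : ∀ {i j} → suc n ℕ.≤ i ℕ.+ j → ¬ Inner (southeast i j) → τ (southeast i j) ≡ false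
    upper-false l ¬i = trans (agree _ ¬i) (≤ᵇ-false (ℕₚ.≤-trans (s≤s S≤) (s≤s l)))

    module _ (P : DEdge → Bool)
      (origin : ∀ b → P (orientedᵇ b (southeast 0 0)) ≡ false) (opposite : ∀ b → P (orientedᵇ b (southeast n n)) ≡ false) where

      weight : Edge → ℤ
      weight e = ⟦ P (oriented τ e) ⟧

      -- Full rectangles of indices suit `sumL-two`. They also contain `southeast 0 0` and
      -- `southeast n n`, which are not edges of the model; `origin` and `opposite` make these count
      -- zero.
      all-edges : ℤ
      all-edges = sumL (range 0 (suc n)) (λ i → sumL (range 1 n) (λ j → weight (east i j)))
        + (sumL (range 1 n) (λ i → sumL (range 0 (suc n)) (λ j → weight (south i j)))
        + sumL (range 0 (suc n)) (λ i → sumL (range 0 (suc n)) (λ j → weight (southeast i j))))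

      ends : ∀ G → sumL (range 0 (suc n)) G ≡ G 0 + (sumL (range 1 m) G + G n)
      ends G = cong (λ t → G 0 + t) (trans (cong (λ l → sumL l G) (trans (cong (range 1) (ℕₚ.+-comm 1 m)) (range-++ 1 m 1)))
        (trans (sumL-++ (range 1 m) (n ∷ []) G) (cong (λ t → sumL (range 1 m) G + t) (+-identityʳ _))))

      sum-inner : sumL (map (oriented τ) inner) (λ e → ⟦ P e ⟧) ≡ sumL (range 1 m) (λ i → sumL (range 1 n) (λ j → weight (east i j)))
        + (sumL (range 1 n) (λ i → sumL (range 1 m) (λ j → weight (south i j))) + sumL (range 1 m) (λ i → sumL (range 1 m) (λ j → weight (southeast i j))))
      sum-inner = trans (sumL-map (oriented τ) inner _) (trans (sumL-++ (concatMap (λ x → map (east x) (range 1 n)) (range 1 m)) _ weight)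
        (cong₂ _+_ (rows east (range 1 n) (range 1 m)) (trans (sumL-++ (concatMap (λ x → map (south x) (range 1 m)) (range 1 n)) _ weight)
          (cong₂ _+_ (rows south (range 1 m) (range 1 n)) (rows southeast (range 1 m) (range 1 m))))))
        where
        rows : ∀ (f : ℕ → ℕ → Edge) js is → sumL (concatMap (λ i → map (f i) js) is) weight ≡ sumL is (λ i → sumL js (λ j → weight (f i j)))
        rows f js is = trans (sumL-concatMap (λ i → map (f i) js) is weight) (sumL-cong is (λ i _ → sumL-map (f i) js weight))

      side : ∀ b (f : ℕ → Edge) a c (rest : List DEdge) {r : ℤ} → (∀ y → y ∈ range a c → τ (f y) ≡ b) → sumL rest (λ e → ⟦ P e ⟧) ≡ r →
        sumL (map (λ y → orientedᵇ b (f y)) (range a c) ++ rest) (λ e → ⟦ P e ⟧) ≡ sumL (range a c) (weight ∘ f) + r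
      side b f a c rest h e = trans (sumL-++ (map (λ y → orientedᵇ b (f y)) (range a c)) rest _) (cong₂ _+_
        (trans (sumL-map (λ y → orientedᵇ b (f y)) (range a c) _) (sumL-cong (range a c) λ y my → cong (λ t → ⟦ P (orientedᵇ t (f y)) ⟧) (sym (h y my)))) e)

      sum-boundary : sumL (boundaryList (n ℕ.<ᵇ S)) (λ e → ⟦ P e ⟧) ≡
        sumL (range 1 n) (λ y → weight (east 0 y)) + (sumL (range 1 n) (λ y → weight (east n y))
        + (sumL (range 1 m) (λ y → weight (southeast 0 y)) + (sumL (range 1 m) (λ y → weight (southeast n y))
        + (sumL (range 1 n) (λ x → weight (south x 0)) + (sumL (range 1 n) (λ x → weight (south x n))
        + (sumL (range 1 m) (λ x → weight (southeast x 0)) + (sumL (range 1 m) (λ x → weight (southeast x n))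
        + (weight (southeast 0 n) + (weight (southeast n 0) + 0ℤ)))))))))
      sum-boundary = side true (east 0) 1 n _ (λ y _ → agree _ 0∉)
        (side false (east n) 1 n _ (λ y _ → agree _ n∉)
        (side true (southeast 0) 1 m _ (λ y my → lower-true (range-< my) (0∉ ∘ proj₁))
        (side false (southeast n) 1 m _ (λ y my → upper-false (ℕₚ.≤-trans (ℕₚ.≤-reflexive (ℕₚ.+-comm 1 n)) (ℕₚ.+-monoʳ-≤ n (range-≥ my))) (n∉ ∘ proj₁))
        (side true (λ x → south x 0) 1 n _ (λ x mx → trans (agree _ 0∉) (south-0 mx))
        (side false (λ x → south x n) 1 n _ (λ x mx → trans (agree _ n∉) (south-n x))
        (side true (λ x → southeast x 0) 1 m _ (λ x mx → lower-true (s≤s (ℕₚ.≤-trans (ℕₚ.≤-reflexive (ℕₚ.+-identityʳ x)) (ℕₚ.≤-pred (range-< mx)))) (0∉ ∘ proj₂))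
        (side false (λ x → southeast x n) 1 m _ (λ x mx → upper-false (ℕₚ.+-monoˡ-≤ n (range-≥ mx)) (n∉ ∘ proj₂))
        (cong₂ (λ a b → ⟦ P (orientedᵇ a (southeast 0 n)) ⟧ + (⟦ P (orientedᵇ b (southeast n 0)) ⟧ + 0ℤ))
          (sym (agree (southeast 0 n) (0∉ ∘ proj₁))) (sym (trans (agree (southeast n 0) (0∉ ∘ proj₂)) (cong (λ t → suc t ℕ.≤ᵇ S) (ℕₚ.+-identityʳ n))))))))))))
        where
        south-0 : ∀ {x} → x ∈ range 1 n → boundary S (south x 0) ≡ true
        south-0 {zero} mx = ⊥-elim (ℕₚ.<⇒≱ (s≤s z≤n) (range-≥ mx))
        south-0 {suc x} _ = refl
        south-n : ∀ x → boundary S (south x n) ≡ false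
        south-n zero = refl
        south-n (suc x) = refl

      sum-edges : sumL (map (oriented τ) inner ++ boundaryList (n ℕ.<ᵇ S)) (λ e → ⟦ P e ⟧) ≡ all-edges
      sum-edges = trans (sumL-++ (map (oriented τ) inner) (boundaryList (n ℕ.<ᵇ S)) _)
        (trans (cong₂ _+_ sum-inner sum-boundary)
          (trans (lem _ _ _ _ _ _ _ _ _ _ _ _ _)
            (sym (cong₂ _+_ (ends (λ i → sumL (range 1 n) (λ j → weight (east i j)))) (cong₂ _+_ souths southeasts)))))
        where
        opaque
          unfolding ℤ
          lem : ∀ a b c d e f g h i j k l q →
            (a + (b + c)) + (d + (e + (f + (g + (h + (i + (j + (k + (l + (q + 0ℤ)))))))))) ≡
            (d + (a + e)) + ((h + (b + i)) + ((0ℤ + (f + l)) + (((j + (c + k))) + (q + (g + 0ℤ)))))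
          lem = solve-∀ ring
        souths : sumL (range 1 n) (λ i → sumL (range 0 (suc n)) (λ j → weight (south i j)))
          ≡ sumL (range 1 n) (λ x → weight (south x 0)) + (sumL (range 1 n) (λ i → sumL (range 1 m) (λ j → weight (south i j))) + sumL (range 1 n) (λ x → weight (south x n)))
        souths = trans (sumL-cong (range 1 n) λ i _ → ends (λ j → weight (south i j)))
          (trans (sumL-+ _ _ (range 1 n)) (cong (λ t → sumL (range 1 n) (λ x → weight (south x 0)) + t) (sumL-+ _ _ (range 1 n))))
        southeasts : sumL (range 0 (suc n)) (λ i → sumL (range 0 (suc n)) (λ j → weight (southeast i j)))
          ≡ (0ℤ + (sumL (range 1 m) (λ y → weight (southeast 0 y)) + weight (southeast 0 n)))
            + ((sumL (range 1 m) (λ x → weight (southeast x 0)) + (sumL (range 1 m) (λ i → sumL (range 1 m) (λ j → weight (southeast i j))) + sumL (range 1 m) (λ x → weight (southeast x n))))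
              + (weight (southeast n 0) + (sumL (range 1 m) (λ y → weight (southeast n y)) + 0ℤ)))
        southeasts = trans (ends (λ i → sumL (range 0 (suc n)) (λ j → weight (southeast i j)))) (cong₂ _+_
          (trans (ends (λ j → weight (southeast 0 j))) (cong (λ t → t + (sumL (range 1 m) (λ y → weight (southeast 0 y)) + weight (southeast 0 n))) (cong ⟦_⟧ (origin (τ (southeast 0 0))))))
          (cong₂ _+_ (trans (sumL-cong (range 1 m) λ i _ → ends (λ j → weight (southeast i j)))
              (trans (sumL-+ _ _ (range 1 m)) (cong (λ t → sumL (range 1 m) (λ x → weight (southeast x 0)) + t) (sumL-+ _ _ (range 1 m)))))
            (trans (ends (λ j → weight (southeast n j))) (cong (λ t → weight (southeast n 0) + (sumL (range 1 m) (λ y → weight (southeast n y)) + t)) (cong ⟦_⟧ (opposite (τ (southeast n n))))))))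

    module _ {x y : ℕ} (x<n : x ℕ.< n) (y<n : y ℕ.< n) where
      private
        v : Point
        v = suc x , suc y
        this : ∀ {k} → k ℕ.< n → k ∈ range 0 (suc n)
        this l = range-∈ z≤n (ℕₚ.m≤n⇒m≤1+n l)
        next : ∀ {k} → k ℕ.< n → suc k ∈ range 0 (suc n)
        next l = range-∈ z≤n (s≤s l)
        here⁺ : ∀ {k} → k ℕ.< n → suc k ∈ range 1 n
        here⁺ l = range-∈ (s≤s z≤n) (s≤s l)
        wide : Unique (range 0 (suc n))
        wide = increasing-unique (range-increasing 0 (suc n))
        narrow : Unique (range 1 n)
        narrow = increasing-unique (range-increasing 1 n)
        float : ∀ {A : Set} (f : DEdge → A) b e → f (orientedᵇ b e) ≡ (if b then f (arrow e) else f (proj₂ (arrow e) , proj₁ (arrow e)))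
        float f true e = refl
        float f false e = refl
        out-of : ∀ {k} → k ℕ.< n → (n ℕ.≡ᵇ k) ≡ false
        out-of l = ≡ᵇ-false λ e → ℕₚ.<-irrefl (sym e) l
        i j k o p′ q : Bool
        i = τ (east x (suc y))
        j = τ (southeast x (suc y))
        k = τ (south (suc x) (suc y))
        o = τ (east (suc x) (suc y))
        p′ = τ (southeast (suc x) y)
        q = τ (south (suc x) y)
        edges-at : List DEdge
        edges-at = map (oriented τ) inner ++ boundaryList (n ℕ.<ᵇ S)
        ι-bit : ∀ b → ⟦ b ⟧ ≡ ι (bit b)
        ι-bit true = sym ι-1
        ι-bit false = sym ι-0
        ι-bits : ∀ a b c d e f → (⟦ a ⟧ + ⟦ b ⟧) + ((⟦ c ⟧ + ⟦ d ⟧) + (⟦ e ⟧ + ⟦ f ⟧))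
          ≡ ι ((bit a ℕ.+ bit b) ℕ.+ ((bit c ℕ.+ bit d) ℕ.+ (bit e ℕ.+ bit f)))
        ι-bits a b c d e f = trans (cong₂ _+_ (two a b) (trans (cong₂ _+_ (two c d) (two e f)) (sym (ι-+ _ _)))) (sym (ι-+ (bit a ℕ.+ bit b) _))
          where
          two : ∀ a b → ⟦ a ⟧ + ⟦ b ⟧ ≡ ι (bit a ℕ.+ bit b)
          two a b = trans (cong₂ _+_ (ι-bit a) (ι-bit b)) (sym (ι-+ (bit a) (bit b)))
        meet : ∀ (P : DEdge → Bool) (f : ℕ → ℕ → Edge) {a b a′ b′ is js} → Unique is → Unique js →
          (∀ i j → P (arrow (f i j)) ≡ (i ℕ.≡ᵇ a) ∧ (j ℕ.≡ᵇ b)) →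
          (∀ i j → P (proj₂ (arrow (f i j)) , proj₁ (arrow (f i j))) ≡ (i ℕ.≡ᵇ a′) ∧ (j ℕ.≡ᵇ b′)) →
          a ∈ is → b ∈ js → a′ ∈ is → b′ ∈ js →
          sumL is (λ i → sumL js (λ j → ⟦ P (oriented τ (f i j)) ⟧)) ≡ ⟦ τ (f a b) ⟧ + ⟦ not (τ (f a′ b′)) ⟧
        meet P f {is = is} {js} ui uj e e′ ma mb ma′ mb′ = trans
          (sumL-cong is λ i _ → sumL-cong js λ j _ → cong ⟦_⟧ (trans (float P (τ (f i j)) (f i j))
            (cong₂ (if_then_else_ (τ (f i j))) (e i j) (e′ i j))))
          (sumL-two (λ i j → τ (f i j)) ui uj ma mb ma′ mb′)

      indeg-≡ : indeg v edges-at ≡ incoming i j k o p′ q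
      indeg-≡ = ι-injective (trans (ι-countB (λ e → proj₂ e == v) edges-at) (trans
        (sum-edges (λ e → proj₂ e == v) origin opposite)
        (trans (cong₂ _+_
            (meet (λ e → proj₂ e == v) east wide narrow (λ _ _ → refl) (λ _ _ → refl) (this x<n) (here⁺ y<n) (next x<n) (here⁺ y<n))
            (cong₂ _+_ (meet (λ e → proj₂ e == v) south narrow wide (λ _ _ → refl) (λ _ _ → refl) (here⁺ x<n) (next y<n) (here⁺ x<n) (this y<n))
              (meet (λ e → proj₂ e == v) southeast wide wide (λ _ _ → refl) (λ _ _ → refl) (this x<n) (next y<n) (next x<n) (this y<n))))
          (ι-bits i (not o) k (not q) j (not p′)))))
        where
        origin : ∀ b → (proj₂ (orientedᵇ b (southeast 0 0)) == v) ≡ false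
        origin true = ∧-zeroʳ _
        origin false = refl
        opposite : ∀ b → (proj₂ (orientedᵇ b (southeast n n)) == v) ≡ false
        opposite true = cong (_∧ (n ℕ.≡ᵇ suc y)) (out-of x<n)
        opposite false = trans (cong ((n ℕ.≡ᵇ suc x) ∧_) (out-of y<n)) (∧-zeroʳ _)

      outdeg-≡ : outdeg v edges-at ≡ outgoing i j k o p′ q
      outdeg-≡ = ι-injective (trans (ι-countB (λ e → proj₁ e == v) edges-at) (trans
        (sum-edges (λ e → proj₁ e == v) origin opposite)
        (trans (cong₂ _+_
            (meet (λ e → proj₁ e == v) east wide narrow (λ _ _ → refl) (λ _ _ → refl) (next x<n) (here⁺ y<n) (this x<n) (here⁺ y<n))
            (cong₂ _+_ (meet (λ e → proj₁ e == v) south narrow wide (λ _ _ → refl) (λ _ _ → refl) (here⁺ x<n) (this y<n) (here⁺ x<n) (next y<n))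
              (meet (λ e → proj₁ e == v) southeast wide wide (λ _ _ → refl) (λ _ _ → refl) (next x<n) (this y<n) (this x<n) (next y<n))))
          (ι-bits o (not i) q (not k) p′ (not j)))))
        where
        origin : ∀ b → (proj₁ (orientedᵇ b (southeast 0 0)) == v) ≡ false
        origin true = refl
        origin false = ∧-zeroʳ _
        opposite : ∀ b → (proj₁ (orientedᵇ b (southeast n n)) == v) ≡ false
        opposite true = trans (cong ((n ℕ.≡ᵇ suc x) ∧_) (out-of y<n)) (∧-zeroʳ _)
        opposite false = cong (_∧ (n ℕ.≡ᵇ suc y)) (out-of x<n)

-- Counting configurations

unique-++ : ∀ {A : Set} (xs : List A) {ys} → Unique (xs ++ ys) → Unique xs × Unique ys × (∀ {y} → y ∈ ys → y ∉ xs)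
unique-++ [] u = [] , u , λ _ ()
unique-++ (x ∷ xs) (a ∷ u) with unique-++ xs u
... | ux , uy , disjoint = All.tabulate (λ m → All.lookup a (∈-++⁺ˡ m)) ∷ ux , uy , λ where
  my (here refl) → All.lookup a (∈-++⁺ʳ xs my) refl
  my (there m) → disjoint my m

module Counting (m p : ℕ) (p≤1 : p ℕ.≤ 1) where
  private
    n S : ℕ
    n = suc m
    S = p ℕ.+ n
    cs : List Point
    cs = cells (down n) (range 1 n)
  open Boundary m S (ℕₚ.≤-trans (s≤s z≤n) (ℕₚ.m≤n+m n p))
  open Degrees m p p≤1

  allowed : Orientation → ℤ
  allowed τ = ∏ cs (λ c → ok c τ)

  allowed-extensional : Extensional allowed
  allowed-extensional e = ∏-cong (λ { (x , y) → cong ⟦_⟧ (go (e _) (e _) (e _) (e _) (e _) (e _)) }) cs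
    where
    go : ∀ {i i′ j j′ k k′ o o′ p p′ q q′} → i ≡ i′ → j ≡ j′ → k ≡ k′ → o ≡ o′ → p ≡ p′ → q ≡ q′ → balanced i j k o p q ≡ balanced i′ j′ k′ o′ p′ q′
    go refl refl refl refl refl refl = refl

  unique-inner-exits : Unique (inner ++ exits)
  unique-inner-exits = ↭ₛ.Unique-resp-↭ (setoid Edge) (↭.↭⇒↭ₛ outs-inner) (unique-outs (cells-ordered n 1 n (s≤s z≤n)))

  -- The final functional fixes the exit edges, so the sums over them collapse to the boundary
  -- orientation and only the inner edges remain free.
  operator-sum : ap (act (square vertexI n) (final n S)) (initial S) ≡ ∑ᴼ inner allowed (boundary S)
  operator-sum = begin
    ap (act (square vertexI n) (final n S)) (initial S)
      ≡⟨ gridOf-run (down n) (range 1 n) (final n S) (initial S) ⟩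
    ap (act (run cs) (final n S)) (initial S)
      ≡⟨ transfer (Frontier.follows-grid n 1 n (s≤s z≤n)) (cells-ordered n 1 n (s≤s z≤n)) (final n S) (boundary S) (initial S) initial-boundary ⟩
    ∑ᴼ (concatMap outs cs) (λ τ → allowed τ * ap (final n S) (τ ∘ exit)) (boundary S)
      ≡⟨ ∑ᴼ-↭ (λ e → cong₂ _*_ (allowed-extensional e) (ext (final n S) (λ ℓ → e (exit ℓ)))) outs-inner (boundary S) ⟩
    ∑ᴼ (inner ++ exits) (λ τ → allowed τ * ap (final n S) (τ ∘ exit)) (boundary S)
      ≡⟨ ∑ᴼ-++ inner exits (boundary S) ⟩
    ∑ᴼ inner (∑ᴼ exits (λ τ → allowed τ * ap (final n S) (τ ∘ exit))) (boundary S)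
      ≡⟨ ∑ᴼ-cong inner (λ τ agree → trans
           (∑ᴼ-cong exits λ τ′ _ → trans (*-comm _ _) (cong (_* allowed τ′) (final-exits τ′)))
           (∑ᴼ-collapse (boundary S) exits allowed-extensional (proj₁ (proj₂ (unique-++ inner unique-inner-exits)))
             (λ e me → agree e (proj₂ (proj₂ (unique-++ inner unique-inner-exits)) me)))) ⟩
    ∑ᴼ inner allowed (boundary S) ∎
    where open ≡-Reasoning

  innerEdges-≡ : innerEdges n ≡ map reference inner
  innerEdges-≡ = trans (cong₂ list (rng1-range n) (rng1-range m)) (sym (trans (map-++ reference (concatMap (λ x → map (east x) (range 1 n)) (range 1 m)) _)
    (cong₂ _++_ (rows east (range 1 n) (range 1 m)) (trans (map-++ reference (concatMap (λ x → map (south x) (range 1 m)) (range 1 n)) _)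
      (cong₂ _++_ (rows south (range 1 m) (range 1 n)) (rows southeast (range 1 m) (range 1 m)))))))
    where
    list : List ℕ → List ℕ → List DEdge
    list big small = concatMap (λ x → map (λ y → ((x , y) , (suc x , y))) big) small
      ++ concatMap (λ x → map (λ y → ((x , y) , (x , suc y))) small) big
      ++ concatMap (λ x → map (λ y → ((x , suc y) , (suc x , y))) small) small
    rows : ∀ (f : ℕ → ℕ → Edge) js is → map reference (concatMap (λ x → map (f x) js) is) ≡ concatMap (λ x → map (λ y → reference (f x y)) js) is
    rows f js is = trans (map-concatMap reference (λ x → map (f x) js) is) (cong (λ l → Data.List.concat l) (map-cong (λ x → sym (map-∘ js)) is))

  module _ (b : DWBC) (boundary-list : boundaryEdges n b ≡ boundaryList (n ℕ.<ᵇ S)) where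

    local : List DEdge → Point → Bool
    local es v = (indeg v es ℕ.≡ᵇ 3) ∧ (outdeg v es ℕ.≡ᵇ 3)

    product-local : ∀ τ → (∀ e → ¬ Inner e → τ e ≡ boundary S e) → ⟦ all (local (map (oriented τ) inner ++ boundaryEdges n b)) (grid n) ⟧ ≡ allowed τ
    product-local τ agree = begin
      ⟦ all (local (map (oriented τ) inner ++ boundaryEdges n b)) (grid n) ⟧
        ≡⟨ trans (⟦all⟧ (local (map (oriented τ) inner ++ boundaryEdges n b)) (grid n)) (cong₂ (λ vs es → ∏ vs (λ v → ⟦ local (map (oriented τ) inner ++ es) v ⟧))
             (cong (λ r → concatMap (λ x → map (x ,_) r) r) (rng1-range n)) boundary-list) ⟩
      ∏ (cells (range 1 n) (range 1 n)) (λ v → ⟦ local (map (oriented τ) inner ++ boundaryList (n ℕ.<ᵇ S)) v ⟧)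
        ≡⟨ ∏-cong-∈ (cells (range 1 n) (range 1 n)) (λ v mv → cong ⟦_⟧ (balance v (cells-∈ {range 1 n} {range 1 n} mv))) ⟩
      ∏ (cells (range 1 n) (range 1 n)) (λ v → ok v τ)
        ≡⟨ ∏-↭ (λ v → ok v τ) (concatMap-↭ (range 1 n) (λ x → ↭ₚ.map⁺ (x ,_) (↭.↭-sym (down-range n)))) ⟩
      allowed τ ∎
      where
      open ≡-Reasoning
      balance : ∀ v → proj₁ v ∈ range 1 n × proj₂ v ∈ range 1 n → local (map (oriented τ) inner ++ boundaryList (n ℕ.<ᵇ S)) v ≡ okᵇ v τ
      balance (zero , y) (mx , _) = ⊥-elim (ℕₚ.<⇒≱ (s≤s z≤n) (range-≥ mx))
      balance (suc x , zero) (_ , my) = ⊥-elim (ℕₚ.<⇒≱ (s≤s z≤n) (range-≥ my))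
      balance (suc x , suc y) (mx , my) = cong₂ (λ a c → (a ℕ.≡ᵇ 3) ∧ (c ℕ.≡ᵇ 3))
        (indeg-≡ τ agree (ℕₚ.≤-pred (range-< mx)) (ℕₚ.≤-pred (range-< my))) (outdeg-≡ τ agree (ℕₚ.≤-pred (range-< mx)) (ℕₚ.≤-pred (range-< my)))

    numConfigs-operator : ι (numConfigs n b) ≡ ap (act (square vertexI n) (final n S)) (initial S)
    numConfigs-operator = begin
      ι (numConfigs n b)
        ≡⟨ ι-countB (isConfig n b) (allBools (length (innerEdges n))) ⟩
      sumL (allBools (length (innerEdges n))) (λ bs → configuration (orient (innerEdges n) bs))
        ≡⟨ cong (λ es → sumL (allBools (length es)) (λ bs → configuration (orient es bs))) innerEdges-≡ ⟩
      sumL (allBools (length (map reference inner))) (λ bs → configuration (orient (map reference inner) bs))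
        ≡⟨ sumL-orient inner (proj₁ (unique-++ inner unique-inner-exits)) configuration (boundary S) ⟩
      ∑ᴼ inner (λ τ → configuration (map (oriented τ) inner)) (boundary S)
        ≡⟨ ∑ᴼ-cong inner (λ τ agree → product-local τ (λ e ¬i → agree e (λ me → ¬i (All.lookup all-inner me)))) ⟩
      ∑ᴼ inner allowed (boundary S)
        ≡⟨ sym operator-sum ⟩
      ap (act (square vertexI n) (final n S)) (initial S) ∎
      where
      open ≡-Reasoning
      configuration : List DEdge → ℤ
      configuration es = ⟦ all (local (es ++ boundaryEdges n b)) (grid n) ⟧

    numConfigs-T4 : numConfigs n b ≡ T4 n
    numConfigs-T4 = ι-injective (trans numConfigs-operator (trans six-vertex (sym (T4-determinant n))))
      where
      open ≡-Reasoning
      length-down : ∀ n → length (down n) ≡ n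
      length-down zero = refl
      length-down (suc n) = cong suc (length-down n)
      length-range : ∀ a n → length (range a n) ≡ n
      length-range a zero = refl
      length-range a (suc n) = cong suc (length-range (suc a) n)
      nonzero-power : ∀ {x} k → x ≢ 0ℤ → x ^ k ≢ 0ℤ
      nonzero-power zero ne = 1≢0
      nonzero-power (suc k) ne = *-nonzero ne (nonzero-power k ne)
      4≢0 : 4ℤ ≢ 0ℤ
      4≢0 = *-nonzero 2≢0 2≢0
        where
        opaque
          unfolding ℤ
          2≢0 : 2ℤ ≢ 0ℤ
          2≢0 ()
      six-vertex : ap (act (square vertexI n) (final n S)) (initial S) ≡ D (ascending T4-row 0 n) (range 0 n)
      -- Restoring the gauge factor and pulling out the diagonal lines produce the same power, a
      -- factor 4 for each of the n² vertices.
      six-vertex = *-cancelˡ ((4ℤ ^ n) ^ n) (nonzero-power n (nonzero-power n 4≢0)) (begin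
        (4ℤ ^ n) ^ n * ap (act (square vertexI n) (final n S)) (initial S)
          ≡⟨ sym (Gauge.gauge-free n S) ⟩
        ap (act (square vertexV n) (final n S)) (initial S)
          ≡⟨ unravelled-value m p p≤1 ⟩
        (4ℤ ^ length (down n)) ^ length (range 1 n) * ap (act (SixVertex₀.grid6 (down n) (range 1 n)) (SixVertex₀.finish (down n) (range 1 n))) (initial S)
          ≡⟨ cong₂ (λ k l → (4ℤ ^ k) ^ l * ap (act (SixVertex₀.grid6 (down n) (range 1 n)) (SixVertex₀.finish (down n) (range 1 n))) (initial S))
               (length-down n) (length-range 1 n) ⟩
        (4ℤ ^ n) ^ n * ap (act (SixVertex₀.grid6 (down n) (range 1 n)) (SixVertex₀.finish (down n) (range 1 n))) (initial S)
          ≡⟨ cong ((4ℤ ^ n) ^ n *_) (six-vertex-determinant n (down n) (range 1 n) (initial S) (length-down n) (length-range 1 n) (down-unique n)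
               (increasing-unique (range-increasing 1 n)) (All.universal (λ _ → refl) (down n)) (All.universal (λ _ → refl) (range 1 n))) ⟩
        (4ℤ ^ n) ^ n * D (ascending T4-row 0 n) (range 0 n) ∎)

boundary-edges : ∀ m p (p≤1 : p ℕ.≤ 1) b → cornerEdges (suc m) b ≡ Degrees.corners m p p≤1 (suc m ℕ.<ᵇ p ℕ.+ suc m) →
  boundaryEdges (suc m) b ≡ Degrees.boundaryList m p p≤1 (suc m ℕ.<ᵇ p ℕ.+ suc m)
boundary-edges m p p≤1 b e = trans (cong₂ list (rng1-range n) (rng1-range m)) (cong (λ c →
    map (λ y → orientedᵇ true (east 0 y)) (range 1 n) ++ map (λ y → orientedᵇ false (east n y)) (range 1 n)
    ++ map (λ y → orientedᵇ true (southeast 0 y)) (range 1 m) ++ map (λ y → orientedᵇ false (southeast n y)) (range 1 m)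
    ++ map (λ x → orientedᵇ true (south x 0)) (range 1 n) ++ map (λ x → orientedᵇ false (south x n)) (range 1 n)
    ++ map (λ x → orientedᵇ true (southeast x 0)) (range 1 m) ++ map (λ x → orientedᵇ false (southeast x n)) (range 1 m) ++ c) e)
  where
  n : ℕ
  n = suc m
  list : List ℕ → List ℕ → List DEdge
  list big small =
    map (λ y → orientedᵇ true (east 0 y)) big ++ map (λ y → orientedᵇ false (east n y)) big
    ++ map (λ y → orientedᵇ true (southeast 0 y)) small ++ map (λ y → orientedᵇ false (southeast n y)) small
    ++ map (λ x → orientedᵇ true (south x 0)) big ++ map (λ x → orientedᵇ false (south x n)) big
    ++ map (λ x → orientedᵇ true (southeast x 0)) small ++ map (λ x → orientedᵇ false (southeast x n)) small ++ cornerEdges n b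

theorem5p1 : ∀ (n : ℕ) → 1 ≤ n →
    (numConfigs n DWBC1 ≡ T4 n) × (numConfigs n DWBC2 ≡ T4 n)
theorem5p1 (suc m) _ =
  Counting.numConfigs-T4 m 1 (s≤s z≤n) DWBC1 (boundary-edges m 1 (s≤s z≤n) DWBC1 (cong (Degrees.corners m 1 (s≤s z≤n)) (sym (≤ᵇ-true (ℕₚ.n<1+n (suc m)))))) ,
  Counting.numConfigs-T4 m 0 z≤n DWBC2 (boundary-edges m 0 z≤n DWBC2 (cong (Degrees.corners m 0 z≤n) (sym (≤ᵇ-false (ℕₚ.n<1+n (suc m))))))
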